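{- Let $D \geq 3$ be a constant, let $H$ be a fixed $D$-regular connected planar graph on $\{1,2,\ldots,h\}$, and let $f \in E(H)$ be an edge that is not a cut-edge. Then there exist constants $\alpha = \alpha(h) > 0$ and $N = N(h)$ such that $$\mathbf{P}[P_{n,D,D} \text{ does not have a set of at least } \alpha n \text{ 2-appearances of } H \setminus f] < e^{ -\alpha n}$$ for all $n \geq N$ if $D = 4$, and for all even $n \geq N$ if $D \in \{3,5\}$.
   Context: $\mathcal{P}(n,D,D)$ denotes the set of all labelled (simple) planar graphs on $\{1,\ldots,n\}$ in which every vertex has degree exactly $D$, and $P_{n,D,D}$ is a uniformly random element of it. 2-appearances: let $J$ be a connected graph on $\{1,\ldots,|J|\}$ and $G$ a graph. $J$ 2-appears at $W \subset V(G)$ if (a) the increasing bijection from $\{1,\ldots,|J|\}$ to $W$ is an isomorphism between $J$ and the induced subgraph $G[W]$, and (b) there are exactly two edges $e_1 = r_1v_1$ and $e_2 = r_2v_2$ of $G$ between $W$ and $V(G)\setminus W$, with $r_1,r_2 \in W$ and $v_1,v_2 \in V(G)\setminus W$, such that $r_1 \neq r_2$, $v_1 \neq v_2$, and $v_1$ and $v_2$ are non-adjacent in $G$. "A set of at least $m$ 2-appearances" means at least $m$ distinct sets $W$ at which $J$ 2-appears. Here $H \setminus f$ is the graph on $\{1,\ldots,h\}$ obtained by deleting the edge $f$. -}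

module Defs where

open import Data.Bool using (Bool; true; false; _∧_; _∨_; if_then_else_)
open import Data.Nat as ℕ using (ℕ; zero; suc; _≤ᵇ_; _≡ᵇ_)
open import Data.Fin using (Fin; toℕ)
import Data.Fin as F
open import Data.Vec using (Vec; lookup; _[_]≔_)
open import Data.Product using (Σ; ∃; ∃-syntax; _×_; _,_)
open import Data.Sum using (_⊎_)
open import Data.List using (List; length)
open import Data.List.Membership.Propositional using (_∈_)
open import Data.List.Relation.Unary.All using (All)
open import Data.List.Relation.Unary.Unique.Propositional using (Unique)
open import Data.Integer using (+_)
open import Data.Rational using (ℚ; _/_; _+_; _*_; _≤_; _<_; 1ℚ; 0ℚ)
open import Relation.Binary.PropositionalEquality using (_≡_; _≢_)
open import Relation.Nullary using (¬_)
open import Function.Bundles using (_⇔_)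

allF : (n : ℕ) → (Fin n → Bool) → Bool
allF zero    p = true
allF (suc n) p = p F.zero ∧ allF n (λ i → p (F.suc i))

anyF : (n : ℕ) → (Fin n → Bool) → Bool
anyF zero    p = false
anyF (suc n) p = p F.zero ∨ anyF n (λ i → p (F.suc i))

countF : (n : ℕ) → (Fin n → Bool) → ℕ
countF zero    p = zero
countF (suc n) p = (if p F.zero then 1 else 0) ℕ.+ countF n (λ i → p (F.suc i))

sumF : (n : ℕ) → (Fin n → ℕ) → ℕ
sumF zero    f = 0
sumF (suc n) f = f F.zero ℕ.+ sumF n (λ i → f (F.suc i))

allBelow : ℕ → (ℕ → Bool) → Bool
allBelow zero    p = true
allBelow (suc m) p = p m ∧ allBelow m p

iter : ∀ {A : Set} → (A → A) → ℕ → A → A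
iter f zero    x = x
iter f (suc k) x = f (iter f k x)

_==_ : ∀ {n} → Fin n → Fin n → Bool
i == j = toℕ i ≡ᵇ toℕ j

Graph : ℕ → Set
Graph n = Vec (Vec Bool n) n

adj : ∀ {n} → Graph n → Fin n → Fin n → Bool
adj G i j = lookup (lookup G i) j

IsSimple : ∀ {n} → Graph n → Set
IsSimple {n} G = (∀ i j → adj G i j ≡ adj G j i) × (∀ i → adj G i i ≡ false)

degree : ∀ {n} → Graph n → Fin n → ℕ
degree {n} G i = countF n (λ j → adj G i j)

Regular : ∀ {n} → ℕ → Graph n → Set
Regular D G = ∀ i → degree G i ≡ D

data Reach {n} (G : Graph n) : Fin n → Fin n → Set where
  here : ∀ {u} → Reach G u u
  step : ∀ {u v w} → Reach G u v → adj G v w ≡ true → Reach G u w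

Connected : ∀ {n} → Graph n → Set
Connected G = ∀ u v → Reach G u v

deleteEdge : ∀ {n} → Graph n → Fin n → Fin n → Graph n
deleteEdge G a b =
  let G₁ = G [ a ]≔ (lookup G a [ b ]≔ false)
  in  G₁ [ b ]≔ (lookup G₁ b [ a ]≔ false)

-- Planarity via rotation systems (combinatorial embeddings) of genus 0.
-- ρ u is meant to be a cyclic permutation of the neighbourhood of u.

Rotation : ℕ → Set
Rotation n = Fin n → Fin n → Fin n

ValidRotation : ∀ {n} → Graph n → Rotation n → Set
ValidRotation G ρ =
  (∀ u v → adj G u v ≡ true → adj G u (ρ u v) ≡ true) ×
  (∀ u v w → adj G u v ≡ true → adj G u w ≡ true → ρ u v ≡ ρ u w → v ≡ w) ×
  (∀ u v w → adj G u v ≡ true → adj G u w ≡ true → ∃[ k ] iter (ρ u) k v ≡ w)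

faceStep : ∀ {n} → Rotation n → Fin n × Fin n → Fin n × Fin n
faceStep ρ (u , v) = (v , ρ v u)

dartCode : ∀ {n} → Fin n × Fin n → ℕ
dartCode {n} (u , v) = toℕ u ℕ.* n ℕ.+ toℕ v

-- a dart is the representative of its face if it is the least dart in its
-- face orbit (orbits have length ≤ n²)
isFaceRep : ∀ {n} → Graph n → Rotation n → Fin n → Fin n → Bool
isFaceRep {n} G ρ u v =
  adj G u v ∧ allBelow (n ℕ.* n)
    (λ k → dartCode (u , v) ≤ᵇ dartCode (iter (faceStep ρ) k (u , v)))

numFaces : ∀ {n} → Graph n → Rotation n → ℕ
numFaces {n} G ρ = sumF n (λ u → countF n (λ v → isFaceRep G ρ u v))

reachB : ∀ {n} → Graph n → ℕ → Fin n → Fin n → Bool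
reachB G zero    u v = u == v
reachB {n} G (suc k) u v = reachB G k u v ∨ anyF n (λ w → reachB G k u w ∧ adj G w v)

-- number of connected components (least vertex of each component)
numComponents : ∀ {n} → Graph n → ℕ
numComponents {n} G =
  countF n (λ u → allF n (λ v → if reachB G n u v then toℕ u ≤ᵇ toℕ v else true))

numIsolated : ∀ {n} → Graph n → ℕ
numIsolated {n} G = countF n (λ u → degree G u ≡ᵇ 0)

numDarts : ∀ {n} → Graph n → ℕ
numDarts {n} G = sumF n (degree G)

-- Euler's formula summed over components: every component with an edge
-- satisfies V − E + F = 2, isolated vertices contribute V = 1.
-- i.e. n + F + I = E + 2C, written with darts (= 2E) as 2n + 2F + 2I = 2E + 4C.
Planar : ∀ {n} → Graph n → Set
Planar {n} G = ∃[ ρ ] ValidRotation G ρ ×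
  (2 ℕ.* n ℕ.+ 2 ℕ.* numFaces G ρ ℕ.+ 2 ℕ.* numIsolated G
     ≡ numDarts G ℕ.+ 4 ℕ.* numComponents G)

InP : (n D : ℕ) → Graph n → Set
InP n D G = IsSimple G × Regular D G × Planar G

Subset : ℕ → Set
Subset n = Vec Bool n

_∈S_ : ∀ {n} → Fin n → Subset n → Set
v ∈S W = lookup W v ≡ true

_∉S_ : ∀ {n} → Fin n → Subset n → Set
v ∉S W = lookup W v ≡ false

StrictlyIncreasing : ∀ {h n} → (Fin h → Fin n) → Set
StrictlyIncreasing σ = ∀ i j → toℕ i ℕ.< toℕ j → toℕ (σ i) ℕ.< toℕ (σ j)

TwoAppears : ∀ {h n} → Graph h → Graph n → Subset n → Set
TwoAppears {h} {n} J G W =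
  (∃[ σ ] StrictlyIncreasing σ × (∀ v → v ∈S W ⇔ (∃[ i ] σ i ≡ v)) ×
          (∀ i j → adj J i j ≡ adj G (σ i) (σ j))) ×
  (∃[ r₁ ] ∃[ v₁ ] ∃[ r₂ ] ∃[ v₂ ]
     r₁ ∈S W × r₂ ∈S W × v₁ ∉S W × v₂ ∉S W ×
     adj G r₁ v₁ ≡ true × adj G r₂ v₂ ≡ true ×
     r₁ ≢ r₂ × v₁ ≢ v₂ × adj G v₁ v₂ ≡ false ×
     (∀ r v → r ∈S W → v ∉S W → adj G r v ≡ true →
        ((r , v) ≡ (r₁ , v₁)) ⊎ ((r , v) ≡ (r₂ , v₂))))

ℕtoℚ : ℕ → ℚ
ℕtoℚ m = + m / 1

HasAppearances : ∀ {h n} → ℚ → Graph h → Graph n → Set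
HasAppearances {h} {n} x J G =
  ∃[ Ws ] Unique Ws × All (TwoAppears J G) Ws × x ≤ ℕtoℚ (length {A = Subset n} Ws)

expTerm : ℚ → ℕ → ℚ
expTerm x zero    = 1ℚ
expTerm x (suc k) = expTerm x k * x * (+ 1 / suc k)

expPartial : ℚ → ℕ → ℚ
expPartial x zero    = expTerm x zero
expPartial x (suc k) = expPartial x k + expTerm x (suc k)

-- b · eˣ < g   (for x ≥ 0; eˣ = sup of the partial sums)
MulExpLess : ℕ → ℚ → ℕ → Set
MulExpLess b x g = ∃[ r ] r < ℕtoℚ g × (∀ K → ℕtoℚ b * expPartial x K ≤ r)

-- Probability statement  P[¬ Bad-event] < e^{-x}  for the uniform random
-- element of 𝒫(n,D,D), expressed via exact duplicate-free enumerations
-- `all` of 𝒫(n,D,D) and `bad` of the graphs in it failing the property: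
--   |bad| / |all| < e^{-x}   ⇔   |bad| · eˣ < |all|.
ProbFailLess : (n D : ℕ) → (Graph n → Set) → ℚ → Set
ProbFailLess n D Prop x =
  (all bad : List (Graph n)) →
  Unique all → (∀ G → G ∈ all ⇔ InP n D G) →
  Unique bad → (∀ G → G ∈ bad ⇔ (InP n D G × ¬ Prop G)) →
  MulExpLess (length bad) x (length all)

{-# OPTIONS --safe #-}
module Submission where

-- Local switching.  A planar D-regular graph G splits into pieces of bounded size with few edges
-- between different pieces: cut it into bands of breadth-first levels, and cut each band along a
-- spanning tree of the dual.  Inside linearly many of these pieces the graph can be rebuilt on a
-- bounded vertex set so that the result G′ is again planar and D-regular and has a 2-appearance
-- of H ∖ f there.  To recover G from G′ it suffices to know a vertex of that appearance and a
-- bounded amount of information; a hitting set for the appearances in G′ has at most h j elements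
-- if there are no more than j disjoint ones, and a switch increases the maximal number of disjoint
-- appearances by at most a constant L.  So if g j counts the graphs without j + 1 disjoint
-- appearances, then n · g j ≤ C (j + L) · g (j + L), and g grows by a factor 8 every L steps as
-- long as j is small compared to n.  Hence at most a proportion 8⁻ᵗ of the graphs, t = ⌊n / q⌋,
-- has fewer than t + 1 appearances.
--
-- All choices are made under a double negation, which is harmless because the resulting
-- inequality between natural numbers is decidable.

open import Defs

-- Planarity is handled without topology. For every map V - E + F ≤ 2 C (`euler`), so being planar
-- is a lower bound on the number of faces, and a switch must be shown not to lose too many. All
-- face counts rest on one fact about generated equivalence relations (`join-count`): a new
-- generator lowers the number of classes by at most one. The same count shows that the face steps
-- and the dual edges outside a spanning tree form a forest on the darts; having degree at most
-- three, it can be cut into bounded parts. What may replace a piece is constrained: its vertex set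
-- stays, the outer ends of the edges leaving it stay, in cyclic order, and all degrees are D. So
-- the replacement is a ring of chains with two poles each: H minus an edge, units that carry the
-- legs, and fillers that bring the number of vertices to the right value. Regular planar graphs of
-- degree at least 3 exist for the degrees 3, 4 and 5 only, and small ones of each degree serve as
-- fillers; parity is the one obstruction to reaching a large size. The factor 8 is meant to exceed
-- the bound 4 for the exponential, with a margin that absorbs rounding.

module Switching where
  open import Data.Bool using (Bool; true; false; if_then_else_; T; _∧_; _∨_)
  import Data.Bool.Properties as BP
  open import Data.Empty using (⊥; ⊥-elim)
  open import Data.Fin as Fin using (Fin; zero; suc; toℕ; fromℕ<; _↑ˡ_; _↑ʳ_; splitAt)
  import Data.Fin.Properties as FP
  import Data.Integer as ℤ
  import Data.Integer.Properties as ℤP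
  open import Data.List as List using (List; []; _∷_; length; map; _++_; filter; concatMap; allFin; cartesianProduct; upTo)
  open import Data.List.Membership.Propositional using (_∈_; _∉_)
  open import Data.List.Membership.Propositional.Properties using (∈-map⁺; ∈-map⁻; ∈-++⁺ˡ; ∈-++⁺ʳ; ∈-++⁻; ∈-filter⁺; ∈-filter⁻; ∈-allFin; ∈-cartesianProduct⁺; ∈-cartesianProduct⁻; ∈-upTo⁺)
  open import Data.List.Properties using (length-map; length-++; length-tabulate; length-take; map-tabulate)
  import Data.List.Relation.Unary.All as All
  open import Data.List.Relation.Unary.All using (All; []; _∷_)
  import Data.List.Relation.Unary.All.Properties as AllP
  import Data.List.Relation.Unary.AllPairs as AllPairs
  open import Data.List.Relation.Unary.AllPairs using (AllPairs; []; _∷_)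
  import Data.List.Relation.Unary.AllPairs.Properties as APP
  import Data.List.Relation.Unary.Any as Any
  open import Data.List.Relation.Unary.Any using (Any; here; there)
  open import Data.List.Relation.Unary.Unique.Propositional using (Unique)
  import Data.List.Relation.Unary.Unique.Propositional.Properties as UP
  open import Data.Nat as ℕ using (ℕ; zero; suc; _+_; _*_; _∸_; _^_; _≤_; _<_; z≤n; s≤s; _⊔_)
  open import Data.Nat.DivMod using (_/_; _%_; m≡m%n+[m/n]*n; m%n<n; +-distrib-/-∣ʳ; m*n/n≡m; m<n⇒m/n≡0; _mod_; m/n*n≤m; /-monoˡ-≤)
  open import Data.Nat.Divisibility using (_∣_; ∣⇒≤; m%n≡0⇒n∣m; ∣m+n∣m⇒∣n; n∣m*n)
  open import Data.Nat.Properties as ℕP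
  open import Data.Nat.Tactic.RingSolver using (solve-∀)
  open import Data.Product using (Σ; ∃; _×_; _,_; proj₁; proj₂; uncurry)
  open import Data.Product.Properties using (≡-dec)
  open import Data.Rational as ℚ using (ℚ; 0ℚ; 1ℚ; toℚᵘ)
  import Data.Rational.Properties as QP
  open import Data.Rational.Solver using (module +-*-Solver)
  import Data.Rational.Unnormalised as ℚᵘ
  import Data.Rational.Unnormalised.Properties as ℚᵘP
  open import Data.Sum using (_⊎_; inj₁; inj₂; [_,_]′)
  open import Data.Unit using (⊤; tt)
  open import Data.Vec as Vec using (lookup; tabulate; _[_]≔_)
  import Data.Vec.Properties as VP
  open import Data.Vec.Properties using (lookup∘tabulate)
  open import Function using (_∘_; id; case_of_)
  open import Function.Bundles using (mk⇔; Equivalence)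
  open import Relation.Binary.Definitions using (DecidableEquality; tri<; tri≈; tri>)
  open import Relation.Binary.PropositionalEquality using (_≡_; _≢_; refl; sym; trans; cong; cong₂; subst; subst₂; module ≡-Reasoning)
  open import Relation.Nullary using (¬_; Dec; yes; no)
  open import Relation.Nullary.Decidable using (_×-dec_; _⊎-dec_; ¬?; decidable-stable; True; toWitness; _→-dec_; map′; dec-true; dec-false)

  -- Choices under double negation, finite types, counting by injections

  NN : Set → Set
  NN A = ¬ ¬ A

  return : {A : Set} → A → NN A
  return a k = k a

  _>>=_ : {A B : Set} → NN A → (A → NN B) → NN B
  (m >>= f) k = m (λ a → f a k)

  nn-dec : {P : Set} → NN (Dec P)
  nn-dec k = k (no (λ p → k (yes p)))

  nn-list : {A : Set} {P : A → Set} (xs : List A) → (∀ x → NN (P x)) → NN (∀ {x} → x ∈ xs → P x)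
  nn-list []       f = return λ ()
  nn-list {P = P} (x ∷ xs) f = do
    p ← f x
    q ← nn-list xs f
    return λ { (here refl) → p ; (there i) → q i }

  nn-∈ : {A : Set} {P : A → Set} (xs : List A) → (∀ x → x ∈ xs → NN (P x)) → NN (∀ {x} → x ∈ xs → P x)
  nn-∈ []       f = return λ ()
  nn-∈ {P = P} (x ∷ xs) f = do
    p ← f x (here refl)
    q ← nn-∈ xs (λ y i → f y (there i))
    return λ { (here refl) → p ; (there i) → q i }

  record Finite (A : Set) : Set where
    field
      els      : List A
      complete : ∀ a → a ∈ els
      uniq     : Unique els
      _≟F_     : DecidableEquality A

  nn-fin : {A : Set} {P : A → Set} → Finite A → (∀ x → NN (P x)) → NN (∀ x → P x)
  nn-fin F f = do
    g ← nn-list (Finite.els F) f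
    return λ x → g (Finite.complete F x)

  finFinite : ∀ n → Finite (Fin n)
  finFinite n = record { els = allFin n ; complete = ∈-allFin ; uniq = UP.allFin⁺ n ; _≟F_ = FP._≟_ }

  prodFinite : {A B : Set} → Finite A → Finite B → Finite (A × B)
  prodFinite F G = record
    { els = cartesianProduct (Finite.els F) (Finite.els G)
    ; complete = λ { (a , b) → ∈-cartesianProduct⁺ (Finite.complete F a) (Finite.complete G b) }
    ; uniq = UP.cartesianProduct⁺ (Finite.uniq F) (Finite.uniq G)
    ; _≟F_ = ≡-dec (Finite._≟F_ F) (Finite._≟F_ G) }

  ∈-remove : {A : Set} {x : A} {xs : List A} → x ∈ xs →
    ∃ λ ys → length xs ≡ suc (length ys) × (∀ {y} → y ∈ xs → y ≡ x ⊎ y ∈ ys)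
  ∈-remove {xs = x ∷ xs} (here refl) = xs , refl , λ { (here e) → inj₁ e ; (there i) → inj₂ i }
  ∈-remove {xs = x ∷ xs} (there i) with ∈-remove i
  ... | ys , e , f = x ∷ ys , cong suc e , λ { (here e′) → inj₂ (here e′)
                                            ; (there j) → [ inj₁ , (λ k → inj₂ (there k)) ]′ (f j) }

  -- A pigeonhole principle for relations, so that no function from `xs` to `ys` has to be chosen.
  -- `Q` is the kind of separateness at hand: distinctness for duplicate-free lists, inequivalence
  -- for independent lists, disjointness for families of vertex sets.
  inj-count : {A B : Set} {Q : A → A → Set} (P : A → B → Set) {xs : List A} {ys : List B} →
    AllPairs Q xs → (∀ {x} → x ∈ xs → ∃ λ y → y ∈ ys × P x y) →
    (∀ {x x′ y} → Q x x′ → P x y → P x′ y → ⊥) → length xs ≤ length ys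
  inj-count P []        f g = z≤n
  inj-count P {x ∷ xs} {ys} (q ∷ qs) f g with f (here refl)
  ... | y , y∈ , p with ∈-remove y∈
  ... | ys′ , e , rem = subst (suc (length xs) ≤_) (sym e) (s≤s (inj-count P qs f′ g))
    where
    f′ : ∀ {x′} → x′ ∈ xs → ∃ λ y′ → y′ ∈ ys′ × P x′ y′
    f′ i with f (there i)
    ... | y′ , y′∈ , p′ with rem y′∈
    ... | inj₁ refl = ⊥-elim (g (All.lookup q i) p p′)
    ... | inj₂ k = y′ , k , p′

  unique-⊆ : {A : Set} {xs ys : List A} → Unique xs → (∀ {x} → x ∈ xs → x ∈ ys) → length xs ≤ length ys
  unique-⊆ u f = inj-count _≡_ u (λ {x} i → x , f i , refl) (λ q e e′ → q (trans e (sym e′)))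

  -- Generated equivalence relations and their numbers of classes

  data Conn {A : Set} (L : A → A → Set) : A → A → Set where
    nil : ∀ {x} → Conn L x x
    fwd : ∀ {x y z} → L x y → Conn L y z → Conn L x z
    bwd : ∀ {x y z} → L y x → Conn L y z → Conn L x z

  module _ {A : Set} {L : A → A → Set} where
    ctrans : ∀ {x y z} → Conn L x y → Conn L y z → Conn L x z
    ctrans nil q = q
    ctrans (fwd l p) q = fwd l (ctrans p q)
    ctrans (bwd l p) q = bwd l (ctrans p q)

    clink : ∀ {x y} → L x y → Conn L x y
    clink l = fwd l nil

    csym : ∀ {x y} → Conn L x y → Conn L y x
    csym nil = nil
    csym (fwd l p) = ctrans (csym p) (bwd l nil)
    csym (bwd l p) = ctrans (csym p) (fwd l nil)

    creflexive : ∀ {x y} → x ≡ y → Conn L x y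
    creflexive refl = nil

  record IsEq {A : Set} (E : A → A → Set) : Set where
    field
      erefl  : ∀ {x} → E x x
      esym   : ∀ {x y} → E x y → E y x
      etrans : ∀ {x y z} → E x y → E y z → E x z

  connEq : {A : Set} {L : A → A → Set} → IsEq (Conn L)
  connEq = record { erefl = nil ; esym = csym ; etrans = ctrans }

  kerEq : {A B : Set} (f : A → B) → IsEq (λ x y → f x ≡ f y)
  kerEq f = record { erefl = refl ; esym = sym ; etrans = trans }

  cfold : {A : Set} {L E : A → A → Set} → IsEq E → (∀ {x y} → L x y → E x y) → ∀ {x y} → Conn L x y → E x y
  cfold I f nil = IsEq.erefl I
  cfold I f (fwd l p) = IsEq.etrans I (f l) (cfold I f p)
  cfold I f (bwd l p) = IsEq.etrans I (IsEq.esym I (f l)) (cfold I f p)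

  cgmap : {A B : Set} {L : A → A → Set} {M : B → B → Set} (h : A → B) →
    (∀ {x y} → L x y → Conn M (h x) (h y)) → ∀ {x y} → Conn L x y → Conn M (h x) (h y)
  cgmap h f nil = nil
  cgmap h f (fwd l p) = ctrans (f l) (cgmap h f p)
  cgmap h f (bwd l p) = ctrans (csym (f l)) (cgmap h f p)

  cmap : {A : Set} {L M : A → A → Set} → (∀ {x y} → L x y → Conn M x y) → ∀ {x y} → Conn L x y → Conn M x y
  cmap = cgmap id

  Cover : {A : Set} → (A → A → Set) → List A → Set
  Cover R ys = ∀ x → ∃ λ y → y ∈ ys × R x y

  Indep : {A : Set} → (A → A → Set) → List A → Set
  Indep R = AllPairs (λ x y → ¬ R x y)

  indep≤cover : {A : Set} {R : A → A → Set} → IsEq R → {xs ys : List A} → Indep R xs →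
    (∀ {x} → x ∈ xs → ∃ λ y → y ∈ ys × R x y) → length xs ≤ length ys
  indep≤cover {R = R} I ind f = inj-count R ind f (λ q r r′ → q (IsEq.etrans I r (IsEq.esym I r′)))

  indep-∈ : {A : Set} {R : A → A → Set} → IsEq R → {xs : List A} → Indep R xs →
    ∀ {x y} → x ∈ xs → y ∈ xs → R x y → x ≡ y
  indep-∈ I (q ∷ qs) (here refl) (here refl) r = refl
  indep-∈ I (q ∷ qs) (here refl) (there j) r = ⊥-elim (All.lookup q j r)
  indep-∈ I (q ∷ qs) (there i) (here refl) r = ⊥-elim (All.lookup q i (IsEq.esym I r))
  indep-∈ I (q ∷ qs) (there i) (there j) r = indep-∈ I qs i j r

  addL : {A : Set} → (A → A → Set) → List (A × A) → A → A → Set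
  addL L ps x y = L x y ⊎ (x , y) ∈ ps

  module _ {A : Set} {L : A → A → Set} {a b : A} where
    private
      L₁ : A → A → Set
      L₁ x y = L x y ⊎ (x , y) ≡ (a , b)
      Near : A → Set
      Near x = Conn L x a ⊎ Conn L x b

    -- A path that uses the new link can be cut at its first and at its last use of it; the two
    -- outer parts then join its ends to `a` or `b` by old links.
    one-more : ∀ {x y} → Conn L₁ x y → Conn L x y ⊎ (Near x × Near y)
    one-more nil = inj₁ nil
    one-more (fwd (inj₁ l) p) with one-more p
    ... | inj₁ c = inj₁ (fwd l c)
    ... | inj₂ (inj₁ c , n) = inj₂ (inj₁ (fwd l c) , n)
    ... | inj₂ (inj₂ c , n) = inj₂ (inj₂ (fwd l c) , n)
    one-more (bwd (inj₁ l) p) with one-more p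
    ... | inj₁ c = inj₁ (bwd l c)
    ... | inj₂ (inj₁ c , n) = inj₂ (inj₁ (bwd l c) , n)
    ... | inj₂ (inj₂ c , n) = inj₂ (inj₂ (bwd l c) , n)
    one-more (fwd (inj₂ refl) p) with one-more p
    ... | inj₁ c = inj₂ (inj₁ nil , inj₂ (csym c))
    ... | inj₂ (_ , n) = inj₂ (inj₁ nil , n)
    one-more (bwd (inj₂ refl) p) with one-more p
    ... | inj₁ c = inj₂ (inj₂ nil , inj₁ (csym c))
    ... | inj₂ (_ , n) = inj₂ (inj₂ nil , n)

    -- Removing one generator splits at most one class, into the class of `a` and that of `b`. The
    -- old representative `ya` still lies in one of the two, and the extra element represents the
    -- other.
    cover-split : {ys : List A} → Cover (Conn L₁) ys → ∃ λ y → Cover (Conn L) (y ∷ ys)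
    cover-split {ys} cov with cov a
    ... | ya , ya∈ , c with one-more c
    ... | inj₁ c′ = b , go c′
      where
      go : Conn L a ya → Cover (Conn L) (b ∷ ys)
      go c′ z with cov z
      ... | y , y∈ , p with one-more p
      ... | inj₁ q = y , there y∈ , q
      ... | inj₂ (inj₁ q , _) = ya , there ya∈ , ctrans q c′
      ... | inj₂ (inj₂ q , _) = b , here refl , q
    ... | inj₂ (_ , inj₁ d) = b , go (csym d)
      where
      go : Conn L a ya → Cover (Conn L) (b ∷ ys)
      go c′ z with cov z
      ... | y , y∈ , p with one-more p
      ... | inj₁ q = y , there y∈ , q
      ... | inj₂ (inj₁ q , _) = ya , there ya∈ , ctrans q c′
      ... | inj₂ (inj₂ q , _) = b , here refl , q
    ... | inj₂ (_ , inj₂ d) = a , go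
      where
      go : Cover (Conn L) (a ∷ ys)
      go z with cov z
      ... | y , y∈ , p with one-more p
      ... | inj₁ q = y , there y∈ , q
      ... | inj₂ (inj₁ q , _) = a , here refl , q
      ... | inj₂ (inj₂ q , _) = ya , there ya∈ , ctrans q (csym d)

  cover-unjoin : {A : Set} {L : A → A → Set} (ps : List (A × A)) {ys : List A} → Cover (Conn (addL L ps)) ys →
    ∃ λ zs → Cover (Conn L) zs × length zs ≡ length ps + length ys
  cover-unjoin {L = L} [] {ys} cov = ys , (λ x → let (y , i , c) = cov x in y , i , cmap (λ { (inj₁ l) → clink l }) c) , refl
  cover-unjoin {L = L} ((a , b) ∷ ps) {ys} cov with cover-split {L = addL L ps} {a} {b} cov′
    where
    cov′ : Cover (Conn (λ x y → addL L ps x y ⊎ (x , y) ≡ (a , b))) ys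
    cov′ x = let (y , i , c) = cov x in y , i ,
      cmap (λ { (inj₁ l) → clink (inj₁ (inj₁ l)) ; (inj₂ (here e)) → clink (inj₂ e) ; (inj₂ (there j)) → clink (inj₁ (inj₂ j)) }) c
  ... | y , cov₁ with cover-unjoin ps cov₁
  ... | zs , cov₂ , e = zs , cov₂ , trans e (+-suc (length ps) (length ys))

  -- The one device for comparing numbers of faces: each added pair costs at most one class. An
  -- independent list bounds the number of old classes from below and a cover that of the new ones
  -- from above, so neither number is ever computed.
  join-count : {A : Set} {L : A → A → Set} (ps : List (A × A)) {xs ys : List A} → Indep (Conn L) xs →
    Cover (Conn (addL L ps)) ys → length xs ≤ length ps + length ys
  join-count ps ind cov with cover-unjoin ps cov
  ... | zs , cov′ , e = subst (_ ≤_) e (indep≤cover connEq ind (λ {x} _ → cov′ x))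

  reps : {A : Set} {R : A → A → Set} → IsEq R → (∀ x y → Dec (R x y)) → (xs : List A) →
    ∃ λ ys → Indep R ys × (∀ {x} → x ∈ xs → ∃ λ y → y ∈ ys × R x y)
  reps I R? [] = [] , [] , λ ()
  reps {R = R} I R? (x ∷ xs) with reps I R? xs
  ... | ys , ind , cov with Any.any? (R? x) ys
  ... | yes p = ys , ind , λ { (here refl) → find p ; (there i) → cov i }
    where
    find : ∀ {zs} → Any (R x) zs → ∃ λ y → y ∈ zs × R x y
    find (here r) = _ , here refl , r
    find (there q) with find q
    ... | y , i , r = y , there i , r
  ... | no ¬p = x ∷ ys , All.tabulate (λ i r → ¬p (lose i r)) ∷ ind ,
        λ { (here refl) → x , here refl , IsEq.erefl I ; (there i) → let (y , j , r) = cov i in y , there j , r }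
    where
    lose : ∀ {y zs} → y ∈ zs → R x y → Any (R x) zs
    lose (here refl) r = here r
    lose (there i) r = there (lose i r)

  nn-reps : {A : Set} {R : A → A → Set} → Finite A → IsEq R → NN (∃ λ ys → Indep R ys × Cover R ys)
  nn-reps {R = R} F I = do
    d ← nn-fin F (λ x → nn-fin F (λ y → nn-dec {R x y}))
    let (ys , ind , cov) = reps I d (Finite.els F)
    return (ys , ind , λ x → cov (Finite.complete F x))

  nn-min : {P : ℕ → Set} (b k : ℕ) → k ≤ b → P k → NN (∃ λ m → P m × (∀ j → P j → m ≤ j))
  nn-min zero zero z≤n p = return (zero , p , λ _ _ → z≤n)
  nn-min {P} (suc b) k k≤ p = nn-dec {∃ λ j → j < k × P j} >>= λ
    { (yes (j , j<k , q)) → nn-min b j (≤-pred (≤-trans j<k k≤)) q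
    ; (no ¬q) → return (k , p , λ j q → ≮⇒≥ (λ j<k → ¬q (j , j<k , q))) }
  nn-min {P} zero (suc k) () p

  -- Breadth-first levels

  record Bfs {A : Set} (L : A → A → Set) (rs : List A) : Set where
    field
      lev  : A → ℕ
      par  : A → A
      root : ∀ {x} → lev x ≡ 0 → x ∈ rs
      lev0 : ∀ {x} → x ∈ rs → lev x ≡ 0
      parL : ∀ {x k} → lev x ≡ suc k → L x (par x)
      parlev : ∀ {x k} → lev x ≡ suc k → lev (par x) ≡ k
      lip  : ∀ {x y} → L x y → lev x ≤ suc (lev y)

  module _ {A : Set} (F : Finite A) {L : A → A → Set} (Lsym : ∀ {x y} → L x y → L y x) (rs : List A) where
    private
      data Dist : ℕ → A → Set where
        d0 : ∀ {x} → x ∈ rs → Dist 0 x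
        ds : ∀ {k x y} → Dist k y → L x y → Dist (suc k) x

      reach : ∀ {x y} → Conn L x y → y ∈ rs → ∃ λ k → Dist k x
      reach nil i = 0 , d0 i
      reach (fwd l p) i = let (k , d) = reach p i in suc k , ds d l
      reach (bwd l p) i = let (k , d) = reach p i in suc k , ds d (Lsym l)

      build : (m : ∀ x → ∃ λ k → Dist k x × (∀ j → Dist j x → k ≤ j)) → Bfs L rs
      build m = record { lev = lev ; par = par ; root = root ; lev0 = lev0 ; parL = parL ; parlev = parlev ; lip = lip }
        where
        lev : A → ℕ
        lev x = proj₁ (m x)
        parOf : ∀ {k x} → Dist k x → A
        parOf {x = x} (d0 _) = x
        parOf (ds {y = y} _ _) = y
        par : A → A
        par x = parOf (proj₁ (proj₂ (m x)))
        root : ∀ {x} → lev x ≡ 0 → x ∈ rs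
        root {x} e with m x
        root {x} refl | zero , d0 i , _ = i
        lev0 : ∀ {x} → x ∈ rs → lev x ≡ 0
        lev0 {x} i = n≤0⇒n≡0 (proj₂ (proj₂ (m x)) 0 (d0 i))
        parL : ∀ {x k} → lev x ≡ suc k → L x (par x)
        parL {x} e with m x
        parL {x} () | zero , d0 i , _
        parL {x} e | suc k , ds d l , _ = l
        lip : ∀ {x y} → L x y → lev x ≤ suc (lev y)
        lip {x} {y} l = proj₂ (proj₂ (m x)) _ (ds (proj₁ (proj₂ (m y))) l)
        parlev : ∀ {x k} → lev x ≡ suc k → lev (par x) ≡ k
        parlev {x} {k} e with m x
        parlev {x} () | zero , d0 i , _
        parlev {x} {k} refl | suc .k , ds {y = y} d l , mn =
          ≤-antisym (proj₂ (proj₂ (m y)) k d) (≤-pred (mn _ (ds (proj₁ (proj₂ (m y))) l)))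

    bfs : Cover (Conn L) rs → NN (Bfs L rs)
    bfs cov = do
      m ← nn-fin F (λ x → let (y , i , c) = cov x ; (k , d) = reach c i in nn-min {λ k → Dist k x} k k ≤-refl d)
      return (build m)

  -- Finite sums and indicator functions

  ∑ : {A : Set} → List A → (A → ℕ) → ℕ
  ∑ []       f = 0
  ∑ (x ∷ xs) f = f x + ∑ xs f

  𝟙 : {P : Set} → Dec P → ℕ
  𝟙 (yes _) = 1
  𝟙 (no _)  = 0

  ∑-cong : {A : Set} {f g : A → ℕ} (xs : List A) → (∀ {x} → x ∈ xs → f x ≡ g x) → ∑ xs f ≡ ∑ xs g
  ∑-cong [] e = refl
  ∑-cong (x ∷ xs) e = cong₂ _+_ (e (here refl)) (∑-cong xs (λ i → e (there i)))

  ∑-mono : {A : Set} {f g : A → ℕ} (xs : List A) → (∀ {x} → x ∈ xs → f x ≤ g x) → ∑ xs f ≤ ∑ xs g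
  ∑-mono [] e = z≤n
  ∑-mono (x ∷ xs) e = +-mono-≤ (e (here refl)) (∑-mono xs (λ i → e (there i)))

  interchange : ∀ a b c d → (a + b) + (c + d) ≡ (a + c) + (b + d)
  interchange = solve-∀

  ∑-+ : {A : Set} (f g : A → ℕ) (xs : List A) → ∑ xs (λ x → f x + g x) ≡ ∑ xs f + ∑ xs g
  ∑-+ f g [] = refl
  ∑-+ f g (x ∷ xs) = trans (cong (f x + g x +_) (∑-+ f g xs)) (interchange (f x) (g x) (∑ xs f) (∑ xs g))

  ∑-0 : {A : Set} (xs : List A) → ∑ xs (λ _ → 0) ≡ 0
  ∑-0 [] = refl
  ∑-0 (x ∷ xs) = ∑-0 xs

  ∑-const : {A : Set} (c : ℕ) (xs : List A) → ∑ xs (λ _ → c) ≡ length xs * c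
  ∑-const c [] = refl
  ∑-const c (x ∷ xs) = cong (c +_) (∑-const c xs)

  ∑-* : {A : Set} (c : ℕ) (f : A → ℕ) (xs : List A) → ∑ xs (λ x → c * f x) ≡ c * ∑ xs f
  ∑-* c f [] = sym (*-zeroʳ c)
  ∑-* c f (x ∷ xs) = trans (cong (c * f x +_) (∑-* c f xs)) (sym (*-distribˡ-+ c (f x) (∑ xs f)))

  ∑-swap : {A B : Set} (f : A → B → ℕ) (xs : List A) (ys : List B) →
    ∑ xs (λ x → ∑ ys (f x)) ≡ ∑ ys (λ y → ∑ xs (λ x → f x y))
  ∑-swap f [] ys = sym (∑-0 ys)
  ∑-swap f (x ∷ xs) ys = trans (cong (∑ ys (f x) +_) (∑-swap f xs ys)) (sym (∑-+ (f x) (λ y → ∑ xs (λ x → f x y)) ys))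

  ∑-++ : {A : Set} (f : A → ℕ) (xs ys : List A) → ∑ (xs ++ ys) f ≡ ∑ xs f + ∑ ys f
  ∑-++ f [] ys = refl
  ∑-++ f (x ∷ xs) ys = trans (cong (f x +_) (∑-++ f xs ys)) (sym (+-assoc (f x) _ _))

  ∑-filter : {A : Set} {P : A → Set} (P? : ∀ x → Dec (P x)) (f : A → ℕ) (xs : List A) →
    ∑ (filter P? xs) f ≡ ∑ xs (λ x → 𝟙 (P? x) * f x)
  ∑-filter P? f [] = refl
  ∑-filter P? f (x ∷ xs) with P? x
  ... | yes _ = cong₂ _+_ (sym (+-identityʳ (f x))) (∑-filter P? f xs)
  ... | no _  = ∑-filter P? f xs

  length-filter : {A : Set} {P : A → Set} (P? : ∀ x → Dec (P x)) (xs : List A) →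
    length (filter P? xs) ≡ ∑ xs (λ x → 𝟙 (P? x))
  length-filter P? [] = refl
  length-filter P? (x ∷ xs) with P? x
  ... | yes _ = cong suc (length-filter P? xs)
  ... | no _  = length-filter P? xs

  ∑-≤-∈ : {A : Set} (f : A → ℕ) {xs : List A} {x : A} → x ∈ xs → f x ≤ ∑ xs f
  ∑-≤-∈ f (here refl) = m≤m+n _ _
  ∑-≤-∈ f {y ∷ _} (there i) = ≤-trans (∑-≤-∈ f i) (m≤n+m _ (f y))

  ∑-≟ : {A : Set} (_≈?_ : DecidableEquality A) {xs : List A} {a : A} → Unique xs → a ∈ xs → (g : A → ℕ) →
    ∑ xs (λ x → 𝟙 (a ≈? x) * g x) ≡ g a
  ∑-≟ {A} _≈?_ {a = a} (q ∷ u) (here {xs = xs} refl) g with a ≈? a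
  ... | no ¬e = ⊥-elim (¬e refl)
  ... | yes _ = trans (cong₂ _+_ (+-identityʳ (g a)) (zeros xs q)) (+-identityʳ (g a))
    where
    zeros : ∀ xs → All (a ≢_) xs → ∑ xs (λ x → 𝟙 (a ≈? x) * g x) ≡ 0
    zeros [] [] = refl
    zeros (x ∷ xs) (n ∷ ns) with a ≈? x
    ... | yes e = ⊥-elim (n e)
    ... | no _ = zeros xs ns
  ∑-≟ _≈?_ {x ∷ xs} {a} (q ∷ u) (there i) g with a ≈? x
  ... | yes refl = ⊥-elim (All.lookup q i refl)
  ... | no _ = ∑-≟ _≈?_ u i g

  filter-split : {A : Set} {P Q : A → Set} (P? : ∀ x → Dec (P x)) (Q? : ∀ x → Dec (Q x)) →
    (∀ {x} → P x → Q x → ⊥) → (∀ {x} → ¬ P x → Q x) → (xs : List A) →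
    length (filter P? xs) + length (filter Q? xs) ≡ length xs
  filter-split P? Q? ex tot [] = refl
  filter-split P? Q? ex tot (x ∷ xs) with P? x | Q? x
  ... | yes p | yes q = ⊥-elim (ex p q)
  ... | yes p | no _ = cong suc (filter-split P? Q? ex tot xs)
  ... | no _ | yes _ = trans (+-suc _ _) (cong suc (filter-split P? Q? ex tot xs))
  ... | no np | no nq = ⊥-elim (nq (tot np))

  -- The cyclic successor

  nx : ∀ {m} → Fin (suc m) → Fin (suc m)
  nx {m} i with suc (toℕ i) <? suc m
  ... | yes p = fromℕ< p
  ... | no _  = zero

  nx-step : ∀ {m k} (p : k < suc m) (q : suc k < suc m) → nx (fromℕ< p) ≡ fromℕ< q
  nx-step {m} {k} p q with suc (toℕ (fromℕ< p)) <? suc m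
  ... | yes r = FP.fromℕ<-cong _ _ (cong suc (FP.toℕ-fromℕ< p)) r q
  ... | no ¬r = ⊥-elim (¬r (subst (λ j → suc j < suc m) (sym (FP.toℕ-fromℕ< p)) q))

  nx-last : ∀ {m} (i : Fin (suc m)) → toℕ i ≡ m → nx i ≡ zero
  nx-last {m} i e with suc (toℕ i) <? suc m
  ... | yes r = ⊥-elim (<-irrefl e (≤-pred r))
  ... | no _ = refl

  toℕ-nx : ∀ {m} (i : Fin (suc m)) → (suc (toℕ i) < suc m × toℕ (nx i) ≡ suc (toℕ i)) ⊎ (toℕ i ≡ m × toℕ (nx i) ≡ 0)
  toℕ-nx {m} i with suc (toℕ i) <? suc m
  ... | yes r = inj₁ (r , FP.toℕ-fromℕ< r)
  ... | no ¬r = inj₂ (≤-antisym (FP.toℕ≤pred[n] i) (≤-pred (≮⇒≥ ¬r)) , refl)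

  nx-inj : ∀ {m} {i j : Fin (suc m)} → nx i ≡ nx j → i ≡ j
  nx-inj {m} {i} {j} e with toℕ-nx i | toℕ-nx j
  ... | inj₁ (_ , a) | inj₁ (_ , b) = FP.toℕ-injective (suc-injective (trans (sym a) (trans (cong toℕ e) b)))
  ... | inj₁ (_ , a) | inj₂ (_ , b) = ⊥-elim (1+n≢0 (trans (sym a) (trans (cong toℕ e) b)))
  ... | inj₂ (_ , a) | inj₁ (_ , b) = ⊥-elim (1+n≢0 (trans (sym b) (trans (cong toℕ (sym e)) a)))
  ... | inj₂ (a , _) | inj₂ (b , _) = FP.toℕ-injective (trans a (sym b))

  module _ {m : ℕ} {E : Fin (suc m) → Fin (suc m) → Set} (I : IsEq E) (i₀ : Fin (suc m))
           (step : ∀ i → i ≢ i₀ → E (nx i) i) where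
    open IsEq I

    private
      low : ∀ k (p : k < suc m) → k ≤ toℕ i₀ → E (fromℕ< p) zero
      low zero (s≤s p) _ = erefl
      low (suc k) p le = etrans (subst (λ z → E z (fromℕ< k<)) (nx-step k< p) (step _ ne)) (low k k< (≤-trans (n≤1+n k) le))
        where
        k< : k < suc m
        k< = ≤-trans (n≤1+n _) p
        ne : fromℕ< k< ≢ i₀
        ne e = <-irrefl (trans (sym (FP.toℕ-fromℕ< k<)) (cong toℕ e)) le

      high : ∀ k (p : k < suc m) → toℕ i₀ < k → E (fromℕ< p) (nx i₀)
      high (suc k) p (s≤s le) with toℕ i₀ ℕP.≟ k
      ... | yes refl = IsEq.esym I (subst (λ z → E (nx i₀) z) (trans (cong nx (sym (FP.fromℕ<-toℕ i₀ k<))) (nx-step k< p)) erefl)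
        where
        k< : toℕ i₀ < suc m
        k< = ≤-trans (n≤1+n _) p
      ... | no ne′ = etrans (subst (λ z → E z (fromℕ< k<)) (nx-step k< p) (step _ ne)) (high k k< (≤∧≢⇒< le ne′))
        where
        k< : k < suc m
        k< = ≤-trans (n≤1+n _) p
        ne : fromℕ< k< ≢ i₀
        ne e = ne′ (sym (trans (sym (FP.toℕ-fromℕ< k<)) (cong toℕ e)))

      wrap : E (nx i₀) zero
      wrap with toℕ i₀ ℕP.≟ m
      ... | yes e = subst (λ z → E z zero) (sym (nx-last i₀ e)) erefl
      ... | no ne = etrans (esym (high m ≤-refl (≤∧≢⇒< (FP.toℕ≤pred[n] i₀) ne)))
                     (esym (subst (λ z → E z (fromℕ< {m} ≤-refl)) (nx-last (fromℕ< {m} ≤-refl) (FP.toℕ-fromℕ< ≤-refl)) (step _ ne₂)))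
        where
        ne₂ : fromℕ< {m} ≤-refl ≢ i₀
        ne₂ e = ne (trans (cong toℕ (sym e)) (FP.toℕ-fromℕ< ≤-refl))

      to0 : ∀ i → E i zero
      to0 i with ≤-total (toℕ i) (toℕ i₀)
      ... | inj₁ le = subst (λ z → E z zero) (FP.fromℕ<-toℕ i (FP.toℕ<n i)) (low (toℕ i) (FP.toℕ<n i) le)
      ... | inj₂ ge with toℕ i₀ ℕP.≟ toℕ i
      ... | yes e = subst (λ z → E z zero) (FP.fromℕ<-toℕ i (FP.toℕ<n i)) (low (toℕ i) (FP.toℕ<n i) (≤-reflexive (sym e)))
      ... | no ne = etrans (subst (λ z → E z (nx i₀)) (FP.fromℕ<-toℕ i (FP.toℕ<n i)) (high (toℕ i) (FP.toℕ<n i) (≤∧≢⇒< ge ne))) wrap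

    -- A cycle without one of its links is still a path, so the step at `i₀` may be missing. In
    -- `Contour` this is the step at the port towards the parent.
    cycle-const : ∀ i j → E i j
    cycle-const i j = etrans (to0 i) (esym (to0 j))

  -- Combinatorial maps, spanning forests and their contours

  -- Maps with all degrees suc D′: the dart (u , i) is the i-th half-edge at u in rotation order,
  -- and the map is determined by the involution α exchanging the two halves of each edge.
  module RegMap (n D′ : ℕ) (α : Fin n × Fin (suc D′) → Fin n × Fin (suc D′))
                (inv : ∀ d → α (α d) ≡ d) (nofix : ∀ d → α d ≢ d) where
    D : ℕ
    D = suc D′

    X : Set
    X = Fin n × Fin D

    FV : Finite (Fin n)
    FV = finFinite n

    abstract
      FX : Finite X
      FX = prodFinite (finFinite n) (finFinite D)

      length-allX : length (Finite.els FX) ≡ n * D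
      length-allX = trans (len (allFin n)) (cong (_* D) (length-tabulate {n = n} id))
        where
        len : ∀ (xs : List (Fin n)) → length (cartesianProduct xs (allFin D)) ≡ length xs * D
        len [] = refl
        len (x ∷ xs) = trans (length-++ (map (x ,_) (allFin D)))
          (cong₂ _+_ (trans (length-map (x ,_) (allFin D)) (length-tabulate {n = D} id)) (len xs))

    allX : List X
    allX = Finite.els FX

    _≟X_ : DecidableEquality X
    _≟X_ = Finite._≟F_ FX

    σ : X → X
    σ (u , i) = u , nx i

    φ : X → X
    φ d = σ (α d)

    hd : X → Fin n
    hd d = proj₁ (α d)

    α-inj : ∀ {d e} → α d ≡ α e → d ≡ e
    α-inj {d} {e} eq = trans (sym (inv d)) (trans (cong α eq) (inv e))

    σ-inj : ∀ {d e} → σ d ≡ σ e → d ≡ e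
    σ-inj eq = cong₂ _,_ (cong proj₁ eq) (nx-inj (cong proj₂ eq))

    φ-inj : ∀ {d e} → φ d ≡ φ e → d ≡ e
    φ-inj eq = α-inj (σ-inj eq)

    σφ : ∀ d → σ d ≡ φ (α d)
    σφ d = cong σ (sym (inv d))

    φL : X → X → Set
    φL d e = e ≡ φ d

    AdjL : Fin n → Fin n → Set
    AdjL u v = ∃ λ i → hd (u , i) ≡ v

    adj-sym : ∀ {u v} → AdjL u v → AdjL v u
    adj-sym {u} (i , refl) = proj₂ (α (u , i)) , cong proj₁ (inv (u , i))

    key : X → ℕ
    key (u , i) = toℕ (Fin.combine u i)

    key-inj : ∀ {d e} → key d ≡ key e → d ≡ e
    key-inj {u , i} {v , j} eq = let (a , b) = FP.combine-injective u i v j (FP.toℕ-injective eq) in cong₂ _,_ a b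

    Lower : X → Set
    Lower d = key d < key (α d)

    lower? : ∀ d → Dec (Lower d)
    lower? d = key d <? key (α d)

    lower-or : ∀ d → Lower d ⊎ Lower (α d)
    lower-or d with <-cmp (key d) (key (α d))
    ... | tri< a _ _ = inj₁ a
    ... | tri≈ _ b _ = ⊥-elim (nofix d (sym (key-inj b)))
    ... | tri> _ _ c = inj₂ (subst (λ z → key (α d) < key z) (sym (inv d)) c)

    half : (xs : List X) → Unique xs → (∀ {d} → d ∈ xs → α d ∈ xs) → 2 * length (filter lower? xs) ≤ length xs
    half xs u cl = subst (_≤ length xs) (trans (length-++ ls) (cong₂ _+_ refl (trans (length-map α ls) (sym (+-identityʳ _)))))
      (unique-⊆ (UP.++⁺ uls (UP.map⁺ α-inj uls) disj) sub)
      where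
      ls : List X
      ls = filter lower? xs
      uls : Unique ls
      uls = UP.filter⁺ lower? u
      disj : ∀ {v} → (v ∈ ls × v ∈ map α ls) → ⊥
      disj (a , b) with ∈-map⁻ α b
      ... | d , d∈ , refl = <-asym (proj₂ (∈-filter⁻ lower? {xs = xs} d∈))
             (subst (λ z → key (α d) < key z) (inv d) (proj₂ (∈-filter⁻ lower? {xs = xs} a)))
      sub : ∀ {d} → d ∈ ls ++ map α ls → d ∈ xs
      sub i with ∈-++⁻ ls i
      ... | inj₁ a = proj₁ (∈-filter⁻ lower? {xs = xs} a)
      ... | inj₂ b with ∈-map⁻ α b
      ... | d , d∈ , refl = cl (proj₁ (∈-filter⁻ lower? {xs = xs} d∈))

    -- The parent is given by the port that leads to it, which for a simple graph is the same as the
    -- tree edge itself. A mere decrease of `lev` is required, so breadth-first trees of subgraphs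
    -- qualify too; vertices at level 0 are the roots.
    record Forest : Set where
      field
        lev  : Fin n → ℕ
        p    : Fin n → Fin D
        plev : ∀ {v} → 0 < lev v → lev (hd (v , p v)) < lev v

      Up : X → Set
      Up (u , i) = 0 < lev u × i ≡ p u

      up? : ∀ d → Dec (Up d)
      up? (u , i) = (0 <? lev u) ×-dec (i FP.≟ p u)

      Tr : X → Set
      Tr d = Up d ⊎ Up (α d)

      tr? : ∀ d → Dec (Tr d)
      tr? d = up? d ⊎-dec up? (α d)

      tr-α : ∀ {d} → Tr d → Tr (α d)
      tr-α (inj₁ x) = inj₂ (subst Up (sym (inv _)) x)
      tr-α (inj₂ y) = inj₁ y

      up-α : ∀ {d} → Up d → ¬ Up (α d)
      up-α {u , i} (l , refl) (l′ , e) = <-asym (plev l)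
        (subst (λ z → lev z < lev (hd (u , i))) (cong proj₁ (trans (cong α (sym (cong₂ _,_ refl e))) (inv (u , i)))) (plev l′))

      data Anc : Fin n → Fin n → Set where
        self : ∀ {v} → Anc v v
        dn   : ∀ {c x} → 0 < lev c → Anc c x → Anc (hd (c , p c)) x

      nonroots : List (Fin n)
      nonroots = filter (λ v → 0 <? lev v) (allFin n)

      idents : List X → List X
      idents qs = filter lower? (filter (λ d → ¬? (tr? d)) qs)

      idPairs : List X → List (X × X)
      idPairs qs = map (λ d → d , α d) (idents qs)

      idPairs-∈ : ∀ {qs} → (∀ {d} → d ∈ qs → α d ∈ qs) → ∀ {d} → d ∈ qs → ¬ Tr d →
        (d , α d) ∈ idPairs qs ⊎ (α d , d) ∈ idPairs qs
      idPairs-∈ {qs} cl {d} i nt with lower-or d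
      ... | inj₁ l = inj₁ (∈-map⁺ (λ d → d , α d) (∈-filter⁺ lower? (∈-filter⁺ (λ d → ¬? (tr? d)) i nt) l))
      ... | inj₂ l = inj₂ (subst (λ z → (α d , z) ∈ idPairs qs) (inv d)
          (∈-map⁺ (λ d → d , α d) (∈-filter⁺ lower? (∈-filter⁺ (λ d → ¬? (tr? d)) (cl i) (λ t → nt (subst Tr (inv d) (tr-α t)))) l)))

      -- Each non-root owns a tree edge, that is, two darts of `qs`, and `up-α` prevents an edge
      -- from being owned twice. The remaining darts fall into pairs under `α`, of which `idents`
      -- keeps one.
      idents-count : (qs : List X) → Unique qs → (∀ {d} → d ∈ qs → α d ∈ qs) → (∀ {d} → Tr d → d ∈ qs) →
        2 * length (idents qs) + 2 * length nonroots ≤ length qs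
      idents-count qs u cl tq = ≤-trans (+-mono-≤ (half ns uns cln) tl) (≤-reflexive eq)
        where
        ns : List X
        ns = filter (λ d → ¬? (tr? d)) qs
        uns : Unique ns
        uns = UP.filter⁺ (λ d → ¬? (tr? d)) u
        cln : ∀ {d} → d ∈ ns → α d ∈ ns
        cln {d} i with ∈-filter⁻ (λ d → ¬? (tr? d)) {xs = qs} i
        ... | a , b = ∈-filter⁺ (λ d → ¬? (tr? d)) (cl a) (λ t → b (subst Tr (inv d) (tr-α t)))
        ts : List X
        ts = filter tr? qs
        ups : List X
        ups = map (λ v → v , p v) nonroots
        unr : Unique nonroots
        unr = UP.filter⁺ (λ v → 0 <? lev v) (UP.allFin⁺ n)
        uups : Unique ups
        uups = UP.map⁺ (cong proj₁) unr
        ups-up : ∀ {d} → d ∈ ups → Up d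
        ups-up i with ∈-map⁻ (λ v → v , p v) i
        ... | v , v∈ , refl = proj₂ (∈-filter⁻ (λ v → 0 <? lev v) {xs = allFin n} v∈) , refl
        disj : ∀ {d} → (d ∈ ups × d ∈ map α ups) → ⊥
        disj (a , b) with ∈-map⁻ α b
        ... | e , e∈ , refl = up-α (ups-up e∈) (ups-up a)
        sub : ∀ {d} → d ∈ ups ++ map α ups → d ∈ ts
        sub i with ∈-++⁻ ups i
        ... | inj₁ a = ∈-filter⁺ tr? (tq (inj₁ (ups-up a))) (inj₁ (ups-up a))
        ... | inj₂ b with ∈-map⁻ α b
        ... | e , e∈ , refl = ∈-filter⁺ tr? (tq (tr-α (inj₁ (ups-up e∈)))) (tr-α (inj₁ (ups-up e∈)))
        tl : 2 * length nonroots ≤ length ts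
        tl = subst (_≤ length ts) (trans (length-++ ups) (cong₂ _+_ (length-map _ nonroots)
               (trans (length-map α ups) (trans (length-map _ nonroots) (sym (+-identityʳ _))))))
               (unique-⊆ (UP.++⁺ uups (UP.map⁺ α-inj uups) disj) sub)
        eq : length ns + length ts ≡ length qs
        eq = filter-split (λ d → ¬? (tr? d)) tr? (λ nt t → nt t) (λ nnt → dne nnt) qs
          where
          dne : ∀ {d} → ¬ ¬ Tr d → Tr d
          dne {d} = decidable-stable (tr? d)

      -- Walking around a tree: if the corners on the two sides of a dart are related whenever
      -- the contour of the forest does not separate them, all corners of a subtree are related.
      module Contour {E : X → X → Set} (I : IsEq E) where
        open IsEq I

        OK : Fin n → Set
        OK u = ∀ i → (¬ Tr (u , i) → E (σ (u , i)) (u , i)) ×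
                     (Tr (u , i) → E (σ (α (u , i))) (u , i) × E (σ (u , i)) (α (u , i)))

        Good : Fin n → Set
        Good v = (∀ i j → E (v , i) (v , j)) ×
                 (0 < lev v → E (v , p v) (α (v , p v)) × E (σ (α (v , p v))) (α (v , p v)))

        private
          around : ∀ v i₀ → (∀ i → i ≢ i₀ → E (σ (v , i)) (v , i)) → ∀ i j → E (v , i) (v , j)
          around v i₀ st = cycle-const {E = λ i j → E (v , i) (v , j)}
            (record { erefl = erefl ; esym = esym ; etrans = etrans }) i₀ st

        -- Mutual induction with `transp` on `f`, a bound for how far the levels extend beyond that
        -- of `v`. Once the subtree of a child is settled, the corners on both sides of the edge to
        -- the child are related. So all steps around `v` are available except the one at the parent
        -- port, and `cycle-const` manages without it.
        subtree : ∀ f v → (∀ w → lev w ≤ f + lev v) → (∀ x → Anc v x → OK x) → Good v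
        transp : ∀ f v → (∀ w → lev w ≤ f + lev v) → (∀ x → Anc v x → OK x) →
          ∀ i → ¬ Up (v , i) → E (σ (v , i)) (v , i)

        transp f v bd ok i nu with tr? (v , i)
        ... | no nt = proj₁ (ok v self i) nt
        ... | yes (inj₁ u) = ⊥-elim (nu u)
        ... | yes (inj₂ (l , e)) with f
        ...   | zero = ⊥-elim (<⇒≱ (subst (λ z → lev z < lev (hd (v , i))) hv (plev l)) (bd _))
          where
          hv : hd (hd (v , i) , p (hd (v , i))) ≡ v
          hv = cong proj₁ (trans (cong α (cong₂ _,_ refl (sym e))) (inv (v , i)))
        ...   | suc f′ = subst (λ z → E (σ z) z) ac (proj₂ (proj₂ (subtree f′ c bd′ ok′) l))
          where
          c : Fin n
          c = hd (v , i)
          ac : α (c , p c) ≡ (v , i)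
          ac = trans (cong α (cong₂ _,_ refl (sym e))) (inv (v , i))
          hv : hd (c , p c) ≡ v
          hv = cong proj₁ ac
          bd′ : ∀ w → lev w ≤ f′ + lev c
          bd′ w = ≤-trans (bd w) (≤-trans (≤-reflexive (sym (+-suc f′ (lev v)))) (+-monoʳ-≤ f′ (subst (λ z → lev z < lev c) hv (plev l))))
          ok′ : ∀ x → Anc c x → OK x
          ok′ x a = ok x (subst (λ z → Anc z x) hv (dn l a))

        subtree f v bd ok = all , rest
          where
          all : ∀ i j → E (v , i) (v , j)
          all with 0 <? lev v
          ... | yes l = around v (p v) (λ i ne → transp f v bd ok i (λ u → ne (proj₂ u)))
          ... | no nl = around v zero (λ i _ → transp f v bd ok i (λ u → nl (proj₁ u)))
          rest : 0 < lev v → E (v , p v) (α (v , p v)) × E (σ (α (v , p v))) (α (v , p v))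
          rest l with proj₂ (ok v self (p v)) (inj₁ (l , refl))
          ... | a , b = dα , etrans a dα
            where
            dα : E (v , p v) (α (v , p v))
            dα = etrans (all (p v) (nx (p v))) b

        levBound : ∀ v w → lev w ≤ ∑ (allFin n) lev + lev v
        levBound v w = ≤-trans (∑-≤-∈ lev (∈-allFin w)) (m≤m+n _ _)

        good : ∀ v → (∀ x → Anc v x → OK x) → Good v
        good v = subtree (∑ (allFin n) lev) v (levBound v)

        toRoot : (∀ x → OK x) → ∀ k v → lev v ≤ k → ∃ λ r → lev r ≡ 0 × (∀ i j → E (v , i) (r , j))
        toRoot ok k v le with lev v in eq
        toRoot ok k v le | zero = v , eq , proj₁ (good v (λ x _ → ok x))
        toRoot ok (suc k) v (s≤s le) | suc l with toRoot ok k (hd (v , p v)) (≤-trans (≤-pred (subst (lev (hd (v , p v)) <_) eq (plev (subst (0 <_) (sym eq) (s≤s z≤n))))) le)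
        ... | r , e , f = r , e , λ i j → etrans (etrans (proj₁ g i (p v)) (proj₁ (proj₂ g (subst (0 <_) (sym eq) (s≤s z≤n))))) (f _ j)
          where
          g : Good v
          g = good v (λ x _ → ok x)

    module OfBfs {L : Fin n → Fin n → Set} {rs : List (Fin n)} (L⊆ : ∀ {u v} → L u v → AdjL u v) (B : Bfs L rs) where
      open Bfs B
      private
        port : ∀ v k → lev v ≡ k → Σ (Fin D) λ i → 0 < k → hd (v , i) ≡ par v × L v (hd (v , i))
        port v zero e = zero , λ ()
        port v (suc k) e = let (i , h) = L⊆ (parL e) in i , λ _ → h , subst (L v) (sym h) (parL e)

      up-port : Fin n → Fin D
      up-port v = proj₁ (port v (lev v) refl)

      up-par : ∀ {v} → 0 < lev v → hd (v , up-port v) ≡ par v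
      up-par {v} l = proj₁ (proj₂ (port v (lev v) refl) l)

      up-L : ∀ {v} → 0 < lev v → L v (hd (v , up-port v))
      up-L {v} l = proj₂ (proj₂ (port v (lev v) refl) l)

      par-suc : ∀ {v} → 0 < lev v → suc (lev (par v)) ≡ lev v
      par-suc {v} l = go (lev v) refl l
        where
        go : ∀ k → lev v ≡ k → 0 < k → suc (lev (par v)) ≡ k
        go (suc k) e _ = cong suc (parlev e)

      forestOf : Forest
      forestOf = record { lev = lev ; p = up-port
        ; plev = λ {v} l → subst (λ z → lev z < lev v) (sym (up-par l)) (≤-reflexive (par-suc l)) }

    open OfBfs using (forestOf) public

    module _ (F : Forest) where
      open Forest F
      roots : List (Fin n)
      roots = filter (λ v → lev v ℕP.≟ 0) (allFin n)

      n-split : n ≡ length nonroots + length roots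
      n-split = trans (sym (length-tabulate {n = n} id))
        (sym (filter-split (λ v → 0 <? lev v) (λ v → lev v ℕP.≟ 0)
          (λ l e → <-irrefl (sym e) l) (λ nl → n≤0⇒n≡0 (≮⇒≥ nl)) (allFin n)))

    -- The pairs `ps` glue together the faces on the two sides of every edge outside the forest.
    -- What remains separating is the forest alone, and the walk around a tree meets every dart of
    -- its component: dually, the edges outside a spanning tree connect all faces.
    allV-cover : {rs : List (Fin n)} (B : Bfs AdjL rs) (ps : List (X × X)) →
      let open Forest (forestOf id B) in
      (∀ d → ¬ Tr d → (d , α d) ∈ ps ⊎ (α d , d) ∈ ps) →
      ∀ v i → ∃ λ r → r ∈ rs × Conn (addL φL ps) (v , i) (r , zero)
    allV-cover {rs} B ps h v i = let (r , e , c) = toRoot ok _ v ≤-refl in r , Bfs.root B e , c i zero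
      where
      open Forest (forestOf id B)
      open Contour (connEq {L = addL φL ps})
      ok : ∀ x → OK x
      ok x i = (λ nt → ctrans (bwd (inj₁ (σφ (x , i))) nil) (ids nt)) ,
               (λ t → bwd (inj₁ refl) nil , bwd (inj₁ (σφ (x , i))) nil)
        where
        ids : ¬ Tr (x , i) → Conn (addL φL ps) (α (x , i)) (x , i)
        ids nt with h (x , i) nt
        ... | inj₁ j = bwd (inj₂ j) nil
        ... | inj₂ j = fwd (inj₂ j) nil

  -- Orbits of injections of a finite set

  module _ {A : Set} where
    iter-+ : (f : A → A) (a b : ℕ) (x : A) → iter f (a + b) x ≡ iter f a (iter f b x)
    iter-+ f zero b x = refl
    iter-+ f (suc a) b x = cong f (iter-+ f a b x)

    iter-comm : (f : A → A) (k : ℕ) (x : A) → iter f k (f x) ≡ f (iter f k x)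
    iter-comm f zero x = refl
    iter-comm f (suc k) x = cong f (iter-comm f k x)

    iter-* : (f : A → A) (p : ℕ) {x : A} → iter f p x ≡ x → ∀ q → iter f (q * p) x ≡ x
    iter-* f p e zero = refl
    iter-* f p {x} e (suc q) = trans (iter-+ f p (q * p) x) (trans (cong (iter f p) (iter-* f p e q)) e)

    iter-inj : {f : A → A} → (∀ {x y} → f x ≡ f y → x ≡ y) → ∀ k {x y} → iter f k x ≡ iter f k y → x ≡ y
    iter-inj inj zero e = e
    iter-inj inj (suc k) e = iter-inj inj k (inj e)

    iter-cancel : {f : A → A} → (∀ {x y} → f x ≡ f y → x ≡ y) → ∀ {i j x} → i ≤ j → iter f i x ≡ iter f j x → iter f (j ∸ i) x ≡ x
    iter-cancel {f} inj {i} {j} {x} le e = sym (iter-inj inj i (trans e (trans (cong (λ k → iter f k x) (sym (m+[n∸m]≡n le))) (iter-+ f i (j ∸ i) x))))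

  index-inj : {A : Set} {xs : List A} {x y : A} (i : x ∈ xs) (j : y ∈ xs) → Any.index i ≡ Any.index j → x ≡ y
  index-inj (here refl) (here refl) e = refl
  index-inj (there i) (there j) e = index-inj i j (FP.suc-injective e)

  module Orbit {A : Set} (FA : Finite A) (f : A → A) (inj : ∀ {x y} → f x ≡ f y → x ≡ y) where
    open Finite FA

    N : ℕ
    N = length els

    abstract
      period : ∀ x → ∃ λ p → 0 < p × p ≤ N × iter f p x ≡ x
      period x with FP.pigeonhole {m = N} {n = suc N} ≤-refl (λ i → Any.index (complete (iter f (toℕ i) x)))
      ... | i , j , i<j , e = toℕ j ∸ toℕ i , m<n⇒0<n∸m i<j , ≤-trans (m∸n≤m (toℕ j) (toℕ i)) (FP.toℕ≤pred[n] j) ,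
            iter-cancel inj (<⇒≤ i<j) (index-inj (complete _) (complete _) e)

      reduce : ∀ x k → ∃ λ j → j < N × iter f j x ≡ iter f k x
      reduce x k with period x
      ... | suc p , _ , le , e = k % suc p , ≤-trans (m%n<n k (suc p)) le ,
            sym (trans (cong (λ z → iter f z x) (m≡m%n+[m/n]*n k (suc p)))
                (trans (iter-+ f (k % suc p) (k / suc p * suc p) x) (cong (iter f (k % suc p)) (iter-* f (suc p) e (k / suc p)))))

      -- A backward step of an injection of a finite set is a forward walk through the rest of a
      -- period.
      conn-iter : ∀ {x y} → Conn (λ d e → e ≡ f d) x y → ∃ λ k → iter f k x ≡ y
      conn-iter nil = 0 , refl
      conn-iter {x} (fwd refl c) = let (k , e) = conn-iter c in suc k , trans (sym (iter-comm f k x)) e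
      conn-iter {x} (bwd {y = z} refl c) with conn-iter c | period z
      ... | k , e | suc p , _ , _ , e′ = k + p , trans (iter-+ f k p x) (trans (cong (iter f k) (trans (iter-comm f p z) e′)) e)

      iter-conn : ∀ k x → Conn (λ d e → e ≡ f d) x (iter f k x)
      iter-conn zero x = nil
      iter-conn (suc k) x = ctrans (iter-conn k x) (fwd refl nil)

      surj : ∀ y → ∃ λ x → f x ≡ y
      surj y with period y
      ... | suc p , _ , _ , e = iter f p y , e

  unique→indep : {A : Set} {R : A → A → Set} {xs : List A} → Unique xs →
    (∀ {x y} → x ∈ xs → y ∈ xs → R x y → x ≡ y) → Indep R xs
  unique→indep [] h = []
  unique→indep (q ∷ u) h = All.tabulate (λ i r → All.lookup q i (h (here refl) (there i) r)) ∷ unique→indep u (λ i j → h (there i) (there j))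

  unique-full : {A : Set} (F : Finite A) {xs ys : List A} → Unique xs → (∀ {x} → x ∈ xs → x ∈ ys) → length ys ≤ length xs →
    ∀ {y} → y ∈ ys → y ∈ xs
  unique-full F {xs} {ys} u sub le {y} i with Any.any? (Finite._≟F_ F y) xs
  ... | yes p = p
  ... | no np = ⊥-elim (<⇒≱ (unique-⊆ (AllP.¬Any⇒All¬ xs np ∷ u) λ { (here refl) → i ; (there j) → sub j }) le)

  -- The Boolean tests and counts of the definitions

  allFin-suc : ∀ n → allFin (suc n) ≡ zero ∷ map suc (allFin n)
  allFin-suc n = cong (zero ∷_) (sym (map-tabulate id suc))

  ∑-map : {A B : Set} (g : A → B) (f : B → ℕ) (xs : List A) → ∑ (map g xs) f ≡ ∑ xs (f ∘ g)
  ∑-map g f [] = refl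
  ∑-map g f (x ∷ xs) = cong (f (g x) +_) (∑-map g f xs)

  ∑-allFin-suc : ∀ n (f : Fin (suc n) → ℕ) → ∑ (allFin (suc n)) f ≡ f zero + ∑ (allFin n) (f ∘ suc)
  ∑-allFin-suc n f = trans (cong (λ l → ∑ l f) (allFin-suc n)) (cong (f zero +_) (∑-map suc f (allFin n)))

  countF-∑ : ∀ n (p : Fin n → Bool) → countF n p ≡ ∑ (allFin n) (λ v → if p v then 1 else 0)
  countF-∑ zero p = refl
  countF-∑ (suc n) p = trans (cong ((if p zero then 1 else 0) +_) (countF-∑ n (p ∘ suc))) (sym (∑-allFin-suc n _))

  sumF-∑ : ∀ n (f : Fin n → ℕ) → sumF n f ≡ ∑ (allFin n) f
  sumF-∑ zero f = refl
  sumF-∑ (suc n) f = trans (cong (f zero +_) (sumF-∑ n (f ∘ suc))) (sym (∑-allFin-suc n f))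

  𝟙-bool : (b : Bool) → 𝟙 (b BP.≟ true) ≡ (if b then 1 else 0)
  𝟙-bool true = refl
  𝟙-bool false = refl

  countF-filter : ∀ n (p : Fin n → Bool) → countF n p ≡ length (filter (λ v → p v BP.≟ true) (allFin n))
  countF-filter n p = trans (countF-∑ n p) (trans (∑-cong (allFin n) (λ {v} _ → sym (𝟙-bool (p v)))) (sym (length-filter (λ v → p v BP.≟ true) (allFin n))))

  ∧-true : ∀ {a b} → a ∧ b ≡ true → a ≡ true × b ≡ true
  ∧-true {true} {true} _ = refl , refl

  ∨-true : ∀ {a b} → a ∨ b ≡ true → a ≡ true ⊎ b ≡ true
  ∨-true {true} _ = inj₁ refl
  ∨-true {false} {true} _ = inj₂ refl

  ∨-introˡ : ∀ {a} b → a ≡ true → a ∨ b ≡ true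
  ∨-introˡ b refl = refl

  ∨-introʳ : ∀ a {b} → b ≡ true → a ∨ b ≡ true
  ∨-introʳ true refl = refl
  ∨-introʳ false refl = refl

  allF-true : ∀ {n} {p : Fin n → Bool} → allF n p ≡ true → ∀ i → p i ≡ true
  allF-true {suc n} e zero = proj₁ (∧-true e)
  allF-true {suc n} e (suc i) = allF-true {n} (proj₂ (∧-true e)) i

  true-allF : ∀ {n} {p : Fin n → Bool} → (∀ i → p i ≡ true) → allF n p ≡ true
  true-allF {zero} h = refl
  true-allF {suc n} h = cong₂ _∧_ (h zero) (true-allF (h ∘ suc))

  anyF-true : ∀ {n} {p : Fin n → Bool} → anyF n p ≡ true → ∃ λ i → p i ≡ true
  anyF-true {suc n} {p} e with ∨-true {p zero} e
  ... | inj₁ x = zero , x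
  ... | inj₂ y = let (i , z) = anyF-true {n} y in suc i , z

  true-anyF : ∀ {n} {p : Fin n → Bool} i → p i ≡ true → anyF n p ≡ true
  true-anyF {suc n} zero e = ∨-introˡ _ e
  true-anyF {suc n} {p} (suc i) e = ∨-introʳ (p zero) (true-anyF i e)

  allBelow-true : ∀ {m} {p : ℕ → Bool} → allBelow m p ≡ true → ∀ {k} → k < m → p k ≡ true
  allBelow-true {suc m} {p} e {k} (s≤s le) with k ℕP.≟ m
  ... | yes refl = proj₁ (∧-true e)
  ... | no ne = allBelow-true {m} (proj₂ (∧-true {p m} e)) (≤∧≢⇒< le ne)

  true-allBelow : ∀ {m} {p : ℕ → Bool} → (∀ {k} → k < m → p k ≡ true) → allBelow m p ≡ true
  true-allBelow {zero} h = refl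
  true-allBelow {suc m} h = cong₂ _∧_ (h ≤-refl) (true-allBelow (λ l → h (≤-trans l (n≤1+n m))))

  T→≡ : ∀ {b} → T b → b ≡ true
  T→≡ {true} _ = refl

  ≡→T : ∀ {b} → b ≡ true → T b
  ≡→T refl = tt

  ≤ᵇ-true : ∀ {m n} → m ≤ n → (m ℕ.≤ᵇ n) ≡ true
  ≤ᵇ-true le = T→≡ (≤⇒≤ᵇ le)

  true-≤ᵇ : ∀ {m n} → (m ℕ.≤ᵇ n) ≡ true → m ≤ n
  true-≤ᵇ {m} {n} e = ≤ᵇ⇒≤ m n (≡→T e)

  ==-true : ∀ {n} {i j : Fin n} → (i == j) ≡ true → i ≡ j
  ==-true {i = i} {j} e = FP.toℕ-injective (≡ᵇ⇒≡ (toℕ i) (toℕ j) (≡→T e))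

  ==-refl : ∀ {n} (i : Fin n) → (i == i) ≡ true
  ==-refl i = T→≡ (≡⇒≡ᵇ (toℕ i) (toℕ i) refl)

  least : ∀ {n} (p : Fin n → Bool) {v} → p v ≡ true → ∃ λ w → p w ≡ true × (∀ w′ → p w′ ≡ true → toℕ w ≤ toℕ w′)
  least {suc n} p {v} e with p zero in eq
  ... | true = zero , eq , λ _ _ → z≤n
  least {suc n} p {zero} e | false = ⊥-elim (λf (trans (sym eq) e))
    where
    λf : false ≢ true
    λf ()
  least {suc n} p {suc v} e | false with least (p ∘ suc) {v} e
  ... | w , a , b = suc w , a , λ { zero x → ⊥-elim (λf (trans (sym eq) x)) ; (suc w′) x → s≤s (b w′ x) }
    where
    λf : false ≢ true
    λf ()

  -- Connected components of a graph

  Adj : ∀ {n} → Graph n → Fin n → Fin n → Set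
  Adj G u v = adj G u v ≡ true

  module Components {n : ℕ} (G : Graph n) (symG : ∀ i j → adj G i j ≡ adj G j i) where

    adj-symm : ∀ {u v} → Adj G u v → Adj G v u
    adj-symm {u} {v} e = trans (symG v u) e

    reach-sound : ∀ k {u v} → reachB G k u v ≡ true → Conn (Adj G) u v
    reach-sound zero e = creflexive (==-true e)
    reach-sound (suc k) {u} {v} e with ∨-true {reachB G k u v} e
    ... | inj₁ x = reach-sound k x
    ... | inj₂ y = let (w , z) = anyF-true y ; (a , b) = ∧-true {reachB G k u w} z in ctrans (reach-sound k a) (clink b)

    reach-suc : ∀ k {u v} → reachB G k u v ≡ true → reachB G (suc k) u v ≡ true
    reach-suc k {u} {v} e = ∨-introˡ _ e

    reach-step : ∀ k {u v w} → reachB G k u v ≡ true → Adj G v w → reachB G (suc k) u w ≡ true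
    reach-step k {u} {v} {w} e a = ∨-introʳ (reachB G k u w) (true-anyF v (cong₂ _∧_ e a))

    private
      set : ℕ → Fin n → List (Fin n)
      set k u = filter (λ v → reachB G k u v BP.≟ true) (allFin n)

      Closed : ℕ → Fin n → Set
      Closed k u = ∀ v w → reachB G k u v ≡ true → Adj G v w → reachB G k u w ≡ true

      closed-suc : ∀ k u → Closed k u → Closed (suc k) u
      closed-suc k u c v w e a with ∨-true {reachB G k u v} e
      ... | inj₁ x = reach-suc k (c v w x a)
      ... | inj₂ y = let (z , q) = anyF-true y ; (r , s) = ∧-true {reachB G k u z} q in reach-suc k (c v w (c z v r s) a)

      -- While the reachable set is not closed, it gains a vertex in each round; not being closed
      -- after n rounds, it would have more than n elements.
      grow : ∀ k u → Closed k u ⊎ k < length (set k u)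
      grow zero u = inj₂ (∈-length (∈-filter⁺ (λ v → (u == v) BP.≟ true) (∈-allFin u) (==-refl u)))
        where
        ∈-length : ∀ {x : Fin n} {xs} → x ∈ xs → 0 < length xs
        ∈-length (here _) = s≤s z≤n
        ∈-length (there _) = s≤s z≤n
      grow (suc k) u with grow k u
      ... | inj₁ c = inj₁ (closed-suc k u c)
      ... | inj₂ l with FP.any? (λ w → (reachB G (suc k) u w BP.≟ true) ×-dec ¬? (reachB G k u w BP.≟ true))
      ... | yes (w , a , b) = inj₂ (≤-trans (s≤s l) (unique-⊆ {xs = w ∷ set k u}
              (AllP.¬Any⇒All¬ _ (λ i → b (proj₂ (∈-filter⁻ (λ v → reachB G k u v BP.≟ true) {xs = allFin n} i))) ∷ UP.filter⁺ (λ v → reachB G k u v BP.≟ true) (UP.allFin⁺ n))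
              λ { (here refl) → ∈-filter⁺ (λ v → reachB G (suc k) u v BP.≟ true) (∈-allFin w) a
                ; (there i) → ∈-filter⁺ (λ v → reachB G (suc k) u v BP.≟ true) (∈-allFin _) (reach-suc k (proj₂ (∈-filter⁻ (λ v → reachB G k u v BP.≟ true) {xs = allFin n} i))) }))
      ... | no none = inj₁ (closed-suc k u (λ v w e a → decidable-stable (reachB G k u w BP.≟ true) (λ ne → none (w , reach-step k e a , ne))))

      closedn : ∀ u → Closed n u
      closedn u with grow n u
      ... | inj₁ c = c
      ... | inj₂ l = ⊥-elim (<⇒≱ l (subst (length (set n u) ≤_) (length-tabulate {n = n} id) (unique-⊆ (UP.filter⁺ (λ v → reachB G n u v BP.≟ true) (UP.allFin⁺ n)) (λ i → ∈-allFin _))))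

      reach-mono : ∀ k {u v} → reachB G 0 u v ≡ true → reachB G k u v ≡ true
      reach-mono zero e = e
      reach-mono (suc k) e = reach-suc k (reach-mono k e)

    reach-complete : ∀ {u v} → Conn (Adj G) u v → reachB G n u v ≡ true
    reach-complete {u} c = go c (reach-mono n (==-refl u))
      where
      go : ∀ {x v} → Conn (Adj G) x v → reachB G n u x ≡ true → reachB G n u v ≡ true
      go nil r = r
      go (fwd l p) r = go p (closedn u _ _ r l)
      go (bwd l p) r = go p (closedn u _ _ r (adj-symm l))

    isRep : Fin n → Bool
    isRep u = allF n (λ v → if reachB G n u v then toℕ u ℕ.≤ᵇ toℕ v else true)

    compReps : List (Fin n)
    compReps = filter (λ u → isRep u BP.≟ true) (allFin n)

    length-compReps : length compReps ≡ numComponents G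
    length-compReps = sym (countF-filter n isRep)

    private
      rep-≤ : ∀ {u} → isRep u ≡ true → ∀ {v} → Conn (Adj G) u v → toℕ u ≤ toℕ v
      rep-≤ {u} e {v} c with reachB G n u v in eq | allF-true e v
      ... | true | x = true-≤ᵇ x
      ... | false | _ with trans (sym eq) (reach-complete c)
      ... | ()

      ≤-rep : ∀ {u} → (∀ {v} → Conn (Adj G) u v → toℕ u ≤ toℕ v) → isRep u ≡ true
      ≤-rep {u} h = true-allF go
        where
        go : ∀ v → (if reachB G n u v then toℕ u ℕ.≤ᵇ toℕ v else true) ≡ true
        go v with reachB G n u v in eq
        ... | true = ≤ᵇ-true (h (reach-sound n eq))
        ... | false = refl

    compReps-indep : Indep (Conn (Adj G)) compReps
    compReps-indep = unique→indep (UP.filter⁺ (λ u → isRep u BP.≟ true) (UP.allFin⁺ n)) λ i j c →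
      FP.toℕ-injective (≤-antisym (rep-≤ (proj₂ (∈-filter⁻ (λ u → isRep u BP.≟ true) {xs = allFin n} i)) c)
                                  (rep-≤ (proj₂ (∈-filter⁻ (λ u → isRep u BP.≟ true) {xs = allFin n} j)) (csym c)))

    compReps-cover : Cover (Conn (Adj G)) compReps
    compReps-cover v with least (reachB G n v) (reach-complete nil)
    ... | w , e , mn = w , ∈-filter⁺ (λ u → isRep u BP.≟ true) (∈-allFin w)
          (≤-rep (λ c → mn _ (reach-complete (ctrans (reach-sound n e) c)))) , reach-sound n e

  -- Euler's inequality and planar maps

  module Euler (n D′ : ℕ) (α : Fin n × Fin (suc D′) → Fin n × Fin (suc D′))
               (inv : ∀ d → α (α d) ≡ d) (nofix : ∀ d → α d ≢ d) where
    open RegMap n D′ α inv nofix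

    cotree-count : {L : Fin n → Fin n → Set} {cs : List (Fin n)} (L⊆ : ∀ {u v} → L u v → AdjL u v) (B : Bfs L cs) →
      let open Forest (forestOf L⊆ B) in
      (qs : List X) → Unique qs → (∀ {d} → d ∈ qs → α d ∈ qs) → (∀ {d} → Tr d → d ∈ qs) →
      2 * length (idents qs) + 2 * n ≤ length qs + 2 * length cs
    cotree-count {cs = cs} L⊆ B qs u cl tq = begin
      2 * length (idents qs) + 2 * n
        ≡⟨ cong (λ z → 2 * length (idents qs) + 2 * z) (n-split F) ⟩
      2 * length (idents qs) + 2 * (length nonroots + length (roots F))
        ≡⟨ rearr (length (idents qs)) (length nonroots) (length (roots F)) ⟩
      (2 * length (idents qs) + 2 * length nonroots) + 2 * length (roots F)
        ≤⟨ +-mono-≤ (idents-count qs u cl tq) (*-monoʳ-≤ 2 roots≤) ⟩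
      length qs + 2 * length cs ∎
      where
      open ≤-Reasoning
      F = forestOf L⊆ B
      open Forest F
      rearr : ∀ a b c → 2 * a + 2 * (b + c) ≡ (2 * a + 2 * b) + 2 * c
      rearr = solve-∀
      roots≤ : length (roots F) ≤ length cs
      roots≤ = unique-⊆ (UP.filter⁺ (λ v → lev v ℕP.≟ 0) (UP.allFin⁺ n))
        (λ i → Bfs.root B (proj₂ (∈-filter⁻ (λ v → lev v ℕP.≟ 0) {xs = allFin n} i)))

    module Tree {cs : List (Fin n)} (B : Bfs AdjL cs) where
      F : Forest
      F = forestOf id B
      open Forest F public

      ips : List (X × X)
      ips = idPairs allX

      ips-count : 2 * length ips + 2 * n ≤ n * D + 2 * length cs
      ips-count = subst₂ (λ a b → 2 * a + 2 * n ≤ b + 2 * length cs) (sym (length-map _ (idents allX))) length-allX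
        (cotree-count id B allX (Finite.uniq FX) (λ _ → Finite.complete FX _) (λ _ → Finite.complete FX _))

      ips-∈ : ∀ d → ¬ Tr d → (d , α d) ∈ ips ⊎ (α d , d) ∈ ips
      ips-∈ d nt = idPairs-∈ (λ _ → Finite.complete FX _) (Finite.complete FX d) nt

    rootDarts : List (Fin n) → List X
    rootDarts = map (λ r → r , zero)

    -- Euler's inequality V - E + F ≤ 2 C for maps of any genus, doubled, with 2 E = n D. Merging
    -- the two sides of each of the E - V + C edges outside a spanning forest leaves one class per
    -- component, so F ≤ (E - V + C) + C.
    euler : {fs : List X} {cs : List (Fin n)} → Indep (Conn φL) fs → Cover (Conn AdjL) cs →
      2 * n + 2 * length fs ≤ n * D + 4 * length cs
    euler {fs} {cs} ind cov = decidable-stable (_ ≤? _) do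
      B ← bfs FV adj-sym cs cov
      return (main B)
      where
      open ≤-Reasoning
      main : Bfs AdjL cs → 2 * n + 2 * length fs ≤ n * D + 4 * length cs
      main B = begin
        2 * n + 2 * length fs ≤⟨ +-monoʳ-≤ (2 * n) (*-monoʳ-≤ 2 (join-count ips ind cover)) ⟩
        2 * n + 2 * (length ips + length (rootDarts cs)) ≡⟨ cong (λ z → 2 * n + 2 * (length ips + z)) (length-map _ cs) ⟩
        2 * n + 2 * (length ips + length cs) ≡⟨ rearr n (length ips) (length cs) ⟩
        (2 * length ips + 2 * n) + 2 * length cs ≤⟨ +-monoˡ-≤ (2 * length cs) ips-count ⟩
        (n * D + 2 * length cs) + 2 * length cs ≡⟨ rearr₂ (n * D) (length cs) ⟩
        n * D + 4 * length cs ∎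
        where
        open Tree B
        rearr : ∀ a b c → 2 * a + 2 * (b + c) ≡ (2 * b + 2 * a) + 2 * c
        rearr = solve-∀
        rearr₂ : ∀ a b → (a + 2 * b) + 2 * b ≡ a + 4 * b
        rearr₂ = solve-∀
        cover : Cover (Conn (addL φL ips)) (rootDarts cs)
        cover (v , i) = let (r , r∈ , c) = allV-cover B ips ips-∈ v i in (r , zero) , ∈-map⁺ _ r∈ , c

    -- `genus0` is the inequality opposite to `euler`, so together they are Euler's formula. For
    -- `fs` independence is enough, since planarity needs the number of faces from below.
    record PlanarR : Set where
      field
        fs     : List X
        cs     : List (Fin n)
        findep : Indep (Conn φL) fs
        cindep : Indep (Conn AdjL) cs
        ccover : Cover (Conn AdjL) cs
        genus0 : n * D + 4 * length cs ≤ 2 * n + 2 * length fs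

  -- Translation between rotation systems of graphs and maps

  argmin : (f : ℕ → ℕ) (m : ℕ) → ∃ λ k → k ≤ m × (∀ j → j ≤ m → f k ≤ f j)
  argmin f zero = 0 , z≤n , λ { zero z≤n → ≤-refl }
  argmin f (suc m) with argmin f m
  ... | k , k≤ , mn with f (suc m) <? f k
  ... | yes l = suc m , ≤-refl , λ j le → [ (λ lt → ≤-trans (<⇒≤ l) (mn j (≤-pred lt))) , (λ { refl → ≤-refl }) ]′ (m≤n⇒m<n∨m≡n le)
  ... | no nl = k , ≤-trans k≤ (n≤1+n m) , λ j le → [ (λ lt → mn j (≤-pred lt)) , (λ { refl → ≮⇒≥ nl }) ]′ (m≤n⇒m<n∨m≡n le)

  ∑-cart : {A B : Set} (xs : List A) (ys : List B) (f : A × B → ℕ) →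
    ∑ (cartesianProduct xs ys) f ≡ ∑ xs (λ x → ∑ ys (λ y → f (x , y)))
  ∑-cart [] ys f = refl
  ∑-cart (x ∷ xs) ys f = trans (∑-++ f (map (x ,_) ys) (cartesianProduct xs ys)) (cong₂ _+_ (∑-map (x ,_) f ys) (∑-cart xs ys f))

  dartCode-inj : ∀ {n} {d e : Fin n × Fin n} → dartCode d ≡ dartCode e → d ≡ e
  dartCode-inj {n} {u , v} {u′ , v′} eq = cong₂ _,_ (proj₁ both) (proj₂ both)
    where
    code : ∀ (x y : Fin n) → toℕ (Fin.combine x y) ≡ toℕ x * n + toℕ y
    code x y = trans (FP.toℕ-combine x y) (cong (_+ toℕ y) (*-comm n (toℕ x)))
    both : u ≡ u′ × v ≡ v′
    both = FP.combine-injective u v u′ v′ (FP.toℕ-injective (trans (code u v) (trans eq (sym (code u′ v′)))))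

  module Corr {n D′ : ℕ} (α : Fin n × Fin (suc D′) → Fin n × Fin (suc D′))
              (inv : ∀ d → α (α d) ≡ d) (nofix : ∀ d → α d ≢ d)
              (G : Graph n) (ρ : Rotation n) (symG : ∀ i j → adj G i j ≡ adj G j i) where
    open RegMap n D′ α inv nofix
    open Euler n D′ α inv nofix
    open Components G symG

    module _ (c₁ : ∀ {u v} → Adj G u v → AdjL u v) (c₂ : ∀ u i → Adj G u (hd (u , i)))
             (c₃ : ∀ {u i j} → hd (u , i) ≡ hd (u , j) → i ≡ j) (c₄ : ∀ u i → ρ u (hd (u , i)) ≡ hd (u , nx i)) where

      AdjL→Adj : ∀ {u v} → AdjL u v → Adj G u v
      AdjL→Adj {u} (i , refl) = c₂ u i

      π : X → Fin n × Fin n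
      π (u , i) = u , hd (u , i)

      π-inj : ∀ {d e} → π d ≡ π e → d ≡ e
      π-inj {u , i} {v , j} eq with cong proj₁ eq
      ... | refl = cong (u ,_) (c₃ (cong proj₂ eq))

      π-φ : ∀ d → π (φ d) ≡ faceStep ρ (π d)
      π-φ d = cong (hd d ,_) (trans (sym (c₄ (hd d) (proj₂ (α d)))) (cong (ρ (hd d)) (cong proj₁ (inv d))))

      π-iter : ∀ k d → π (iter φ k d) ≡ iter (faceStep ρ) k (π d)
      π-iter zero d = refl
      π-iter (suc k) d = trans (π-φ (iter φ k d)) (cong (faceStep ρ) (π-iter k d))

      open Orbit FX φ φ-inj using (reduce; conn-iter; iter-conn)

      rep? : ∀ (d : Fin n × Fin n) → Dec (uncurry (isFaceRep G ρ) d ≡ true)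
      rep? d = uncurry (isFaceRep G ρ) d BP.≟ true

      faceReps : List X
      faceReps = filter (λ d → rep? (π d)) allX

      private
        rep∈ : ∀ {d} → d ∈ faceReps → uncurry (isFaceRep G ρ) (π d) ≡ true
        rep∈ i = proj₂ (∈-filter⁻ (λ d → rep? (π d)) {xs = allX} i)

        upairs : Unique (cartesianProduct (allFin n) (allFin n))
        upairs = Finite.uniq (prodFinite FV FV)

        pairs : List (Fin n × Fin n)
        pairs = filter rep? (cartesianProduct (allFin n) (allFin n))

      length-pairs : length pairs ≡ numFaces G ρ
      length-pairs = trans (length-filter rep? (cartesianProduct (allFin n) (allFin n))) (trans (∑-cart (allFin n) (allFin n) _)
        (sym (trans (sumF-∑ n _) (∑-cong (allFin n) (λ {u} _ → trans (countF-∑ n _) (∑-cong (allFin n) (λ {v} _ → sym (𝟙-bool (isFaceRep G ρ u v)))))))))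

      length-faceReps : length faceReps ≡ numFaces G ρ
      length-faceReps = trans (≤-antisym le ge) length-pairs
        where
        le : length faceReps ≤ length pairs
        le = inj-count (λ d q → π d ≡ q) (UP.filter⁺ (λ d → rep? (π d)) (Finite.uniq FX))
               (λ {d} i → π d , ∈-filter⁺ rep? (Finite.complete (prodFinite FV FV) (π d)) (rep∈ i) , refl)
               (λ ne a b → ne (π-inj (trans a (sym b))))
        ge : length pairs ≤ length faceReps
        ge = inj-count (λ q d → π d ≡ q) (UP.filter⁺ rep? upairs) f (λ ne a b → ne (trans (sym a) b))
          where
          f : ∀ {q} → q ∈ pairs → ∃ λ d → d ∈ faceReps × π d ≡ q
          f {u , v} i with ∈-filter⁻ rep? {xs = cartesianProduct (allFin n) (allFin n)} i
          ... | _ , r with c₁ (proj₁ (∧-true {adj G u v} r))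
          ... | j , refl = (u , j) , ∈-filter⁺ (λ d → rep? (π d)) (Finite.complete FX _) r , refl

      private
        -- The heads of the darts at a vertex are distinct vertices, whence D ≤ n. So a face orbit
        -- fits into the n² steps that `isFaceRep` inspects.
        N≤ : Fin n → length allX ≤ n * n
        N≤ u = subst (_≤ n * n) (sym length-allX) (*-monoʳ-≤ n (FP.injective⇒≤ {f = λ i → hd (u , i)} c₃))

        min-of : ∀ {d} → d ∈ faceReps → ∀ {e} → Conn φL d e → dartCode (π d) ≤ dartCode (π e)
        min-of {u , i} m {e} c with conn-iter c
        ... | k , refl with reduce (u , i) k
        ... | j , j< , eq = subst (λ z → dartCode (π (u , i)) ≤ dartCode z) (trans (sym (π-iter j (u , i))) (cong π eq))
              (true-≤ᵇ (allBelow-true {n * n} (proj₂ (∧-true {adj G u (hd (u , i))} (rep∈ m))) (≤-trans j< (N≤ u))))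

      faceReps-indep : Indep (Conn φL) faceReps
      faceReps-indep = unique→indep (UP.filter⁺ (λ d → rep? (π d)) (Finite.uniq FX)) λ i j c →
        π-inj (dartCode-inj (≤-antisym (min-of i c) (min-of j (csym c))))

      faceReps-cover : Cover (Conn φL) faceReps
      faceReps-cover d with argmin (λ k → dartCode (π (iter φ k d))) (length allX)
      ... | k , _ , mn = e , ∈-filter⁺ (λ d → rep? (π d)) (Finite.complete FX e) (cong₂ _∧_ (c₂ (proj₁ e) (proj₂ e)) (true-allBelow bel)) , iter-conn k d
        where
        e : X
        e = iter φ k d
        bel : ∀ {j} → j < n * n → (dartCode (π e) ℕ.≤ᵇ dartCode (iter (faceStep ρ) j (π e))) ≡ true
        bel {j} _ with reduce d (j + k)
        ... | i , i< , eq = ≤ᵇ-true (subst (λ z → dartCode (π e) ≤ dartCode z)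
                (trans (cong π (trans eq (iter-+ φ j k d))) (π-iter j e)) (mn i (<⇒≤ i<)))

      conn→ : ∀ {u v} → Conn (Adj G) u v → Conn AdjL u v
      conn→ = cmap (λ a → clink (c₁ a))

      conn← : ∀ {u v} → Conn AdjL u v → Conn (Adj G) u v
      conn← = cmap (λ a → clink (AdjL→Adj a))

      comps-cover : Cover (Conn AdjL) compReps
      comps-cover v = let (r , i , c) = compReps-cover v in r , i , conn→ c

      comps-indep : Indep (Conn AdjL) compReps
      comps-indep = AllPairs.map (λ nc c → nc (conn← c)) compReps-indep

      degree-D : ∀ u → degree G u ≡ D
      degree-D u = trans (countF-filter n (adj G u)) (trans (≤-antisym le ge) (length-tabulate {n = D} id))
        where
        nbrs : List (Fin n)
        nbrs = filter (λ v → adj G u v BP.≟ true) (allFin n)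
        le : length nbrs ≤ length (allFin D)
        le = inj-count (λ v i → hd (u , i) ≡ v) (UP.filter⁺ (λ v → adj G u v BP.≟ true) (UP.allFin⁺ n))
          (λ {v} i → let (j , e) = c₁ (proj₂ (∈-filter⁻ (λ v → adj G u v BP.≟ true) {xs = allFin n} i)) in j , ∈-allFin j , e)
          (λ ne a b → ne (trans (sym a) b))
        ge : length (allFin D) ≤ length nbrs
        ge = inj-count (λ i v → hd (u , i) ≡ v) (UP.allFin⁺ D)
          (λ {i} _ → hd (u , i) , ∈-filter⁺ (λ v → adj G u v BP.≟ true) (∈-allFin _) (c₂ u i) , refl)
          (λ ne a b → ne (c₃ (trans a (sym b))))

      noIsolated : numIsolated G ≡ 0
      noIsolated = trans (countF-∑ n _) (trans (∑-cong (allFin n) (λ {u} _ → cong (λ k → if k ℕ.≡ᵇ 0 then 1 else 0) (degree-D u))) (∑-0 (allFin n)))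

      darts-count : numDarts G ≡ n * D
      darts-count = trans (sumF-∑ n (degree G)) (trans (∑-cong (allFin n) (λ {u} _ → degree-D u))
        (trans (∑-const D (allFin n)) (cong (_* D) (length-tabulate {n = n} id))))

      genus-eq : (2 * n + 2 * numFaces G ρ + 2 * numIsolated G ≡ numDarts G + 4 * numComponents G) → PlanarR
      genus-eq eq = record { fs = faceReps ; cs = compReps ; findep = faceReps-indep ; cindep = comps-indep ; ccover = comps-cover
        ; genus0 = ≤-reflexive (sym (trans (cong (λ z → 2 * n + 2 * z) length-faceReps) (trans (sym (trans (cong (λ z → 2 * n + 2 * numFaces G ρ + 2 * z) noIsolated) (+-identityʳ _)))
                    (trans eq (cong₂ (λ a b → a + 4 * b) darts-count (sym length-compReps)))))) }

      eq-genus : PlanarR → 2 * n + 2 * numFaces G ρ + 2 * numIsolated G ≡ numDarts G + 4 * numComponents G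
      eq-genus P = trans (trans (cong (λ z → 2 * n + 2 * numFaces G ρ + 2 * z) noIsolated) (+-identityʳ _))
        (trans (≤-antisym le ge) (cong₂ (λ a b → a + 4 * b) (sym darts-count) length-compReps))
        where
        open PlanarR P
        le : 2 * n + 2 * numFaces G ρ ≤ n * D + 4 * length compReps
        le = subst (λ z → 2 * n + 2 * z ≤ n * D + 4 * length compReps) length-faceReps (euler faceReps-indep comps-cover)
        ge : n * D + 4 * length compReps ≤ 2 * n + 2 * numFaces G ρ
        ge = ≤-trans (+-monoʳ-≤ (n * D) (*-monoʳ-≤ 4 (indep≤cover connEq comps-indep (λ {x} _ → ccover x))))
             (≤-trans genus0 (+-monoʳ-≤ (2 * n) (*-monoʳ-≤ 2 (subst (length fs ≤_) length-faceReps (indep≤cover connEq findep (λ {x} _ → faceReps-cover x))))))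

  record RMap (n D′ : ℕ) : Set where
    field
      α      : Fin n × Fin (suc D′) → Fin n × Fin (suc D′)
      inv    : ∀ d → α (α d) ≡ d
      noloop : ∀ u i → proj₁ (α (u , i)) ≢ u
      simple : ∀ {u i j} → proj₁ (α (u , i)) ≡ proj₁ (α (u , j)) → i ≡ j

    nofix : ∀ d → α d ≢ d
    nofix (u , i) e = noloop u i (cong proj₁ e)

    open RegMap n D′ α inv nofix public
    open Euler n D′ α inv nofix public

  record Presents {n D′ : ℕ} (M : RMap n D′) (G : Graph n) : Set where
    open RMap M
    field
      adj→ : ∀ {u v} → Adj G u v → AdjL u v
      →adj : ∀ u i → Adj G u (hd (u , i))

  module FromGraph {n D′ : ℕ} (G : Graph n) (simp : IsSimple G) (reg : Regular (suc D′) G)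
                   (ρ : Rotation n) (valid : ValidRotation G ρ) where
    private
      D : ℕ
      D = suc D′
      v₁ : ∀ u v → Adj G u v → Adj G u (ρ u v)
      v₁ = proj₁ valid
      v₂ : ∀ u v w → Adj G u v → Adj G u w → ρ u v ≡ ρ u w → v ≡ w
      v₂ = proj₁ (proj₂ valid)
      v₃ : ∀ u v w → Adj G u v → Adj G u w → ∃ λ k → iter (ρ u) k v ≡ w
      v₃ = proj₂ (proj₂ valid)

      nbrs : Fin n → List (Fin n)
      nbrs u = filter (λ v → adj G u v BP.≟ true) (allFin n)

      nbrs-adj : ∀ {u v} → v ∈ nbrs u → Adj G u v
      nbrs-adj {u} i = proj₂ (∈-filter⁻ (λ v → adj G u v BP.≟ true) {xs = allFin n} i)

      adj-nbrs : ∀ {u v} → Adj G u v → v ∈ nbrs u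
      adj-nbrs {u} a = ∈-filter⁺ (λ v → adj G u v BP.≟ true) (∈-allFin _) a

      len : ∀ u → length (nbrs u) ≡ D
      len u = trans (sym (countF-filter n (adj G u))) (reg u)

      unbrs : ∀ u → Unique (nbrs u)
      unbrs u = UP.filter⁺ (λ v → adj G u v BP.≟ true) (UP.allFin⁺ n)

      first′ : ∀ u (xs : List (Fin n)) → length xs ≡ D → (∀ {v} → v ∈ xs → Adj G u v) → ∃ λ v → Adj G u v
      first′ u (x ∷ xs) e h = x , h (here refl)

      first : Fin n → Fin n
      first u = proj₁ (first′ u (nbrs u) (len u) nbrs-adj)

      first-adj : ∀ u → Adj G u (first u)
      first-adj u = proj₂ (first′ u (nbrs u) (len u) nbrs-adj)

      at : Fin n → ℕ → Fin n
      at u k = iter (ρ u) k (first u)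

      iter-adj : ∀ u k {v} → Adj G u v → Adj G u (iter (ρ u) k v)
      iter-adj u zero a = a
      iter-adj u (suc k) a = v₁ u _ (iter-adj u k a)

      iter-injₐ : ∀ u k {v w} → Adj G u v → Adj G u w → iter (ρ u) k v ≡ iter (ρ u) k w → v ≡ w
      iter-injₐ u zero a b e = e
      iter-injₐ u (suc k) a b e = iter-injₐ u k a b (v₂ u _ _ (iter-adj u k a) (iter-adj u k b) e)

      -- The orbit of the first neighbour under the rotation is the whole neighbourhood. After an
      -- early return it would have only q < D elements.
      no-short : ∀ u q → 0 < q → q < D → at u q ≢ first u
      no-short u (suc q) _ lt e = <⇒≱ lt (subst₂ _≤_ (len u) (trans (length-map (λ i → at u (toℕ i)) (allFin (suc q))) (length-tabulate {n = suc q} id))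
        (unique-⊆ {ys = map (λ i → at u (toℕ i)) (allFin (suc q))} (unbrs u) sub))
        where
        sub : ∀ {v} → v ∈ nbrs u → v ∈ map (λ i → at u (toℕ i)) (allFin (suc q))
        sub {v} i with v₃ u (first u) v (first-adj u) (nbrs-adj i)
        ... | k , refl = subst (_∈ map (λ i → at u (toℕ i)) (allFin (suc q))) eq (∈-map⁺ (λ i → at u (toℕ i)) (∈-allFin (fromℕ< (m%n<n k (suc q)))))
          where
          eq : at u (toℕ (fromℕ< (m%n<n k (suc q)))) ≡ at u k
          eq = trans (cong (at u) (FP.toℕ-fromℕ< (m%n<n k (suc q)))) (sym (trans (cong (at u) (m≡m%n+[m/n]*n k (suc q)))
                 (trans (iter-+ (ρ u) (k % suc q) (k / suc q * suc q) (first u)) (cong (iter (ρ u) (k % suc q)) (iter-* (ρ u) (suc q) e (k / suc q))))))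

      -- Cancelling i steps turns the coincidence into a return after j - i steps. By `no-short`
      -- such a return takes at least D steps, and within 0, ..., D only the full turn is that long.
      at-inj< : ∀ u {i j} → i < j → j ≤ D → at u i ≡ at u j → i ≡ 0 × j ≡ D
      at-inj< u {i} {j} lt le e with j ∸ i <? D
      ... | yes l = ⊥-elim (no-short u (j ∸ i) (m<n⇒0<n∸m lt) l (sym (iter-injₐ u i (first-adj u) (iter-adj u (j ∸ i) (first-adj u))
              (trans e (trans (cong (at u) (sym (m+[n∸m]≡n (<⇒≤ lt)))) (iter-+ (ρ u) i (j ∸ i) (first u)))))))
      ... | no nl = i0 , ≤-antisym le (≤-trans (≮⇒≥ nl) (m∸n≤m j i))
        where
        i0 : i ≡ 0
        i0 = n≤0⇒n≡0 (≮⇒≥ (λ 0<i → nl (≤-trans (∸-monoʳ-< 0<i (<⇒≤ lt)) le)))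

    nb : Fin n → Fin (suc D′) → Fin n
    nb u i = at u (toℕ i)

    nb-adj : ∀ u i → Adj G u (nb u i)
    nb-adj u i = iter-adj u (toℕ i) (first-adj u)

    nb-inj : ∀ {u i j} → nb u i ≡ nb u j → i ≡ j
    nb-inj {u} {i} {j} e with <-cmp (toℕ i) (toℕ j)
    ... | tri≈ _ b _ = FP.toℕ-injective b
    ... | tri< a _ _ = ⊥-elim (<-irrefl (proj₂ (at-inj< u a (<⇒≤ (FP.toℕ<n j)) e)) (FP.toℕ<n j))
    ... | tri> _ _ c = ⊥-elim (<-irrefl (proj₂ (at-inj< u c (<⇒≤ (FP.toℕ<n i)) (sym e))) (FP.toℕ<n i))

    nb-surj : ∀ {u v} → Adj G u v → ∃ λ i → nb u i ≡ v
    nb-surj {u} {v} a with ∈-map⁻ (nb u) {xs = allFin D} (unique-full (finFinite n) {xs = map (nb u) (allFin D)} {ys = nbrs u}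
        (UP.map⁺ nb-inj (UP.allFin⁺ D)) sub
        (≤-reflexive (trans (len u) (sym (trans (length-map (nb u) (allFin D)) (length-tabulate {n = D} id))))) (adj-nbrs a))
      where
      sub : ∀ {w} → w ∈ map (nb u) (allFin D) → w ∈ nbrs u
      sub i with ∈-map⁻ (nb u) {xs = allFin D} i
      ... | j , _ , refl = adj-nbrs (nb-adj u j)
    ... | i , _ , e = i , sym e

    nb-step : ∀ u i → ρ u (nb u i) ≡ nb u (nx i)
    nb-step u i with toℕ-nx i
    ... | inj₁ (_ , e) = cong (at u) (sym e)
    ... | inj₂ (e , e′) with nb-surj {u} (v₁ u _ (nb-adj u i))
    ... | zero , eq = trans (sym eq) (cong (at u) (sym e′))
    -- At the last port the rotation makes its D-th step. Landing on a port other than 0 would be a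
    -- coincidence of a positive index with D, which `at-inj<` excludes.
    ... | suc j , eq with at-inj< u {suc (toℕ j)} {suc (toℕ i)} (s≤s (subst (toℕ j <_) (sym e) (FP.toℕ<n j))) (FP.toℕ<n i) eq
    ... | () , _

    private
      symm : ∀ {u v} → Adj G u v → Adj G v u
      symm {u} {v} a = trans (proj₁ simp v u) a

      back : ∀ u i → ∃ λ j → nb (nb u i) j ≡ u
      back u i = nb-surj (symm (nb-adj u i))

    rmap : RMap n D′
    rmap = record
      { α = λ { (u , i) → nb u i , proj₁ (back u i) }
      ; inv = λ { (u , i) → inv′ u i }
      ; noloop = λ u i e → tf (trans (sym (nb-adj u i)) (trans (cong (adj G u) e) (proj₂ simp u)))
      ; simple = nb-inj }
      where
      tf : true ≢ false
      tf ()
      aux : ∀ {u v} i j → v ≡ u → nb v j ≡ nb u i → (v , j) ≡ (u , i)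
      aux i j refl e = cong (_ ,_) (nb-inj e)
      inv′ : ∀ u i → (nb (nb u i) (proj₁ (back u i)) , proj₁ (back (nb u i) (proj₁ (back u i)))) ≡ (u , i)
      inv′ u i = aux i _ (proj₂ (back u i)) (proj₂ (back (nb u i) (proj₁ (back u i))))

    presents : Presents rmap G
    presents = record { adj→ = nb-surj ; →adj = nb-adj }

    open RMap rmap using (PlanarR)

    planar : (2 * n + 2 * numFaces G ρ + 2 * numIsolated G ≡ numDarts G + 4 * numComponents G) → PlanarR
    planar = Corr.genus-eq (RMap.α rmap) (RMap.inv rmap) (RMap.nofix rmap) G ρ (proj₁ simp) nb-surj nb-adj nb-inj nb-step

  record MapOf {n D′ : ℕ} (G : Graph n) : Set where
    field
      M        : RMap n D′
      presents : Presents M G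
      planar   : RMap.PlanarR M

  mapOf : ∀ {n D′} {G : Graph n} → InP n (suc D′) G → MapOf {n} {D′} G
  mapOf {G = G} (simp , reg , ρ , valid , eq) = record { M = F.rmap ; presents = F.presents ; planar = F.planar eq }
    where module F = FromGraph G simp reg ρ valid


  does-true : {P : Set} (d : Dec P) → Dec.does d ≡ true → P
  does-true (yes p) _ = p

  mkGraph : ∀ {n} → (Fin n → Fin n → Bool) → Graph n
  mkGraph f = tabulate (λ u → tabulate (f u))

  adj-mk : ∀ {n} (f : Fin n → Fin n → Bool) u v → adj (mkGraph f) u v ≡ f u v
  adj-mk f u v = trans (cong (λ r → lookup r v) (lookup∘tabulate (λ u → tabulate (f u)) u)) (lookup∘tabulate (f u) v)

  module ToGraph {n D′ : ℕ} (M : RMap n D′) where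
    open RMap M

    private
      nbr? : ∀ u v → Dec (∃ λ i → hd (u , i) ≡ v)
      nbr? u v = FP.any? (λ i → hd (u , i) FP.≟ v)

    abstract
      graph : Graph n
      graph = mkGraph (λ u v → Dec.does (nbr? u v))

      g→ : ∀ {u v} → Adj graph u v → AdjL u v
      g→ {u} {v} a = does-true (nbr? u v) (trans (sym (adj-mk (λ u v → Dec.does (nbr? u v)) u v)) a)

      →g : ∀ {u v} → AdjL u v → Adj graph u v
      →g {u} {v} p = trans (adj-mk (λ u v → Dec.does (nbr? u v)) u v) (dec-true (nbr? u v) p)

    presents : Presents M graph
    presents = record { adj→ = g→ ; →adj = λ u i → →g (i , refl) }

    bool-ext : ∀ {a b : Bool} → (a ≡ true → b ≡ true) → (b ≡ true → a ≡ true) → a ≡ b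
    bool-ext {true} {true} f g = refl
    bool-ext {true} {false} f g = sym (f refl)
    bool-ext {false} {true} f g = g refl
    bool-ext {false} {false} f g = refl

    simp : IsSimple graph
    simp = (λ i j → bool-ext (λ a → →g (adj-sym (g→ a))) (λ a → →g (adj-sym (g→ a)))) , nl
      where
      nl : ∀ i → adj graph i i ≡ false
      nl i with adj graph i i in eq
      ... | false = refl
      ... | true = let (k , e) = g→ eq in ⊥-elim (noloop i k e)

    rot : Rotation n
    rot u v with nbr? u v
    ... | yes (i , _) = hd (u , nx i)
    ... | no _ = v

    rot-step : ∀ u i → rot u (hd (u , i)) ≡ hd (u , nx i)
    rot-step u i with nbr? u (hd (u , i))
    ... | yes (j , e) = cong (λ k → hd (u , nx k)) (simple e)
    ... | no ne = ⊥-elim (ne (i , refl))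

    valid : ValidRotation graph rot
    valid = (λ u v a → cl u v (g→ a)) , (λ u v w a b → ij u v w (g→ a) (g→ b)) , (λ u v w a b → tr u v w (g→ a) (g→ b))
      where
      cl : ∀ u v → AdjL u v → Adj graph u (rot u v)
      cl u _ (i , refl) = →g (nx i , sym (rot-step u i))
      ij : ∀ u v w → AdjL u v → AdjL u w → rot u v ≡ rot u w → v ≡ w
      ij u _ _ (i , refl) (j , refl) e = cong (λ k → hd (u , k)) (nx-inj (simple (trans (sym (rot-step u i)) (trans e (rot-step u j)))))
      it : ∀ u k i → iter (rot u) k (hd (u , i)) ≡ hd (u , iter nx k i)
      it u zero i = refl
      it u (suc k) i = trans (cong (rot u) (it u k i)) (rot-step u (iter nx k i))
      tr : ∀ u v w → AdjL u v → AdjL u w → ∃ λ k → iter (rot u) k v ≡ w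
      tr u _ _ (i , refl) (j , refl) = k , trans (it u k i) (cong (λ z → hd (u , z)) e)
        where
        path : Conn (λ d e → e ≡ nx d) i j
        path = cycle-const {E = Conn (λ d e → e ≡ nx d)} connEq zero (λ i _ → bwd refl nil) i j
        k : ℕ
        k = proj₁ (Orbit.conn-iter (finFinite D) nx nx-inj path)
        e : iter nx k i ≡ j
        e = proj₂ (Orbit.conn-iter (finFinite D) nx nx-inj path)

    open module C = Corr α inv nofix graph rot (proj₁ simp)

    inP : PlanarR → InP n (suc D′) graph
    inP P = simp , degree-D g→ (λ u i → →g (i , refl)) simple rot-step , rot , valid ,
            eq-genus g→ (λ u i → →g (i , refl)) simple rot-step P

  -- Averaging, and cutting a weighted tree

  atmost1 : {A : Set} {P : A → Set} (P? : ∀ x → Dec (P x)) {xs : List A} → Unique xs →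
    (∀ {x y} → P x → P y → x ≡ y) → ∑ xs (λ x → 𝟙 (P? x)) ≤ 1
  atmost1 P? {xs} u h = subst (_≤ 1) (length-filter P? xs)
    (inj-count (λ x _ → x ∈ filter P? xs) {ys = tt ∷ []} (UP.filter⁺ P? u) (λ i → tt , here refl , i)
      (λ ne i j → ne (h (proj₂ (∈-filter⁻ P? {xs = xs} i)) (proj₂ (∈-filter⁻ P? {xs = xs} j)))))

  pick-avg : {A : Set} (f : A → ℕ) (x : A) (xs : List A) → ∃ λ y → y ∈ x ∷ xs × length (x ∷ xs) * f y ≤ ∑ (x ∷ xs) f
  pick-avg f x [] = x , here refl , ≤-refl
  pick-avg f x (z ∷ xs) with pick-avg f z xs
  ... | y , y∈ , le with f x ≤? f y
  ... | yes a = x , here refl , +-monoʳ-≤ (f x) (≤-trans (*-monoʳ-≤ (length (z ∷ xs)) a) le)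
  ... | no na = y , there y∈ , +-mono-≤ (≰⇒≥ na) le

  𝟙-yes : {P : Set} (d : Dec P) → P → 𝟙 d ≡ 1
  𝟙-yes (yes _) _ = refl
  𝟙-yes (no n) p = ⊥-elim (n p)

  𝟙-no : {P : Set} (d : Dec P) → ¬ P → 𝟙 d ≡ 0
  𝟙-no (yes p) n = ⊥-elim (n p)
  𝟙-no (no _) _ = refl

  𝟙-⇔ : {P Q : Set} (d : Dec P) (e : Dec Q) → (P → Q) → (Q → P) → 𝟙 d ≡ 𝟙 e
  𝟙-⇔ (yes p) e f g = sym (𝟙-yes e (f p))
  𝟙-⇔ (no n) e f g = sym (𝟙-no e (n ∘ g))

  -- Cutting a rooted tree bottom-up: a vertex is cut off from its parent as soon as the
  -- weight W hanging below it (beneath earlier cuts) reaches K.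
  module Accumulate {A : Set} (FA : Finite A) {L : A → A → Set} {rs : List A} (B : Bfs L rs) (w : A → ℕ) (K : ℕ) where
    open Finite FA
    open Bfs B

    Child : A → A → Set
    Child e c = 0 < lev e × par e ≡ c

    child? : ∀ e c → Dec (Child e c)
    child? e c = (0 <? lev e) ×-dec (par e ≟F c)

    -- The load that a vertex hands on to its parent: nothing if it has been cut off.
    tr : ℕ → ℕ
    tr x with K ≤? x
    ... | yes _ = 0
    ... | no _ = x

    tr≤K : ∀ x → tr x ≤ K
    tr≤K x with K ≤? x
    ... | yes _ = z≤n
    ... | no n = <⇒≤ (≰⇒> n)

    tr-cut : ∀ {x} → K ≤ x → tr x ≡ 0
    tr-cut {x} le with K ≤? x
    ... | yes _ = refl
    ... | no n = ⊥-elim (n le)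

    tr-uncut : ∀ {x} → ¬ K ≤ x → tr x ≡ x
    tr-uncut {x} nle with K ≤? x
    ... | yes y = ⊥-elim (nle y)
    ... | no _ = refl

    -- The recursion runs from a vertex to its children, although a breadth-first tree records
    -- parents only. The fuel, `M ∸ lev c` in `W`, exceeds or equals the number of levels that
    -- remain.
    Wf : ℕ → A → ℕ
    Wf zero c = w c
    Wf (suc f) c = w c + ∑ els (λ e → 𝟙 (child? e c) * tr (Wf f e))

    M : ℕ
    M = ∑ els lev

    W : A → ℕ
    W c = Wf (M ∸ lev c) c

    lev-child : ∀ {e c} → Child e c → lev e ≡ suc (lev c)
    lev-child {e} {c} (l , refl) = go (lev e) refl l
      where
      go : ∀ k → lev e ≡ k → 0 < k → k ≡ suc (lev (par e))
      go (suc k) eq _ = cong suc (sym (parlev eq))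

    W-eq : ∀ c → W c ≡ w c + ∑ els (λ e → 𝟙 (child? e c) * tr (W e))
    W-eq c with M ∸ lev c in eq
    ... | zero = trans (sym (+-identityʳ (w c))) (cong (w c +_) (sym (trans (∑-cong els (λ {e} _ → z e)) (∑-0 els))))
      where
      z : ∀ e → 𝟙 (child? e c) * tr (W e) ≡ 0
      z e = cong (_* tr (W e)) (𝟙-no (child? e c) (λ ch → <⇒≱ (≤-trans (≤-reflexive (sym (lev-child ch))) (∑-≤-∈ lev (complete e))) (m∸n≡0⇒m≤n eq)))
    ... | suc f = cong (w c +_) (∑-cong els (λ {e} _ → st e))
      where
      st : ∀ e → 𝟙 (child? e c) * tr (Wf f e) ≡ 𝟙 (child? e c) * tr (W e)
      st e with child? e c
      ... | no _ = refl
      ... | yes ch = cong (λ g → 1 * tr (Wf g e)) (sym (trans (cong (M ∸_) (lev-child ch)) (trans (sym (pred[m∸n]≡m∸[1+n] M (lev c))) (cong ℕ.pred eq))))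

    Cut : A → Set
    Cut e = K ≤ W e

    cut? : ∀ e → Dec (Cut e)
    cut? e = K ≤? W e

    split-W : ∀ e → W e ≡ tr (W e) + 𝟙 (cut? e) * W e
    split-W e = go (cut? e)
      where
      go : (c : Dec (Cut e)) → W e ≡ tr (W e) + 𝟙 c * W e
      go (yes y) = sym (cong₂ _+_ (tr-cut y) (+-identityʳ (W e)))
      go (no n) = sym (trans (+-identityʳ _) (tr-uncut n))

    -- Exchanging the sums, the load handed on by e is counted with the coefficient `P` of its
    -- parent. With `P` constant this yields `cut-count`, with `P` the indicator of a piece it
    -- yields `piece`.
    children-sum : ∀ (P : A → ℕ) → ∑ els (λ c → P c * W c) ≡
      ∑ els (λ c → P c * w c) + ∑ els (λ e → tr (W e) * ∑ els (λ c → P c * 𝟙 (child? e c)))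
    children-sum P = begin
      ∑ els (λ c → P c * W c)
        ≡⟨ ∑-cong els (λ {c} _ → trans (cong (P c *_) (W-eq c)) (*-distribˡ-+ (P c) (w c) _)) ⟩
      ∑ els (λ c → P c * w c + P c * ∑ els (λ e → 𝟙 (child? e c) * tr (W e)))
        ≡⟨ ∑-+ (λ c → P c * w c) _ els ⟩
      ∑ els (λ c → P c * w c) + ∑ els (λ c → P c * ∑ els (λ e → 𝟙 (child? e c) * tr (W e)))
        ≡⟨ cong (∑ els (λ c → P c * w c) +_) (∑-cong els (λ {c} _ → sym (∑-* (P c) _ els))) ⟩
      ∑ els (λ c → P c * w c) + ∑ els (λ c → ∑ els (λ e → P c * (𝟙 (child? e c) * tr (W e))))
        ≡⟨ cong (∑ els (λ c → P c * w c) +_) (∑-swap _ els els) ⟩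
      ∑ els (λ c → P c * w c) + ∑ els (λ e → ∑ els (λ c → P c * (𝟙 (child? e c) * tr (W e))))
        ≡⟨ cong (∑ els (λ c → P c * w c) +_) (∑-cong els (λ {e} _ → trans (∑-cong els (λ {c} _ → rr (P c) (𝟙 (child? e c)) (tr (W e)))) (∑-* (tr (W e)) _ els))) ⟩
      ∑ els (λ c → P c * w c) + ∑ els (λ e → tr (W e) * ∑ els (λ c → P c * 𝟙 (child? e c))) ∎
      where
      open ≡-Reasoning
      rr : ∀ a b c → a * (b * c) ≡ c * (a * b)
      rr = solve-∀

    cuts : List A
    cuts = filter cut? els

    -- Conservation of weight: a load is either handed on to a parent or stopped at a cut, and every
    -- stopped load is at least `K`.
    cut-count : K * length cuts ≤ ∑ els w
    cut-count = begin
      K * length cuts ≡⟨ cong (K *_) (length-filter cut? els) ⟩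
      K * ∑ els (λ e → 𝟙 (cut? e)) ≡⟨ sym (∑-* K _ els) ⟩
      ∑ els (λ e → K * 𝟙 (cut? e)) ≤⟨ ∑-mono els (λ {e} _ → kk e) ⟩
      ∑ els (λ e → 𝟙 (cut? e) * W e) ≤⟨ +-cancelˡ-≤ (∑ els (λ e → tr (W e))) _ _ main ⟩
      ∑ els w ∎
      where
      open ≤-Reasoning
      kk : ∀ e → K * 𝟙 (cut? e) ≤ 𝟙 (cut? e) * W e
      kk e with cut? e
      ... | yes y = ≤-trans (≤-reflexive (*-identityʳ K)) (≤-trans y (≤-reflexive (sym (+-identityʳ (W e)))))
      ... | no _ = ≤-reflexive (*-zeroʳ K)
      main : ∑ els (λ e → tr (W e)) + ∑ els (λ e → 𝟙 (cut? e) * W e) ≤ ∑ els (λ e → tr (W e)) + ∑ els w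
      main = begin
        ∑ els (λ e → tr (W e)) + ∑ els (λ e → 𝟙 (cut? e) * W e) ≡⟨ sym (∑-+ _ _ els) ⟩
        ∑ els (λ e → tr (W e) + 𝟙 (cut? e) * W e) ≡⟨ ∑-cong els (λ {e} _ → trans (sym (split-W e)) (sym (+-identityʳ (W e)))) ⟩
        ∑ els (λ e → 1 * W e) ≡⟨ children-sum (λ _ → 1) ⟩
        ∑ els (λ c → 1 * w c) + ∑ els (λ e → tr (W e) * ∑ els (λ c → 1 * 𝟙 (child? e c)))
          ≤⟨ +-mono-≤ (≤-reflexive (∑-cong els (λ {c} _ → *-identityˡ (w c)))) (∑-mono els (λ {e} _ → le1 e)) ⟩
        ∑ els w + ∑ els (λ e → tr (W e)) ≡⟨ +-comm (∑ els w) _ ⟩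
        ∑ els (λ e → tr (W e)) + ∑ els w ∎
        where
        le1 : ∀ e → tr (W e) * ∑ els (λ c → 1 * 𝟙 (child? e c)) ≤ tr (W e)
        le1 e = ≤-trans (*-monoʳ-≤ (tr (W e)) (≤-trans (≤-reflexive (∑-cong els (λ {c} _ → *-identityˡ (𝟙 (child? e c)))))
                  (atmost1 (child? e) uniq (λ a b → trans (sym (proj₂ a)) (proj₂ b))))) (≤-reflexive (*-identityʳ _))

    topf : ℕ → A → A
    topf zero d = d
    topf (suc k) d with cut? d
    ... | yes _ = d
    ... | no _ = topf k (par d)

    -- The nearest cut vertex on the way from d to the root, d included, or else the root. It serves
    -- as the name of the piece that contains d.
    top : A → A
    top d = topf (lev d) d

    top-cut : ∀ {d} → Cut d → top d ≡ d
    top-cut {d} c = go (lev d)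
      where
      go : ∀ k → topf k d ≡ d
      go zero = refl
      go (suc k) with cut? d
      ... | yes _ = refl
      ... | no n = ⊥-elim (n c)

    top-root : ∀ {d} → lev d ≡ 0 → top d ≡ d
    top-root {d} e = cong (λ k → topf k d) e

    top-par : ∀ {d} → 0 < lev d → ¬ Cut d → top d ≡ top (par d)
    top-par {d} l nc = trans (go (lev d) l) (cong (λ k → topf k (par d)) (pr (lev d) refl l))
      where
      go : ∀ k → 0 < k → topf k d ≡ topf (ℕ.pred k) (par d)
      go (suc k) _ with cut? d
      ... | yes c = ⊥-elim (nc c)
      ... | no _ = refl
      pr : ∀ k → lev d ≡ k → 0 < k → ℕ.pred k ≡ lev (par d)
      pr (suc k) e _ = sym (parlev e)

    -- Every member of the piece other than c hands its load to a parent in the same piece. In the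
    -- sum over the piece these loads cancel, and `W c` is left.
    piece : ∀ c → ∑ els (λ d → 𝟙 (top d ≟F c) * w d) ≤ W c
    piece c = +-cancelʳ-≤ S _ _ (begin
      ∑ els (λ d → P d * w d) + S ≡⟨ cong (∑ els (λ d → P d * w d) +_) (sym (∑-cong els (λ {e} _ → down e))) ⟩
      ∑ els (λ d → P d * w d) + ∑ els (λ e → tr (W e) * ∑ els (λ d → P d * 𝟙 (child? e d))) ≡⟨ sym (children-sum P) ⟩
      ∑ els (λ d → P d * W d) ≤⟨ ∑-mono els (λ {e} _ → bound e) ⟩
      ∑ els (λ e → tr (W e) * (𝟙 (0 <? lev e) * P e) + 𝟙 (c ≟F e) * W e) ≡⟨ ∑-+ _ _ els ⟩
      S + ∑ els (λ e → 𝟙 (c ≟F e) * W e) ≡⟨ cong (S +_) (∑-≟ _≟F_ uniq (complete c) W) ⟩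
      S + W c ≡⟨ +-comm S (W c) ⟩
      W c + S ∎)
      where
      open ≤-Reasoning
      P : A → ℕ
      P d = 𝟙 (top d ≟F c)
      S : ℕ
      S = ∑ els (λ e → tr (W e) * (𝟙 (0 <? lev e) * P e))
      inner : ∀ e → ∑ els (λ d → P d * 𝟙 (child? e d)) ≡ 𝟙 (0 <? lev e) * P (par e)
      inner e with 0 <? lev e
      ... | no _ = trans (∑-cong els (λ {d} _ → *-zeroʳ (P d))) (∑-0 els)
      ... | yes l = trans (∑-cong els (λ {d} _ → trans (cong (P d *_) (same d)) (*-comm (P d) _))) (trans (∑-≟ _≟F_ uniq (complete (par e)) P) (sym (+-identityʳ _)))
        where
        same : ∀ d → 𝟙 (yes l ×-dec (par e ≟F d)) ≡ 𝟙 (par e ≟F d)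
        same d = 𝟙-⇔ (yes l ×-dec (par e ≟F d)) (par e ≟F d) proj₂ (l ,_)
      down : ∀ e → tr (W e) * ∑ els (λ d → P d * 𝟙 (child? e d)) ≡ tr (W e) * (𝟙 (0 <? lev e) * P e)
      down e = trans (cong (tr (W e) *_) (inner e)) (help (cut? e) (0 <? lev e))
        where
        help : Dec (Cut e) → (l? : Dec (0 < lev e)) → tr (W e) * (𝟙 l? * P (par e)) ≡ tr (W e) * (𝟙 l? * P e)
        help (yes y) l? = trans (cong (_* (𝟙 l? * P (par e))) (tr-cut y)) (sym (cong (_* (𝟙 l? * P e)) (tr-cut y)))
        help (no n) (no _) = refl
        help (no n) (yes l) = cong (λ z → tr (W e) * (1 * 𝟙 (z ≟F c))) (sym (top-par l n))
      bound : ∀ e → P e * W e ≤ tr (W e) * (𝟙 (0 <? lev e) * P e) + 𝟙 (c ≟F e) * W e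
      bound e = go (cut? e) (0 <? lev e)
        where
        go : Dec (Cut e) → (l? : Dec (0 < lev e)) → P e * W e ≤ tr (W e) * (𝟙 l? * P e) + 𝟙 (c ≟F e) * W e
        go (yes y) l? = ≤-trans (≤-reflexive (cong (_* W e) (𝟙-⇔ (top e ≟F c) (c ≟F e) (λ q → sym (trans (sym (top-cut y)) q)) (λ q → trans (top-cut y) (sym q))))) (m≤n+m _ (tr (W e) * (𝟙 l? * P e)))
        go (no n) (no nl) = ≤-reflexive (trans (cong (_* W e) (𝟙-⇔ (top e ≟F c) (c ≟F e) (λ q → sym (trans (sym (top-root lv)) q)) (λ q → trans (top-root lv) (sym q)))) (cong (_+ 𝟙 (c ≟F e) * W e) (sym (*-zeroʳ (tr (W e))))))
          where
          lv : lev e ≡ 0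
          lv = n≤0⇒n≡0 (≮⇒≥ nl)
        go (no n) (yes l) = ≤-trans (≤-reflexive (trans (*-comm (P e) (W e)) (cong₂ _*_ (sym (tr-uncut n)) (sym (+-identityʳ (P e)))))) (m≤m+n _ _)

    module _ (kids : A → List A) (kid : ∀ {e c} → Child e c → e ∈ kids c) (kid3 : ∀ c → length (kids c) ≤ 3) where
      W-bound : ∀ c → W c ≤ w c + 3 * K
      W-bound c = begin
        W c ≡⟨ W-eq c ⟩
        w c + ∑ els (λ e → 𝟙 (child? e c) * tr (W e)) ≤⟨ +-monoʳ-≤ (w c) (∑-mono els (λ {e} _ → ≤-trans (*-monoʳ-≤ (𝟙 (child? e c)) (tr≤K (W e))) (≤-reflexive (*-comm (𝟙 (child? e c)) K)))) ⟩
        w c + ∑ els (λ e → K * 𝟙 (child? e c)) ≡⟨ cong (w c +_) (trans (∑-* K _ els) (cong (K *_) (sym (length-filter (λ e → child? e c) els)))) ⟩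
        w c + K * length (filter (λ e → child? e c) els) ≤⟨ +-monoʳ-≤ (w c) (*-monoʳ-≤ K (≤-trans (unique-⊆ (UP.filter⁺ (λ e → child? e c) uniq) (λ i → kid (proj₂ (∈-filter⁻ (λ e → child? e c) {xs = els} i)))) (kid3 c))) ⟩
        w c + K * 3 ≡⟨ cong (w c +_) (*-comm K 3) ⟩
        w c + 3 * K ∎
        where open ≤-Reasoning


  -- Planar maps split into bounded pieces

  div-step : ∀ m k → suc m / suc k ≢ m / suc k → suc m % suc k ≡ 0
  div-step m k ne with suc m % suc k in eq
  ... | zero = refl
  ... | suc ρ = ⊥-elim (ne (sym (trans (cong (_/ suc k) e) (trans (+-distrib-/-∣ʳ ρ (n∣m*n q)) (trans (cong₂ _+_ (m<n⇒m/n≡0 ρ<) (m*n/n≡m q (suc k))) refl)))))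
    where
    q : ℕ
    q = suc m / suc k
    e : m ≡ ρ + q * suc k
    e = suc-injective (trans (m≡m%n+[m/n]*n (suc m) (suc k)) (cong (_+ q * suc k) eq))
    ρ< : ρ < suc k
    ρ< = ≤-trans (n≤1+n _) (subst (_< suc k) eq (m%n<n (suc m) (suc k)))

  -- Two offsets that put a band boundary at the same level agree modulo the width of the bands. So
  -- an edge crosses a boundary for at most one offset, which is what the averaging in `offset`
  -- lives on.
  shift-unique : ∀ k b {r s} → r < suc k → s < suc k → (b + r) % suc k ≡ 0 → (b + s) % suc k ≡ 0 → r ≡ s
  shift-unique k b {r} {s} r< s< er es with ≤-total r s
  ... | inj₁ le = go le r< s< er es
    where
    go : ∀ {r s} → r ≤ s → r < suc k → s < suc k → (b + r) % suc k ≡ 0 → (b + s) % suc k ≡ 0 → r ≡ s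
    go {r} {s} le r< s< er es with s ∸ r in eq
    ... | zero = ≤-antisym le (m∸n≡0⇒m≤n eq)
    ... | suc t = ⊥-elim (<⇒≱ s< (≤-trans (∣⇒≤ (∣m+n∣m⇒∣n (subst (suc k ∣_) (trans (cong (b +_) (sym (m+[n∸m]≡n le))) (trans (sym (+-assoc b r (s ∸ r))) (cong (b + r +_) eq))) (m%n≡0⇒n∣m (b + s) (suc k) es)) (m%n≡0⇒n∣m (b + r) (suc k) er))) (subst (_≤ s) eq (m∸n≤m s r))))
  ... | inj₂ ge = sym (go ge s< r< es er)
    where
    go : ∀ {r s} → r ≤ s → r < suc k → s < suc k → (b + r) % suc k ≡ 0 → (b + s) % suc k ≡ 0 → r ≡ s
    go {r} {s} le r< s< er es with s ∸ r in eq
    ... | zero = ≤-antisym le (m∸n≡0⇒m≤n eq)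
    ... | suc t = ⊥-elim (<⇒≱ s< (≤-trans (∣⇒≤ (∣m+n∣m⇒∣n (subst (suc k ∣_) (trans (cong (b +_) (sym (m+[n∸m]≡n le))) (trans (sym (+-assoc b r (s ∸ r))) (cong (b + r +_) eq))) (m%n≡0⇒n∣m (b + s) (suc k) es)) (m%n≡0⇒n∣m (b + r) (suc k) er))) (subst (_≤ s) eq (m∸n≤m s r))))

  length-concatMap : {A B : Set} (f : A → List B) (xs : List A) → length (concatMap f xs) ≡ ∑ xs (length ∘ f)
  length-concatMap f [] = refl
  length-concatMap f (x ∷ xs) = trans (length-++ (f x)) (cong (length (f x) +_) (length-concatMap f xs))

  length-cart : {A B : Set} (xs : List A) (ys : List B) → length (cartesianProduct xs ys) ≡ length xs * length ys
  length-cart [] ys = refl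
  length-cart (x ∷ xs) ys = trans (length-++ (map (x ,_) ys)) (cong₂ _+_ (length-map (x ,_) ys) (length-cart xs ys))

  ∈-cM⁺ : {A B : Set} (f : A → List B) {xs : List A} {x : A} {y : B} → x ∈ xs → y ∈ f x → y ∈ concatMap f xs
  ∈-cM⁺ f (here refl) j = ∈-++⁺ˡ j
  ∈-cM⁺ f {z ∷ xs} (there i) j = ∈-++⁺ʳ (f z) (∈-cM⁺ f i j)

  -- A connected graph with too few links to lose one is a tree: every link joins a child to its parent.
  module AllTree {A : Set} (FA : Finite A) (ls : List (A × A)) (rs : List A)
                 (T : Bfs (λ x y → (x , y) ∈ ls ⊎ (y , x) ∈ ls) rs)
                 (count : length ls + length rs ≤ length (Finite.els FA)) where
    open Bfs T

    Ch : A → A → Set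
    Ch e c = 0 < lev e × par e ≡ c

    ch? : ∀ e c → Dec (Ch e c)
    ch? e c = (0 <? lev e) ×-dec (Finite._≟F_ FA (par e) c)

    private
      none : A → A → Set
      none _ _ = ⊥

      module _ {x y : A} {ys : List (A × A)} (rem : ∀ {z} → z ∈ ls → z ≡ (x , y) ⊎ z ∈ ys)
               (na : ¬ Ch x y) (nb : ¬ Ch y x) where
        up : ∀ d {l} → lev d ≡ suc l → Conn (addL none ys) d (par d)
        up d eq with parL eq
        ... | inj₁ j with rem j
        ... | inj₁ refl = ⊥-elim (na (subst (0 <_) (sym eq) (s≤s z≤n) , refl))
        ... | inj₂ k = fwd (inj₂ k) nil
        up d eq | inj₂ j with rem j
        ... | inj₁ e = ⊥-elim (nb (subst (λ z → 0 < lev z) (cong proj₂ e) (subst (0 <_) (sym eq) (s≤s z≤n)) , trans (cong par (sym (cong proj₂ e))) (cong proj₁ e)))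
        ... | inj₂ k = bwd (inj₂ k) nil

        toRoot : ∀ k d → lev d ≤ k → ∃ λ r → r ∈ rs × Conn (addL none ys) d r
        toRoot k d le with lev d in eq
        toRoot k d le | zero = d , root eq , nil
        toRoot (suc k) d (s≤s le) | suc l with toRoot k (par d) (subst (_≤ k) (sym (parlev eq)) le)
        ... | r , r∈ , c = r , r∈ , ctrans (up d eq) c

    treeLink : ∀ {x y} → (x , y) ∈ ls → Ch x y ⊎ Ch y x
    treeLink {x} {y} i with ch? x y | ch? y x
    ... | yes a | _ = inj₁ a
    ... | no _ | yes b = inj₂ b
    ... | no na | no nb with ∈-remove i
    ... | ys , len , rem = ⊥-elim (<-irrefl refl (≤-trans (≤-reflexive (cong (_+ length rs) (sym len))) (≤-trans count
          (join-count ys (unique→indep (Finite.uniq FA) (λ _ _ c → cfold (kerEq id) (λ ()) c)) (λ d → toRoot rem na nb (lev d) d ≤-refl)))))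

  -- Hyperfiniteness of a single map: `Cut` is a set of edges, given as a property of darts that `α`
  -- preserves, and `Un` is adjacency along the edges that survive.
  record Pieces {n D′ : ℕ} (M : RMap n D′) (Z c : ℕ) : Set₁ where
    open RMap M
    field
      Cut   : X → Set
      cut?  : ∀ d → Dec (Cut d)
      cut-α : ∀ {d} → Cut d → Cut (α d)
      few   : Z * length (filter cut? allX) ≤ n
    Un : Fin n → Fin n → Set
    Un u v = ∃ λ i → hd (u , i) ≡ v × ¬ Cut (u , i)
    field
      small : ∀ v (vs : List (Fin n)) → Unique vs → (∀ {w} → w ∈ vs → Conn Un v w) → length vs ≤ c

  module Hyper {n D′ : ℕ} (M : RMap n D′) (P : RMap.PlanarR M) where
    open RMap M
    open PlanarR P
    module Oφ = Orbit FX φ φ-inj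

    abstract
      infs? : ∀ d → Dec (φ d ∈ fs)
      infs? d = Any.any? (φ d ≟X_) fs

    -- Each face that has a representative in `fs` is opened there and becomes a path of darts
    -- instead of a cycle.
    φps : List (X × X)
    φps = map (λ d → d , φ d) (filter (λ d → ¬? (infs? d)) allX)

    ufs : Unique fs
    ufs = AllPairs.map (λ nr e → nr (creflexive e)) findep

    φps-count : length φps + length fs ≤ n * D
    φps-count = begin
      length φps + length fs ≤⟨ +-mono-≤ (≤-reflexive (length-map _ (filter (λ d → ¬? (infs? d)) allX))) fs≤ ⟩
      length (filter (λ d → ¬? (infs? d)) allX) + length (filter infs? allX)
        ≡⟨ filter-split (λ d → ¬? (infs? d)) infs? (λ a b → a b) (λ {d} nn → decidable-stable (infs? d) nn) allX ⟩
      length allX ≡⟨ length-allX ⟩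
      n * D ∎
      where
      open ≤-Reasoning
      fs≤ : length fs ≤ length (filter infs? allX)
      fs≤ = inj-count (λ r d → φ d ≡ r) ufs
        (λ {r} i → let (d , e) = Oφ.surj r in d , ∈-filter⁺ infs? (Finite.complete FX d) (subst (_∈ fs) (sym e) i) , e)
        (λ ne a b → ne (trans (sym a) b))

    module Dual (B : Bfs AdjL cs) where
      open Tree B using (ips; ips-count; ips-∈; F)

      abstract
        links : List (X × X)
        links = φps ++ ips

        φ-link : ∀ d → φ d ∉ fs → (d , φ d) ∈ links
        φ-link d ni = ∈-++⁺ˡ (∈-map⁺ (λ d → d , φ d) (∈-filter⁺ (λ d → ¬? (infs? d)) (Finite.complete FX _) ni))

        ip-link : ∀ {z} → z ∈ ips → z ∈ links
        ip-link j = ∈-++⁺ʳ φps j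

        link-form : ∀ {x y} → (x , y) ∈ links → (y ≡ φ x) ⊎ (y ≡ α x)
        link-form i with ∈-++⁻ φps i
        ... | inj₁ j with ∈-map⁻ (λ d → d , φ d) j
        ... | d , _ , refl = inj₁ refl
        link-form i | inj₂ j with ∈-map⁻ (λ d → d , α d) j
        ... | d , _ , refl = inj₂ refl

        -- This is where planarity enters. Opened faces contribute at most n D - F links and the
        -- pairs across non-tree edges at most E - V + C; since F ≥ E - V + 2 C, there are at most n
        -- D - C links on the n D darts. As they also connect all darts to C roots, they form a
        -- forest.
        links-count : length links + length cs ≤ n * D
        links-count = begin
          length links + length cs ≡⟨ cong (_+ length cs) (length-++ φps) ⟩
          length φps + length ips + length cs ≡⟨ +-assoc (length φps) _ _ ⟩
          length φps + (length ips + length cs) ≤⟨ +-monoʳ-≤ (length φps) ic ⟩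
          length φps + length fs ≤⟨ φps-count ⟩
          n * D ∎
          where
          open ≤-Reasoning
          r₁ : ∀ a b c e → 2 * (a + b) + (2 * c + (e + 2 * b)) ≡ (2 * a + 2 * c) + (e + 4 * b)
          r₁ = solve-∀
          r₂ : ∀ a b c e → (e + 2 * b) + (2 * c + 2 * a) ≡ 2 * a + (2 * c + (e + 2 * b))
          r₂ = solve-∀
          ic : length ips + length cs ≤ length fs
          ic = *-cancelˡ-≤ 2 (+-cancelʳ-≤ (2 * n + (n * D + 2 * length cs)) _ _
            (subst₂ _≤_ (sym (r₁ (length ips) (length cs) n (n * D))) (r₂ (length fs) (length cs) n (n * D)) (+-mono-≤ ips-count genus0)))

      LL : X → X → Set
      LL x y = (x , y) ∈ links ⊎ (y , x) ∈ links

      LL-sym : ∀ {x y} → LL x y → LL y x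
      LL-sym = [ inj₂ , inj₁ ]′

      orbit-conn : ∀ {r} → r ∈ fs → ∀ k → Conn LL r (iter φ k r)
      orbit-conn r∈ zero = nil
      orbit-conn {r} r∈ (suc k) with infs? (iter φ k r)
      ... | yes i = creflexive (indep-∈ connEq findep r∈ i (Oφ.iter-conn (suc k) r))
      ... | no ni = ctrans (orbit-conn r∈ k) (clink (inj₁ (φ-link _ ni)))

      -- Where the link from d to `φ d` is missing, the rest of the face leads from `φ d` round to
      -- d.
      φ-conn : ∀ d → Conn LL d (φ d)
      φ-conn d with infs? d
      ... | no ni = clink (inj₁ (φ-link d ni))
      ... | yes i = let (k , e) = Oφ.conn-iter {φ d} {d} (bwd refl nil) in csym (subst (Conn LL (φ d)) e (orbit-conn i k))

      cover : Cover (Conn LL) (rootDarts cs)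
      cover (v , i) = let (r , r∈ , c) = allV-cover B ips ips-∈ v i in (r , zero) , ∈-map⁺ _ r∈ ,
        cmap (λ { {x} (inj₁ refl) → φ-conn x ; (inj₂ j) → clink (inj₁ (ip-link j)) }) c

      module DT (T : Bfs LL (rootDarts cs)) where
        open Bfs T
        open AllTree FX links (rootDarts cs) T
          (subst₂ _≤_ (cong (length links +_) (sym (length-map _ cs))) (sym length-allX) links-count) public

        abstract
          φi : X → X
          φi d = proj₁ (Oφ.surj d)

          φφi : ∀ d → φ (φi d) ≡ d
          φφi d = proj₂ (Oφ.surj d)

        -- A dual tree with faces as nodes would have unbounded degrees. Spread over the darts, it
        -- has at most three neighbours at each node, which keeps the loads in `Accumulate` bounded.
        kids : X → List X
        kids c = φ c ∷ φi c ∷ α c ∷ []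

        kid : ∀ {e c} → Ch e c → e ∈ kids c
        kid {e} {c} (l , refl) = go (lev e) refl l
          where
          go : ∀ k → lev e ≡ k → 0 < k → e ∈ kids (par e)
          go (suc k) eq _ with parL eq
          ... | inj₁ i with link-form i
          ... | inj₁ x = there (here (φ-inj (trans (sym x) (sym (φφi (par e))))))
          ... | inj₂ x = there (there (here (trans (sym (inv e)) (cong α (sym x)))))
          go (suc k) eq _ | inj₂ i with link-form i
          ... | inj₁ x = here x
          ... | inj₂ x = there (there (here x))

        module Band (kk r K : ℕ) where
          k : ℕ
          k = suc kk

          level : Fin n → ℕ
          level = Bfs.lev B

          bd : Fin n → ℕ
          bd v = (level v + r) / k

          -- Every vertex of band j contributes weight 1, placed on its dart at port 0. The same
          -- tree is cut anew for each band; the weights of all bands add up to n, so all the cuts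
          -- together are at most n / K in number.
          Q : ℕ → X → Set
          Q j d = proj₂ d ≡ zero × bd (proj₁ d) ≡ j

          abstract
            q? : ∀ j d → Dec (Q j d)
            q? j d = (proj₂ d FP.≟ zero) ×-dec (bd (proj₁ d) ℕP.≟ j)

          w : ℕ → X → ℕ
          w j d = 𝟙 (q? j d)

          private
            module Acc (j : ℕ) = Accumulate FX T (w j) K

          abstract
            lab : ℕ → X → X
            lab j = Acc.top j

            cuts : ℕ → List X
            cuts j = Acc.cuts j

            child-cut : ∀ j {e c} → Ch e c → lab j e ≢ lab j c → e ∈ cuts j
            child-cut j {e} {c} (l , refl) ne = ∈-filter⁺ (Acc.cut? j) (Finite.complete FX e)
              (decidable-stable (Acc.cut? j e) (λ nc → ne (Acc.top-par j l nc)))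

            cuts-count : ∀ j → K * length (cuts j) ≤ ∑ allX (w j)
            cuts-count = Acc.cut-count

            label-weight : ∀ j c → ∑ allX (λ d → 𝟙 (lab j d ≟X c) * w j d) ≤ w j c + 3 * K
            label-weight j c = ≤-trans (Acc.piece j c) (Acc.W-bound j kids kid (λ _ → s≤s (s≤s (s≤s z≤n))) c)

          link-cut : ∀ j {x y} → (x , y) ∈ links → lab j x ≢ lab j y → x ∈ cuts j ⊎ y ∈ cuts j
          link-cut j i ne with treeLink i
          ... | inj₁ a = inj₁ (child-cut j a ne)
          ... | inj₂ b = inj₂ (child-cut j b (ne ∘ sym))

          abstract
            v1? : ∀ j d → Dec (lab j (φ d) ≢ lab j d)
            v1? j d = ¬? (lab j (φ d) ≟X lab j d)

          V1 V1a V1b V2 : ℕ → List X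
          V1 j = filter (v1? j) allX
          V1a j = filter (λ d → ¬? (infs? d)) (V1 j)
          V1b j = filter infs? (V1 j)

          open Forest F using (Tr; tr?; Anc; self; dn; module Contour)

          abstract
            v2? : ∀ j d → Dec ((¬ Tr d) × lab j (α d) ≢ lab j d)
            v2? j d = ¬? (tr? d) ×-dec ¬? (lab j (α d) ≟X lab j d)

          V2 j = filter (v2? j) allX

          private
            uV1 : ∀ j → Unique (V1 j)
            uV1 j = UP.filter⁺ (v1? j) (Finite.uniq FX)

            v1∈ : ∀ j {d} → d ∈ V1 j → lab j (φ d) ≢ lab j d
            v1∈ j i = proj₂ (∈-filter⁻ (v1? j) {xs = allX} i)

            ∈v1 : ∀ j {d} → lab j (φ d) ≢ lab j d → d ∈ V1 j
            ∈v1 j ne = ∈-filter⁺ (v1? j) (Finite.complete FX _) ne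

            twice : ∀ (f : X → X) (xs : List X) → length (xs ++ map f xs) ≡ 2 * length xs
            twice f xs = trans (length-++ xs) (cong (length xs +_) (trans (length-map f xs) (sym (+-identityʳ _))))

          V1a-count : ∀ j → length (V1a j) ≤ 2 * length (cuts j)
          V1a-count j = subst (length (V1a j) ≤_) (twice φi (cuts j)) (unique-⊆ (UP.filter⁺ (λ d → ¬? (infs? d)) (uV1 j)) sub)
            where
            sub : ∀ {d} → d ∈ V1a j → d ∈ cuts j ++ map φi (cuts j)
            sub {d} i with ∈-filter⁻ (λ d → ¬? (infs? d)) {xs = V1 j} i
            ... | m , ni with link-cut j (φ-link d ni) (v1∈ j m ∘ sym)
            ... | inj₁ a = ∈-++⁺ˡ a
            ... | inj₂ b = ∈-++⁺ʳ (cuts j) (subst (_∈ map φi (cuts j)) (φ-inj (φφi (φ d))) (∈-map⁺ φi b))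

          -- The step from such a d to `φ d` is not a link. A change of label there must be undone
          -- along the other steps of the same face, where it shows up in `V1a`. A face is opened
          -- only once, so different d belong to different faces.
          V1b-count : ∀ j → length (V1b j) ≤ 2 * length (cuts j)
          V1b-count j = ≤-trans (inj-count (λ d e → φ d ∈ fs × Conn φL (φ d) e) (UP.filter⁺ infs? (uV1 j)) f
              (λ { ne (a , c) (a′ , c′) → ne (φ-inj (indep-∈ connEq findep a a′ (ctrans c (csym c′)))) })) (V1a-count j)
            where
            walk : ∀ {r} → r ∈ fs → ∀ k → (∃ λ i → iter φ i r ∈ V1a j) ⊎ lab j (iter φ k r) ≡ lab j r
            walk r∈ zero = inj₂ refl
            walk {r} r∈ (suc k) with walk r∈ k
            ... | inj₁ a = inj₁ a
            ... | inj₂ e with infs? (iter φ k r)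
            ... | yes i = inj₂ (cong (lab j) (sym (indep-∈ connEq findep r∈ i (Oφ.iter-conn (suc k) r))))
            ... | no ni with lab j (iter φ (suc k) r) ≟X lab j (iter φ k r)
            ... | yes e′ = inj₂ (trans e′ e)
            ... | no ne = inj₁ (k , ∈-filter⁺ (λ d → ¬? (infs? d)) (∈v1 j ne) ni)
            f : ∀ {d} → d ∈ V1b j → ∃ λ e → e ∈ V1a j × φ d ∈ fs × Conn φL (φ d) e
            f {d} i with ∈-filter⁻ infs? {xs = V1 j} i
            ... | m , r∈ with Oφ.conn-iter {φ d} {d} (bwd refl nil)
            ... | k , e with walk r∈ k
            ... | inj₁ (t , x) = iter φ t (φ d) , x , r∈ , Oφ.iter-conn t (φ d)
            ... | inj₂ x = ⊥-elim (v1∈ j m (sym (trans (cong (lab j) (sym e)) x)))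

          V1-count : ∀ j → length (V1 j) ≤ 4 * length (cuts j)
          V1-count j = begin
            length (V1 j) ≡⟨ sym (filter-split infs? (λ d → ¬? (infs? d)) (λ a b → b a) id (V1 j)) ⟩
            length (V1b j) + length (V1a j) ≤⟨ +-mono-≤ (V1b-count j) (V1a-count j) ⟩
            2 * length (cuts j) + 2 * length (cuts j) ≡⟨ sym (*-distribʳ-+ (length (cuts j)) 2 2) ⟩
            4 * length (cuts j) ∎
            where open ≤-Reasoning

          V2-count : ∀ j → length (V2 j) ≤ 2 * length (cuts j)
          V2-count j = subst (length (V2 j) ≤_) (twice α (cuts j)) (unique-⊆ (UP.filter⁺ (v2? j) (Finite.uniq FX)) sub)
            where
            mem : ∀ {d} → α d ∈ cuts j → d ∈ map α (cuts j)
            mem {d} i = subst (_∈ map α (cuts j)) (inv d) (∈-map⁺ α i)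
            sub : ∀ {d} → d ∈ V2 j → d ∈ cuts j ++ map α (cuts j)
            sub {d} i with ∈-filter⁻ (v2? j) {xs = allX} i
            ... | _ , nt , ne with ips-∈ d nt
            ... | inj₁ l = [ ∈-++⁺ˡ , (λ b → ∈-++⁺ʳ (cuts j) (mem b)) ]′ (link-cut j (ip-link l) (ne ∘ sym))
            ... | inj₂ l = [ (λ b → ∈-++⁺ʳ (cuts j) (mem b)) , ∈-++⁺ˡ ]′ (link-cut j (ip-link l) ne)

          -- The vertices at which the premise `OK` of `Contour` can fail for the labels of band j.
          seeds : ℕ → List (Fin n)
          seeds j = map proj₁ (V1 j) ++ (map hd (V1 j) ++ map proj₁ (V2 j))

          seeds-count : ∀ j → length (seeds j) ≤ 10 * length (cuts j)
          seeds-count j = begin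
            length (seeds j) ≡⟨ trans (length-++ (map proj₁ (V1 j))) (cong₂ _+_ (length-map proj₁ (V1 j)) (trans (length-++ (map hd (V1 j))) (cong₂ _+_ (length-map hd (V1 j)) (length-map proj₁ (V2 j))))) ⟩
            length (V1 j) + (length (V1 j) + length (V2 j)) ≤⟨ +-mono-≤ (V1-count j) (+-mono-≤ (V1-count j) (V2-count j)) ⟩
            4 * length (cuts j) + (4 * length (cuts j) + 2 * length (cuts j)) ≡⟨ ar (length (cuts j)) ⟩
            10 * length (cuts j) ∎
            where
            open ≤-Reasoning
            ar : ∀ c → 4 * c + (4 * c + 2 * c) ≡ 10 * c
            ar = solve-∀

          module C (j : ℕ) = Contour {E = λ d e → lab j d ≡ lab j e} (kerEq (lab j))

          v1-seed : ∀ j {u} → u ∉ seeds j → ∀ i → lab j (φ (u , i)) ≡ lab j (u , i)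
          v1-seed j {u} ns i = decidable-stable (lab j (φ (u , i)) ≟X lab j (u , i)) (λ ne → ns (∈-++⁺ˡ (∈-map⁺ proj₁ (∈v1 j ne))))

          ok : ∀ j {u} → u ∉ seeds j → C.OK j u
          ok j {u} ns i = (λ nt → trans across (decidable-stable (lab j (α d) ≟X lab j d)
                (λ ne → ns (∈-++⁺ʳ (map proj₁ (V1 j)) (∈-++⁺ʳ (map hd (V1 j)) (∈-map⁺ proj₁ (∈-filter⁺ (v2? j) (Finite.complete FX d) (nt , ne)))))))) ,
              (λ _ → v1-seed j ns i , across)
            where
            d : X
            d = u , i
            across : lab j (σ d) ≡ lab j (α d)
            across = trans (cong (lab j) (σφ d)) (decidable-stable (lab j (φ (α d)) ≟X lab j (α d))
              (λ ne → ns (∈-++⁺ʳ (map proj₁ (V1 j)) (∈-++⁺ˡ (subst (_∈ map hd (V1 j)) (cong proj₁ (inv d)) (∈-map⁺ hd (∈v1 j ne)))))))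

          -- The contour argument looks at the subtree below a vertex only. If this contains no seed
          -- of the band of v, all corners at v carry the same label, which thereby becomes a label
          -- of the vertex v.
          Mixed : Fin n → Set
          Mixed v = ∃ λ x → x ∈ seeds (bd v) × Anc v x

          calm : ∀ {v} → ¬ Mixed v → C.Good (bd v) v
          calm {v} nm = C.good (bd v) v (λ x a → ok (bd v) (λ s → nm (x , s , a)))

          calm-φ : ∀ {v} → ¬ Mixed v → ∀ i → lab (bd v) (φ (v , i)) ≡ lab (bd v) (v , i)
          calm-φ {v} nm i = v1-seed (bd v) (λ s → nm (v , s , self)) i

          anc-iter : ∀ {v x} → Anc v x → ∃ λ t → v ≡ iter (Bfs.par B) t x × level v + t ≡ level x
          anc-iter self = 0 , refl , +-identityʳ _
          anc-iter (dn {c} l a) with anc-iter a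
          ... | t , e , e′ = suc t , trans up (cong (Bfs.par B) e) ,
                trans (+-suc _ t) (trans (cong (_+ t) (trans (cong (suc ∘ level) up) (OfBfs.par-suc id B l))) e′)
            where
            up : hd (c , OfBfs.up-port id B c) ≡ Bfs.par B c
            up = OfBfs.up-par id B l

          anc-unique : ∀ {v v′ x} → Anc v x → Anc v′ x → level v ≡ level v′ → v ≡ v′
          anc-unique {v} {v′} a a′ e with anc-iter a | anc-iter a′
          ... | t , p , q | t′ , p′ , q′ = trans p (trans (cong (λ z → iter (Bfs.par B) z _) tt′) (sym p′))
            where
            tt′ : t ≡ t′
            tt′ = +-cancelˡ-≡ (level v) t t′ (trans q (trans (sym q′) (cong (_+ t′) (sym e))))

          abstract
            cross? : ∀ d → Dec (bd (proj₁ d) ≢ bd (hd d))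
            cross? d = ¬? (bd (proj₁ d) ℕP.≟ bd (hd d))

          crossmod : ∀ d → bd (proj₁ d) ≢ bd (hd d) → ((level (proj₁ d) ⊔ level (hd d)) + r) % k ≡ 0
          crossmod (u , i) ne with <-cmp (level u) (level (hd (u , i)))
          ... | tri≈ _ e _ = ⊥-elim (ne (cong (λ z → (z + r) / k) e))
          ... | tri< lt _ _ = trans (cong (λ z → (z + r) % k) (trans (m≤n⇒m⊔n≡n (<⇒≤ lt)) e)) (div-step (level u + r) kk (λ q → ne (trans (sym q) (cong (λ z → (z + r) / k) (sym e)))))
            where
            e : level (hd (u , i)) ≡ suc (level u)
            e = ≤-antisym (Bfs.lip B (adj-sym (i , refl))) lt
          ... | tri> _ _ gt = trans (cong (λ z → (z + r) % k) (trans (m≥n⇒m⊔n≡m (<⇒≤ gt)) e)) (div-step (level (hd (u , i)) + r) kk (λ q → ne (trans (cong (λ z → (z + r) / k) e) q)))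
            where
            e : level u ≡ suc (level (hd (u , i)))
            e = ≤-antisym (Bfs.lip B (i , refl)) gt

          module _ (mixed? : ∀ v → Dec (Mixed v)) where
            mx : List (Fin n)
            mx = filter mixed? (allFin n)

            js : List ℕ
            js = upTo (suc (∑ (allFin n) bd))

            block : ℕ → List (ℕ × (Fin n × Fin k))
            block j = map (j ,_) (cartesianProduct (seeds j) (allFin k))

            target : List (ℕ × (Fin n × Fin k))
            target = concatMap block js

            -- A seed has at most one ancestor on each level, and a band consists of k consecutive
            -- levels. So a mixed vertex is determined by its band, a seed below it, and its shifted
            -- level modulo k.
            mx-target : length mx ≤ length target
            mx-target = inj-count Meet (UP.filter⁺ mixed? (UP.allFin⁺ n)) f (λ {v} {v′} {t} → g {v} {v′} {t})
              where
              Meet : Fin n → ℕ × (Fin n × Fin k) → Set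
              Meet v t = bd v ≡ proj₁ t × Anc v (proj₁ (proj₂ t)) × (level v + r) % k ≡ toℕ (proj₂ (proj₂ t))
              f : ∀ {v} → v ∈ mx → ∃ λ t → t ∈ target × Meet v t
              f {v} i with proj₂ (∈-filter⁻ mixed? {xs = allFin n} i)
              ... | x , s , a = (bd v , x , ρ) , ∈-cM⁺ block (∈-upTo⁺ (s≤s (∑-≤-∈ bd (∈-allFin v)))) (∈-map⁺ (bd v ,_) (∈-cartesianProduct⁺ s (∈-allFin ρ))) , refl , a , sym (FP.toℕ-fromℕ< _)
                where
                ρ : Fin k
                ρ = fromℕ< (m%n<n (level v + r) k)
              g : ∀ {v v′ t} → v ≢ v′ → Meet v t → Meet v′ t → ⊥
              g {v} {v′} ne (b , a , m) (b′ , a′ , m′) = ne (anc-unique a a′ (+-cancelʳ-≡ r (level v) (level v′)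
                (trans (m≡m%n+[m/n]*n (level v + r) k) (trans (cong₂ (λ x y → x + y * k) (trans m (sym m′)) (trans b (sym b′))) (sym (m≡m%n+[m/n]*n (level v′ + r) k))))))

            mx-count : K * length mx ≤ 10 * k * (n * D)
            mx-count = begin
              K * length mx ≤⟨ *-monoʳ-≤ K mx-target ⟩
              K * length target ≡⟨ cong (K *_) (trans (length-concatMap block js) (∑-cong js (λ {j} _ → trans (length-map (j ,_) (cartesianProduct (seeds j) (allFin k))) (trans (length-cart (seeds j) (allFin k)) (cong (length (seeds j) *_) (length-tabulate {n = k} id)))))) ⟩
              K * ∑ js (λ j → length (seeds j) * k) ≡⟨ sym (∑-* K _ js) ⟩
              ∑ js (λ j → K * (length (seeds j) * k)) ≤⟨ ∑-mono js (λ {j} _ → each j) ⟩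
              ∑ js (λ j → 10 * k * ∑ allX (w j)) ≡⟨ ∑-* (10 * k) _ js ⟩
              10 * k * ∑ js (λ j → ∑ allX (w j)) ≡⟨ cong (10 * k *_) (∑-swap w js allX) ⟩
              10 * k * ∑ allX (λ d → ∑ js (λ j → w j d)) ≤⟨ *-monoʳ-≤ (10 * k) (∑-mono allX (λ {d} _ → le1 d)) ⟩
              10 * k * ∑ allX (λ _ → 1) ≡⟨ cong (10 * k *_) (trans (∑-const 1 allX) (trans (*-identityʳ _) length-allX)) ⟩
              10 * k * (n * D) ∎
              where
              open ≤-Reasoning
              ujs : Unique js
              ujs = UP.upTo⁺ (suc (∑ (allFin n) bd))
              le1 : ∀ d → ∑ js (λ j → w j d) ≤ 1
              le1 d = atmost1 {P = λ j → Q j d} (λ j → q? j d) {js} ujs (λ a b → trans (sym (proj₂ a)) (proj₂ b))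
              ar₁ : ∀ a b c → a * (10 * b * c) ≡ 10 * c * (a * b)
              ar₁ = solve-∀
              each : ∀ j → K * (length (seeds j) * k) ≤ 10 * k * ∑ allX (w j)
              each j = begin
                K * (length (seeds j) * k) ≤⟨ *-monoʳ-≤ K (*-monoˡ-≤ k (seeds-count j)) ⟩
                K * (10 * length (cuts j) * k) ≡⟨ ar₁ K (length (cuts j)) k ⟩
                10 * k * (K * length (cuts j)) ≤⟨ *-monoʳ-≤ (10 * k) (cuts-count j) ⟩
                10 * k * ∑ allX (w j) ∎

            CutD : X → Set
            CutD d = Mixed (proj₁ d) ⊎ (Mixed (hd d) ⊎ bd (proj₁ d) ≢ bd (hd d))

            abstract
              cutD? : ∀ d → Dec (CutD d)
              cutD? d = mixed? (proj₁ d) ⊎-dec (mixed? (hd d) ⊎-dec cross? d)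

            cutD-α : ∀ {d} → CutD d → CutD (α d)
            cutD-α {d} (inj₁ m) = inj₂ (inj₁ (subst Mixed (sym (cong proj₁ (inv d))) m))
            cutD-α {d} (inj₂ (inj₁ m)) = inj₁ m
            cutD-α {d} (inj₂ (inj₂ c)) = inj₂ (inj₂ (λ e → c (trans (cong bd (sym (cong proj₁ (inv d)))) (sym e))))

            cutD-count : length (filter cutD? allX) ≤ 2 * (length mx * D) + length (filter cross? allX)
            cutD-count = subst (length (filter cutD? allX) ≤_)
                (trans (length-++ (md ++ map α md)) (cong (_+ length (filter cross? allX)) (trans (twice α md) (cong (2 *_) lmd))))
                (unique-⊆ (UP.filter⁺ cutD? (Finite.uniq FX)) sub)
              where
              md : List X
              md = cartesianProduct mx (allFin D)
              lmd : length md ≡ length mx * D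
              lmd = trans (length-cart mx (allFin D)) (cong (length mx *_) (length-tabulate {n = D} id))
              md∈ : ∀ {d} → Mixed (proj₁ d) → d ∈ md
              md∈ {v , i} m = ∈-cartesianProduct⁺ (∈-filter⁺ mixed? (∈-allFin v) m) (∈-allFin i)
              sub : ∀ {d} → d ∈ filter cutD? allX → d ∈ (md ++ map α md) ++ filter cross? allX
              sub {d} i with proj₂ (∈-filter⁻ cutD? {xs = allX} i)
              ... | inj₁ m = ∈-++⁺ˡ (∈-++⁺ˡ (md∈ m))
              ... | inj₂ (inj₁ m) = ∈-++⁺ˡ (∈-++⁺ʳ md (subst (_∈ map α md) (inv d) (∈-map⁺ α (md∈ m))))
              ... | inj₂ (inj₂ c) = ∈-++⁺ʳ (md ++ map α md) (∈-filter⁺ cross? (Finite.complete FX d) c)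

            UnD : Fin n → Fin n → Set
            UnD u v = ∃ λ i → hd (u , i) ≡ v × ¬ CutD (u , i)

            -- An uncut edge joins unmixed vertices of one band, and the face step along it keeps
            -- the label. So a component of the uncut edges lies in one band and in one part of the
            -- dual tree, and the weight of that part bounds its size.
            μ : Fin n → ℕ × X
            μ v = bd v , lab (bd v) (v , zero)

            un-μ : ∀ {u v} → UnD u v → μ u ≡ μ v
            un-μ {u} (i , refl , nc) = cong₂ _,_ same (trans (proj₁ (calm nu) zero i) (trans (sym (calm-φ nu i)) (trans
                (subst (λ j → lab j (φ (u , i)) ≡ lab j (hd (u , i) , zero)) (sym same) (proj₁ (calm nv) (proj₂ (φ (u , i))) zero))
                (cong (λ j → lab j (hd (u , i) , zero)) same))))
              where
              nu : ¬ Mixed u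
              nu m = nc (inj₁ m)
              nv : ¬ Mixed (hd (u , i))
              nv m = nc (inj₂ (inj₁ m))
              same : bd u ≡ bd (hd (u , i))
              same = decidable-stable (bd u ℕP.≟ bd (hd (u , i))) (λ ne → nc (inj₂ (inj₂ ne)))

            small : ∀ v vs → Unique vs → (∀ {x} → x ∈ vs → Conn UnD v x) → length vs ≤ 1 + 3 * K
            small v vs u h = begin
              length vs ≡⟨ sym (length-map (λ v → v , zero) vs) ⟩
              length (map (λ v → v , zero) vs) ≤⟨ unique-⊆ {ys = filter (q? j) (filter (λ d → lab j d ≟X c) allX)} (UP.map⁺ (cong proj₁) u) sub ⟩
              length (filter (q? j) (filter (λ d → lab j d ≟X c) allX)) ≡⟨ trans (length-filter (q? j) (filter (λ d → lab j d ≟X c) allX)) (∑-filter (λ d → lab j d ≟X c) (w j) allX) ⟩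
              ∑ allX (λ d → 𝟙 (lab j d ≟X c) * w j d) ≤⟨ label-weight j c ⟩
              w j c + 3 * K ≤⟨ +-monoˡ-≤ (3 * K) (𝟙≤1 (q? j c)) ⟩
              1 + 3 * K ∎
              where
              open ≤-Reasoning
              j : ℕ
              j = bd v
              c : X
              c = lab j (v , zero)
              𝟙≤1 : {S : Set} (d : Dec S) → 𝟙 d ≤ 1
              𝟙≤1 (yes _) = ≤-refl
              𝟙≤1 (no _) = z≤n
              sub : ∀ {d} → d ∈ map (λ v → v , zero) vs → d ∈ filter (q? j) (filter (λ d → lab j d ≟X c) allX)
              sub i with ∈-map⁻ (λ v → v , zero) i
              ... | x , x∈ , refl = ∈-filter⁺ (q? j) (∈-filter⁺ (λ d → lab j d ≟X c) (Finite.complete FX _) lx) (refl , sym bx)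
                where
                e : μ v ≡ μ x
                e = cfold (kerEq μ) un-μ (h x∈)
                bx : bd v ≡ bd x
                bx = cong proj₁ e
                lx : lab j (x , zero) ≡ c
                lx = trans (cong (λ z → lab z (x , zero)) bx) (sym (cong proj₂ e))

        module Final (z : ℕ) where
          -- Both kinds of cut darts are allowed n / (2 Z). For a suitable offset at most n D / k
          -- darts cross bands, where k = `suc kk`, so k > 2 D Z will do. There are at most 10 k n D
          -- / K mixed vertices, each responsible for 2 D darts, which leads to `K`.
          Z kk K : ℕ
          Z = suc z
          kk = 2 * D * Z
          K = 4 * D * Z * (10 * suc kk * D)

          f : Fin (suc kk) → ℕ
          f r = length (filter (Band.cross? kk (toℕ r) K) allX)

          f-sum : ∑ (allFin (suc kk)) f ≤ n * D
          f-sum = begin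
            ∑ (allFin (suc kk)) f ≡⟨ ∑-cong (allFin (suc kk)) (λ {r} _ → length-filter (Band.cross? kk (toℕ r) K) allX) ⟩
            ∑ (allFin (suc kk)) (λ r → ∑ allX (λ d → 𝟙 (Band.cross? kk (toℕ r) K d))) ≡⟨ ∑-swap _ (allFin (suc kk)) allX ⟩
            ∑ allX (λ d → ∑ (allFin (suc kk)) (λ r → 𝟙 (Band.cross? kk (toℕ r) K d)))
              ≤⟨ ∑-mono allX (λ {d} _ → atmost1 (λ r → Band.cross? kk (toℕ r) K d) (UP.allFin⁺ (suc kk))
                   (λ {r} {s} a b → FP.toℕ-injective (shift-unique kk (Bfs.lev B (proj₁ d) ⊔ Bfs.lev B (hd d)) (FP.toℕ<n r) (FP.toℕ<n s) (Band.crossmod kk (toℕ r) K d a) (Band.crossmod kk (toℕ s) K d b)))) ⟩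
            ∑ allX (λ _ → 1) ≡⟨ trans (∑-const 1 allX) (trans (*-identityʳ _) length-allX) ⟩
            n * D ∎
            where open ≤-Reasoning

          offset : ∃ λ r → suc kk * f r ≤ n * D
          offset with pick-avg f zero (List.tabulate suc)
          ... | r , _ , le = r , ≤-trans (subst (λ l → l * f r ≤ ∑ (allFin (suc kk)) f) (length-tabulate {n = suc kk} id) le) f-sum

          private
            r : Fin (suc kk)
            r = proj₁ offset
          open Band kk (toℕ r) K using (Mixed; mx; mx-count; CutD; cutD?; cutD-α; cutD-count; small; cross?)

          pieces : (∀ v → Dec (Mixed v)) → Pieces M Z (1 + 3 * K)
          pieces mixed? = record { Cut = CutD mixed? ; cut? = cutD? mixed? ; cut-α = cutD-α mixed? ; few = few ; small = small mixed? }
            where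
            open ≤-Reasoning
            m c : ℕ
            m = length (mx mixed?)
            c = length (filter cross? allX)
            ar₁ : ∀ a b c → a * b * c ≡ b * (a * c)
            ar₁ = solve-∀
            ar₂ : ∀ a b c → a * (c * b) ≡ a * b * c
            ar₂ = solve-∀
            ar₃ : ∀ a b c → 2 * a * b * c ≡ a * (2 * b * c)
            ar₃ = solve-∀
            ar₄ : ∀ z m d c → 2 * (z * (2 * (m * d) + c)) ≡ 4 * d * z * m + 2 * z * c
            ar₄ = solve-∀
            e₁ : 4 * D * Z * m ≤ n
            e₁ = *-cancelˡ-≤ (10 * suc kk * D) (begin
              10 * suc kk * D * (4 * D * Z * m) ≡⟨ sym (ar₁ (4 * D * Z) (10 * suc kk * D) m) ⟩
              K * m ≤⟨ mx-count mixed? ⟩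
              10 * suc kk * (n * D) ≡⟨ ar₂ (10 * suc kk) D n ⟩
              10 * suc kk * D * n ∎)
            e₂ : 2 * Z * c ≤ n
            e₂ = *-cancelˡ-≤ D (begin
              D * (2 * Z * c) ≡⟨ sym (ar₃ D Z c) ⟩
              2 * D * Z * c ≤⟨ m≤n+m _ c ⟩
              suc kk * c ≤⟨ proj₂ offset ⟩
              n * D ≡⟨ *-comm n D ⟩
              D * n ∎)
            few : Z * length (filter (cutD? mixed?) allX) ≤ n
            few = *-cancelˡ-≤ 2 (begin
              2 * (Z * length (filter (cutD? mixed?) allX)) ≤⟨ *-monoʳ-≤ 2 (*-monoʳ-≤ Z (cutD-count mixed?)) ⟩
              2 * (Z * (2 * (m * D) + c)) ≡⟨ ar₄ Z m D c ⟩
              4 * D * Z * m + 2 * Z * c ≤⟨ +-mono-≤ e₁ e₂ ⟩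
              n + n ≡⟨ cong (n +_) (sym (+-identityʳ n)) ⟩
              2 * n ∎)

          with-pieces : {R : Set} → (Pieces M Z (1 + 3 * K) → NN R) → NN R
          with-pieces k = nn-fin FV (λ v → nn-dec) >>= λ mixed? → k (pieces mixed?)

  pieceBound : ℕ → ℕ → ℕ
  pieceBound D z = 1 + 3 * (4 * D * suc z * (10 * suc (2 * D * suc z) * D))

  module _ {n D′ : ℕ} (M : RMap n D′) (P : RMap.PlanarR M) (z : ℕ) where
    open RMap M using (adj-sym; FX; FV; rootDarts)
    open RMap.PlanarR M P using (cs; ccover)

    hyperfinite : {R : Set} → (Pieces M (suc z) (pieceBound (suc D′) z) → NN R) → NN R
    hyperfinite k = do
      B ← bfs FV adj-sym cs ccover
      T ← bfs FX (λ {x} {y} → Hyper.Dual.LL-sym M P B {x} {y}) (rootDarts cs) (Hyper.Dual.cover M P B)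
      Hyper.Dual.DT.Final.with-pieces M P B T z k

  -- Patches and their insertion into a map

  nxt : ∀ {b} → Fin b → Fin b
  nxt {suc b} = nx

  σₐ : ∀ {A : Set} {D′} → A × Fin (suc D′) → A × Fin (suc D′)
  σₐ (a , i) = a , nx i

  -- A piece of a map with b half-edges ("legs") sticking out into its outer face, in cyclic order,
  -- and f closed faces.  The label inj₁ k marks the part of the outer face that leads to leg k.
  record Patch (D′ : ℕ) (A : Set) (b f : ℕ) : Set where
    field
      β        : A × Fin (suc D′) → (A × Fin (suc D′)) ⊎ Fin b
      leg      : Fin b → A × Fin (suc D′)
      β-leg    : ∀ k → β (leg k) ≡ inj₂ k
      leg-β    : ∀ {d k} → β d ≡ inj₂ k → d ≡ leg k
      β-sym    : ∀ {d e} → β d ≡ inj₁ e → β e ≡ inj₁ d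
      noloop   : ∀ {d e} → β d ≡ inj₁ e → proj₁ d ≢ proj₁ e
      simple   : ∀ {d e d′ e′} → β d ≡ inj₁ e → β d′ ≡ inj₁ e′ → proj₁ d ≡ proj₁ d′ → proj₁ e ≡ proj₁ e′ → d ≡ d′
      leg-inj  : ∀ {k k′} → proj₁ (leg k) ≡ proj₁ (leg k′) → k ≡ k′
      lab      : A × Fin (suc D′) → Fin b ⊎ Fin f
      lab-leg  : ∀ k → lab (leg k) ≡ inj₁ k
      lab-next : ∀ k → lab (σₐ (leg k)) ≡ inj₁ (nxt k)
      lab-β    : ∀ {d e} → β d ≡ inj₁ e → lab (σₐ e) ≡ lab d
      lab-surj : ∀ c → ∃ λ d → lab d ≡ inj₂ c
    Link : A → A → Set
    Link x y = ∃ λ i → ∃ λ j → β (x , i) ≡ inj₁ (y , j)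
    field
      conn     : ∀ x y → Conn Link x y

  -- `e` places the patch on the vertices of a region, and `legAt k` is the dart that leaves the
  -- region as leg k. Outside nothing moves: the outer half of leg k is merely reattached to leg k
  -- of the patch. That the cyclic orders match enters later, as `contour`.
  module Surgery {n D′ : ℕ} (M : RMap n D′) {A : Set} {b f : ℕ} (P : Patch D′ A b f)
    (e : A → Fin n) (e-inj : ∀ {x y} → e x ≡ e y → x ≡ y)
    (view : ∀ v → (∃ λ a → e a ≡ v) ⊎ (∀ a → e a ≢ v))
    (legAt : Fin b → RMap.X M)
    (legIn : ∀ k → ∃ λ a → e a ≡ proj₁ (legAt k))
    (legOut : ∀ k a → e a ≢ RMap.hd M (legAt k))
    (legAt-inj : ∀ {k k′} → legAt k ≡ legAt k′ → k ≡ k′)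
    (legAll : ∀ d → (∃ λ a → e a ≡ proj₁ d) → (∀ a → e a ≢ RMap.hd M d) → ∃ λ k → legAt k ≡ d) where

    open RMap M hiding (noloop; simple)
    open Patch P

    In Out : Fin n → Set
    In v = ∃ λ a → e a ≡ v
    Out v = ∀ a → e a ≢ v

    up : A × Fin D → X
    up (a , i) = e a , i

    private
      inner : (A × Fin D) ⊎ Fin b → X
      inner (inj₁ y) = up y
      inner (inj₂ k) = α (legAt k)

      outer : ∀ d → Out (proj₁ d) → In (hd d) ⊎ Out (hd d) → X
      outer d o (inj₂ _) = α d
      outer d o (inj₁ p) = up (leg (proj₁ (legAll (α d) p (λ a q → o a (trans q (cong proj₁ (inv d)))))))

      α″ : ∀ d → In (proj₁ d) ⊎ Out (proj₁ d) → X
      α″ (u , i) (inj₁ (a , _)) = inner (β (a , i))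
      α″ d (inj₂ o) = outer d o (view (hd d))

    α′ : X → X
    α′ d = α″ d (view (proj₁ d))

    α′-inner : ∀ a i → α′ (e a , i) ≡ inner (β (a , i))
    α′-inner a i with view (e a)
    ... | inj₁ (a′ , q) = cong (λ z → inner (β (z , i))) (e-inj q)
    ... | inj₂ o = ⊥-elim (o a refl)

    α′-in₁ : ∀ {d y} → β d ≡ inj₁ y → α′ (up d) ≡ up y
    α′-in₁ {a , i} eq = trans (α′-inner a i) (cong inner eq)

    α′-in₂ : ∀ k → α′ (up (leg k)) ≡ α (legAt k)
    α′-in₂ k = trans (α′-inner (proj₁ (leg k)) (proj₂ (leg k))) (cong inner (β-leg k))

    α′-out : ∀ d → Out (proj₁ d) → Out (hd d) → α′ d ≡ α d
    α′-out d o o′ with view (proj₁ d)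
    ... | inj₁ (a , q) = ⊥-elim (o a q)
    ... | inj₂ o₂ with view (hd d)
    ... | inj₁ (a , q) = ⊥-elim (o′ a q)
    ... | inj₂ _ = refl

    α′-leg : ∀ k → α′ (α (legAt k)) ≡ up (leg k)
    α′-leg k with view (hd (legAt k))
    ... | inj₁ (a , q) = ⊥-elim (legOut k a q)
    ... | inj₂ o₂ with view (hd (α (legAt k)))
    ... | inj₂ o = ⊥-elim (o (proj₁ (legIn k)) (trans (proj₂ (legIn k)) (sym (cong proj₁ (inv (legAt k))))))
    ... | inj₁ p = cong (up ∘ leg) (legAt-inj (trans (proj₂ (legAll (α (α (legAt k))) p _)) (inv (legAt k))))

    data Kind : X → Set where
      in₁    : ∀ {d y} → β d ≡ inj₁ y → Kind (up d)
      in₂    : ∀ k → Kind (up (leg k))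
      outOut : ∀ {d} → Out (proj₁ d) → Out (hd d) → Kind d
      outLeg : ∀ k → Kind (α (legAt k))

    kind : ∀ d → Kind d
    kind (u , i) with view u
    kind (_ , i) | inj₁ (a , refl) with β (a , i) in eq
    ... | inj₁ y = in₁ eq
    ... | inj₂ k = subst Kind (cong up (sym (leg-β eq))) (in₂ k)
    kind (u , i) | inj₂ o with view (hd (u , i))
    ... | inj₂ o′ = outOut o o′
    ... | inj₁ p with legAll (α (u , i)) p (λ a q → o a (trans q (cong proj₁ (inv (u , i)))))
    ... | k , eq = subst Kind (trans (cong α eq) (inv (u , i))) (outLeg k)

    M′ : RMap n D′
    M′ = record { α = α′ ; inv = inv′ ; noloop = λ u i → nl (u , i) ; simple = λ {u} {i} {j} eq → cong proj₂ (simp (u , i) (u , j) refl eq) }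
      where
      inv′ : ∀ d → α′ (α′ d) ≡ d
      inv′ d with kind d
      ... | in₁ eq = trans (cong α′ (α′-in₁ eq)) (α′-in₁ (β-sym eq))
      ... | in₂ k = trans (cong α′ (α′-in₂ k)) (α′-leg k)
      ... | outLeg k = trans (cong α′ (α′-leg k)) (α′-in₂ k)
      ... | outOut o o′ = trans (cong α′ (α′-out d o o′)) (trans (α′-out (α d) o′ (subst Out (sym (cong proj₁ (inv d))) o)) (inv d))
      nl : ∀ d → proj₁ (α′ d) ≢ proj₁ d
      nl d q with kind d
      ... | in₁ eq = noloop eq (sym (e-inj (trans (sym (cong proj₁ (α′-in₁ eq))) q)))
      ... | in₂ k = legOut k _ (sym (trans (sym (cong proj₁ (α′-in₂ k))) q))
      ... | outLeg k = legOut k _ (trans (sym (cong proj₁ (α′-leg k))) q)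
      ... | outOut o o′ = RMap.noloop M _ _ (trans (sym (cong proj₁ (α′-out d o o′))) q)
      simp : ∀ d d′ → proj₁ d ≡ proj₁ d′ → proj₁ (α′ d) ≡ proj₁ (α′ d′) → d ≡ d′
      simp d d′ t h with kind d | kind d′
      ... | in₁ p | in₁ q = cong up (simple p q (e-inj t) (e-inj (trans (sym (cong proj₁ (α′-in₁ p))) (trans h (cong proj₁ (α′-in₁ q))))))
      ... | in₁ p | in₂ k = ⊥-elim (legOut k _ (trans (sym (cong proj₁ (α′-in₁ p))) (trans h (cong proj₁ (α′-in₂ k)))))
      ... | in₁ p | outOut o _ = ⊥-elim (o _ t)
      ... | in₁ p | outLeg k = ⊥-elim (legOut k _ t)
      ... | in₂ k | in₁ p = ⊥-elim (legOut k _ (sym (trans (sym (cong proj₁ (α′-in₂ k))) (trans h (cong proj₁ (α′-in₁ p))))))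
      ... | in₂ k | in₂ l = cong (up ∘ leg) (leg-inj (e-inj t))
      ... | in₂ k | outOut o _ = ⊥-elim (o _ t)
      ... | in₂ k | outLeg l = ⊥-elim (legOut l _ t)
      ... | outOut o _ | in₁ p = ⊥-elim (o _ (sym t))
      ... | outOut o _ | in₂ k = ⊥-elim (o _ (sym t))
      ... | outLeg k | in₁ p = ⊥-elim (legOut k _ (sym t))
      ... | outLeg k | in₂ l = ⊥-elim (legOut k _ (sym t))
      ... | outOut o o′ | outLeg k = ⊥-elim (o′ _ (sym (trans (sym (cong proj₁ (α′-out d o o′))) (trans h (cong proj₁ (α′-leg k))))))
      ... | outLeg k | outOut o o′ = ⊥-elim (o′ _ (trans (sym (cong proj₁ (α′-leg k))) (trans h (cong proj₁ (α′-out d′ o o′)))))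
      ... | outLeg k | outLeg l = cong (α ∘ legAt) (leg-inj (e-inj (trans (sym (cong proj₁ (α′-leg k))) (trans h (cong proj₁ (α′-leg l))))))
      ... | outOut {u , i} o o′ | outOut {u′ , i′} p p′ with t
      ... | refl = cong (u ,_) (RMap.simple M (trans (sym (cong proj₁ (α′-out (u , i) o o′))) (trans h (cong proj₁ (α′-out (u , i′) p p′)))))

    open module M′ = RMap M′ using () renaming (AdjL to AdjL′; φL to φL′; φ to φ′; PlanarR to PlanarR′)

    module _ (ps : List (X × X)) (extra : List X)
      (contour : ∀ k → Conn (addL φL ps) (α (legAt k)) (legAt (nxt k)))
      (inside : ∀ d → In (proj₁ d) → (∃ λ k → Conn (addL φL ps) d (legAt k)) ⊎ (∃ λ s → s ∈ extra × Conn (addL φL ps) d s)) where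

      Y : Set
      Y = X ⊎ Fin f

      LY : Y → Y → Set
      LY (inj₁ x) (inj₁ y) = φL x y
      LY _ _ = ⊥

      psY : List (Y × Y)
      psY = map (λ { (x , y) → inj₁ x , inj₁ y }) ps

      private
        lift : ∀ {x y} → Conn (addL φL ps) x y → Conn (addL LY psY) (inj₁ x) (inj₁ y)
        lift = cgmap inj₁ (λ { (inj₁ l) → clink (inj₁ l) ; (inj₂ i) → clink (inj₂ (∈-map⁺ _ i)) })

        lb : Fin b ⊎ Fin f → Y
        lb (inj₁ k) = inj₁ (legAt k)
        lb (inj₂ c) = inj₂ c

        h″ : ∀ d → In (proj₁ d) ⊎ Out (proj₁ d) → Y
        h″ (u , i) (inj₁ (a , _)) = lb (lab (a , i))
        h″ d (inj₂ _) = inj₁ d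

        h : X → Y
        h d = h″ d (view (proj₁ d))

        h-in : ∀ x → h (up x) ≡ lb (lab x)
        h-in (a , i) with view (e a)
        ... | inj₁ (a′ , q) = cong (λ z → lb (lab (z , i))) (e-inj q)
        ... | inj₂ o = ⊥-elim (o a refl)

        h-out : ∀ d → Out (proj₁ d) → h d ≡ inj₁ d
        h-out d o with view (proj₁ d)
        ... | inj₁ (a , q) = ⊥-elim (o a q)
        ... | inj₂ _ = refl

        _~_ : Y → Y → Set
        _~_ = Conn (addL LY psY)

        same : ∀ {x y x′ y′} → x ≡ x′ → y ≡ y′ → x′ ~ y′ → x ~ y
        same refl refl c = c

        resp : ∀ d → h d ~ h (φ′ d)
        resp d with kind d
        ... | in₁ {x} {y} eq = same (h-in x) (trans (cong (h ∘ σ) (α′-in₁ eq)) (trans (h-in (σₐ y)) (cong lb (lab-β eq)))) nil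
        ... | in₂ k = same (trans (h-in (leg k)) (cong lb (lab-leg k))) (trans (cong (h ∘ σ) (α′-in₂ k)) (h-out _ (legOut k))) (lift (clink (inj₁ refl)))
        ... | outLeg k = same (h-out _ (legOut k)) (trans (cong (h ∘ σ) (α′-leg k)) (trans (h-in (σₐ (leg k))) (cong lb (lab-next k)))) (lift (contour k))
        ... | outOut o o′ = same (h-out d o) (trans (cong (h ∘ σ) (α′-out d o o′)) (h-out _ o′)) (lift (clink (inj₁ refl)))

        cover : {fs′ : List X} → Cover (Conn φL′) fs′ → Cover _~_ (map h fs′ ++ map inj₁ extra)
        cover {fs′} cov y = go (hit y)
          where
          hit : ∀ y → (∃ λ d → y ~ h d) ⊎ (∃ λ s → s ∈ extra × y ~ inj₁ s)
          hit (inj₂ c) = let (d , q) = lab-surj c in inj₁ (up d , creflexive (sym (trans (h-in d) (cong lb q))))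
          hit (inj₁ d) with view (proj₁ d)
          ... | inj₂ o = inj₁ (d , creflexive (sym (h-out d o)))
          ... | inj₁ p with inside d p
          ... | inj₁ (k , c) = inj₁ (up (leg k) , ctrans (lift c) (creflexive (sym (trans (h-in (leg k)) (cong lb (lab-leg k))))))
          ... | inj₂ (s , s∈ , c) = inj₂ (s , s∈ , lift c)
          go : (∃ λ d → y ~ h d) ⊎ (∃ λ s → s ∈ extra × y ~ inj₁ s) → ∃ λ z → z ∈ map h fs′ ++ map inj₁ extra × y ~ z
          go (inj₁ (d , c)) = let (r , r∈ , c′) = cov d in h r , ∈-++⁺ˡ (∈-map⁺ h r∈) , ctrans c (cgmap h (λ { {x} refl → resp x }) c′)
          go (inj₂ (s , s∈ , c)) = inj₁ s , ∈-++⁺ʳ (map h fs′) (∈-map⁺ inj₁ s∈) , c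

        EY : Y → Y → Set
        EY (inj₁ x) (inj₁ y) = Conn φL x y
        EY (inj₂ c) (inj₂ c′) = c ≡ c′
        EY _ _ = ⊥

        EYeq : IsEq EY
        EYeq = record { erefl = λ { {inj₁ _} → nil ; {inj₂ _} → refl }
                      ; esym = λ { {inj₁ _} {inj₁ _} c → csym c ; {inj₂ _} {inj₂ _} c → sym c }
                      ; etrans = λ { {inj₁ _} {inj₁ _} {inj₁ _} c c′ → ctrans c c′ ; {inj₂ _} {inj₂ _} {inj₂ _} c c′ → trans c c′ } }

        link-EY : ∀ x y → LY x y → EY x y
        link-EY (inj₁ _) (inj₁ _) l = clink l
        link-EY (inj₁ _) (inj₂ _) ()
        link-EY (inj₂ _) (inj₁ _) ()
        link-EY (inj₂ _) (inj₂ _) ()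

      -- Merge the old faces along `ps` and add the f closed faces of the patch as new points.
      -- Sending each dart of the patch to its label gives a map `h` of the new darts that is
      -- constant on new faces and meets every class except possibly those of `extra`. So the
      -- classes number at most F′ plus the length of `extra`, and by `join-count` at least F + f
      -- minus the length of `ps`.
      faces-bound : ∀ {fs fs′} → Indep (Conn φL) fs → Cover (Conn φL′) fs′ →
        length fs + f ≤ length ps + (length fs′ + length extra)
      faces-bound {fs} {fs′} ind cov = subst₂ _≤_ e₁ e₂ (join-count psY {xs = map inj₁ fs ++ map inj₂ (allFin f)} indY (cover cov))
        where
        e₁ : length (map inj₁ fs ++ map {B = Y} inj₂ (allFin f)) ≡ length fs + f
        e₁ = trans (length-++ (map inj₁ fs)) (cong₂ _+_ (length-map inj₁ fs) (trans (length-map inj₂ (allFin f)) (length-tabulate {n = f} id)))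
        e₂ : length psY + length (map h fs′ ++ map inj₁ extra) ≡ length ps + (length fs′ + length extra)
        e₂ = cong₂ _+_ (length-map _ ps) (trans (length-++ (map h fs′)) (cong₂ _+_ (length-map h fs′) (length-map inj₁ extra)))
        ufs : Unique fs
        ufs = AllPairs.map (λ nr q → nr (creflexive q)) ind
        inj₁-inj : ∀ {x y : X} → inj₁ {B = Fin f} x ≡ inj₁ y → x ≡ y
        inj₁-inj refl = refl
        inj₂-inj : ∀ {x y : Fin f} → inj₂ {A = X} x ≡ inj₂ y → x ≡ y
        inj₂-inj refl = refl
        disj : ∀ {y : Y} → (y ∈ map inj₁ fs × y ∈ map inj₂ (allFin f)) → ⊥
        disj (i , j) with ∈-map⁻ inj₁ i | ∈-map⁻ inj₂ j
        ... | _ , _ , refl | _ , _ , ()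
        indY : Indep (Conn LY) (map inj₁ fs ++ map inj₂ (allFin f))
        indY = unique→indep (UP.++⁺ (UP.map⁺ inj₁-inj ufs) (UP.map⁺ inj₂-inj (UP.allFin⁺ f)) disj) λ {x} {y} i j c →
          eqv x y (mem x i) (mem y j) (cfold EYeq (λ {x} {y} → link-EY x y) c)
          where
          Mem : Y → Set
          Mem (inj₁ x) = x ∈ fs
          Mem (inj₂ _) = ⊤
          mem : ∀ y → y ∈ map inj₁ fs ++ map inj₂ (allFin f) → Mem y
          mem (inj₂ _) _ = tt
          mem (inj₁ x) i with ∈-++⁻ (map inj₁ fs) i
          ... | inj₁ j with ∈-map⁻ inj₁ j
          ... | _ , q , refl = q
          mem (inj₁ x) i | inj₂ j with ∈-map⁻ inj₂ j
          ... | _ , _ , ()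
          eqv : ∀ x y → Mem x → Mem y → EY x y → x ≡ y
          eqv (inj₁ x) (inj₁ y) p q c = cong inj₁ (indep-∈ connEq ind p q c)
          eqv (inj₂ _) (inj₂ _) _ _ q = cong inj₂ q

    patch-conn : ∀ x y → Conn AdjL′ (e x) (e y)
    patch-conn x y = cgmap e (λ { {x} (i , j , eq) → clink (i , cong proj₁ (α′-in₁ eq)) }) (conn x y)

    module _ (a₀ : A) where
      private
        g″ : ∀ {v} → In v ⊎ Out v → Fin n
        g″ (inj₁ _) = e a₀
        g″ {v} (inj₂ _) = v

      g : Fin n → Fin n
      g v = g″ (view v)

      g-in : ∀ {v} → In v → g v ≡ e a₀
      g-in {v} (a , q) with view v
      ... | inj₁ _ = refl
      ... | inj₂ o = ⊥-elim (o a q)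

      g-out : ∀ {v} → Out v → g v ≡ v
      g-out {v} o with view v
      ... | inj₁ (a , q) = ⊥-elim (o a q)
      ... | inj₂ _ = refl

      to-g : ∀ v → Conn AdjL′ v (g v)
      to-g v with view v
      ... | inj₁ (a , refl) = patch-conn a a₀
      ... | inj₂ _ = nil

      adj-g : ∀ {u v} → AdjL u v → Conn AdjL′ (g u) (g v)
      adj-g {u} (i , refl) with view u | view (hd (u , i))
      ... | inj₁ p | inj₁ q = creflexive refl
      ... | inj₂ o | inj₂ o′ = clink (i , cong proj₁ (α′-out (u , i) o o′))
      ... | inj₂ o | inj₁ p with legAll (α (u , i)) p (λ a q → o a (trans q (cong proj₁ (inv (u , i)))))
      ... | k , eq = ctrans (clink (i , trans (cong (proj₁ ∘ α′) (sym (trans (cong α eq) (inv (u , i))))) (cong proj₁ (α′-leg k)))) (patch-conn _ a₀)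
      adj-g {u} (i , refl) | inj₁ p | inj₂ o with legAll (u , i) p o
      ... | k , eq = ctrans (patch-conn a₀ _) (clink (proj₂ (leg k) , trans (cong proj₁ (α′-in₂ k)) (cong hd eq)))

      conn-g : ∀ {u v} → Conn AdjL u v → Conn AdjL′ (g u) (g v)
      conn-g = cgmap g adj-g

      cover-g : ∀ {cs} → Cover (Conn AdjL) cs → Cover (Conn AdjL′) (map g cs)
      cover-g cov v = let (c , c∈ , p) = cov v in g c , ∈-map⁺ g c∈ , ctrans (to-g v) (conn-g p)

      in? : ∀ v → Dec (In v)
      in? v with view v
      ... | inj₁ p = yes p
      ... | inj₂ o = no (λ { (a , q) → o a q })

      -- For a region made up of whole components: the patch is connected, so all components inside
      -- the region become one.
      cover-g₀ : ∀ {cs} → Cover (Conn AdjL) cs → Cover (Conn AdjL′) (e a₀ ∷ filter (λ v → ¬? (in? v)) cs)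
      cover-g₀ {cs} cov v with cov v
      ... | c , c∈ , p with in? c
      ... | yes i = e a₀ , here refl , ctrans (to-g v) (subst (Conn AdjL′ (g v)) (g-in i) (conn-g p))
      ... | no ni = c , there (∈-filter⁺ (λ v → ¬? (in? v)) c∈ ni) , ctrans (to-g v) (subst (Conn AdjL′ (g v)) (g-out (λ a q → ni (a , q))) (conn-g p))

    planar′ : ∀ {fn cn} → (∀ {fs′} → Cover (Conn φL′) fs′ → fn ≤ length fs′) →
      (cs′ : List (Fin n)) → Cover (Conn AdjL′) cs′ → length cs′ ≤ cn → n * D + 4 * cn ≤ 2 * n + 2 * fn → NN PlanarR′
    planar′ {fn} {cn} fb cs′ ccov cle gen = do
      (fs , find , fcov) ← nn-reps (RMap.FX M′) connEq
      (cs , cind , ccov′) ← nn-reps (finFinite n) connEq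
      return (record { fs = fs ; cs = cs ; findep = find ; cindep = cind ; ccover = ccov′
        ; genus0 = ≤-trans (+-monoʳ-≤ (n * D) (*-monoʳ-≤ 4 (≤-trans (indep≤cover connEq cind (λ {x} _ → ccov x)) cle)))
            (≤-trans gen (+-monoʳ-≤ (2 * n) (*-monoʳ-≤ 2 (fb fcov)))) })

    agree→ : ∀ {u v} → Out u → Out v → AdjL u v → AdjL′ u v
    agree→ {u} o o′ (i , refl) = i , cong proj₁ (α′-out (u , i) o o′)

    agree← : ∀ {u v} → Out u → Out v → AdjL′ u v → AdjL u v
    agree← {u} o o′ (i , eq) with kind (u , i) in keq
    ... | in₁ _ = ⊥-elim (o _ refl)
    ... | in₂ _ = ⊥-elim (o _ refl)
    ... | outLeg k = ⊥-elim (o′ _ (trans (sym (cong proj₁ (α′-leg k))) eq))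
    ... | outOut p p′ = i , trans (sym (cong proj₁ (α′-out (u , i) p p′))) eq

    leaves : ∀ {a v} → AdjL′ (e a) v → Out v → ∃ λ k → a ≡ proj₁ (leg k) × v ≡ hd (legAt k)
    leaves {a} (i , eq) o with β (a , i) in q
    ... | inj₁ y = ⊥-elim (o _ (trans (sym (cong proj₁ (α′-in₁ q))) eq))
    ... | inj₂ k = k , cong proj₁ (leg-β q) , trans (sym eq) (trans (cong (proj₁ ∘ α′ ∘ up) (leg-β q)) (cong proj₁ (α′-in₂ k)))

    leg-edge : ∀ k → AdjL′ (e (proj₁ (leg k))) (hd (legAt k))
    leg-edge k = proj₂ (leg k) , cong proj₁ (α′-in₂ k)

    inside→ : ∀ {x y} → AdjL′ (e x) (e y) → Link x y
    inside→ {x} {y} (i , eq) with β (x , i) in q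
    ... | inj₁ (z , j) = i , j , trans q (cong (λ t → inj₁ (t , j)) (e-inj (trans (sym (cong proj₁ (α′-in₁ q))) eq)))
    ... | inj₂ k = ⊥-elim (legOut k y (sym (trans (sym (trans (cong (proj₁ ∘ α′ ∘ up) (leg-β q)) (cong proj₁ (α′-in₂ k)))) eq)))

    →inside : ∀ {x y} → Link x y → AdjL′ (e x) (e y)
    →inside (i , j , eq) = i , cong proj₁ (α′-in₁ eq)

  -- Regions, their legs and their contours

  module Region {n D′ : ℕ} (M : RMap n D′) (Q : Fin n → Set) (Q? : ∀ v → Dec (Q v)) where
    open RMap M hiding (noloop; simple)

    LS : Fin n → Fin n → Set
    LS u v = AdjL u v × Q u × Q v

    LS-sym : ∀ {u v} → LS u v → LS v u
    LS-sym (a , p , q) = adj-sym a , q , p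

    outs verts : List (Fin n)
    outs = filter (λ v → ¬? (Q? v)) (allFin n)
    verts = filter Q? (allFin n)

    split-n : length outs + length verts ≡ n
    split-n = trans (filter-split (λ v → ¬? (Q? v)) Q? (λ a b → a b) (λ {v} nn → decidable-stable (Q? v) nn) (allFin n)) (length-tabulate {n = n} id)

    inner? : ∀ d → Dec (Q (proj₁ d) × Q (hd d))
    inner? d = Q? (proj₁ d) ×-dec Q? (hd d)

    Leg : X → Set
    Leg d = Q (proj₁ d) × ¬ Q (hd d)

    abstract
      leg? : ∀ d → Dec (Leg d)
      leg? d = Q? (proj₁ d) ×-dec ¬? (Q? (hd d))

    qs : List X
    qs = filter inner? allX

    qs-α : ∀ {d} → d ∈ qs → α d ∈ qs
    qs-α {d} i with ∈-filter⁻ inner? {xs = allX} i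
    ... | _ , a , b = ∈-filter⁺ inner? (Finite.complete FX _) (b , subst Q (sym (cong proj₁ (inv d))) a)

    qs-count : {ls : List X} → Unique ls → (∀ {d} → d ∈ ls → Leg d) → length qs + length ls ≤ length verts * D
    qs-count {ls} u h = subst₂ _≤_ (length-++ qs) (trans (length-cart verts (allFin D)) (cong (length verts *_) (length-tabulate {n = D} id)))
      (unique-⊆ (UP.++⁺ (UP.filter⁺ inner? (Finite.uniq FX)) u (λ { (i , j) → proj₂ (h j) (proj₂ (proj₂ (∈-filter⁻ inner? {xs = allX} i))) })) sub)
      where
      sub : ∀ {d} → d ∈ qs ++ ls → d ∈ cartesianProduct verts (allFin D)
      sub {v , i} m with ∈-++⁻ qs m
      ... | inj₁ j = ∈-cartesianProduct⁺ (∈-filter⁺ Q? (∈-allFin v) (proj₁ (proj₂ (∈-filter⁻ inner? {xs = allX} j)))) (∈-allFin i)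
      ... | inj₂ j = ∈-cartesianProduct⁺ (∈-filter⁺ Q? (∈-allFin v) (proj₁ (h j))) (∈-allFin i)

    module Spanned {rs : List (Fin n)} (B : Bfs LS rs) where
      F : Forest
      F = forestOf proj₁ B
      open Forest F public
      open OfBfs {L = LS} proj₁ B using (up-L)

      tr-Q : ∀ {d} → Tr d → Q (proj₁ d) × Q (hd d)
      tr-Q {d} (inj₁ (l , refl)) = proj₂ (up-L l)
      tr-Q {d} (inj₂ (l , eq)) with proj₂ (up-L l)
      ... | a , b = subst Q (cong proj₁ (trans (cong α (cong₂ _,_ refl (sym eq))) (inv d))) b , a

      ps : List (X × X)
      ps = idPairs qs

      ps-count : 2 * length ps + 2 * n ≤ length qs + 2 * length rs
      ps-count = subst (λ z → 2 * z + 2 * n ≤ length qs + 2 * length rs) (sym (length-map _ (idents qs)))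
        (cotree-count proj₁ B qs (UP.filter⁺ inner? (Finite.uniq FX)) qs-α (λ t → ∈-filter⁺ inner? (Finite.complete FX _) (tr-Q t)))

      R : X → X → Set
      R = Conn (addL φL ps)

      abstract
        -- The walk around the spanning forest: cross a tree edge, turn past any other dart. For a
        -- connected region it is a single cycle through all darts of the region, which puts the
        -- legs into a cyclic order.
        κ : X → X
        κ d with tr? d
        ... | yes _ = σ (α d)
        ... | no _ = σ d

        κ-tr : ∀ {d} → Tr d → κ d ≡ σ (α d)
        κ-tr {d} t with tr? d
        ... | yes _ = refl
        ... | no nt = ⊥-elim (nt t)

        κ-nt : ∀ {d} → ¬ Tr d → κ d ≡ σ d
        κ-nt {d} nt with tr? d
        ... | yes t = ⊥-elim (nt t)
        ... | no _ = refl

      κ-inj : ∀ {d d′} → κ d ≡ κ d′ → d ≡ d′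
      κ-inj {d} {d′} eq with tr? d | tr? d′
      ... | yes t | yes t′ = φ-inj (trans (sym (κ-tr t)) (trans eq (κ-tr t′)))
      ... | no nt | no nt′ = σ-inj (trans (sym (κ-nt nt)) (trans eq (κ-nt nt′)))
      ... | yes t | no nt = ⊥-elim (nt (subst Tr (σ-inj (trans (sym (κ-tr t)) (trans eq (κ-nt nt)))) (tr-α t)))
      ... | no nt | yes t = ⊥-elim (nt (subst Tr (sym (σ-inj (trans (sym (κ-nt nt)) (trans eq (κ-tr t))))) (tr-α t)))

      κL : X → X → Set
      κL d d′ = d′ ≡ κ d

      κ-Q : ∀ d → (Q (proj₁ d) → Q (proj₁ (κ d))) × (Q (proj₁ (κ d)) → Q (proj₁ d))
      κ-Q d with tr? d
      ... | yes t = (λ _ → subst Q (sym (cong proj₁ (κ-tr t))) (proj₂ (tr-Q t))) , (λ _ → proj₁ (tr-Q t))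
      ... | no nt = subst Q (sym (cong proj₁ (κ-nt nt))) , subst Q (cong proj₁ (κ-nt nt))

      ident : ∀ {d} → ¬ Tr d → Q (proj₁ d) → Q (hd d) → R (α d) d
      ident {d} nt a b with idPairs-∈ qs-α (∈-filter⁺ inner? (Finite.complete FX d) (a , b)) nt
      ... | inj₁ i = bwd (inj₂ i) nil
      ... | inj₂ i = fwd (inj₂ i) nil

      -- Crossing a tree edge is a step along a face. Turning past another inner edge leads from one
      -- of its sides to the other, and `ps` has merged these two.
      κ-R : ∀ {d} → Q (proj₁ d) → ¬ Leg d → R d (κ d)
      κ-R {d} q nl with tr? d
      ... | yes t = clink (inj₁ (κ-tr t))
      ... | no nt = ctrans (csym (ident nt q (decidable-stable (Q? (hd d)) (λ nq → nl (q , nq))))) (clink (inj₁ (trans (κ-nt nt) (σφ d))))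

      κ-leg : ∀ {d} → Leg d → R (α d) (κ d)
      κ-leg {d} l with tr? d
      ... | yes t = ⊥-elim (proj₂ l (proj₂ (tr-Q t)))
      ... | no nt = clink (inj₁ (trans (κ-nt nt) (σφ d)))

      contour-root : ∀ v i → Q v → ∃ λ r → r ∈ rs × Q r × Conn κL (v , i) (r , zero)
      contour-root v i q with toRoot ok _ v ≤-refl
        where
        open Contour (connEq {L = κL})
        ok : ∀ x → OK x
        ok x i = (λ nt → bwd (sym (κ-nt nt)) nil) , (λ t → bwd (sym (κ-tr t)) nil ,
          bwd (sym (trans (κ-tr (tr-α t)) (cong σ (inv (x , i))))) nil)
      ... | r , e , c = r , Bfs.root B e , proj₁ (cfold IE (λ {x} {y} l → lk x y l) (c i zero)) q , c i zero
        where
        E : X → X → Set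
        E x y = (Q (proj₁ x) → Q (proj₁ y)) × (Q (proj₁ y) → Q (proj₁ x))
        IE : IsEq E
        IE = record { erefl = id , id ; esym = λ { (a , b) → b , a } ; etrans = λ { (a , b) (c , d) → c ∘ a , b ∘ d } }
        lk : ∀ x y → κL x y → E x y
        lk x _ refl = κ-Q x

      closed-R : (∀ d → ¬ Leg d) → ∀ {x y} → Q (proj₁ x) → Conn κL x y → R x y
      closed-R nl {x} {y} q c = proj₂ (cfold IE (λ {x} {y} l → lk x y l) c) q
        where
        E : X → X → Set
        E x y = ((Q (proj₁ x) → Q (proj₁ y)) × (Q (proj₁ y) → Q (proj₁ x))) × (Q (proj₁ x) → R x y)
        IE : IsEq E
        IE = record { erefl = (id , id) , (λ _ → nil) ; esym = λ { ((a , b) , r) → (b , a) , (λ q → csym (r (b q))) }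
                    ; etrans = λ { ((a , b) , r) ((c , d) , s) → (c ∘ a , b ∘ d) , (λ q → ctrans (r q) (s (a q))) } }
        lk : ∀ x y → κL x y → E x y
        lk x _ refl = κ-Q x , (λ q → κ-R q (nl x))

    -- By `contour`, once the faces inside the region are merged, the face that comes in along leg k
    -- goes out along the next leg. This is what the labels of a patch presuppose of its
    -- surroundings.
    record Legs : Set where
      field
        b         : ℕ
        legAt     : Fin b → X
        legL      : ∀ k → Leg (legAt k)
        legAt-inj : ∀ {k k′} → legAt k ≡ legAt k′ → k ≡ k′
        legAll    : ∀ d → Leg d → ∃ λ k → legAt k ≡ d
        ps        : List (X × X)
        contour   : ∀ k → Conn (addL φL ps) (α (legAt k)) (legAt (nxt k))
        inside    : ∀ d → Q (proj₁ d) → ∃ λ k → Conn (addL φL ps) d (legAt k)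
        ps-bound  : 2 * length ps + 2 * length verts + b ≤ length verts * D + 2

    lookup-inj : {A : Set} {xs : List A} → Unique xs → ∀ {i j : Fin (length xs)} → List.lookup xs i ≡ List.lookup xs j → i ≡ j
    lookup-inj (q ∷ u) {zero} {zero} e = refl
    lookup-inj {xs = x ∷ xs} (q ∷ u) {zero} {suc j} e = ⊥-elim (All.lookup q (∈-lookup′ xs j) e)
      where
      ∈-lookup′ : ∀ {A : Set} (xs : List A) j → List.lookup xs j ∈ xs
      ∈-lookup′ (x ∷ xs) zero = here refl
      ∈-lookup′ (x ∷ xs) (suc j) = there (∈-lookup′ xs j)
    lookup-inj {xs = x ∷ xs} (q ∷ u) {suc i} {zero} e = sym (lookup-inj (q ∷ u) {zero} {suc i} (sym e))
    lookup-inj (q ∷ u) {suc i} {suc j} e = cong suc (lookup-inj u e)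

    -- The legs of a connected region are ordered by the contour κ of a spanning tree of it.
    module Ordered (r₀ : Fin n) (qr₀ : Q r₀) (conn : ∀ v → Q v → Conn LS v r₀) (d₀ : X) (l₀ : Leg d₀)
                   (B : Bfs LS (r₀ ∷ outs)) where
      open Spanned B
      module Oκ = Orbit FX κ κ-inj

      all-κ : ∀ d → Q (proj₁ d) → Conn κL d (r₀ , zero)
      all-κ (v , i) q with contour-root v i q
      ... | r , here refl , _ , c = c
      ... | r , there m , qr , _ = ⊥-elim (proj₂ (∈-filter⁻ (λ v → ¬? (Q? v)) {xs = allFin n} m) qr)

      -- The starting point is left out and the m-th iterate included. Over one period the path from
      -- `d₀` therefore ends with `d₀`: this leg is listed last, and the relation from it to the
      -- first leg closes the cycle.
      path : ℕ → X → List X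
      path zero x = []
      path (suc m) x = κ x ∷ path m (κ x)

      path-∈⁺ : ∀ m j x → 0 < j → j ≤ m → iter κ j x ∈ path m x
      path-∈⁺ (suc m) (suc zero) x _ _ = here refl
      path-∈⁺ (suc m) (suc (suc j)) x _ (s≤s le) = there (subst (_∈ path m (κ x)) (iter-comm κ (suc j) x) (path-∈⁺ m (suc j) (κ x) (s≤s z≤n) le))

      path-∈⁻ : ∀ m x {y} → y ∈ path m x → ∃ λ j → 0 < j × j ≤ m × iter κ j x ≡ y
      path-∈⁻ (suc m) x (here refl) = 1 , s≤s z≤n , s≤s z≤n , refl
      path-∈⁻ (suc m) x (there i) with path-∈⁻ m (κ x) i
      ... | j , l , le , e = suc j , s≤s z≤n , s≤s le , trans (sym (iter-comm κ j x)) e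

      data Seq : X → List X → Set where
        []  : ∀ {ℓ} → Seq ℓ []
        _∷_ : ∀ {ℓ x xs} → R (α ℓ) x → Seq x xs → Seq ℓ (x ∷ xs)

      seq : ∀ m x ℓ → Q (proj₁ x) → R (α ℓ) (κ x) → Seq ℓ (filter leg? (path m x))
      seq zero x ℓ q r = []
      seq (suc m) x ℓ q r with leg? (κ x)
      ... | yes l = r ∷ seq m (κ x) (κ x) (proj₁ (κ-Q x) q) (κ-leg l)
      ... | no nl = seq m (κ x) ℓ (proj₁ (κ-Q x) q) (ctrans r (κ-R (proj₁ (κ-Q x) q) nl))

      seq-step : ∀ {ℓ ls} → Seq ℓ ls → ∀ i (p : i < length ls) (q : suc i < length ls) →
        R (α (List.lookup ls (fromℕ< p))) (List.lookup ls (fromℕ< q))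
      seq-step (r ∷ (r′ ∷ s)) zero (s≤s p) (s≤s (s≤s q)) = r′
      seq-step (r ∷ s) (suc i) (s≤s p) (s≤s q) = seq-step s i p q

      module _ (p : ℕ) (0<p : 0 < p) (per : iter κ p d₀ ≡ d₀) (mn : ∀ j → 0 < j × iter κ j d₀ ≡ d₀ → p ≤ j) where
        ys ls : List X
        ys = path p d₀
        ls = filter leg? ys

        upath : ∀ m j → j + m ≤ p → Unique (path m (iter κ j d₀))
        upath zero j le = []
        upath (suc m) j le = All.tabulate ne ∷ upath m (suc j) (subst (_≤ p) (+-suc j m) le)
          where
          ne : ∀ {y} → y ∈ path m (iter κ (suc j) d₀) → iter κ (suc j) d₀ ≢ y
          ne i e with path-∈⁻ m (iter κ (suc j) d₀) i
          ... | k , l , k≤ , e′ = <⇒≱ (≤-trans (s≤s k≤) (≤-trans (m≤n+m (suc m) j) le)) (mn k (l , eq))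
            where
            eq : iter κ k d₀ ≡ d₀
            eq = iter-inj κ-inj (suc j) (trans (sym (iter-+ κ (suc j) k d₀)) (trans (cong (λ z → iter κ z d₀) (+-comm (suc j) k)) (trans (iter-+ κ k (suc j) d₀) (trans e′ (sym e)))))

        uys : Unique ys
        uys = upath p 0 ≤-refl

        uls : Unique ls
        uls = UP.filter⁺ leg? uys

        all-ys : ∀ d → Q (proj₁ d) → d ∈ ys
        all-ys d q with Oκ.conn-iter (ctrans (all-κ d₀ (proj₁ l₀)) (csym (all-κ d q)))
        ... | k , e = go p 0<p per (λ j l → path-∈⁺ p j d₀ l) k e
          where
          go : ∀ p → 0 < p → iter κ p d₀ ≡ d₀ → (∀ j → 0 < j → j ≤ p → iter κ j d₀ ∈ ys) → ∀ k → iter κ k d₀ ≡ d → d ∈ ys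
          go (suc p) _ per mem k e = fin (k % suc p) (≤-trans (n≤1+n _) (m%n<n k (suc p))) (trans (sym eq) e)
            where
            eq : iter κ k d₀ ≡ iter κ (k % suc p) d₀
            eq = trans (cong (λ z → iter κ z d₀) (m≡m%n+[m/n]*n k (suc p))) (trans (iter-+ κ (k % suc p) (k / suc p * suc p) d₀) (cong (iter κ (k % suc p)) (iter-* κ (suc p) per (k / suc p))))
            fin : ∀ j → j ≤ suc p → iter κ j d₀ ≡ d → d ∈ ys
            fin zero _ e = subst (_∈ ys) (trans per e) (mem (suc p) (s≤s z≤n) ≤-refl)
            fin (suc j) le e = subst (_∈ ys) e (mem (suc j) (s≤s z≤n) le)

        all-ls : ∀ d → Leg d → d ∈ ls
        all-ls d l = ∈-filter⁺ leg? (all-ys d (proj₁ l)) l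

        ls-leg : ∀ {d} → d ∈ ls → Leg d
        ls-leg i = proj₂ (∈-filter⁻ leg? {xs = ys} i)

        ends : ∀ m x → iter κ (suc m) x ≡ d₀ → ∃ λ zs → filter leg? (path (suc m) x) ≡ zs ++ (d₀ ∷ [])
        ends zero x e with leg? (κ x)
        ... | yes l = [] , cong (_∷ []) e
        ... | no nl = ⊥-elim (nl (subst Leg (sym e) l₀))
        ends (suc m) x e with ends m (κ x) (trans (iter-comm κ (suc m) x) e)
        ... | zs , eq with leg? (κ x)
        ... | yes l = κ x ∷ zs , cong (κ x ∷_) eq
        ... | no nl = zs , eq

        ls-end : ∃ λ zs → ls ≡ zs ++ (d₀ ∷ [])
        ls-end = go p 0<p per
          where
          go : ∀ p → 0 < p → iter κ p d₀ ≡ d₀ → ∃ λ zs → filter leg? (path p d₀) ≡ zs ++ (d₀ ∷ [])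
          go (suc p) _ e = ends p d₀ e

        lookup-last : ∀ (zs : List X) (i : Fin (length (zs ++ (d₀ ∷ [])))) → suc (toℕ i) ≡ length (zs ++ (d₀ ∷ [])) → List.lookup (zs ++ (d₀ ∷ [])) i ≡ d₀
        lookup-last [] zero e = refl
        lookup-last (z ∷ zs) zero e with zs
        lookup-last (z ∷ zs) zero () | []
        lookup-last (z ∷ zs) zero () | _ ∷ _
        lookup-last (z ∷ zs) (suc i) e = lookup-last zs i (suc-injective e)

        cyc : ∀ (xs : List X) → Seq d₀ xs → (∃ λ zs → xs ≡ zs ++ (d₀ ∷ [])) → ∀ k → R (α (List.lookup xs k)) (List.lookup xs (nxt k))
        cyc (x ∷ xs) s@(r ∷ _) (zs , eq) k with toℕ-nx k
        ... | inj₁ (lt , e) = subst₂ (λ a c → R (α (List.lookup (x ∷ xs) a)) (List.lookup (x ∷ xs) c))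
              (FP.fromℕ<-toℕ k (FP.toℕ<n k)) (FP.toℕ-injective (trans (FP.toℕ-fromℕ< lt) (sym e))) (seq-step s (toℕ k) (FP.toℕ<n k) lt)
        ... | inj₂ (e , e0) = subst₂ (λ a c → R (α a) (List.lookup (x ∷ xs) c)) (sym (last (x ∷ xs) eq k (cong suc e))) (FP.toℕ-injective (sym e0)) r
          where
          last : ∀ ws → ws ≡ zs ++ (d₀ ∷ []) → (k : Fin (length ws)) → suc (toℕ k) ≡ length ws → List.lookup ws k ≡ d₀
          last _ refl k e = lookup-last zs k e

        walk : ∀ m x → Q (proj₁ x) → iter κ m x ≡ d₀ → ∃ λ ℓ → Leg ℓ × R x ℓ
        walk zero x q refl = x , l₀ , nil
        walk (suc m) x q e with leg? x
        ... | yes l = x , l , nil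
        ... | no nl with walk m (κ x) (proj₁ (κ-Q x) q) (trans (iter-comm κ m x) e)
        ... | ℓ , l , r = ℓ , l , ctrans (κ-R q nl) r

        find : ∀ d → Leg d → ∃ λ k → List.lookup ls k ≡ d
        find d l = Any.index (all-ls d l) , sym (look (all-ls d l))
          where
          look : ∀ {xs} (i : d ∈ xs) → d ≡ List.lookup xs (Any.index i)
          look (here e) = e
          look (there i) = look i

        look-leg : ∀ (xs : List X) → (∀ {d} → d ∈ xs → Leg d) → ∀ k → Leg (List.lookup xs k)
        look-leg (x ∷ xs) h zero = h (here refl)
        look-leg (x ∷ xs) h (suc k) = look-leg xs (h ∘ there) k

        legs : Legs
        legs = record
          { b = length ls ; legAt = List.lookup ls ; legL = look-leg ls ls-leg
          ; legAt-inj = lookup-inj uls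
          ; legAll = find
          ; ps = ps
          ; contour = cyc ls (seq p d₀ d₀ (proj₁ l₀) (κ-leg l₀)) ls-end
          ; inside = λ d q → let (k , e) = Oκ.conn-iter (ctrans (all-κ d q) (csym (all-κ d₀ (proj₁ l₀)))) ; (ℓ , l , r) = walk k d q e ; (j , e′) = find ℓ l in j , subst (R d) (sym e′) r
          ; ps-bound = bound }
          where
          open ≤-Reasoning
          o v : ℕ
          o = length outs
          v = length verts
          ar : ∀ a o v b → 2 * a + 2 * v + b + 2 * o ≡ (2 * a + 2 * (o + v)) + b
          ar = solve-∀
          ar₂ : ∀ q b o → q + 2 * suc o + b ≡ (q + b) + 2 + 2 * o
          ar₂ = solve-∀
          bound : 2 * length ps + 2 * v + length ls ≤ v * D + 2
          -- Vertices outside the region are roots of trees of their own and cancel. With one root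
          -- left for the region, the pairs number at most E′ - V′ + 1, where E′ counts the inner
          -- edges and 2 E′ + b is at most V′ D.
          bound = +-cancelʳ-≤ (2 * o) _ _ (begin
            2 * length ps + 2 * v + length ls + 2 * o ≡⟨ ar (length ps) o v (length ls) ⟩
            (2 * length ps + 2 * (o + v)) + length ls ≡⟨ cong (λ z → 2 * length ps + 2 * z + length ls) split-n ⟩
            (2 * length ps + 2 * n) + length ls ≤⟨ +-monoˡ-≤ (length ls) ps-count ⟩
            length qs + 2 * suc o + length ls ≡⟨ ar₂ (length qs) (length ls) o ⟩
            (length qs + length ls) + 2 + 2 * o ≤⟨ +-monoˡ-≤ (2 * o) (+-monoˡ-≤ 2 (qs-count uls ls-leg)) ⟩
            v * D + 2 + 2 * o ∎)

    orderLegs : ∀ r₀ → Q r₀ → (∀ v → Q v → Conn LS v r₀) → (∃ λ d → Leg d) → NN (Legs)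
    orderLegs r₀ q conn (d₀ , l₀) = do
      B ← bfs FV LS-sym (r₀ ∷ outs) cov
      let open Ordered r₀ q conn d₀ l₀ B
          (p , 0<p , _ , e) = Oκ.period d₀
      (m , (0<m , e′) , mn) ← nn-min {λ k → 0 < k × iter (Spanned.κ B) k d₀ ≡ d₀} p p ≤-refl (0<p , e)
      return (legs m 0<m e′ mn)
      where
      cov : Cover (Conn LS) (r₀ ∷ outs)
      cov v with Q? v
      ... | yes qv = r₀ , here refl , conn v qv
      ... | no nq = v , there (∈-filter⁺ (λ v → ¬? (Q? v)) (∈-allFin v) nq) , nil

    record Closed (cs : List (Fin n)) : Set where
      field
        ps       : List (X × X)
        inside   : ∀ d → Q (proj₁ d) → ∃ λ s → s ∈ rootDarts (filter Q? cs) × Conn (addL φL ps) d s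
        ps-bound : 2 * length ps + 2 * length verts ≤ length verts * D + 2 * length (filter Q? cs)

    closedRegion : (cs : List (Fin n)) → Cover (Conn AdjL) cs → (∀ d → ¬ Leg d) → NN (Closed cs)
    closedRegion cs cov nl = do
      B ← bfs FV LS-sym (filter Q? cs ++ outs) cov′
      return (main B)
      where
      next : ∀ {u v} → Q u → AdjL u v → Q v
      next {u} q (i , refl) = decidable-stable (Q? _) (λ nq → nl (u , i) (q , nq))
      inS : ∀ {u v} → Q u → Conn AdjL u v → Conn LS u v × Q v
      inS q nil = nil , q
      inS q (fwd l c) = let (c′ , q′) = inS (next q l) c in fwd (l , q , next q l) c′ , q′
      inS q (bwd l c) = let (c′ , q′) = inS (next q (adj-sym l)) c in bwd (l , next q (adj-sym l) , q) c′ , q′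
      cov′ : Cover (Conn LS) (filter Q? cs ++ outs)
      cov′ v with Q? v
      ... | no nq = v , ∈-++⁺ʳ (filter Q? cs) (∈-filter⁺ (λ v → ¬? (Q? v)) (∈-allFin v) nq) , nil
      ... | yes qv with cov v
      ... | c , c∈ , p = c , ∈-++⁺ˡ (∈-filter⁺ Q? c∈ (proj₂ (inS qv p))) , proj₁ (inS qv p)
      main : Bfs LS (filter Q? cs ++ outs) → Closed cs
      main B = record { ps = ps ; inside = ins ; ps-bound = bound }
        where
        open Spanned B
        ins : ∀ d → Q (proj₁ d) → ∃ λ s → s ∈ rootDarts (filter Q? cs) × R d s
        ins (v , i) q with contour-root v i q
        ... | r , r∈ , qr , c with ∈-++⁻ (filter Q? cs) r∈
        ... | inj₁ m = (r , zero) , ∈-map⁺ _ m , closed-R nl q c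
        ... | inj₂ m = ⊥-elim (proj₂ (∈-filter⁻ (λ v → ¬? (Q? v)) {xs = allFin n} m) qr)
        open ≤-Reasoning
        o v c : ℕ
        o = length outs
        v = length verts
        c = length (filter Q? cs)
        ar : ∀ a o v → 2 * a + 2 * v + 2 * o ≡ 2 * a + 2 * (o + v)
        ar = solve-∀
        ar₂ : ∀ q c o → q + 2 * (c + o) ≡ q + 0 + 2 * c + 2 * o
        ar₂ = solve-∀
        bound : 2 * length ps + 2 * v ≤ v * D + 2 * c
        bound = +-cancelʳ-≤ (2 * o) _ _ (begin
          2 * length ps + 2 * v + 2 * o ≡⟨ ar (length ps) o v ⟩
          2 * length ps + 2 * (o + v) ≡⟨ cong (λ z → 2 * length ps + 2 * z) split-n ⟩
          2 * length ps + 2 * n ≤⟨ ps-count ⟩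
          length qs + 2 * length (filter Q? cs ++ outs) ≡⟨ cong (λ z → length qs + 2 * z) (length-++ (filter Q? cs)) ⟩
          length qs + 2 * (c + o) ≡⟨ ar₂ (length qs) c o ⟩
          length qs + 0 + 2 * c + 2 * o ≤⟨ +-monoˡ-≤ (2 * o) (+-monoˡ-≤ (2 * c) (qs-count [] λ ())) ⟩
          v * D + 2 * c + 2 * o ∎)


  -- Chains: composition, closing to rings, building blocks

  data Port (b : ℕ) : Set where
    lft rgt : Port b
    pin     : Fin b → Port b

  data Side (f : ℕ) : Set where
    up  : ℕ → Side f
    low : Side f
    fc  : Fin f → Side f

  -- A piece with two poles and b legs on its upper side.  The label up k marks the stretch of
  -- the upper side leading to leg k (to the right pole for k = b), low the lower side.
  record Chain (D′ : ℕ) (A : Set) (b f : ℕ) : Set where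
    field
      β        : A × Fin (suc D′) → (A × Fin (suc D′)) ⊎ Port b
      pd       : Port b → A × Fin (suc D′)
      pd-β     : ∀ q → β (pd q) ≡ inj₂ q
      β-pd     : ∀ {d q} → β d ≡ inj₂ q → d ≡ pd q
      β-sym    : ∀ {d e} → β d ≡ inj₁ e → β e ≡ inj₁ d
      noloop   : ∀ {d e} → β d ≡ inj₁ e → proj₁ d ≢ proj₁ e
      simple   : ∀ {d e d′ e′} → β d ≡ inj₁ e → β d′ ≡ inj₁ e′ → proj₁ d ≡ proj₁ d′ → proj₁ e ≡ proj₁ e′ → d ≡ d′
      pin-inj  : ∀ {k k′} → proj₁ (pd (pin k)) ≡ proj₁ (pd (pin k′)) → k ≡ k′
      lab      : A × Fin (suc D′) → Side f
      lab-lft  : lab (pd lft) ≡ low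
      lab-rgt  : lab (pd rgt) ≡ up b
      lab-pin  : ∀ k → lab (pd (pin k)) ≡ up (toℕ k)
      nxt-lft  : lab (σₐ (pd lft)) ≡ up 0
      nxt-rgt  : lab (σₐ (pd rgt)) ≡ low
      nxt-pin  : ∀ k → lab (σₐ (pd (pin k))) ≡ up (suc (toℕ k))
      lab-β    : ∀ {d e} → β d ≡ inj₁ e → lab (σₐ e) ≡ lab d
      lab-surj : ∀ c → ∃ λ d → lab d ≡ fc c
    Link : A → A → Set
    Link x y = ∃ λ i → ∃ λ j → β (x , i) ≡ inj₁ (y , j)
    field
      conn     : ∀ x y → Conn Link x y
    -- The poles are to be joined by an edge when a chain is closed, and the poles of the rest
    -- become the outer ends v₁, v₂ of the two edges that leave an appearance. Either use requires
    -- them distinct and non-adjacent.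
    Far : Set
    Far = proj₁ (pd lft) ≢ proj₁ (pd rgt) × ¬ Link (proj₁ (pd lft)) (proj₁ (pd rgt))

  module Compose {D′ : ℕ} {A₁ A₂ : Set} {b₁ b₂ f₁ f₂ : ℕ} (c₁ : Chain D′ A₁ b₁ f₁) (c₂ : Chain D′ A₂ b₂ f₂) where
    private
      module C₁ = Chain c₁
      module C₂ = Chain c₂
      A : Set
      A = A₁ ⊎ A₂
      DD : Set → Set
      DD B = B × Fin (suc D′)

    i₁ : DD A₁ → DD A
    i₁ (a , i) = inj₁ a , i

    i₂ : DD A₂ → DD A
    i₂ (a , i) = inj₂ a , i

    private
      g₁ : DD A₁ ⊎ Port b₁ → DD A ⊎ Port (b₁ + b₂)
      g₁ (inj₁ y) = inj₁ (i₁ y)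
      g₁ (inj₂ lft) = inj₂ lft
      g₁ (inj₂ rgt) = inj₁ (i₂ (C₂.pd lft))
      g₁ (inj₂ (pin k)) = inj₂ (pin (k ↑ˡ b₂))

      g₂ : DD A₂ ⊎ Port b₂ → DD A ⊎ Port (b₁ + b₂)
      g₂ (inj₁ y) = inj₁ (i₂ y)
      g₂ (inj₂ rgt) = inj₂ rgt
      g₂ (inj₂ lft) = inj₁ (i₁ (C₁.pd rgt))
      g₂ (inj₂ (pin k)) = inj₂ (pin (b₁ ↑ʳ k))

      β : DD A → DD A ⊎ Port (b₁ + b₂)
      β (inj₁ a , i) = g₁ (C₁.β (a , i))
      β (inj₂ a , i) = g₂ (C₂.β (a , i))

      pinOf : Fin b₁ ⊎ Fin b₂ → DD A
      pinOf (inj₁ k) = i₁ (C₁.pd (pin k))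
      pinOf (inj₂ k) = i₂ (C₂.pd (pin k))

      pd : Port (b₁ + b₂) → DD A
      pd lft = i₁ (C₁.pd lft)
      pd rgt = i₂ (C₂.pd rgt)
      pd (pin k) = pinOf (splitAt b₁ k)

      s₁ : Side f₁ → Side (f₁ + f₂)
      s₁ (up k) = up k
      s₁ low = low
      s₁ (fc c) = fc (c ↑ˡ f₂)

      s₂ : Side f₂ → Side (f₁ + f₂)
      s₂ (up k) = up (b₁ + k)
      s₂ low = low
      s₂ (fc c) = fc (f₁ ↑ʳ c)

      lab : DD A → Side (f₁ + f₂)
      lab (inj₁ a , i) = s₁ (C₁.lab (a , i))
      lab (inj₂ a , i) = s₂ (C₂.lab (a , i))

      pd-β : ∀ q → β (pd q) ≡ inj₂ q
      pd-β lft = cong g₁ (C₁.pd-β lft)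
      pd-β rgt = cong g₂ (C₂.pd-β rgt)
      pd-β (pin k) with splitAt b₁ k in eq
      ... | inj₁ k₁ = trans (cong g₁ (C₁.pd-β (pin k₁))) (cong (inj₂ ∘ pin) (FP.splitAt⁻¹-↑ˡ eq))
      ... | inj₂ k₂ = trans (cong g₂ (C₂.pd-β (pin k₂))) (cong (inj₂ ∘ pin) (FP.splitAt⁻¹-↑ʳ eq))

      β-pd : ∀ {d q} → β d ≡ inj₂ q → d ≡ pd q
      β-pd {inj₁ a , i} e with C₁.β (a , i) in eq
      β-pd {inj₁ a , i} refl | inj₂ lft = cong i₁ (C₁.β-pd eq)
      β-pd {inj₁ a , i} refl | inj₂ (pin k) = trans (cong i₁ (C₁.β-pd eq)) (cong pinOf (sym (FP.splitAt-↑ˡ b₁ k b₂)))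
      β-pd {inj₂ a , i} e with C₂.β (a , i) in eq
      β-pd {inj₂ a , i} refl | inj₂ rgt = cong i₂ (C₂.β-pd eq)
      β-pd {inj₂ a , i} refl | inj₂ (pin k) = trans (cong i₂ (C₂.β-pd eq)) (cong pinOf (sym (FP.splitAt-↑ʳ b₁ b₂ k)))

      data Lk : DD A → DD A → Set where
        l₁ : ∀ {x y} → C₁.β x ≡ inj₁ y → Lk (i₁ x) (i₁ y)
        l₂ : ∀ {x y} → C₂.β x ≡ inj₁ y → Lk (i₂ x) (i₂ y)
        j₁ : Lk (i₁ (C₁.pd rgt)) (i₂ (C₂.pd lft))
        j₂ : Lk (i₂ (C₂.pd lft)) (i₁ (C₁.pd rgt))

      lk : ∀ {d e} → β d ≡ inj₁ e → Lk d e
      lk {inj₁ a , i} e with C₁.β (a , i) in eq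
      lk {inj₁ a , i} refl | inj₁ y = l₁ eq
      lk {inj₁ a , i} refl | inj₂ rgt = subst (λ z → Lk (i₁ z) (i₂ (C₂.pd lft))) (sym (C₁.β-pd eq)) j₁
      lk {inj₂ a , i} e with C₂.β (a , i) in eq
      lk {inj₂ a , i} refl | inj₁ y = l₂ eq
      lk {inj₂ a , i} refl | inj₂ lft = subst (λ z → Lk (i₂ z) (i₁ (C₁.pd rgt))) (sym (C₂.β-pd eq)) j₂

      kl : ∀ {d e} → Lk d e → β d ≡ inj₁ e
      kl (l₁ eq) = cong g₁ eq
      kl (l₂ eq) = cong g₂ eq
      kl j₁ = cong g₁ (C₁.pd-β rgt)
      kl j₂ = cong g₂ (C₂.pd-β lft)

      lk-sym : ∀ {d e} → Lk d e → Lk e d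
      lk-sym (l₁ eq) = l₁ (C₁.β-sym eq)
      lk-sym (l₂ eq) = l₂ (C₂.β-sym eq)
      lk-sym j₁ = j₂
      lk-sym j₂ = j₁

      inj₁-inj : ∀ {x y : A₁} → inj₁ {B = A₂} x ≡ inj₁ y → x ≡ y
      inj₁-inj refl = refl
      inj₂-inj : ∀ {x y : A₂} → inj₂ {A = A₁} x ≡ inj₂ y → x ≡ y
      inj₂-inj refl = refl

      lk-noloop : ∀ {d e} → Lk d e → proj₁ d ≢ proj₁ e
      lk-noloop (l₁ eq) h = C₁.noloop eq (inj₁-inj h)
      lk-noloop (l₂ eq) h = C₂.noloop eq (inj₂-inj h)
      lk-noloop j₁ ()
      lk-noloop j₂ ()

      lk-simple : ∀ {d e d′ e′} → Lk d e → Lk d′ e′ → proj₁ d ≡ proj₁ d′ → proj₁ e ≡ proj₁ e′ → d ≡ d′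
      lk-simple (l₁ p) (l₁ q) h h′ = cong i₁ (C₁.simple p q (inj₁-inj h) (inj₁-inj h′))
      lk-simple (l₂ p) (l₂ q) h h′ = cong i₂ (C₂.simple p q (inj₂-inj h) (inj₂-inj h′))
      lk-simple j₁ j₁ _ _ = refl
      lk-simple j₂ j₂ _ _ = refl
      lk-simple (l₁ p) j₁ h ()
      lk-simple (l₂ p) j₂ h ()
      lk-simple j₁ (l₁ q) h ()
      lk-simple j₂ (l₂ q) h ()

      lab-lk : ∀ {d e} → Lk d e → lab (σₐ e) ≡ lab d
      lab-lk (l₁ eq) = cong s₁ (C₁.lab-β eq)
      lab-lk (l₂ eq) = cong s₂ (C₂.lab-β eq)
      -- The stretch of the left upper side after its last leg continues into the first stretch of
      -- the right one, since stretches on the right are shifted by `b₁`.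
      lab-lk j₁ = trans (cong s₂ C₂.nxt-lft) (trans (cong up (+-identityʳ b₁)) (sym (cong s₁ C₁.lab-rgt)))
      lab-lk j₂ = trans (cong s₁ C₁.nxt-rgt) (sym (cong s₂ C₂.lab-lft))

      pin-inj : ∀ {k k′} → proj₁ (pd (pin k)) ≡ proj₁ (pd (pin k′)) → k ≡ k′
      pin-inj {k} {k′} h with splitAt b₁ k in eq | splitAt b₁ k′ in eq′
      ... | inj₁ x | inj₁ y = trans (sym (FP.splitAt⁻¹-↑ˡ eq)) (trans (cong (_↑ˡ b₂) (C₁.pin-inj (inj₁-inj h))) (FP.splitAt⁻¹-↑ˡ eq′))
      ... | inj₂ x | inj₂ y = trans (sym (FP.splitAt⁻¹-↑ʳ eq)) (trans (cong (b₁ ↑ʳ_) (C₂.pin-inj (inj₂-inj h))) (FP.splitAt⁻¹-↑ʳ eq′))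
      pin-inj () | inj₁ x | inj₂ y
      pin-inj () | inj₂ x | inj₁ y

      lab-pin : ∀ k → lab (pd (pin k)) ≡ up (toℕ k)
      lab-pin k with splitAt b₁ k in eq
      ... | inj₁ x = trans (cong s₁ (C₁.lab-pin x)) (cong up (trans (sym (FP.toℕ-↑ˡ x b₂)) (cong toℕ (FP.splitAt⁻¹-↑ˡ eq))))
      ... | inj₂ x = trans (cong s₂ (C₂.lab-pin x)) (cong up (trans (sym (FP.toℕ-↑ʳ b₁ x)) (cong toℕ (FP.splitAt⁻¹-↑ʳ eq))))

      nxt-pin : ∀ k → lab (σₐ (pd (pin k))) ≡ up (suc (toℕ k))
      nxt-pin k with splitAt b₁ k in eq
      ... | inj₁ x = trans (cong s₁ (C₁.nxt-pin x)) (cong (up ∘ suc) (trans (sym (FP.toℕ-↑ˡ x b₂)) (cong toℕ (FP.splitAt⁻¹-↑ˡ eq))))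
      ... | inj₂ x = trans (cong s₂ (C₂.nxt-pin x)) (cong up (trans (+-suc b₁ (toℕ x)) (cong suc (trans (sym (FP.toℕ-↑ʳ b₁ x)) (cong toℕ (FP.splitAt⁻¹-↑ʳ eq))))))

      lab-surj : ∀ c → ∃ λ d → lab d ≡ fc c
      lab-surj c with splitAt f₁ c in eq
      ... | inj₁ x = let (d , h) = C₁.lab-surj x in i₁ d , trans (cong s₁ h) (cong fc (FP.splitAt⁻¹-↑ˡ eq))
      ... | inj₂ x = let (d , h) = C₂.lab-surj x in i₂ d , trans (cong s₂ h) (cong fc (FP.splitAt⁻¹-↑ʳ eq))

      LL : A → A → Set
      LL x y = ∃ λ i → ∃ λ j → β (x , i) ≡ inj₁ (y , j)

      in₁ : ∀ x y → Conn LL (inj₁ x) (inj₁ y)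
      in₁ x y = cgmap inj₁ (λ { (i , j , eq) → clink (i , j , cong g₁ eq) }) (C₁.conn x y)

      in₂ : ∀ x y → Conn LL (inj₂ x) (inj₂ y)
      in₂ x y = cgmap inj₂ (λ { (i , j , eq) → clink (i , j , cong g₂ eq) }) (C₂.conn x y)

      mid : Conn LL (inj₁ (proj₁ (C₁.pd rgt))) (inj₂ (proj₁ (C₂.pd lft)))
      mid = clink (proj₂ (C₁.pd rgt) , proj₂ (C₂.pd lft) , kl j₁)

      conn : ∀ x y → Conn LL x y
      conn (inj₁ x) (inj₁ y) = in₁ x y
      conn (inj₂ x) (inj₂ y) = in₂ x y
      conn (inj₁ x) (inj₂ y) = ctrans (in₁ x _) (ctrans mid (in₂ _ y))
      conn (inj₂ x) (inj₁ y) = csym (ctrans (in₁ y _) (ctrans mid (in₂ _ x)))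

    composite : Chain D′ (A₁ ⊎ A₂) (b₁ + b₂) (f₁ + f₂)
    composite = record
      { β = β ; pd = pd ; pd-β = pd-β ; β-pd = β-pd
      ; β-sym = λ e → kl (lk-sym (lk e)) ; noloop = λ e → lk-noloop (lk e) ; simple = λ e e′ → lk-simple (lk e) (lk e′)
      ; pin-inj = λ {k} {k′} → pin-inj {k} {k′} ; lab = lab
      ; lab-lft = cong s₁ C₁.lab-lft ; lab-rgt = cong s₂ C₂.lab-rgt ; lab-pin = lab-pin
      ; nxt-lft = cong s₁ C₁.nxt-lft ; nxt-rgt = cong s₂ C₂.nxt-rgt ; nxt-pin = nxt-pin
      ; lab-β = λ {d} {e} h → lab-lk {d} {e} (lk h) ; lab-surj = lab-surj ; conn = conn }

    -- The poles of a composite lie in different factors, between which the joint is the only edge.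
    -- The joint ends at the right pole of `c₁`, which is not the left pole.
    far : proj₁ (C₁.pd lft) ≢ proj₁ (C₁.pd rgt) → Chain.Far composite
    far ne = (λ ()) , λ { (i , j , eq) → absurd (lk eq) refl refl }
      where
      absurd : ∀ {d e} → Lk d e → proj₁ d ≡ inj₁ (proj₁ (C₁.pd lft)) → proj₁ e ≡ inj₂ (proj₁ (C₂.pd rgt)) → ⊥
      absurd j₁ h h′ = ne (inj₁-inj (sym h))
      absurd (l₁ _) _ ()
      absurd (l₂ _) ()
      absurd j₂ ()

    link₁ : ∀ {x y} → C₁.Link x y → Chain.Link composite (inj₁ x) (inj₁ y)
    link₁ (i , j , eq) = i , j , cong g₁ eq

    link₁⁻ : ∀ {x y} → Chain.Link composite (inj₁ x) (inj₁ y) → C₁.Link x y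
    link₁⁻ (i , j , eq) = go (lk eq) refl refl
      where
      go : ∀ {d e x y} → Lk d e → proj₁ d ≡ inj₁ x → proj₁ e ≡ inj₁ y → C₁.Link x y
      go (l₁ eq) refl refl = _ , _ , eq

    link₁₂⁻ : ∀ {x y} → Chain.Link composite (inj₁ x) (inj₂ y) → x ≡ proj₁ (C₁.pd rgt) × y ≡ proj₁ (C₂.pd lft)
    link₁₂⁻ (i , j , eq) = go (lk eq) refl refl
      where
      go : ∀ {d e x y} → Lk d e → proj₁ d ≡ inj₁ x → proj₁ e ≡ inj₂ y → x ≡ proj₁ (C₁.pd rgt) × y ≡ proj₁ (C₂.pd lft)
      go j₁ refl refl = refl , refl

    link₁₂ : Chain.Link composite (inj₁ (proj₁ (C₁.pd rgt))) (inj₂ (proj₁ (C₂.pd lft)))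
    link₁₂ = proj₂ (C₁.pd rgt) , proj₂ (C₂.pd lft) , kl j₁

    link₂⁻ : ∀ {x y} → Chain.Link composite (inj₂ x) (inj₂ y) → C₂.Link x y
    link₂⁻ (i , j , eq) = go (lk eq) refl refl
      where
      go : ∀ {d e x y} → Lk d e → proj₁ d ≡ inj₂ x → proj₁ e ≡ inj₂ y → C₂.Link x y
      go (l₂ eq) refl refl = _ , _ , eq

  -- Joining the two poles of a chain; its lower side becomes a closed face, and so does its
  -- upper side when there are no legs.
  module Close {D′ : ℕ} {A : Set} {b f f′ : ℕ} (c : Chain D′ A b f) (far : Chain.Far c)
    (U : ℕ → Fin b ⊎ Fin f′) (lo : Fin f′) (emb : Fin f → Fin f′)
    (U-b : U b ≡ U 0) (U-k : ∀ k → U (toℕ k) ≡ inj₁ k) (U-n : ∀ k → U (suc (toℕ k)) ≡ inj₁ (nxt k))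
    (onto : ∀ x → x ≡ lo ⊎ ((∃ λ c → emb c ≡ x) ⊎ U 0 ≡ inj₂ x)) where
    private
      module C = Chain c
      DD : Set
      DD = A × Fin (suc D′)

      g : DD ⊎ Port b → DD ⊎ Fin b
      g (inj₁ y) = inj₁ y
      g (inj₂ lft) = inj₁ (C.pd rgt)
      g (inj₂ rgt) = inj₁ (C.pd lft)
      g (inj₂ (pin k)) = inj₂ k

      β : DD → DD ⊎ Fin b
      β d = g (C.β d)

      s : Side f → Fin b ⊎ Fin f′
      s (up k) = U k
      s low = inj₂ lo
      s (fc x) = inj₂ (emb x)

      data Lk : DD → DD → Set where
        l  : ∀ {x y} → C.β x ≡ inj₁ y → Lk x y
        lr : Lk (C.pd lft) (C.pd rgt)
        rl : Lk (C.pd rgt) (C.pd lft)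

      lk : ∀ {d e} → β d ≡ inj₁ e → Lk d e
      lk {d} e with C.β d in eq
      lk refl | inj₁ y = l eq
      lk refl | inj₂ lft = subst (λ z → Lk z _) (sym (C.β-pd eq)) lr
      lk refl | inj₂ rgt = subst (λ z → Lk z _) (sym (C.β-pd eq)) rl

      kl : ∀ {d e} → Lk d e → β d ≡ inj₁ e
      kl (l eq) = cong g eq
      kl lr = cong g (C.pd-β lft)
      kl rl = cong g (C.pd-β rgt)

      lk-sym : ∀ {d e} → Lk d e → Lk e d
      lk-sym (l eq) = l (C.β-sym eq)
      lk-sym lr = rl
      lk-sym rl = lr

      lk-noloop : ∀ {d e} → Lk d e → proj₁ d ≢ proj₁ e
      lk-noloop (l eq) = C.noloop eq
      lk-noloop lr = proj₁ far
      lk-noloop rl = proj₁ far ∘ sym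

      nolr : ∀ {d e} → C.β d ≡ inj₁ e → proj₁ d ≡ proj₁ (C.pd lft) → proj₁ e ≡ proj₁ (C.pd rgt) → ⊥
      nolr {a , i} {a′ , j} eq refl refl = proj₂ far (i , j , eq)

      lk-simple : ∀ {d e d′ e′} → Lk d e → Lk d′ e′ → proj₁ d ≡ proj₁ d′ → proj₁ e ≡ proj₁ e′ → d ≡ d′
      lk-simple (l p) (l q) h h′ = C.simple p q h h′
      lk-simple lr lr _ _ = refl
      lk-simple rl rl _ _ = refl
      lk-simple (l p) lr h h′ = ⊥-elim (nolr p h h′)
      lk-simple (l p) rl h h′ = ⊥-elim (nolr (C.β-sym p) h′ h)
      lk-simple lr (l q) h h′ = ⊥-elim (nolr q (sym h) (sym h′))
      lk-simple rl (l q) h h′ = ⊥-elim (nolr (C.β-sym q) (sym h′) (sym h))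
      lk-simple lr rl h _ = ⊥-elim (proj₁ far h)
      lk-simple rl lr h _ = ⊥-elim (proj₁ far (sym h))

      lab-lk : ∀ {d e} → Lk d e → s (C.lab (σₐ e)) ≡ s (C.lab d)
      lab-lk (l eq) = cong s (C.lab-β eq)
      lab-lk lr = cong s (trans C.nxt-rgt (sym C.lab-lft))
      lab-lk rl = trans (cong s C.nxt-lft) (trans (sym U-b) (sym (cong s C.lab-rgt)))

      leg-β : ∀ {d k} → β d ≡ inj₂ k → d ≡ C.pd (pin k)
      leg-β {d} e with C.β d in eq
      leg-β refl | inj₂ (pin k) = C.β-pd eq

      surj : ∀ x → ∃ λ d → s (C.lab d) ≡ inj₂ x
      surj x with onto x
      ... | inj₁ refl = C.pd lft , cong s C.lab-lft
      ... | inj₂ (inj₁ (c , refl)) = let (d , h) = C.lab-surj c in d , cong s h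
      ... | inj₂ (inj₂ e) = σₐ (C.pd lft) , trans (cong s C.nxt-lft) e

    patch : Patch D′ A b f′
    patch = record
      { β = β ; leg = C.pd ∘ pin ; β-leg = λ k → cong g (C.pd-β (pin k)) ; leg-β = leg-β
      ; β-sym = λ e → kl (lk-sym (lk e)) ; noloop = λ e → lk-noloop (lk e) ; simple = λ e e′ → lk-simple (lk e) (lk e′)
      ; leg-inj = C.pin-inj ; lab = s ∘ C.lab
      ; lab-leg = λ k → trans (cong s (C.lab-pin k)) (U-k k) ; lab-next = λ k → trans (cong s (C.nxt-pin k)) (U-n k)
      ; lab-β = λ {d} {e} h → lab-lk {d} {e} (lk h) ; lab-surj = surj
      ; conn = λ x y → cmap (λ { (i , j , eq) → clink (i , j , cong g eq) }) (C.conn x y) }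

    link⁺ : ∀ {x y} → C.Link x y → Patch.Link patch x y
    link⁺ (i , j , eq) = i , j , cong g eq

    link⁻ : ∀ {x y} → Patch.Link patch x y → C.Link x y ⊎
      ((x ≡ proj₁ (C.pd lft) × y ≡ proj₁ (C.pd rgt)) ⊎ (x ≡ proj₁ (C.pd rgt) × y ≡ proj₁ (C.pd lft)))
    link⁻ (i , j , eq) = go (lk eq)
      where
      go : ∀ {d e} → Lk d e → C.Link (proj₁ d) (proj₁ e) ⊎ ((proj₁ d ≡ proj₁ (C.pd lft) × proj₁ e ≡ proj₁ (C.pd rgt)) ⊎ (proj₁ d ≡ proj₁ (C.pd rgt) × proj₁ e ≡ proj₁ (C.pd lft)))
      go (l eq) = inj₁ (_ , _ , eq)
      go lr = inj₂ (inj₁ (refl , refl))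
      go rl = inj₂ (inj₂ (refl , refl))

    link-lr : Patch.Link patch (proj₁ (C.pd lft)) (proj₁ (C.pd rgt))
    link-lr = proj₂ (C.pd lft) , proj₂ (C.pd rgt) , kl lr

  -- In a ring the stretch after the last leg runs on into the stretch before leg 0.
  segment : ∀ b → ℕ → Fin (suc b)
  segment b j with j <? suc b
  ... | yes p = fromℕ< p
  ... | no _ = zero

  closedFaces : ℕ → ℕ → ℕ
  closedFaces zero f = suc (suc f)
  closedFaces (suc _) f = suc f

  module CloseAny {D′ : ℕ} {A : Set} {f : ℕ} where
    U : ∀ b f → ℕ → Fin b ⊎ Fin (closedFaces b f)
    U zero f _ = inj₂ zero
    U (suc b) f j = inj₁ (segment b j)

    lo : ∀ b f → Fin (closedFaces b f)
    lo zero f = suc zero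
    lo (suc b) f = zero

    emb : ∀ b f → Fin f → Fin (closedFaces b f)
    emb zero f c = suc (suc c)
    emb (suc b) f c = suc c

    U-b : ∀ b f → U b f b ≡ U b f 0
    U-b zero f = refl
    U-b (suc b) f with suc b <? suc b
    ... | yes p = ⊥-elim (<-irrefl refl p)
    ... | no _ = refl

    U-k : ∀ b f k → U b f (toℕ k) ≡ inj₁ k
    U-k (suc b) f k with toℕ k <? suc b
    ... | yes p = cong inj₁ (FP.fromℕ<-toℕ k p)
    ... | no np = ⊥-elim (np (FP.toℕ<n k))

    U-n : ∀ b f k → U b f (suc (toℕ k)) ≡ inj₁ (nxt k)
    U-n (suc b) f k with suc (toℕ k) <? suc b
    ... | yes p = refl
    ... | no np = refl

    onto : ∀ b f x → x ≡ lo b f ⊎ ((∃ λ c → emb b f c ≡ x) ⊎ U b f 0 ≡ inj₂ x)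
    onto zero f zero = inj₂ (inj₂ refl)
    onto zero f (suc zero) = inj₁ refl
    onto zero f (suc (suc c)) = inj₂ (inj₁ (c , refl))
    onto (suc b) f zero = inj₁ refl
    onto (suc b) f (suc c) = inj₂ (inj₁ (c , refl))

  module Closed′ {D′ : ℕ} {A : Set} {b f : ℕ} (c : Chain D′ A b f) (far : Chain.Far c) where
    open CloseAny {D′} {A} {f}
    open Close c far (U b f) (lo b f) (emb b f) (U-b b f) (U-k b f) (U-n b f) (onto b f) public

  -- A planar map with the non-bridge edge {d₀ , α d₀} removed, as a chain without legs.
  module Bead {h D′ : ℕ} (M : RMap h D′)
    (fs : List (RMap.X M)) (find : Indep (Conn (RMap.φL M)) fs) (fcov : Cover (Conn (RMap.φL M)) fs)
    (gen : h * suc D′ + 4 ≤ 2 * h + 2 * length fs) (d₀ : RMap.X M)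
    (conn : ∀ u v → Conn (λ u v → ∃ λ i → RMap.hd M (u , i) ≡ v × (u , i) ≢ d₀ × (u , i) ≢ RMap.α M d₀) u v) where

    open RMap M hiding (noloop; simple)

    L′ : Fin h → Fin h → Set
    L′ u v = ∃ λ i → hd (u , i) ≡ v × (u , i) ≢ d₀ × (u , i) ≢ α d₀

    L′-sym : ∀ {u v} → L′ u v → L′ v u
    L′-sym {u} (i , refl , n₁ , n₂) = proj₂ (α (u , i)) , cong proj₁ (inv (u , i)) ,
      (λ e → n₂ (trans (sym (inv (u , i))) (cong α e))) , (λ e → n₁ (α-inj e))

    L′⊆ : ∀ {u v} → L′ u v → AdjL u v
    L′⊆ (i , e , _) = i , e

    module Cotree (B : Bfs L′ (proj₁ d₀ ∷ [])) where
      abstract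
        F : Forest
        F = forestOf L′⊆ B

        avoid : ∀ {d} → Forest.Up F d → d ≢ d₀ × d ≢ α d₀
        avoid {v , i} (l , refl) with OfBfs.up-L L′⊆ B l
        ... | j , e , n₁ , n₂ with RMap.simple M e
        ... | refl = n₁ , n₂

        root : ∀ {v} → Forest.lev F v ≡ 0 → v ≡ proj₁ d₀
        root e with Bfs.root B e
        ... | here refl = refl

      open Forest F using (Tr; idents)

      abstract
        ips : List (X × X)
        ips = Forest.idPairs F allX

        ips-∈ : ∀ d → ¬ Tr d → (d , α d) ∈ ips ⊎ (α d , d) ∈ ips
        ips-∈ d = Forest.idPairs-∈ F {qs = allX} (λ _ → Finite.complete FX _) (Finite.complete FX d)

        ips-count : 2 * length ips + 2 * h ≤ h * D + 2
        ips-count = ≤-trans (≤-reflexive (cong (λ k → 2 * k + 2 * h) (length-map _ (idents allX))))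
          (≤-trans (cotree-count L′⊆ B allX (Finite.uniq FX) (λ _ → Finite.complete FX _) (λ _ → Finite.complete FX _))
                   (≤-reflexive (cong (_+ 2) length-allX)))

      dual : ∃ λ z → z ∈ ips × (z ≡ (d₀ , α d₀) ⊎ z ≡ (α d₀ , d₀))
      dual with ips-∈ d₀ (λ { (inj₁ u) → proj₁ (avoid u) refl ; (inj₂ u) → proj₂ (avoid u) refl })
      ... | inj₁ i = _ , i , inj₁ refl
      ... | inj₂ i = _ , i , inj₂ refl

      module _ (E : X → X → Set) (I : IsEq E) (turn : ∀ d → E d (φ d)) (pair : ∀ {x y} → (x , y) ∈ ips → E x y) where
        open IsEq I

        one-class : Cover E ((proj₁ d₀ , zero) ∷ [])
        one-class (v , i) = let (r , e , c) = Forest.Contour.toRoot F I ok _ v ≤-refl in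
          (proj₁ d₀ , zero) , here refl , subst (λ r → E (v , i) (r , zero)) (root e) (c i zero)
          where
          back : ∀ d → E (σ d) (α d)
          back d = esym (subst (E (α d)) (sym (σφ d)) (turn (α d)))
          across : ∀ d → ¬ Tr d → E (α d) d
          across d nt = [ (λ j → esym (pair j)) , pair ]′ (ips-∈ d nt)
          ok : ∀ x → Forest.Contour.OK F I x
          ok x i = (λ nt → etrans (back (x , i)) (across (x , i) nt)) , (λ _ → esym (turn (x , i)) , back (x , i))

    -- The graph stays connected without the edge, so a spanning tree can avoid it, and its dual is
    -- among the pairs `ips`. If both sides belonged to one face, this pair would merge nothing and
    -- could be dropped. The bound of `euler` would then be lower by one face, against `gen`.
    two-faces : ¬ Conn φL d₀ (α d₀)
    two-faces same = bfs FV L′-sym (proj₁ d₀ ∷ []) (λ v → proj₁ d₀ , here refl , conn v (proj₁ d₀)) main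
      where
      main : ¬ Bfs L′ (proj₁ d₀ ∷ [])
      main B with Cotree.dual B
      ... | z , z∈ , zf with ∈-remove z∈
      ... | ys , len , rem = <⇒≱ {h * D + 2} {h * D + 4} (+-monoʳ-< (h * D) (s≤s (s≤s (s≤s z≤n)))) (begin
        h * D + 4 ≤⟨ gen ⟩
        2 * h + 2 * length fs ≤⟨ +-monoʳ-≤ (2 * h) (*-monoʳ-≤ 2 (join-count ys find (Cotree.one-class B E connEq (λ d → fwd (inj₁ refl) nil) pair))) ⟩
        2 * h + 2 * (length ys + 1) ≡⟨ cong (λ k → 2 * h + 2 * k) (trans (+-comm (length ys) 1) (sym len)) ⟩
        2 * h + 2 * length (Cotree.ips B) ≡⟨ +-comm (2 * h) _ ⟩
        2 * length (Cotree.ips B) + 2 * h ≤⟨ Cotree.ips-count B ⟩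
        h * D + 2 ∎)
        where
        open ≤-Reasoning
        E : X → X → Set
        E = Conn (addL φL ys)
        same′ : E d₀ (α d₀)
        same′ = cmap (clink ∘ inj₁) same
        lost : ∀ {x y} → (x , y) ≡ z → z ≡ (d₀ , α d₀) ⊎ z ≡ (α d₀ , d₀) → E x y
        lost refl (inj₁ refl) = same′
        lost refl (inj₂ refl) = csym same′
        pair : ∀ {x y} → (x , y) ∈ Cotree.ips B → E x y
        pair i = [ (λ e → lost e zf) , (λ k → clink (inj₂ k)) ]′ (rem i)

    private
      rep : X → X
      rep d = proj₁ (fcov d)

      rep∈ : ∀ d → rep d ∈ fs
      rep∈ d = proj₁ (proj₂ (fcov d))

      rep-resp : ∀ {d e} → Conn φL d e → rep d ≡ rep e
      rep-resp {d} {e} c = indep-∈ connEq find (rep∈ d) (rep∈ e) (ctrans (csym (proj₂ (proj₂ (fcov d)))) (ctrans c (proj₂ (proj₂ (fcov e)))))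

      rep-φ : ∀ d → rep (φ d) ≡ rep d
      rep-φ d = sym (rep-resp (clink refl))

      f₁ f₂ : X
      f₁ = rep (α d₀)
      f₂ = rep d₀

      f₁≢f₂ : f₁ ≢ f₂
      f₁≢f₂ e = two-faces (ctrans (proj₂ (proj₂ (fcov d₀))) (csym (subst (Conn φL (α d₀)) e (proj₂ (proj₂ (fcov (α d₀)))))))

      other? : ∀ r → Dec (r ≢ f₁ × r ≢ f₂)
      other? r = ¬? (r ≟X f₁) ×-dec ¬? (r ≟X f₂)

      gs : List X
      gs = filter other? fs

    faces : ℕ
    faces = length gs

    private
      pos : ∀ r → Dec (Any (r ≡_) gs) → Side faces
      pos r (yes p) = fc (Any.index p)
      -- A default that representatives of faces never reach: `gs` contains all of `fs` except `f₁`
      -- and `f₂`, which `side` treats beforehand.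
      pos r (no _) = low

      side : X → Side faces
      side r with r ≟X f₁ | r ≟X f₂
      ... | yes _ | _ = up 0
      ... | no _ | yes _ = low
      ... | no _ | no _ = pos r (Any.any? (r ≟X_) gs)

      side₁ : side f₁ ≡ up 0
      side₁ with f₁ ≟X f₁
      ... | yes _ = refl
      ... | no n = ⊥-elim (n refl)

      side₂ : side f₂ ≡ low
      side₂ with f₂ ≟X f₁ | f₂ ≟X f₂
      ... | yes e | _ = ⊥-elim (f₁≢f₂ (sym e))
      ... | no _ | yes _ = refl
      ... | no _ | no n = ⊥-elim (n refl)

      ugs : Unique gs
      ugs = UP.filter⁺ other? (AllPairs.map (λ nr e → nr (creflexive e)) find)

      idx : ∀ {gs : List X} → Unique gs → ∀ c (p : List.lookup gs c ∈ gs) → Any.index p ≡ c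
      idx (q ∷ u) zero (here _) = refl
      idx (q ∷ u) zero (there p) = ⊥-elim (All.lookup q p refl)
      idx {g ∷ gs} (q ∷ u) (suc c) (here e) = ⊥-elim (All.lookup q (mem gs c) (sym e))
        where
        mem : ∀ (xs : List X) c → List.lookup xs c ∈ xs
        mem (x ∷ xs) zero = here refl
        mem (x ∷ xs) (suc c) = there (mem xs c)
      idx (q ∷ u) (suc c) (there p) = cong suc (idx u c p)

      mem : ∀ (xs : List X) c → List.lookup xs c ∈ xs
      mem (x ∷ xs) zero = here refl
      mem (x ∷ xs) (suc c) = there (mem xs c)

      side-g : ∀ c → side (List.lookup gs c) ≡ fc c
      side-g c with proj₂ (∈-filter⁻ other? {xs = fs} (mem gs c))
      ... | n₁ , n₂ with List.lookup gs c ≟X f₁ | List.lookup gs c ≟X f₂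
      ... | yes e | _ = ⊥-elim (n₁ e)
      ... | no _ | yes e = ⊥-elim (n₂ e)
      ... | no _ | no _ with Any.any? (List.lookup gs c ≟X_) gs
      ... | yes p = cong fc (idx ugs c p)
      ... | no np = ⊥-elim (np (mem gs c))

      lab : X → Side faces
      lab d = side (rep d)

      β″ : ∀ d → Dec (d ≡ d₀) → Dec (d ≡ α d₀) → X ⊎ Port 0
      β″ d (yes _) _ = inj₂ lft
      β″ d (no _) (yes _) = inj₂ rgt
      β″ d (no _) (no _) = inj₁ (α d)

      β : X → X ⊎ Port 0
      β d = β″ d (d ≟X d₀) (d ≟X α d₀)

      pd : Port 0 → X
      pd lft = d₀
      pd rgt = α d₀
      pd (pin ())

      pd-β : ∀ q → β (pd q) ≡ inj₂ q
      pd-β lft with d₀ ≟X d₀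
      ... | yes _ = refl
      ... | no n = ⊥-elim (n refl)
      pd-β rgt with α d₀ ≟X d₀ | α d₀ ≟X α d₀
      ... | yes e | _ = ⊥-elim (nofix d₀ e)
      ... | no _ | yes _ = refl
      ... | no _ | no n = ⊥-elim (n refl)

      β-pd : ∀ {d q} → β d ≡ inj₂ q → d ≡ pd q
      β-pd {d} e with d ≟X d₀ | d ≟X α d₀
      β-pd {d} refl | yes e | _ = e
      β-pd {d} refl | no _ | yes e = e

      β-in : ∀ {d e} → β d ≡ inj₁ e → e ≡ α d × d ≢ d₀ × d ≢ α d₀
      β-in {d} h with d ≟X d₀ | d ≟X α d₀
      β-in {d} refl | no a | no b = refl , a , b

      in-β : ∀ {d} → d ≢ d₀ → d ≢ α d₀ → β d ≡ inj₁ (α d)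
      in-β {d} a b with d ≟X d₀ | d ≟X α d₀
      ... | yes e | _ = ⊥-elim (a e)
      ... | no _ | yes e = ⊥-elim (b e)
      ... | no _ | no _ = refl

    chain : Chain D′ (Fin h) 0 faces
    chain = record
      { β = β ; pd = pd ; pd-β = pd-β ; β-pd = β-pd
      ; β-sym = λ {d} {e} h → β-sym′ h
      ; noloop = λ {d} {e} h q → RMap.noloop M (proj₁ d) (proj₂ d) (trans (cong proj₁ (sym (proj₁ (β-in h)))) (sym q))
      ; simple = λ {d} {e} {d′} {e′} h h′ q q′ → simple′ (proj₁ (β-in h)) (proj₁ (β-in h′)) q q′
      ; pin-inj = λ { {()} } ; lab = lab
      ; lab-lft = side₂ ; lab-rgt = side₁ ; lab-pin = λ ()
      ; nxt-lft = trans (cong side (trans (cong rep (σφ d₀)) (rep-φ (α d₀)))) side₁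
      ; nxt-rgt = trans (cong side (rep-φ d₀)) side₂
      ; nxt-pin = λ ()
      ; lab-β = λ {d} h → trans (cong (lab ∘ σ) (proj₁ (β-in h))) (cong side (rep-φ d))
      ; lab-surj = λ c → List.lookup gs c , trans (cong side (sym (indep-∈ connEq find (proj₁ (∈-filter⁻ other? {xs = fs} (mem gs c))) (rep∈ _) (proj₂ (proj₂ (fcov _)))))) (side-g c)
      ; conn = λ x y → cmap (λ { {u} (i , refl , a , b) → clink (i , proj₂ (α (u , i)) , in-β a b) }) (conn x y) }
      where
      β-sym′ : ∀ {d e} → β d ≡ inj₁ e → β e ≡ inj₁ d
      β-sym′ {d} h with β-in h
      ... | refl , a , b = trans (in-β (λ e → b (trans (sym (inv d)) (cong α e))) (λ e → a (α-inj e))) (cong inj₁ (inv d))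
      simple′ : ∀ {d e d′ e′} → e ≡ α d → e′ ≡ α d′ → proj₁ d ≡ proj₁ d′ → proj₁ e ≡ proj₁ e′ → d ≡ d′
      simple′ {u , i} {d′ = .u , j} refl refl refl q = cong (u ,_) (RMap.simple M q)

    distinct : proj₁ (Chain.pd chain lft) ≢ proj₁ (Chain.pd chain rgt)
    distinct e = RMap.noloop M (proj₁ d₀) (proj₂ d₀) (sym e)

    link⁻ : ∀ {x y} → Chain.Link chain x y → L′ x y
    link⁻ {x} (i , j , eq) with β-in {x , i} eq
    ... | e , a , b = i , cong proj₁ (sym e) , a , b

    link⁺ : ∀ {x y} → L′ x y → Chain.Link chain x y
    link⁺ {x} (i , refl , a , b) = i , proj₂ (α (x , i)) , in-β a b

    enough : h * D ≤ 2 * h + 2 * faces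
    enough = +-cancelʳ-≤ 4 _ _ (≤-trans gen (≤-trans (+-monoʳ-≤ (2 * h) (*-monoʳ-≤ 2 le)) (≤-reflexive (ar h faces))))
      where
      ar : ∀ a b → 2 * a + 2 * suc (suc b) ≡ 2 * a + 2 * b + 4
      ar = solve-∀
      le : length fs ≤ suc (suc faces)
      le = unique-⊆ {ys = f₁ ∷ f₂ ∷ gs} (AllPairs.map (λ nr e → nr (creflexive e)) find) sub
        where
        sub : ∀ {r} → r ∈ fs → r ∈ f₁ ∷ f₂ ∷ gs
        sub {r} i with r ≟X f₁ | r ≟X f₂
        ... | yes e | _ = here e
        ... | no _ | yes e = there (here e)
        ... | no a | no b = there (there (∈-filter⁺ other? i (a , b)))

    bead : ∃ λ f → Σ (Chain D′ (Fin h) 0 f) λ c → (proj₁ (Chain.pd c lft) ≢ proj₁ (Chain.pd c rgt)) × h * D ≤ 2 * h + 2 * f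
    bead = faces , chain , distinct , enough

  cubicLeg : Chain 2 (Fin 1) 1 0
  cubicLeg = record
    { β = β ; pd = pd
    ; pd-β = λ { lft → refl ; rgt → refl ; (pin zero) → refl }
    ; β-pd = λ { {zero , zero} refl → refl ; {zero , suc zero} refl → refl ; {zero , suc (suc zero)} refl → refl }
    ; β-sym = λ { {zero , zero} () ; {zero , suc zero} () ; {zero , suc (suc zero)} () }
    ; noloop = λ { {zero , zero} () ; {zero , suc zero} () ; {zero , suc (suc zero)} () }
    ; simple = λ { {zero , zero} () ; {zero , suc zero} () ; {zero , suc (suc zero)} () }
    ; pin-inj = λ { {zero} {zero} _ → refl } ; lab = lab
    ; lab-lft = refl ; lab-rgt = refl ; lab-pin = λ { zero → refl } ; nxt-lft = refl ; nxt-rgt = refl ; nxt-pin = λ { zero → refl }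
    ; lab-β = λ { {zero , zero} () ; {zero , suc zero} () ; {zero , suc (suc zero)} () }
    ; lab-surj = λ () ; conn = λ { zero zero → nil } }
    where
    β : Fin 1 × Fin 3 → (Fin 1 × Fin 3) ⊎ Port 1
    β (zero , zero) = inj₂ lft
    β (zero , suc zero) = inj₂ (pin zero)
    β (zero , suc (suc zero)) = inj₂ rgt
    pd : Port 1 → Fin 1 × Fin 3
    pd lft = zero , zero
    pd rgt = zero , suc (suc zero)
    pd (pin zero) = zero , suc zero
    lab : Fin 1 × Fin 3 → Side 0
    lab (zero , zero) = low
    lab (zero , suc zero) = up 0
    lab (zero , suc (suc zero)) = up 1

  pattern i0 = zero
  pattern i1 = suc zero
  pattern i2 = suc (suc zero)
  pattern i3 = suc (suc (suc zero))
  pattern i4 = suc (suc (suc (suc zero)))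

  -- A vertex with a pole on either side, a leg above, and a loop through the chain K below.
  module QuinticLeg {B : Set} {f : ℕ} (K : Chain 4 B 0 f) (dis : proj₁ (Chain.pd K lft) ≢ proj₁ (Chain.pd K rgt)) where
    private
      module K = Chain K
      A : Set
      A = Fin 1 ⊎ B
      DD : Set → Set
      DD C = C × Fin 5

      x : Fin 5 → DD A
      x i = inj₁ zero , i

      k : DD B → DD A
      k (b , i) = inj₂ b , i

      g : DD B ⊎ Port 0 → DD A ⊎ Port 1
      g (inj₁ y) = inj₁ (k y)
      g (inj₂ lft) = inj₁ (x i4)
      g (inj₂ rgt) = inj₁ (x i3)
      g (inj₂ (pin ()))

      β : DD A → DD A ⊎ Port 1
      β (inj₁ zero , i0) = inj₂ lft
      β (inj₁ zero , i1) = inj₂ (pin zero)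
      β (inj₁ zero , i2) = inj₂ rgt
      β (inj₁ zero , i3) = inj₁ (k (K.pd rgt))
      β (inj₁ zero , i4) = inj₁ (k (K.pd lft))
      β (inj₂ b , i) = g (K.β (b , i))

      pd : Port 1 → DD A
      pd lft = x i0
      pd rgt = x i2
      pd (pin zero) = x i1

      s : Side f → Side (suc f)
      s (up _) = fc zero
      s low = low
      s (fc c) = fc (suc c)

      lab : DD A → Side (suc f)
      lab (inj₁ zero , i0) = low
      lab (inj₁ zero , i1) = up 0
      lab (inj₁ zero , i2) = up 1
      lab (inj₁ zero , i3) = low
      lab (inj₁ zero , i4) = fc zero
      lab (inj₂ b , i) = s (K.lab (b , i))

      data Lk : DD A → DD A → Set where
        l  : ∀ {y z} → K.β y ≡ inj₁ z → Lk (k y) (k z)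
        p₁ : Lk (x i3) (k (K.pd rgt))
        p₂ : Lk (k (K.pd rgt)) (x i3)
        q₁ : Lk (x i4) (k (K.pd lft))
        q₂ : Lk (k (K.pd lft)) (x i4)

      lk : ∀ {d e} → β d ≡ inj₁ e → Lk d e
      lk {inj₁ zero , i0} ()
      lk {inj₁ zero , i1} ()
      lk {inj₁ zero , i2} ()
      lk {inj₁ zero , i3} refl = p₁
      lk {inj₁ zero , i4} refl = q₁
      lk {inj₂ b , i} e with K.β (b , i) in eq
      lk {inj₂ b , i} refl | inj₁ y = l eq
      lk {inj₂ b , i} refl | inj₂ lft = subst (λ z → Lk (k z) (x i4)) (sym (K.β-pd eq)) q₂
      lk {inj₂ b , i} refl | inj₂ rgt = subst (λ z → Lk (k z) (x i3)) (sym (K.β-pd eq)) p₂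

      kl : ∀ {d e} → Lk d e → β d ≡ inj₁ e
      kl (l eq) = cong g eq
      kl p₁ = refl
      kl p₂ = cong g (K.pd-β rgt)
      kl q₁ = refl
      kl q₂ = cong g (K.pd-β lft)

      lk-sym : ∀ {d e} → Lk d e → Lk e d
      lk-sym (l eq) = l (K.β-sym eq)
      lk-sym p₁ = p₂
      lk-sym p₂ = p₁
      lk-sym q₁ = q₂
      lk-sym q₂ = q₁

      inj₂-inj : ∀ {y z : B} → inj₂ {A = Fin 1} y ≡ inj₂ z → y ≡ z
      inj₂-inj refl = refl

      lk-noloop : ∀ {d e} → Lk d e → proj₁ d ≢ proj₁ e
      lk-noloop (l eq) h = K.noloop eq (inj₂-inj h)
      lk-noloop p₁ ()
      lk-noloop p₂ ()
      lk-noloop q₁ ()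
      lk-noloop q₂ ()

      lk-simple : ∀ {d e d′ e′} → Lk d e → Lk d′ e′ → proj₁ d ≡ proj₁ d′ → proj₁ e ≡ proj₁ e′ → d ≡ d′
      lk-simple (l p) (l q) h h′ = cong k (K.simple p q (inj₂-inj h) (inj₂-inj h′))
      lk-simple p₁ p₁ _ _ = refl
      lk-simple p₂ p₂ _ _ = refl
      lk-simple q₁ q₁ _ _ = refl
      lk-simple q₂ q₂ _ _ = refl
      lk-simple p₁ q₁ _ h = ⊥-elim (dis (sym (inj₂-inj h)))
      lk-simple q₁ p₁ _ h = ⊥-elim (dis (inj₂-inj h))
      lk-simple p₂ q₂ h _ = ⊥-elim (dis (sym (inj₂-inj h)))
      lk-simple q₂ p₂ h _ = ⊥-elim (dis (inj₂-inj h))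
      lk-simple (l _) p₁ ()
      lk-simple (l _) p₂ _ ()
      lk-simple (l _) q₁ ()
      lk-simple (l _) q₂ _ ()
      lk-simple p₁ (l _) ()
      lk-simple p₂ (l _) _ ()
      lk-simple q₁ (l _) ()
      lk-simple q₂ (l _) _ ()
      lk-simple p₁ p₂ ()
      lk-simple p₁ q₂ ()
      lk-simple q₁ p₂ ()
      lk-simple q₁ q₂ ()
      lk-simple p₂ p₁ ()
      lk-simple p₂ q₁ ()
      lk-simple q₂ p₁ ()
      lk-simple q₂ q₁ ()

      lab-lk : ∀ {d e} → Lk d e → lab (σₐ e) ≡ lab d
      lab-lk (l eq) = cong s (K.lab-β eq)
      lab-lk p₁ = cong s K.nxt-rgt
      lab-lk p₂ = sym (cong s K.lab-rgt)
      lab-lk q₁ = cong s K.nxt-lft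
      lab-lk q₂ = sym (cong s K.lab-lft)

      β-pd : ∀ {d q} → β d ≡ inj₂ q → d ≡ pd q
      β-pd {inj₁ zero , i0} refl = refl
      β-pd {inj₁ zero , i1} refl = refl
      β-pd {inj₁ zero , i2} refl = refl
      β-pd {inj₁ zero , i3} ()
      β-pd {inj₁ zero , i4} ()
      β-pd {inj₂ b , i} e with K.β (b , i)
      β-pd {inj₂ b , i} () | inj₁ y
      β-pd {inj₂ b , i} () | inj₂ lft
      β-pd {inj₂ b , i} () | inj₂ rgt

      LL : A → A → Set
      LL u v = ∃ λ i → ∃ λ j → β (u , i) ≡ inj₁ (v , j)

      inK : ∀ y z → Conn LL (inj₂ y) (inj₂ z)
      inK y z = cgmap inj₂ (λ { (i , j , eq) → clink (i , j , cong g eq) }) (K.conn y z)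

      toK : ∀ z → Conn LL (inj₁ zero) (inj₂ z)
      toK z = fwd (i3 , proj₂ (K.pd rgt) , refl) (inK _ z)

      conn : ∀ u v → Conn LL u v
      conn (inj₁ zero) (inj₁ zero) = nil
      conn (inj₁ zero) (inj₂ z) = toK z
      conn (inj₂ y) (inj₁ zero) = csym (toK y)
      conn (inj₂ y) (inj₂ z) = inK y z

    chain : Chain 4 (Fin 1 ⊎ B) 1 (suc f)
    chain = record
      { β = β ; pd = pd ; pd-β = λ { lft → refl ; rgt → refl ; (pin zero) → refl } ; β-pd = β-pd
      ; β-sym = λ e → kl (lk-sym (lk e)) ; noloop = λ e → lk-noloop (lk e) ; simple = λ e e′ → lk-simple (lk e) (lk e′)
      ; pin-inj = λ { {zero} {zero} _ → refl } ; lab = lab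
      ; lab-lft = refl ; lab-rgt = refl ; lab-pin = λ { zero → refl } ; nxt-lft = refl ; nxt-rgt = refl ; nxt-pin = λ { zero → refl }
      ; lab-β = λ {d} {e} h → lab-lk {d} {e} (lk h)
      ; lab-surj = λ { zero → x i4 , refl ; (suc c) → let (d , h) = K.lab-surj c in k d , cong s h }
      ; conn = conn }

  -- Two adjacent vertices, each with a leg above, joined below through the chain K.
  module QuarticLegs {B : Set} {f : ℕ} (K : Chain 3 B 0 f) where
    private
      module K = Chain K
      A : Set
      A = Fin 2 ⊎ B
      DD : Set → Set
      DD C = C × Fin 4

      x y : Fin 4 → DD A
      x i = inj₁ zero , i
      y i = inj₁ (suc zero) , i

      k : DD B → DD A
      k (b , i) = inj₂ b , i

      g : DD B ⊎ Port 0 → DD A ⊎ Port 2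
      g (inj₁ z) = inj₁ (k z)
      g (inj₂ lft) = inj₁ (x i3)
      g (inj₂ rgt) = inj₁ (y i3)
      g (inj₂ (pin ()))

      β : DD A → DD A ⊎ Port 2
      β (inj₁ zero , i0) = inj₂ lft
      β (inj₁ zero , i1) = inj₂ (pin zero)
      β (inj₁ zero , i2) = inj₁ (y i0)
      β (inj₁ zero , i3) = inj₁ (k (K.pd lft))
      β (inj₁ (suc zero) , i0) = inj₁ (x i2)
      β (inj₁ (suc zero) , i1) = inj₂ (pin (suc zero))
      β (inj₁ (suc zero) , i2) = inj₂ rgt
      β (inj₁ (suc zero) , i3) = inj₁ (k (K.pd rgt))
      β (inj₂ b , i) = g (K.β (b , i))

      pd : Port 2 → DD A
      pd lft = x i0
      pd rgt = y i2
      pd (pin zero) = x i1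
      pd (pin (suc zero)) = y i1

      s : Side f → Side (suc f)
      s (up _) = fc zero
      s low = low
      s (fc c) = fc (suc c)

      lab : DD A → Side (suc f)
      lab (inj₁ zero , i0) = low
      lab (inj₁ zero , i1) = up 0
      lab (inj₁ zero , i2) = up 1
      lab (inj₁ zero , i3) = fc zero
      lab (inj₁ (suc zero) , i0) = fc zero
      lab (inj₁ (suc zero) , i1) = up 1
      lab (inj₁ (suc zero) , i2) = up 2
      lab (inj₁ (suc zero) , i3) = low
      lab (inj₂ b , i) = s (K.lab (b , i))

      data Lk : DD A → DD A → Set where
        l  : ∀ {u v} → K.β u ≡ inj₁ v → Lk (k u) (k v)
        m₁ : Lk (x i2) (y i0)
        m₂ : Lk (y i0) (x i2)
        p₁ : Lk (x i3) (k (K.pd lft))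
        p₂ : Lk (k (K.pd lft)) (x i3)
        q₁ : Lk (y i3) (k (K.pd rgt))
        q₂ : Lk (k (K.pd rgt)) (y i3)

      lk : ∀ {d e} → β d ≡ inj₁ e → Lk d e
      lk {inj₁ zero , i0} ()
      lk {inj₁ zero , i1} ()
      lk {inj₁ zero , i2} refl = m₁
      lk {inj₁ zero , i3} refl = p₁
      lk {inj₁ (suc zero) , i0} refl = m₂
      lk {inj₁ (suc zero) , i1} ()
      lk {inj₁ (suc zero) , i2} ()
      lk {inj₁ (suc zero) , i3} refl = q₁
      lk {inj₂ b , i} e with K.β (b , i) in eq
      lk {inj₂ b , i} refl | inj₁ z = l eq
      lk {inj₂ b , i} refl | inj₂ lft = subst (λ z → Lk (k z) (x i3)) (sym (K.β-pd eq)) p₂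
      lk {inj₂ b , i} refl | inj₂ rgt = subst (λ z → Lk (k z) (y i3)) (sym (K.β-pd eq)) q₂

      kl : ∀ {d e} → Lk d e → β d ≡ inj₁ e
      kl (l eq) = cong g eq
      kl m₁ = refl
      kl m₂ = refl
      kl p₁ = refl
      kl p₂ = cong g (K.pd-β lft)
      kl q₁ = refl
      kl q₂ = cong g (K.pd-β rgt)

      lk-sym : ∀ {d e} → Lk d e → Lk e d
      lk-sym (l eq) = l (K.β-sym eq)
      lk-sym m₁ = m₂
      lk-sym m₂ = m₁
      lk-sym p₁ = p₂
      lk-sym p₂ = p₁
      lk-sym q₁ = q₂
      lk-sym q₂ = q₁

      inj₂-inj : ∀ {u v : B} → inj₂ {A = Fin 2} u ≡ inj₂ v → u ≡ v
      inj₂-inj refl = refl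

      lk-noloop : ∀ {d e} → Lk d e → proj₁ d ≢ proj₁ e
      lk-noloop (l eq) h = K.noloop eq (inj₂-inj h)
      lk-noloop m₁ ()
      lk-noloop m₂ ()
      lk-noloop p₁ ()
      lk-noloop p₂ ()
      lk-noloop q₁ ()
      lk-noloop q₂ ()

      lk-simple : ∀ {d e d′ e′} → Lk d e → Lk d′ e′ → proj₁ d ≡ proj₁ d′ → proj₁ e ≡ proj₁ e′ → d ≡ d′
      lk-simple (l p) (l q) h h′ = cong k (K.simple p q (inj₂-inj h) (inj₂-inj h′))
      lk-simple m₁ m₁ _ _ = refl
      lk-simple m₂ m₂ _ _ = refl
      lk-simple p₁ p₁ _ _ = refl
      lk-simple p₂ p₂ _ _ = refl
      lk-simple q₁ q₁ _ _ = refl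
      lk-simple q₂ q₂ _ _ = refl
      lk-simple (l _) m₁ ()
      lk-simple (l _) m₂ ()
      lk-simple (l _) p₁ ()
      lk-simple (l _) p₂ _ ()
      lk-simple (l _) q₁ ()
      lk-simple (l _) q₂ _ ()
      lk-simple m₁ (l _) ()
      lk-simple m₁ m₂ ()
      lk-simple m₁ p₁ _ ()
      lk-simple m₁ p₂ ()
      lk-simple m₁ q₁ ()
      lk-simple m₁ q₂ ()
      lk-simple m₂ (l _) ()
      lk-simple m₂ m₁ ()
      lk-simple m₂ p₁ ()
      lk-simple m₂ p₂ ()
      lk-simple m₂ q₁ _ ()
      lk-simple m₂ q₂ ()
      lk-simple p₁ (l _) ()
      lk-simple p₁ m₁ _ ()
      lk-simple p₁ m₂ ()
      lk-simple p₁ p₂ ()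
      lk-simple p₁ q₁ ()
      lk-simple p₁ q₂ ()
      lk-simple p₂ (l _) _ ()
      lk-simple p₂ m₁ ()
      lk-simple p₂ m₂ ()
      lk-simple p₂ p₁ ()
      lk-simple p₂ q₁ ()
      lk-simple p₂ q₂ _ ()
      lk-simple q₁ (l _) ()
      lk-simple q₁ m₁ ()
      lk-simple q₁ m₂ _ ()
      lk-simple q₁ p₁ ()
      lk-simple q₁ p₂ ()
      lk-simple q₁ q₂ ()
      lk-simple q₂ (l _) _ ()
      lk-simple q₂ m₁ ()
      lk-simple q₂ m₂ ()
      lk-simple q₂ p₁ ()
      lk-simple q₂ p₂ _ ()
      lk-simple q₂ q₁ ()

      lab-lk : ∀ {d e} → Lk d e → lab (σₐ e) ≡ lab d
      lab-lk (l eq) = cong s (K.lab-β eq)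
      lab-lk m₁ = refl
      lab-lk m₂ = refl
      lab-lk p₁ = cong s K.nxt-lft
      lab-lk p₂ = sym (cong s K.lab-lft)
      lab-lk q₁ = cong s K.nxt-rgt
      lab-lk q₂ = sym (cong s K.lab-rgt)

      β-pd : ∀ {d q} → β d ≡ inj₂ q → d ≡ pd q
      β-pd {inj₁ zero , i0} refl = refl
      β-pd {inj₁ zero , i1} refl = refl
      β-pd {inj₁ zero , i2} ()
      β-pd {inj₁ zero , i3} ()
      β-pd {inj₁ (suc zero) , i0} ()
      β-pd {inj₁ (suc zero) , i1} refl = refl
      β-pd {inj₁ (suc zero) , i2} refl = refl
      β-pd {inj₁ (suc zero) , i3} ()
      β-pd {inj₂ b , i} e with K.β (b , i)
      β-pd {inj₂ b , i} () | inj₁ y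
      β-pd {inj₂ b , i} () | inj₂ lft
      β-pd {inj₂ b , i} () | inj₂ rgt

      LL : A → A → Set
      LL u v = ∃ λ i → ∃ λ j → β (u , i) ≡ inj₁ (v , j)

      inK : ∀ u v → Conn LL (inj₂ u) (inj₂ v)
      inK u v = cgmap inj₂ (λ { (i , j , eq) → clink (i , j , cong g eq) }) (K.conn u v)

      toK : ∀ c v → Conn LL (inj₁ c) (inj₂ v)
      toK zero v = fwd (i3 , proj₂ (K.pd lft) , refl) (inK _ v)
      toK (suc zero) v = fwd (i3 , proj₂ (K.pd rgt) , refl) (inK _ v)

      conn : ∀ u v → Conn LL u v
      conn (inj₁ c) (inj₁ c′) = ctrans (toK c (proj₁ (K.pd lft))) (csym (toK c′ _))
      conn (inj₁ c) (inj₂ v) = toK c v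
      conn (inj₂ u) (inj₁ c) = csym (toK c u)
      conn (inj₂ u) (inj₂ v) = inK u v

    chain : Chain 3 (Fin 2 ⊎ B) 2 (suc f)
    chain = record
      { β = β ; pd = pd ; pd-β = λ { lft → refl ; rgt → refl ; (pin zero) → refl ; (pin (suc zero)) → refl } ; β-pd = β-pd
      ; β-sym = λ e → kl (lk-sym (lk e)) ; noloop = λ e → lk-noloop (lk e) ; simple = λ e e′ → lk-simple (lk e) (lk e′)
      ; pin-inj = λ { {zero} {zero} _ → refl ; {suc zero} {suc zero} _ → refl ; {zero} {suc zero} () ; {suc zero} {zero} () } ; lab = lab
      ; lab-lft = refl ; lab-rgt = refl ; lab-pin = λ { zero → refl ; (suc zero) → refl } ; nxt-lft = refl ; nxt-rgt = refl ; nxt-pin = λ { zero → refl ; (suc zero) → refl }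
      ; lab-β = λ {d} {e} h → lab-lk {d} {e} (lk h)
      ; lab-surj = λ { zero → x i3 , refl ; (suc c) → let (d , h) = K.lab-surj c in k d , cong s h }
      ; conn = conn }


  -- Small regular planar maps

  -- An explicitly listed planar map: the dart (u , i) has number u * D + i; the lists give the
  -- involution α, the face labels, a spanning tree avoiding the edge of dart 0, and face representatives.
  module Tabulated (m D′ F′ : ℕ) (tα tface tpar trep : List ℕ) where
    private
      X : Set
      X = Fin (suc m) × Fin (suc D′)
      entry : List ℕ → ℕ → ℕ
      entry [] _ = 0
      entry (x ∷ xs) zero = x
      entry (x ∷ xs) (suc k) = entry xs k
      dart : ℕ → X
      dart k = (k / suc D′) mod suc m , k mod suc D′
      code : X → ℕ
      code (u , i) = toℕ u * suc D′ + toℕ i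
      α : X → X
      α d = dart (entry tα (code d))
      face : X → Fin (suc F′)
      face d = entry tface (code d) mod suc F′
      par : Fin (suc m) → Fin (suc D′)
      par u = entry tpar (toℕ u) mod suc D′
      rep : Fin (suc F′) → X
      rep c = dart (entry trep (toℕ c))
      step′ : ∀ u → Dec (u ≡ zero) → Fin (suc m)
      step′ u (yes _) = zero
      step′ u (no _) = proj₁ (α (u , par u))
      next : Fin (suc m) → Fin (suc m)
      next u = step′ u (u FP.≟ zero)
      _≟X_ : DecidableEquality X
      _≟X_ = ≡-dec FP._≟_ FP._≟_
      d₀ : X
      d₀ = zero , zero

      Valid : Set
      Valid = (∀ u i → (α (α (u , i)) ≡ (u , i) × proj₁ (α (u , i)) ≢ u) × face (proj₁ (α (u , i)) , nx (proj₂ (α (u , i)))) ≡ face (u , i))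
            × (∀ u i j → proj₁ (α (u , i)) ≡ proj₁ (α (u , j)) → i ≡ j)
            × (∀ c → face (rep c) ≡ c)
            × (∀ u → u ≡ zero ⊎ ((u , par u) ≢ d₀ × (u , par u) ≢ α d₀))
            × (∀ u → iter next (suc m) u ≡ zero)
            × (suc m * suc D′ + 4 ≤ 2 * suc m + 2 * suc F′)

    valid? : Dec Valid
    valid? = (FP.all? λ u → FP.all? λ i → ((α (α (u , i)) ≟X (u , i)) ×-dec ¬? (proj₁ (α (u , i)) FP.≟ u)) ×-dec (face (proj₁ (α (u , i)) , nx (proj₂ (α (u , i)))) FP.≟ face (u , i)))
      ×-dec ((FP.all? λ u → FP.all? λ i → FP.all? λ j → (proj₁ (α (u , i)) FP.≟ proj₁ (α (u , j))) →-dec (i FP.≟ j))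
      ×-dec ((FP.all? λ c → face (rep c) FP.≟ c)
      ×-dec ((FP.all? λ u → (u FP.≟ zero) ⊎-dec (¬? ((u , par u) ≟X d₀) ×-dec ¬? ((u , par u) ≟X α d₀)))
      ×-dec ((FP.all? λ u → iter next (suc m) u FP.≟ zero)
      ×-dec (_ ≤? _)))))

    module _ (ok : True valid?) where
      private
        v : Valid
        v = toWitness ok

      map₀ : RMap (suc m) D′
      map₀ = record { α = α ; inv = λ { (u , i) → proj₁ (proj₁ (proj₁ v u i)) } ; noloop = λ u i → proj₂ (proj₁ (proj₁ v u i))
                    ; simple = λ {u} {i} {j} → proj₁ (proj₂ v) u i j }

      open RMap map₀ using (φL; hd; inv)

      private
        fs : List X
        fs = map rep (allFin (suc F′))

        face-φ : ∀ {d e} → Conn φL d e → face d ≡ face e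
        face-φ = cfold (kerEq face) (λ { {u , i} refl → sym (proj₂ (proj₁ v u i)) })

        rep-inj : ∀ {c c′} → rep c ≡ rep c′ → c ≡ c′
        rep-inj {c} {c′} e = trans (sym (proj₁ (proj₂ (proj₂ v)) c)) (trans (cong face e) (proj₁ (proj₂ (proj₂ v)) c′))

        find : Indep (Conn φL) fs
        find = unique→indep (UP.map⁺ rep-inj (UP.allFin⁺ (suc F′))) same
          where
          same : ∀ {x y} → x ∈ fs → y ∈ fs → Conn φL x y → x ≡ y
          same i j c with ∈-map⁻ rep {xs = allFin (suc F′)} i | ∈-map⁻ rep {xs = allFin (suc F′)} j
          ... | a , _ , refl | b , _ , refl = cong rep (trans (sym (proj₁ (proj₂ (proj₂ v)) a)) (trans (face-φ c) (proj₁ (proj₂ (proj₂ v)) b)))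

        len : length fs ≡ suc F′
        len = trans (length-map rep (allFin (suc F′))) (length-tabulate {n = suc F′} id)

        L′ : Fin (suc m) → Fin (suc m) → Set
        L′ u w = ∃ λ i → hd (u , i) ≡ w × (u , i) ≢ d₀ × (u , i) ≢ α d₀

        one : ∀ u → Conn L′ u (next u)
        one u = go (u FP.≟ zero) (proj₁ (proj₂ (proj₂ (proj₂ v))) u)
          where
          go : (d : Dec (u ≡ zero)) → u ≡ zero ⊎ ((u , par u) ≢ d₀ × (u , par u) ≢ α d₀) → Conn L′ u (step′ u d)
          go (yes refl) _ = nil
          go (no n) (inj₁ e) = ⊥-elim (n e)
          go (no n) (inj₂ (a , b)) = clink (par u , refl , a , b)

        many : ∀ k u → Conn L′ u (iter next k u)
        many zero u = nil
        many (suc k) u = ctrans (many k u) (one _)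

        toZero : ∀ u → Conn L′ u zero
        toZero u = subst (Conn L′ u) (proj₁ (proj₂ (proj₂ (proj₂ (proj₂ v)))) u) (many (suc m) u)

      bead : NN (∃ λ f → Σ (Chain D′ (Fin (suc m)) 0 f) λ c →
        (proj₁ (Chain.pd c lft) ≢ proj₁ (Chain.pd c rgt)) × suc m * suc D′ ≤ 2 * suc m + 2 * f)
      bead = do
        (fs′ , find′ , fcov) ← nn-reps (RMap.FX map₀) connEq
        let le = ≤-trans (≤-reflexive (sym len)) (indep≤cover connEq find (λ {x} _ → fcov x))
        return (Bead.bead map₀ fs′ find′ fcov
          (≤-trans (proj₂ (proj₂ (proj₂ (proj₂ (proj₂ v))))) (+-monoʳ-≤ (2 * suc m) (*-monoʳ-≤ 2 le))) d₀
          (λ u w → ctrans (toZero u) (csym (toZero w))))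

  -- The tetrahedron; `Cubic₁` is the triangular prism. Sizes of cubic graphs are even, so 4 and 6
  -- are consecutive.
  module Cubic₀ = Tabulated 3 2 3
    (5 ∷ 11 ∷ 6 ∷ 8 ∷ 9 ∷ 0 ∷ 2 ∷ 10 ∷ 3 ∷ 4 ∷ 7 ∷ 1 ∷ [])
    (0 ∷ 1 ∷ 2 ∷ 0 ∷ 3 ∷ 1 ∷ 0 ∷ 2 ∷ 3 ∷ 1 ∷ 3 ∷ 2 ∷ [])
    (0 ∷ 1 ∷ 0 ∷ 2 ∷ [])
    (0 ∷ 1 ∷ 2 ∷ 4 ∷ [])

  module Cubic₁ = Tabulated 5 2 4
    (5 ∷ 10 ∷ 6 ∷ 8 ∷ 13 ∷ 0 ∷ 2 ∷ 16 ∷ 3 ∷ 17 ∷ 1 ∷ 12 ∷ 11 ∷ 4 ∷ 15 ∷ 14 ∷ 7 ∷ 9 ∷ [])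
    (0 ∷ 1 ∷ 2 ∷ 0 ∷ 3 ∷ 1 ∷ 0 ∷ 2 ∷ 3 ∷ 4 ∷ 2 ∷ 1 ∷ 4 ∷ 1 ∷ 3 ∷ 4 ∷ 3 ∷ 2 ∷ [])
    (0 ∷ 0 ∷ 0 ∷ 1 ∷ 0 ∷ 2 ∷ [])
    (0 ∷ 1 ∷ 2 ∷ 4 ∷ 9 ∷ [])

  -- The square antiprism, with 8 vertices; `Quartic₁` has 9. The octahedron with 6 vertices is
  -- passed over because no quartic planar graph has 7.
  module Quartic₀ = Tabulated 7 3 9
    (11 ∷ 16 ∷ 15 ∷ 4 ∷ 3 ∷ 22 ∷ 31 ∷ 8 ∷ 7 ∷ 30 ∷ 17 ∷ 0 ∷ 19 ∷ 24 ∷ 23 ∷ 2 ∷ 1 ∷ 10 ∷ 25 ∷ 12 ∷ 27 ∷ 28 ∷ 5 ∷ 14 ∷ 13 ∷ 18 ∷ 29 ∷ 20 ∷ 21 ∷ 26 ∷ 9 ∷ 6 ∷ [])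
    (0 ∷ 1 ∷ 2 ∷ 3 ∷ 0 ∷ 3 ∷ 4 ∷ 5 ∷ 0 ∷ 5 ∷ 6 ∷ 1 ∷ 2 ∷ 7 ∷ 8 ∷ 3 ∷ 2 ∷ 1 ∷ 6 ∷ 7 ∷ 8 ∷ 9 ∷ 4 ∷ 3 ∷ 8 ∷ 7 ∷ 6 ∷ 9 ∷ 4 ∷ 9 ∷ 6 ∷ 5 ∷ [])
    (0 ∷ 0 ∷ 2 ∷ 3 ∷ 0 ∷ 3 ∷ 1 ∷ 3 ∷ [])
    (0 ∷ 1 ∷ 2 ∷ 3 ∷ 6 ∷ 7 ∷ 10 ∷ 13 ∷ 14 ∷ 21 ∷ [])

  module Quartic₁ = Tabulated 8 3 10
    (11 ∷ 16 ∷ 15 ∷ 4 ∷ 3 ∷ 14 ∷ 23 ∷ 8 ∷ 7 ∷ 28 ∷ 27 ∷ 0 ∷ 19 ∷ 20 ∷ 5 ∷ 2 ∷ 1 ∷ 26 ∷ 35 ∷ 12 ∷ 13 ∷ 34 ∷ 29 ∷ 6 ∷ 31 ∷ 32 ∷ 17 ∷ 10 ∷ 9 ∷ 22 ∷ 33 ∷ 24 ∷ 25 ∷ 30 ∷ 21 ∷ 18 ∷ [])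
    (0 ∷ 1 ∷ 2 ∷ 3 ∷ 0 ∷ 3 ∷ 4 ∷ 5 ∷ 0 ∷ 5 ∷ 6 ∷ 1 ∷ 2 ∷ 7 ∷ 4 ∷ 3 ∷ 2 ∷ 1 ∷ 8 ∷ 7 ∷ 4 ∷ 7 ∷ 9 ∷ 5 ∷ 6 ∷ 10 ∷ 8 ∷ 1 ∷ 6 ∷ 5 ∷ 9 ∷ 10 ∷ 8 ∷ 10 ∷ 9 ∷ 7 ∷ [])
    (0 ∷ 0 ∷ 0 ∷ 3 ∷ 0 ∷ 0 ∷ 2 ∷ 3 ∷ 3 ∷ [])
    (0 ∷ 1 ∷ 2 ∷ 3 ∷ 6 ∷ 7 ∷ 10 ∷ 13 ∷ 18 ∷ 22 ∷ 25 ∷ [])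

  -- 16 vertices, and 18 for `Quintic₁`. The icosahedron with 12 is passed over because no quintic
  -- planar graph has 14 vertices, and fillers of two consecutive even sizes are wanted.
  module Quintic₀ = Tabulated 15 4 25
    (11 ∷ 5 ∷ 48 ∷ 22 ∷ 19 ∷ 1 ∷ 10 ∷ 63 ∷ 57 ∷ 49 ∷ 6 ∷ 0 ∷ 18 ∷ 67 ∷ 64 ∷ 21 ∷ 25 ∷ 68 ∷ 12 ∷ 4 ∷ 26 ∷ 15 ∷ 3 ∷ 37 ∷ 34 ∷ 16 ∷ 20 ∷ 33 ∷ 72 ∷ 69 ∷ 36 ∷ 40 ∷ 73 ∷ 27 ∷ 24 ∷ 41 ∷ 30 ∷ 23 ∷ 47 ∷ 54 ∷ 31 ∷ 35 ∷ 53 ∷ 77 ∷ 74 ∷ 56 ∷ 50 ∷ 38 ∷ 2 ∷ 9 ∷ 46 ∷ 55 ∷ 78 ∷ 42 ∷ 39 ∷ 51 ∷ 45 ∷ 8 ∷ 62 ∷ 79 ∷ 66 ∷ 75 ∷ 58 ∷ 7 ∷ 14 ∷ 71 ∷ 60 ∷ 13 ∷ 17 ∷ 29 ∷ 76 ∷ 65 ∷ 28 ∷ 32 ∷ 44 ∷ 61 ∷ 70 ∷ 43 ∷ 52 ∷ 59 ∷ [])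
    (0 ∷ 1 ∷ 2 ∷ 3 ∷ 4 ∷ 2 ∷ 1 ∷ 5 ∷ 6 ∷ 7 ∷ 5 ∷ 1 ∷ 0 ∷ 8 ∷ 9 ∷ 4 ∷ 10 ∷ 11 ∷ 8 ∷ 0 ∷ 12 ∷ 10 ∷ 4 ∷ 3 ∷ 13 ∷ 11 ∷ 10 ∷ 12 ∷ 14 ∷ 15 ∷ 13 ∷ 16 ∷ 17 ∷ 14 ∷ 12 ∷ 18 ∷ 16 ∷ 13 ∷ 3 ∷ 19 ∷ 17 ∷ 16 ∷ 18 ∷ 20 ∷ 21 ∷ 7 ∷ 22 ∷ 19 ∷ 3 ∷ 2 ∷ 19 ∷ 22 ∷ 23 ∷ 20 ∷ 18 ∷ 23 ∷ 22 ∷ 7 ∷ 6 ∷ 24 ∷ 9 ∷ 25 ∷ 24 ∷ 6 ∷ 5 ∷ 15 ∷ 25 ∷ 9 ∷ 8 ∷ 11 ∷ 21 ∷ 25 ∷ 15 ∷ 14 ∷ 17 ∷ 24 ∷ 25 ∷ 21 ∷ 20 ∷ 23 ∷ [])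
    (0 ∷ 0 ∷ 0 ∷ 4 ∷ 2 ∷ 1 ∷ 4 ∷ 3 ∷ 2 ∷ 3 ∷ 0 ∷ 2 ∷ 3 ∷ 3 ∷ 2 ∷ 0 ∷ [])
    (0 ∷ 1 ∷ 2 ∷ 3 ∷ 4 ∷ 7 ∷ 8 ∷ 9 ∷ 13 ∷ 14 ∷ 16 ∷ 17 ∷ 20 ∷ 24 ∷ 28 ∷ 29 ∷ 31 ∷ 32 ∷ 35 ∷ 39 ∷ 43 ∷ 44 ∷ 46 ∷ 52 ∷ 59 ∷ 61 ∷ [])

  module Quintic₁ = Tabulated 17 4 28
    (11 ∷ 5 ∷ 33 ∷ 22 ∷ 19 ∷ 1 ∷ 10 ∷ 48 ∷ 42 ∷ 34 ∷ 6 ∷ 0 ∷ 18 ∷ 52 ∷ 49 ∷ 21 ∷ 25 ∷ 63 ∷ 12 ∷ 4 ∷ 26 ∷ 15 ∷ 3 ∷ 32 ∷ 39 ∷ 16 ∷ 20 ∷ 38 ∷ 72 ∷ 64 ∷ 41 ∷ 35 ∷ 23 ∷ 2 ∷ 9 ∷ 31 ∷ 40 ∷ 78 ∷ 27 ∷ 24 ∷ 36 ∷ 30 ∷ 8 ∷ 82 ∷ 79 ∷ 51 ∷ 55 ∷ 83 ∷ 7 ∷ 14 ∷ 56 ∷ 45 ∷ 13 ∷ 62 ∷ 69 ∷ 46 ∷ 50 ∷ 68 ∷ 87 ∷ 84 ∷ 71 ∷ 65 ∷ 53 ∷ 17 ∷ 29 ∷ 61 ∷ 70 ∷ 88 ∷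 57 ∷ 54 ∷ 66 ∷ 60 ∷ 28 ∷ 77 ∷ 89 ∷ 81 ∷ 85 ∷ 73 ∷ 37 ∷ 44 ∷ 86 ∷ 75 ∷ 43 ∷ 47 ∷ 59 ∷ 76 ∷ 80 ∷ 58 ∷ 67 ∷ 74 ∷ [])
    (0 ∷ 1 ∷ 2 ∷ 3 ∷ 4 ∷ 2 ∷ 1 ∷ 5 ∷ 6 ∷ 7 ∷ 5 ∷ 1 ∷ 0 ∷ 8 ∷ 9 ∷ 4 ∷ 10 ∷ 11 ∷ 8 ∷ 0 ∷ 12 ∷ 10 ∷ 4 ∷ 3 ∷ 13 ∷ 11 ∷ 10 ∷ 12 ∷ 14 ∷ 15 ∷ 7 ∷ 16 ∷ 13 ∷ 3 ∷ 2 ∷ 13 ∷ 16 ∷ 17 ∷ 14 ∷ 12 ∷ 17 ∷ 16 ∷ 7 ∷ 6 ∷ 18 ∷ 9 ∷ 19 ∷ 20 ∷ 6 ∷ 5 ∷ 21 ∷ 19 ∷ 9 ∷ 8 ∷ 22 ∷ 20 ∷ 19 ∷ 21 ∷ 23 ∷ 24 ∷ 15 ∷ 25 ∷ 22 ∷ 8 ∷ 11 ∷ 22 ∷ 25 ∷ 26 ∷ 23 ∷ 21 ∷ 26 ∷ 25 ∷ 15 ∷ 14 ∷ 27 ∷ 18 ∷ 28 ∷ 27 ∷ 14 ∷ 17 ∷ 24 ∷ 28 ∷ 18 ∷ 6 ∷ 20 ∷ 27 ∷ 28 ∷ 24 ∷ 23 ∷ 26 ∷ [])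
    (0 ∷ 0 ∷ 0 ∷ 4 ∷ 2 ∷ 1 ∷ 3 ∷ 0 ∷ 2 ∷ 3 ∷ 2 ∷ 0 ∷ 3 ∷ 0 ∷ 2 ∷ 4 ∷ 3 ∷ 2 ∷ [])
    (0 ∷ 1 ∷ 2 ∷ 3 ∷ 4 ∷ 7 ∷ 8 ∷ 9 ∷ 13 ∷ 14 ∷ 16 ∷ 17 ∷ 20 ∷ 24 ∷ 28 ∷ 29 ∷ 31 ∷ 37 ∷ 44 ∷ 46 ∷ 47 ∷ 50 ∷ 54 ∷ 58 ∷ 59 ∷ 61 ∷ 67 ∷ 74 ∷ 76 ∷ [])

  cubic₀-bead = Cubic₀.bead tt
  cubic₁-bead = Cubic₁.bead tt
  quartic₀-bead = Quartic₀.bead tt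
  quartic₁-bead = Quartic₁.bead tt
  quintic₀-bead = Quintic₀.bead tt
  quintic₁-bead = Quintic₁.bead tt

  -- Chains with prescribed numbers of vertices and legs

  record _≅_ (A B : Set) : Set where
    field
      to   : A → B
      from : B → A
      ft   : ∀ a → from (to a) ≡ a
      tf   : ∀ b → to (from b) ≡ b

  idIso : ∀ {A} → A ≅ A
  idIso = record { to = id ; from = id ; ft = λ _ → refl ; tf = λ _ → refl }

  ⊎-Iso : ∀ {A B m k} → A ≅ Fin m → B ≅ Fin k → (A ⊎ B) ≅ Fin (m + k)
  ⊎-Iso {A} {B} {m} {k} I J = record { to = to ; from = from ; ft = ft ; tf = tf }
    where
    module I = _≅_ I
    module J = _≅_ J
    to : A ⊎ B → Fin (m + k)
    to (inj₁ a) = I.to a ↑ˡ k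
    to (inj₂ b) = m ↑ʳ J.to b
    back : Fin m ⊎ Fin k → A ⊎ B
    back (inj₁ i) = inj₁ (I.from i)
    back (inj₂ j) = inj₂ (J.from j)
    from : Fin (m + k) → A ⊎ B
    from i = back (splitAt m i)
    ft : ∀ x → from (to x) ≡ x
    ft (inj₁ a) = trans (cong back (FP.splitAt-↑ˡ m (I.to a) k)) (cong inj₁ (I.ft a))
    ft (inj₂ b) = trans (cong back (FP.splitAt-↑ʳ m k (J.to b))) (cong inj₂ (J.ft b))
    tf : ∀ i → to (from i) ≡ i
    tf i with splitAt m i in eq
    ... | inj₁ x = trans (cong (_↑ˡ k) (I.tf x)) (FP.splitAt⁻¹-↑ˡ eq)
    ... | inj₂ y = trans (cong (m ↑ʳ_) (J.tf y)) (FP.splitAt⁻¹-↑ʳ eq)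

  -- `enough` is the planar Euler count for a chain, whose upper and lower sides are not among the f
  -- closed faces. In this form it is additive under composition.
  record Sized (D′ b N : ℕ) : Set₁ where
    field
      {A}    : Set
      {f}    : ℕ
      chain  : Chain D′ A b f
      iso    : A ≅ Fin N
      enough : N * suc D′ ≤ 2 * N + 2 * f + b

  _∙_ : ∀ {D′ b₁ b₂ N₁ N₂} → Sized D′ b₁ N₁ → Sized D′ b₂ N₂ → Sized D′ (b₁ + b₂) (N₁ + N₂)
  _∙_ {D′} {b₁} {b₂} {N₁} {N₂} S T = record
    { chain = Compose.composite S.chain T.chain ; iso = ⊎-Iso S.iso T.iso
    ; enough = subst₂ _≤_ (sym (*-distribʳ-+ (suc D′) N₁ N₂)) (ar N₁ N₂ S.f T.f b₁ b₂) (+-mono-≤ S.enough T.enough) }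
    where
    module S = Sized S
    module T = Sized T
    ar : ∀ a b c d e g → (2 * a + 2 * c + e) + (2 * b + 2 * d + g) ≡ 2 * (a + b) + 2 * (c + d) + (e + g)
    ar = solve-∀

  -- Legs together with two fillers whose sizes g δ and (g + 1) δ generate every large multiple of δ.
  record Kit (D′ δ g : ℕ) : Set₁ where
    field
      fill₀ : Sized D′ 0 (g * δ)
      fill₁ : Sized D′ 0 (suc g * δ)
      dis   : proj₁ (Chain.pd (Sized.chain fill₀) lft) ≢ proj₁ (Chain.pd (Sized.chain fill₀) rgt)

  record Rest (D′ b N : ℕ) : Set₁ where
    field
      sized : Sized D′ b N
      far   : Chain.Far (Sized.chain sized)

  module _ {D′ δ g : ℕ} (K : Kit D′ δ (suc g)) where
    open Kit K

    repeat : ∀ {b N s} → Sized D′ 0 s → ∀ a → Sized D′ b N → Sized D′ b (a * s + N)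
    repeat S zero T = T
    repeat {b} {N} {s} S (suc a) T = subst (Sized D′ b) (sym (+-assoc s (a * s) N)) (S ∙ repeat S a T)

    -- Divide: r = c + q (g + 1) with c ≤ g. As r ≥ (g + 1)², also c ≤ q, so in units of δ a number
    -- c of fillers of size g + 2 and q - c of size g + 1 make up r. One more filler in front
    -- provides, by `far`, poles that are far apart.
    pad : ∀ {b N} r → suc g * suc g ≤ r → Sized D′ b N → Rest D′ b (suc g * δ + (r * δ + N))
    pad {b} {N} r le T = record { sized = fill₀ ∙ T′ ; far = Compose.far (Sized.chain fill₀) (Sized.chain T′) dis }
      where
      c q : ℕ
      c = r % suc g
      q = r / suc g
      c≤q : c ≤ q
      c≤q = ≤-trans (≤-pred (m%n<n r (suc g))) (≤-trans (n≤1+n g) (≮⇒≥ λ q< → <⇒≱ (s≤s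
        (begin
          r ≡⟨ m≡m%n+[m/n]*n r (suc g) ⟩
          c + q * suc g ≤⟨ +-mono-≤ (≤-pred (m%n<n r (suc g))) (*-monoˡ-≤ (suc g) (≤-pred q<)) ⟩
          g + g * suc g ∎)) le))
        where open ≤-Reasoning
      eq : (q ∸ c) * (suc g * δ) + (c * (suc (suc g) * δ) + N) ≡ r * δ + N
      eq = begin
        (q ∸ c) * (suc g * δ) + (c * (suc (suc g) * δ) + N) ≡⟨ ar (q ∸ c) c g δ N ⟩
        (c + (q ∸ c + c) * suc g) * δ + N ≡⟨ cong (λ z → (c + z * suc g) * δ + N) (m∸n+n≡m c≤q) ⟩
        (c + q * suc g) * δ + N ≡⟨ cong (λ z → z * δ + N) (sym (m≡m%n+[m/n]*n r (suc g))) ⟩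
        r * δ + N ∎
        where
        open ≡-Reasoning
        ar : ∀ a c g d N → a * (suc g * d) + (c * (suc (suc g) * d) + N) ≡ (c + (a + c) * suc g) * d + N
        ar = solve-∀
      T′ : Sized D′ b (r * δ + N)
      T′ = subst (Sized D′ b) eq (repeat fill₀ (q ∸ c) (repeat fill₁ c T))

  record Legged (D′ : ℕ) : Set₁ where
    field
      β s  : ℕ
      unit : Sized D′ (suc β) s
    many : ∀ m → Sized D′ (suc m * suc β) (suc m * s)
    many zero = subst₂ (Sized D′) (sym (+-identityʳ (suc β))) (sym (+-identityʳ s)) unit
    many (suc m) = unit ∙ many m

  finBead : ∀ {D′ m} → (∃ λ f → Σ (Chain D′ (Fin m) 0 f) λ c → (proj₁ (Chain.pd c lft) ≢ proj₁ (Chain.pd c rgt)) × m * suc D′ ≤ 2 * m + 2 * f) → Sized D′ 0 m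
  finBead (f , c , _ , le) = record { chain = c ; iso = idIso ; enough = ≤-trans le (m≤m+n _ 0) }

  cubicKit : {P : Set} → (Kit 2 2 2 → NN P) → NN P
  cubicKit k = do
    x ← cubic₀-bead
    y ← cubic₁-bead
    k (record { fill₀ = finBead x ; fill₁ = finBead y ; dis = proj₁ (proj₂ (proj₂ x)) })

  quarticKit : {P : Set} → (Kit 3 1 8 → Sized 3 2 10 → NN P) → NN P
  quarticKit k = do
    x@(f , c , _ , le) ← quartic₀-bead
    y ← quartic₁-bead
    k (record { fill₀ = finBead x ; fill₁ = finBead y ; dis = proj₁ (proj₂ (proj₂ x)) })
      (record { chain = QuarticLegs.chain c ; iso = ⊎-Iso idIso idIso
              ; enough = ≤-trans (+-monoʳ-≤ 8 le) (≤-reflexive (ar f)) })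
    where
    ar : ∀ f → 8 + (2 * 8 + 2 * f) ≡ 2 * 10 + 2 * suc f + 2
    ar = solve-∀

  quinticKit : {P : Set} → (Kit 4 2 8 → Sized 4 1 17 → NN P) → NN P
  quinticKit k = do
    x@(f , c , d , le) ← quintic₀-bead
    y ← quintic₁-bead
    k (record { fill₀ = finBead x ; fill₁ = finBead y ; dis = proj₁ (proj₂ (proj₂ x)) })
      (record { chain = QuinticLeg.chain c d ; iso = ⊎-Iso idIso idIso
              ; enough = ≤-trans (+-monoʳ-≤ 5 le) (≤-reflexive (ar f)) })
    where
    ar : ∀ f → 5 + (2 * 16 + 2 * f) ≡ 2 * 17 + 2 * suc f + 1
    ar = solve-∀

  -- A single switch: placing the ring, and rings of all admissible sizes

  bfs-short : {A : Set} (F : Finite A) {L : A → A → Set} {rs : List A} (B : Bfs L rs) → ∀ x → Bfs.lev B x < length (Finite.els F)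
  bfs-short F B x = go (lev x) x refl
    where
    open Bfs B
    up-path : ∀ k x → lev x ≡ k → ∃ λ ys → Unique ys × length ys ≡ suc k × (∀ {y} → y ∈ ys → lev y ≤ k)
    up-path zero x e = x ∷ [] , [] ∷ [] , refl , λ { (here refl) → ≤-reflexive e }
    up-path (suc k) x e with up-path k (par x) (parlev e)
    ... | ys , u , l , b = x ∷ ys , All.tabulate (λ i eq → <⇒≱ (s≤s (b i)) (≤-reflexive (trans (sym e) (cong lev eq)))) ∷ u , cong suc l ,
          λ { (here refl) → ≤-reflexive e ; (there i) → ≤-trans (b i) (n≤1+n k) }
    go : ∀ k x → lev x ≡ k → k < length (Finite.els F)
    go k x e with up-path k x e
    ... | ys , u , l , _ = subst (_≤ length (Finite.els F)) l (unique-⊆ u (λ _ → Finite.complete F _))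

  isoFinite : ∀ {A : Set} {N} → A ≅ Fin N → Finite A
  isoFinite {A} {N} I = record
    { els = map from (allFin N)
    ; complete = λ a → subst (_∈ map from (allFin N)) (ft a) (∈-map⁺ from (∈-allFin (to a)))
    ; uniq = UP.map⁺ (λ {x} {y} e → trans (sym (tf x)) (trans (cong to e) (tf y))) (UP.allFin⁺ N)
    ; _≟F_ = λ a b → map′ (λ e → trans (sym (ft a)) (trans (cong from e) (ft b))) (cong to) (to a FP.≟ to b) }
    where open _≅_ I

  isoFinite-length : ∀ {A : Set} {N} (I : A ≅ Fin N) → length (Finite.els (isoFinite I)) ≡ N
  isoFinite-length {N = N} I = trans (length-map (_≅_.from I) (allFin N)) (length-tabulate {n = N} id)

  data Walk {n} (G : Graph n) : ℕ → Fin n → Fin n → Set where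
    stop : ∀ {k u} → Walk G k u u
    move : ∀ {k u v w} → Walk G k u v → Adj G v w → Walk G (suc k) u w

  walk-≤ : ∀ {n} {G : Graph n} {k k′ u v} → k ≤ k′ → Walk G k u v → Walk G k′ u v
  walk-≤ _ stop = stop
  walk-≤ (s≤s le) (move w a) = move (walk-≤ le w) a

  -- A planar regular graph G′ obtained from G by changes inside a small vertex set B, all of it
  -- near an appearance of J in G′.
  record Switch {h n : ℕ} (D κ : ℕ) (J : Graph h) (G : Graph n) : Set where
    field
      G′    : Graph n
      inP   : InP n D G′
      W     : Vec.Vec Bool n
      app   : TwoAppears J G′ W
      w     : Fin n
      w∈    : w ∈S W
      B     : List (Fin n)
      B≤    : length B ≤ κ
      W⊆B   : ∀ {v} → v ∈S W → v ∈ B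
      agree : ∀ u v → u ∉ B ⊎ v ∉ B → adj G u v ≡ adj G′ u v
      near  : ∀ {x} → x ∈ B → Walk G′ κ w x

  -- H minus an edge as a chain
  record Core (D′ h : ℕ) (J : Graph h) : Set where
    field
      {f}    : ℕ
      chain  : Chain D′ (Fin h) 0 f
      dis    : proj₁ (Chain.pd chain lft) ≢ proj₁ (Chain.pd chain rgt)
      enough : h * suc D′ ≤ 2 * h + 2 * f
      link→  : ∀ {i j} → Chain.Link chain i j → Adj J i j
      →link  : ∀ {i j} → Adj J i j → Chain.Link chain i j

  increasing-filter : ∀ {n} {Q : Fin n → Set} (Q? : ∀ v → Dec (Q v)) → AllPairs (λ i j → toℕ i < toℕ j) (filter Q? (allFin n))
  increasing-filter {n} Q? = APP.filter⁺ Q? (APP.tabulate⁺-< {f = id} (λ lt → lt))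

  lookup-mono : ∀ {n} {xs : List (Fin n)} → AllPairs (λ i j → toℕ i < toℕ j) xs → ∀ i j → toℕ i < toℕ j →
    toℕ (List.lookup xs i) < toℕ (List.lookup xs j)
  lookup-mono {xs = x ∷ xs} (q ∷ qs) zero (suc j) _ = All.lookup q (Any-lookup xs j)
    where
    Any-lookup : ∀ {A : Set} (xs : List A) j → List.lookup xs j ∈ xs
    Any-lookup (x ∷ xs) zero = here refl
    Any-lookup (x ∷ xs) (suc j) = there (Any-lookup xs j)
  lookup-mono (q ∷ qs) (suc i) (suc j) (s≤s lt) = lookup-mono qs i j lt

  ∈-lookup″ : ∀ {A : Set} (xs : List A) j → List.lookup xs j ∈ xs
  ∈-lookup″ (x ∷ xs) zero = here refl
  ∈-lookup″ (x ∷ xs) (suc j) = there (∈-lookup″ xs j)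

  bool-ext : ∀ {a b : Bool} → (a ≡ true → b ≡ true) → (b ≡ true → a ≡ true) → a ≡ b
  bool-ext {true} {true} f g = refl
  bool-ext {true} {false} f g = sym (f refl)
  bool-ext {false} {true} f g = g refl
  bool-ext {false} {false} f g = refl


  -- The ring consists of the core and the rest. Two edges connect them: the joint from the right
  -- pole of the core to the left pole of the rest, and the closing edge between the two outer
  -- poles. These are the two edges that leave the appearance.
  module Place {n D′ h N₂ : ℕ} {J : Graph h} (core : Core D′ h J) (M : RMap n D′) (P : RMap.PlanarR M)
    (G : Graph n) (symG : ∀ u v → adj G u v ≡ adj G v u) (pres : Presents M G)
    (Q : Fin n → Set) (Q? : ∀ v → Dec (Q v)) (size : length (Region.verts M Q Q?) ≡ h + N₂)
    {b : ℕ} (rest : Rest D′ b N₂)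
    (legAt : Fin b → RMap.X M) (legL : ∀ k → Region.Leg M Q Q? (legAt k))
    (legAt-inj : ∀ {k k′} → legAt k ≡ legAt k′ → k ≡ k′)
    (legAll : ∀ d → Region.Leg M Q Q? d → ∃ λ k → legAt k ≡ d) where

    open RMap M using (D; X; α; hd; φL; rootDarts)
    open Region M Q Q? using (verts)
    open RMap.PlanarR M P using (fs; cs; ccover; findep; genus0)
    private
      module Co = Core core
      module Rs = Sized (Rest.sized rest)
      module Cp = Compose Co.chain Rs.chain
      module Cl = Closed′ Cp.composite (Cp.far Co.dis)

    A : Set
    A = Fin h ⊎ Rs.A

    iso : A ≅ Fin (h + N₂)
    iso = ⊎-Iso idIso Rs.iso

    open _≅_ iso

    patch : Patch D′ A b (closedFaces b (Co.f + Rs.f))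
    patch = Cl.patch

    uverts : Unique verts
    uverts = UP.filter⁺ Q? (UP.allFin⁺ n)

    abstract
      -- The vertices of the region are listed in increasing order and the core comes first in
      -- `iso`. So the core occupies the h smallest of them by the increasing bijection, as the
      -- definition of a 2-appearance demands.
      e : A → Fin n
      e a = List.lookup verts (Fin.cast (sym size) (to a))

      e-inj : ∀ {x y} → e x ≡ e y → x ≡ y
      e-inj {x} {y} eq = trans (sym (ft x)) (trans (cong from (FP.toℕ-injective (trans (sym (FP.toℕ-cast (sym size) (to x)))
        (trans (cong toℕ (Region.lookup-inj M Q Q? uverts eq)) (FP.toℕ-cast (sym size) (to y)))))) (ft y))

      e-Q : ∀ a → Q (e a)
      e-Q a = proj₂ (∈-filter⁻ Q? {xs = allFin n} (∈-lookup″ verts _))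

      Q-e : ∀ {v} → Q v → ∃ λ a → e a ≡ v
      Q-e {v} q = from (Fin.cast size i) , trans (cong (List.lookup verts) ci) (sym (look m))
        where
        m : v ∈ verts
        m = ∈-filter⁺ Q? (∈-allFin v) q
        i : Fin (length verts)
        i = Any.index m
        ci : Fin.cast (sym size) (to (from (Fin.cast size i))) ≡ i
        ci = FP.toℕ-injective (trans (FP.toℕ-cast (sym size) _) (trans (cong toℕ (tf (Fin.cast size i))) (FP.toℕ-cast size i)))
        look : ∀ {xs} (i : v ∈ xs) → v ≡ List.lookup xs (Any.index i)
        look (here e) = e
        look (there i) = look i

      e-incr : ∀ i j → toℕ i < toℕ j → toℕ (e (inj₁ i)) < toℕ (e (inj₁ j))
      e-incr i j lt = lookup-mono (increasing-filter Q?) _ _ (subst₂ _<_ (sym (pos i)) (sym (pos j)) lt)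
        where
        pos : ∀ i → toℕ (Fin.cast (sym size) (i ↑ˡ N₂)) ≡ toℕ i
        pos i = trans (FP.toℕ-cast (sym size) (i ↑ˡ N₂)) (FP.toℕ-↑ˡ i N₂)

    view : ∀ v → (∃ λ a → e a ≡ v) ⊎ (∀ a → e a ≢ v)
    view v with Q? v
    ... | yes q = inj₁ (Q-e q)
    ... | no nq = inj₂ (λ a eq → nq (subst Q eq (e-Q a)))

    private
      legIn : ∀ k → ∃ λ a → e a ≡ proj₁ (legAt k)
      legIn k = Q-e (proj₁ (legL k))

      legOut : ∀ k a → e a ≢ hd (legAt k)
      legOut k a eq = proj₂ (legL k) (subst Q eq (e-Q a))

      legAll′ : ∀ d → (∃ λ a → e a ≡ proj₁ d) → (∀ a → e a ≢ hd d) → ∃ λ k → legAt k ≡ d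
      legAll′ d (a , eq) o = legAll d (subst Q eq (e-Q a) , λ q → o (proj₁ (Q-e q)) (proj₂ (Q-e q)))

    open Surgery M patch e e-inj view legAt legIn legOut legAt-inj legAll′
      using (M′; leaves; →inside; inside→; agree→; agree←; leg-edge; Out; planar′; cover-g; cover-g₀; faces-bound; in?; g) public

    abstract
      G″ : Graph n
      G″ = ToGraph.graph M′

      g→ : ∀ {u v} → Adj G″ u v → RMap.AdjL M′ u v
      g→ = ToGraph.g→ M′

      →g : ∀ {u v} → RMap.AdjL M′ u v → Adj G″ u v
      →g = ToGraph.→g M′

      symG″ : ∀ u v → adj G″ u v ≡ adj G″ v u
      symG″ = proj₁ (ToGraph.simp M′)

      inP″ : RMap.PlanarR M′ → InP n D G″
      inP″ = ToGraph.inP M′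

    σe : Fin h → Fin n
    σe i = e (inj₁ i)

    σ-incr : StrictlyIncreasing σe
    σ-incr = e-incr

    inW? : ∀ v → Dec (∃ λ i → σe i ≡ v)
    inW? v = FP.any? (λ i → σe i FP.≟ v)

    Wset : Vec.Vec Bool n
    Wset = tabulate (λ v → Dec.does (inW? v))

    W→ : ∀ {v} → v ∈S Wset → ∃ λ i → σe i ≡ v
    W→ {v} m = does-true (inW? v) (trans (sym (lookup∘tabulate (λ v → Dec.does (inW? v)) v)) m)

    →W : ∀ i → σe i ∈S Wset
    →W i = trans (lookup∘tabulate (λ v → Dec.does (inW? v)) (σe i)) (dec-true (inW? (σe i)) (i , refl))

    e₂∉W : ∀ y → e (inj₂ y) ∉S Wset
    e₂∉W y = trans (lookup∘tabulate (λ v → Dec.does (inW? v)) (e (inj₂ y))) (dec-false (inW? (e (inj₂ y))) (λ { (i , eq) → case e-inj eq of λ () }))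

    l₀ r₀ : Fin h
    l₀ = proj₁ (Chain.pd Co.chain lft)
    r₀ = proj₁ (Chain.pd Co.chain rgt)

    l₁ r₁ : Rs.A
    l₁ = proj₁ (Chain.pd Rs.chain lft)
    r₁ = proj₁ (Chain.pd Rs.chain rgt)

    private
      inj₁-inj : ∀ {x y : Fin h} → inj₁ {B = Rs.A} x ≡ inj₁ y → x ≡ y
      inj₁-inj refl = refl
      inj₂-inj : ∀ {x y : Rs.A} → inj₂ {A = Fin h} x ≡ inj₂ y → x ≡ y
      inj₂-inj refl = refl

    JG : ∀ i j → adj J i j ≡ adj G″ (σe i) (σe j)
    JG i j = bool-ext (λ a → →g (→inside {inj₁ i} {inj₁ j} (Cl.link⁺ {inj₁ i} {inj₁ j} (Cp.link₁ {i} {j} (Co.→link a))))) back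
      where
      back : adj G″ (σe i) (σe j) ≡ true → adj J i j ≡ true
      back a with Cl.link⁻ {inj₁ i} {inj₁ j} (inside→ {inj₁ i} {inj₁ j} (g→ a))
      ... | inj₁ l = Co.link→ (Cp.link₁⁻ {x = i} {y = j} l)
      ... | inj₂ (inj₁ (_ , ()))
      ... | inj₂ (inj₂ (() , _))

    leaving : ∀ r v → r ∈S Wset → v ∉S Wset → Adj G″ r v → ((r , v) ≡ (σe l₀ , e (inj₂ r₁))) ⊎ ((r , v) ≡ (σe r₀ , e (inj₂ l₁)))
    leaving r v r∈ v∉ a with W→ r∈
    ... | i , refl with view v
    ... | inj₂ o with leaves (g→ a) o
    -- All legs sit on the rest: the core is a chain without pins, so no edge leads from it out of
    -- the region.
    ... | k , () , _
    leaving r v r∈ v∉ a | i , refl | inj₁ (inj₁ j , refl) = case trans (sym v∉) (→W j) of λ ()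
    leaving r v r∈ v∉ a | i , refl | inj₁ (inj₂ y , refl) with Cl.link⁻ {inj₁ i} {inj₂ y} (inside→ {inj₁ i} {inj₂ y} (g→ a))
    ... | inj₁ l = let (p , q) = Cp.link₁₂⁻ {x = i} {y = y} l in inj₂ (cong₂ _,_ (cong σe p) (cong (e ∘ inj₂) q))
    leaving r v r∈ v∉ a | i , refl | inj₁ (inj₂ y , refl) | inj₂ (inj₁ (p , q)) = inj₁ (cong₂ _,_ (cong e p) (cong e q))
    leaving r v r∈ v∉ a | i , refl | inj₁ (inj₂ y , refl) | inj₂ (inj₂ (() , _))

    poles-apart : adj G″ (e (inj₂ r₁)) (e (inj₂ l₁)) ≡ false
    poles-apart with adj G″ (e (inj₂ r₁)) (e (inj₂ l₁)) in eq
    ... | false = refl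
    ... | true with Cl.link⁻ {inj₂ r₁} {inj₂ l₁} (inside→ {inj₂ r₁} {inj₂ l₁} (g→ eq))
    ... | inj₁ l = ⊥-elim (proj₂ (Rest.far rest) (let (i , j , q) = Cp.link₂⁻ {x = r₁} {y = l₁} l in j , i , Chain.β-sym Rs.chain q))
    ... | inj₂ (inj₁ (() , _))
    ... | inj₂ (inj₂ (_ , ()))

    appears : TwoAppears J G″ Wset
    appears = (σe , σ-incr , (λ v → mk⇔ W→ (λ { (i , refl) → →W i })) , JG) ,
      (σe l₀ , e (inj₂ r₁) , σe r₀ , e (inj₂ l₁) , →W l₀ , →W r₀ , e₂∉W r₁ , e₂∉W l₁ ,
       →g (→inside {inj₁ l₀} {inj₂ r₁} Cl.link-lr) , →g (→inside {inj₁ r₀} {inj₂ l₁} (Cl.link⁺ {inj₁ r₀} {inj₂ l₁} Cp.link₁₂)) ,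
       (λ q → Co.dis (inj₁-inj (e-inj q))) , (λ q → proj₁ (Rest.far rest) (sym (inj₂-inj (e-inj q)))) , poles-apart , leaving)

    legHeads : List (Fin n)
    legHeads = map (hd ∘ legAt) (allFin b)

    -- Edges change inside the region and across its boundary. With the outer ends of the legs
    -- included, both ends of every changed edge are in the set.
    Bset : List (Fin n)
    Bset = verts ++ legHeads

    private
      q∈ : ∀ {v} → Q v → v ∈ Bset
      q∈ q = ∈-++⁺ˡ (∈-filter⁺ Q? (∈-allFin _) q)

      h∈ : ∀ k → hd (legAt k) ∈ Bset
      h∈ k = ∈-++⁺ʳ verts (∈-map⁺ (hd ∘ legAt) (∈-allFin k))

      neither : ∀ u v → Q u → v ∉ Bset → adj G u v ≡ adj G″ u v
      neither u v qu nv = bool-ext (λ a → ⊥-elim (nv (old a))) (λ a → ⊥-elim (nv (new a)))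
        where
        old : Adj G u v → v ∈ Bset
        old a with Presents.adj→ pres a
        ... | i , refl with legAll (u , i) (qu , λ q → nv (q∈ q))
        ... | k , eq = subst (_∈ Bset) (cong hd eq) (h∈ k)
        new : Adj G″ u v → v ∈ Bset
        new a with Q-e qu
        ... | x , refl with leaves (g→ a) (λ y eq → nv (subst (_∈ Bset) eq (q∈ (e-Q y))))
        ... | k , _ , eq = subst (_∈ Bset) (sym eq) (h∈ k)

      out : ∀ {v} → ¬ Q v → Out v
      out nq a eq = nq (subst Q eq (e-Q a))

    agrees : ∀ u v → u ∉ Bset ⊎ v ∉ Bset → adj G u v ≡ adj G″ u v
    agrees u v nb with Q? u | Q? v
    ... | yes qu | yes qv = ⊥-elim ([ (λ n → n (q∈ qu)) , (λ n → n (q∈ qv)) ]′ nb)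
    ... | yes qu | no _ = neither u v qu ([ (λ n → ⊥-elim (n (q∈ qu))) , id ]′ nb)
    ... | no _ | yes qv = trans (symG u v) (trans (neither v u qv ([ id , (λ n → ⊥-elim (n (q∈ qv))) ]′ nb)) (symG″ v u))
    ... | no nu | no nv = bool-ext (λ a → →g (agree→ (out nu) (out nv) (Presents.adj→ pres a)))
                                   (λ a → let (i , eq) = agree← (out nu) (out nv) (g→ a) in subst (Adj G u) eq (Presents.→adj pres u i))

    B-size : ∀ {c} → h + N₂ ≤ c → length Bset ≤ c + c * D
    B-size {c} le = ≤-trans (≤-reflexive (length-++ verts)) (+-mono-≤ (≤-trans (≤-reflexive size) le)
      (≤-trans (≤-reflexive (trans (length-map (hd ∘ legAt) (allFin b)) (length-tabulate {n = b} id)))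
        (≤-trans b≤ (*-monoˡ-≤ D (≤-trans (≤-reflexive size) le)))))
      where
      b≤ : b ≤ length verts * D
      b≤ = subst₂ _≤_ (length-tabulate {n = b} id) (trans (length-cart verts (allFin D)) (cong (length verts *_) (length-tabulate {n = D} id)))
        (inj-count (λ k d → legAt k ≡ d) {ys = cartesianProduct verts (allFin D)} (UP.allFin⁺ b)
          (λ {k} _ → legAt k , ∈-cartesianProduct⁺ (∈-filter⁺ Q? (∈-allFin _) (proj₁ (legL k))) (∈-allFin _) , refl)
          (λ ne p q → ne (legAt-inj (trans p (sym q)))))

    nearby : NN (∀ x → x ∈ Bset → Walk G″ (suc (h + N₂)) (σe l₀) x)
    nearby = do
      B ← bfs (isoFinite iso) {L = Patch.Link patch} (λ { (i , j , q) → j , i , Patch.β-sym patch q }) (inj₁ l₀ ∷ [])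
            (λ a → inj₁ l₀ , here refl , Patch.conn patch a (inj₁ l₀))
      return (λ x → go B {x})
      where
      module _ (B : Bfs (Patch.Link patch) (inj₁ l₀ ∷ [])) where
        open Bfs B
        climb : ∀ k a → lev a ≡ k → Walk G″ k (σe l₀) (e a)
        climb zero a q with root q
        ... | here refl = stop
        climb (suc k) a q = move (climb k (par a) (parlev q)) (→g (RMap.adj-sym M′ (→inside {a} {par a} (parL q))))
        toA : ∀ a → Walk G″ (h + N₂) (σe l₀) (e a)
        toA a = walk-≤ (≤-trans (n≤1+n _) (subst (lev a <_) (isoFinite-length iso) (bfs-short (isoFinite iso) B a))) (climb (lev a) a refl)
        go : ∀ {x} → x ∈ Bset → Walk G″ (suc (h + N₂)) (σe l₀) x
        go x∈ with ∈-++⁻ verts x∈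
        ... | inj₁ m with Q-e (proj₂ (∈-filter⁻ Q? {xs = allFin n} m))
        ... | a , refl = walk-≤ (n≤1+n _) (toA a)
        go x∈ | inj₂ m with ∈-map⁻ (hd ∘ legAt) {xs = allFin b} m
        ... | k , _ , refl = move (toA (proj₁ (Patch.leg patch k))) (→g (leg-edge k))

    switch : ∀ {c} → h + N₂ ≤ c → RMap.PlanarR M′ →
      NN (Σ (Switch (suc D′) (suc c + c * D) J G) λ s → ∀ v → Q v → v ∈ Switch.B s)
    switch {c} le P′ = do
      nb ← nearby
      return (record { G′ = G″ ; inP = inP″ P′ ; W = Wset ; app = appears ; w = σe l₀ ; w∈ = →W l₀ ; B = Bset
                     ; W⊆B = λ m → let (i , eq) = W→ m in subst (_∈ Bset) eq (q∈ (e-Q (inj₁ i)))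
                     ; B≤ = ≤-trans (B-size le) (n≤1+n _) ; agree = agrees
                     ; near = λ {x} i → walk-≤ (≤-trans (s≤s le) (m≤m+n _ _)) (nb x i) } , λ v → q∈ {v})

    patch-enough : (h + N₂) * D ≤ 2 * (h + N₂) + 2 * (Co.f + Rs.f) + b
    patch-enough = subst₂ _≤_ (sym (*-distribʳ-+ D h N₂)) (ar h N₂ Co.f Rs.f b) (+-mono-≤ Co.enough Rs.enough)
      where
      ar : ∀ a b c d g → (2 * a + 2 * c) + (2 * b + 2 * d + g) ≡ 2 * (a + b) + 2 * (c + d) + g
      ar = solve-∀

    -- With F the number of closed faces of core and rest, merging costs at most `length ps` ≤ F + 1
    -- faces and the ring brings at least F + 1. So the number of faces does not drop, while the
    -- number of components does not rise.
    open-planar : (ps : List (X × X)) → (∀ k → Conn (addL φL ps) (α (legAt k)) (legAt (nxt k))) →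
      (∀ d → Q (proj₁ d) → ∃ λ k → Conn (addL φL ps) d (legAt k)) →
      2 * length ps + 2 * length verts + b ≤ length verts * D + 2 → NN (RMap.PlanarR M′)
    open-planar ps cont ins bd = planar′ {length fs} {length cs} fb (map (g (inj₁ l₀)) cs) (cover-g (inj₁ l₀) ccover) (≤-reflexive (length-map _ cs)) genus0
      where
      open ≤-Reasoning
      F : ℕ
      F = Co.f + Rs.f
      suc≤ : ∀ b → suc F ≤ closedFaces b F
      suc≤ zero = n≤1+n _
      suc≤ (suc b) = ≤-refl
      ar : ∀ v F b → 2 * v + 2 * F + b + 2 ≡ 2 * suc F + (2 * v + b)
      ar = solve-∀
      ps≤ : length ps ≤ suc F
      ps≤ = *-cancelˡ-≤ 2 (+-cancelʳ-≤ (2 * length verts + b) _ _ (begin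
        2 * length ps + (2 * length verts + b) ≡⟨ sym (+-assoc (2 * length ps) _ _) ⟩
        2 * length ps + 2 * length verts + b ≤⟨ bd ⟩
        length verts * D + 2 ≤⟨ +-monoˡ-≤ 2 (subst (λ z → z * D ≤ 2 * z + 2 * F + b) (sym size) patch-enough) ⟩
        2 * length verts + 2 * F + b + 2 ≡⟨ ar (length verts) F b ⟩
        2 * suc F + (2 * length verts + b) ∎))
      fb : ∀ {fs′} → Cover (Conn (RMap.φL M′)) fs′ → length fs ≤ length fs′
      fb {fs′} cov = +-cancelʳ-≤ (closedFaces b F) _ _ (begin
        length fs + closedFaces b F ≤⟨ faces-bound ps [] cont (λ { d (a , q) → inj₁ (ins d (subst Q q (e-Q a))) }) findep cov ⟩
        length ps + (length fs′ + 0) ≡⟨ trans (cong (length ps +_) (+-identityʳ _)) (+-comm (length ps) _) ⟩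
        length fs′ + length ps ≤⟨ +-monoʳ-≤ (length fs′) (≤-trans ps≤ (suc≤ b)) ⟩
        length fs′ + closedFaces b F ∎)

    -- The region is a union of c components and is replaced by a connected one, so 2 (c - 1) faces
    -- may be lost without losing planarity. Merging costs at most F + c faces, the base points of
    -- the components another c, and the ring without legs brings F + 2.
    closed-planar : b ≡ 0 → (ps : List (X × X)) →
      (∀ d → Q (proj₁ d) → ∃ λ s → s ∈ rootDarts (filter Q? cs) × Conn (addL φL ps) d s) →
      2 * length ps + 2 * length verts ≤ length verts * D + 2 * length (filter Q? cs) → NN (RMap.PlanarR M′)
    closed-planar refl ps ins bd = planar′ {length fs + 2 ∸ 2 * c} {suc m} fb (e (inj₁ l₀) ∷ filter (λ v → ¬? (in? (inj₁ l₀) v)) cs) (cover-g₀ (inj₁ l₀) ccover) ≤-refl gen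
      where
      open ≤-Reasoning
      F c m : ℕ
      F = Co.f + Rs.f
      c = length (filter Q? cs)
      m = length (filter (λ v → ¬? (in? (inj₁ l₀) v)) cs)
      mc : m + c ≡ length cs
      mc = filter-split (λ v → ¬? (in? (inj₁ l₀) v)) Q? (λ ni q → ni (Q-e q)) (λ {v} nni → let (a , q) = decidable-stable (in? (inj₁ l₀) v) nni in subst Q q (e-Q a)) cs
      ar : ∀ v F c → 2 * v + 2 * F + 0 + 2 * c ≡ 2 * (F + c) + 2 * v
      ar = solve-∀
      ps≤ : length ps ≤ F + c
      ps≤ = *-cancelˡ-≤ 2 (+-cancelʳ-≤ (2 * length verts) _ _ (begin
        2 * length ps + 2 * length verts ≤⟨ bd ⟩
        length verts * D + 2 * c ≤⟨ +-monoˡ-≤ (2 * c) (subst (λ z → z * D ≤ 2 * z + 2 * F + 0) (sym size) patch-enough) ⟩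
        2 * length verts + 2 * F + 0 + 2 * c ≡⟨ ar (length verts) F c ⟩
        2 * (F + c) + 2 * length verts ∎))
      ar₂ : ∀ a F → a + suc (suc F) ≡ (a + 2) + F
      ar₂ = solve-∀
      ar₃ : ∀ F c x → F + c + (x + c) ≡ x + 2 * c + F
      ar₃ = solve-∀
      fb : ∀ {fs′} → Cover (Conn (RMap.φL M′)) fs′ → length fs + 2 ∸ 2 * c ≤ length fs′
      fb {fs′} cov = ≤-trans (∸-monoˡ-≤ (2 * c) (+-cancelʳ-≤ F _ _ (begin
        length fs + 2 + F ≡⟨ sym (ar₂ (length fs) F) ⟩
        length fs + closedFaces 0 F ≤⟨ faces-bound ps (rootDarts (filter Q? cs)) (λ ()) (λ { d (a , q) → inj₂ (ins d (subst Q q (e-Q a))) }) findep cov ⟩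
        length ps + (length fs′ + length (rootDarts (filter Q? cs))) ≡⟨ cong (λ z → length ps + (length fs′ + z)) (length-map _ (filter Q? cs)) ⟩
        length ps + (length fs′ + c) ≤⟨ +-monoˡ-≤ (length fs′ + c) ps≤ ⟩
        F + c + (length fs′ + c) ≡⟨ ar₃ F c (length fs′) ⟩
        length fs′ + 2 * c + F ∎))) (≤-reflexive (m+n∸n≡m (length fs′) (2 * c)))
      ar₄ : ∀ x m c → x + 4 * suc m + 4 * c ≡ x + 4 * (m + c) + 4
      ar₄ = solve-∀
      ar₅ : ∀ n f → 2 * n + 2 * f + 4 ≡ 2 * n + 2 * (f + 2)
      ar₅ = solve-∀
      ar₆ : ∀ n y c → 2 * n + 2 * (y + 2 * c) ≡ 2 * n + 2 * y + 4 * c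
      ar₆ = solve-∀
      gen : n * D + 4 * suc m ≤ 2 * n + 2 * (length fs + 2 ∸ 2 * c)
      gen = +-cancelʳ-≤ (4 * c) _ _ (begin
        n * D + 4 * suc m + 4 * c ≡⟨ ar₄ (n * D) m c ⟩
        n * D + 4 * (m + c) + 4 ≡⟨ cong (λ z → n * D + 4 * z + 4) mc ⟩
        n * D + 4 * length cs + 4 ≤⟨ +-monoˡ-≤ 4 genus0 ⟩
        2 * n + 2 * length fs + 4 ≡⟨ ar₅ n (length fs) ⟩
        2 * n + 2 * (length fs + 2) ≤⟨ +-monoʳ-≤ (2 * n) (*-monoʳ-≤ 2 (≤-trans (m≤n+m∸n (length fs + 2) (2 * c)) (≤-reflexive (+-comm (2 * c) _)))) ⟩
        2 * n + 2 * ((length fs + 2 ∸ 2 * c) + 2 * c) ≡⟨ ar₆ n (length fs + 2 ∸ 2 * c) c ⟩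
        2 * n + 2 * (length fs + 2 ∸ 2 * c) + 4 * c ∎)

  -- The equation is what the handshake lemma for the whole region says about the rest, with 2 X the
  -- number of darts of H. It expresses the parity condition for a D-regular part on N vertices with
  -- b legs. The factor 1000 leaves ample room for the leg units and for `pad`.
  Template : ℕ → Set₁
  Template D′ = ∀ {P : Set} b N X k → N * suc D′ + 2 * X ≡ b + 2 * k → 1000 * suc b ≤ N → (Rest D′ b N → NN P) → NN P

  b≤big : ∀ {b N} → 1000 * suc b ≤ N → b ≤ N
  b≤big {b} le = ≤-trans (≤-trans (n≤1+n b) (m≤n*m (suc b) 1000)) le

  module _ {e g u : ℕ} (K : Kit (2 * e) 2 (suc g)) (unit : Sized (2 * e) 1 (1 + 2 * u))
           (big : ∀ b → b + 2 * (suc g * suc g + 2 * suc g + u * b) ≤ 1000 * suc b) where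
    -- For odd D the equation amounts to N - b being even, N = b + 2 t. Every leg takes a unit of
    -- odd size 1 + 2 u, and fillers of even sizes make up the remainder.
    oddRest : ∀ b N X k → N * suc (2 * e) + 2 * X ≡ b + 2 * k → 1000 * suc b ≤ N → Rest (2 * e) b N
    oddRest b N X k eq le = subst (Rest (2 * e) b) Nt (build b t Y≤t)
      where
      Y : ℕ
      Y = suc g * suc g + 2 * suc g + u * b
      t₀ t : ℕ
      t₀ = N ∸ b
      t = k ∸ (e * N + X)
      Nb : N ≡ b + t₀
      Nb = sym (m+[n∸m]≡n (b≤big le))
      ar : ∀ b t₀ N e X → (b + t₀) + 2 * (e * N + X) ≡ b + (t₀ + 2 * (e * N + X))
      ar = solve-∀
      ar₂ : ∀ N e X → N * suc (2 * e) + 2 * X ≡ N + 2 * (e * N + X)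
      ar₂ = solve-∀
      tk : t₀ + 2 * (e * N + X) ≡ 2 * k
      tk = +-cancelˡ-≡ b _ _ (trans (sym (ar b t₀ N e X)) (trans (cong (_+ 2 * (e * N + X)) (sym Nb)) (trans (sym (ar₂ N e X)) eq)))
      tt′ : t₀ ≡ 2 * t
      tt′ = trans (sym (m+n∸n≡m t₀ (2 * (e * N + X)))) (trans (cong (_∸ 2 * (e * N + X)) tk) (sym (*-distribˡ-∸ 2 k (e * N + X))))
      Nt : b + 2 * t ≡ N
      Nt = trans (cong (b +_) (sym tt′)) (sym Nb)
      Y≤t : Y ≤ t
      Y≤t = *-cancelˡ-≤ 2 (+-cancelˡ-≤ b _ _ (≤-trans (big b) (≤-trans le (≤-reflexive (sym Nt)))))
      build : ∀ b t → suc g * suc g + 2 * suc g + u * b ≤ t → Rest (2 * e) b (b + 2 * t)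
      build zero t le = subst (Rest (2 * e) 0) size (pad K r r≥ (Kit.fill₀ K))
        where
        r : ℕ
        r = t ∸ 2 * suc g
        r≥ : suc g * suc g ≤ r
        r≥ = subst (_≤ r) (m+n∸n≡m (suc g * suc g) (2 * suc g)) (∸-monoˡ-≤ (2 * suc g) (≤-trans (m≤m+n _ (u * 0)) le))
        ar₃ : ∀ g r → suc g * 2 + (r * 2 + suc g * 2) ≡ 2 * (r + 2 * suc g)
        ar₃ = solve-∀
        size : suc g * 2 + (r * 2 + suc g * 2) ≡ 2 * t
        size = trans (ar₃ g r) (cong (2 *_) (m∸n+n≡m (≤-trans (m≤n+m _ (suc g * suc g)) (≤-trans (m≤m+n _ (u * 0)) le))))
      build (suc m) t le = subst₂ (Rest (2 * e)) (*-identityʳ (suc m)) size (pad K r r≥ (Legged.many L m))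
        where
        L : Legged (2 * e)
        L = record { β = 0 ; s = 1 + 2 * u ; unit = unit }
        Z r : ℕ
        Z = suc g + u * suc m
        r = t ∸ Z
        ar₃ : ∀ g r u m → suc g * 2 + (r * 2 + suc m * (1 + 2 * u)) ≡ suc m + 2 * (r + (suc g + u * suc m))
        ar₃ = solve-∀
        ar₄ : ∀ s g u → s + 2 * suc g + u ≡ s + suc g + (suc g + u)
        ar₄ = solve-∀
        ZZ : suc g * suc g + suc g + Z ≤ t
        ZZ = ≤-trans (≤-reflexive (sym (ar₄ (suc g * suc g) g (u * suc m)))) le
        r≥ : suc g * suc g ≤ r
        r≥ = ≤-trans (m≤m+n _ (suc g)) (subst (_≤ r) (m+n∸n≡m (suc g * suc g + suc g) Z) (∸-monoˡ-≤ Z ZZ))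
        size : suc g * 2 + (r * 2 + suc m * (1 + 2 * u)) ≡ suc m + 2 * t
        size = trans (ar₃ g r u m) (cong (λ z → suc m + 2 * z) (m∸n+n≡m (≤-trans (m≤n+m Z (suc g * suc g + suc g)) ZZ)))

  template₃ : Template 2
  template₃ b N X k eq le f = cubicKit λ K → f (oddRest {1} {1} {0} K (record { chain = cubicLeg ; iso = idIso ; enough = ≤-refl }) big b N X k eq le)
    where
    ar : ∀ b → (b + 2 * (4 + 4 + 0 * b)) + (984 + 999 * b) ≡ 1000 * suc b
    ar = solve-∀
    big : ∀ b → b + 2 * (4 + 4 + 0 * b) ≤ 1000 * suc b
    big b = ≤-trans (m≤m+n _ (984 + 999 * b)) (≤-reflexive (ar b))

  template₅ : Template 4
  template₅ b N X k eq le f = quinticKit λ K unit → f (oddRest {2} {7} {8} K unit big b N X k eq le)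
    where
    ar : ∀ b → (b + 2 * (64 + 16 + 8 * b)) + (840 + 983 * b) ≡ 1000 * suc b
    ar = solve-∀
    big : ∀ b → b + 2 * (64 + 16 + 8 * b) ≤ 1000 * suc b
    big b = ≤-trans (m≤m+n _ (840 + 983 * b)) (≤-reflexive (ar b))

  template₄ : Template 3
  template₄ b N X k eq le f = quarticKit λ K L → f (subst₂ (Rest 3) bm refl (build K L N m le′))
    where
    -- For D = 4 the equation reads b = 2 (2 N + X - k). So the legs come in pairs, m of them, and
    -- each unit of `QuarticLegs` carries one pair.
    m : ℕ
    m = 2 * N + X ∸ k
    ar : ∀ N X → N * 4 + 2 * X ≡ 2 * (2 * N + X)
    ar = solve-∀
    bm : m * 2 ≡ b
    bm = trans (*-comm m 2) (trans (*-distribˡ-∸ 2 (2 * N + X) k) (trans (cong (_∸ 2 * k) (trans (sym (ar N X)) eq)) (m+n∸n≡m b (2 * k))))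
    le′ : 1000 * suc (m * 2) ≤ N
    le′ = subst (λ z → 1000 * suc z ≤ N) (sym bm) le
    build : Kit 3 1 8 → Sized 3 2 10 → ∀ N m → 1000 * suc (m * 2) ≤ N → Rest 3 (m * 2) N
    build K L N zero le = subst (Rest 3 0) size (pad K r r≥ (Kit.fill₀ K))
      where
      r : ℕ
      r = N ∸ 16
      r≥ : 64 ≤ r
      r≥ = ∸-monoˡ-≤ 16 (≤-trans (m≤m+n 80 920) le)
      ar₂ : ∀ r → 8 * 1 + (r * 1 + 8 * 1) ≡ r + 16
      ar₂ = solve-∀
      size : 8 * 1 + (r * 1 + 8 * 1) ≡ N
      size = trans (ar₂ r) (m∸n+n≡m (≤-trans (m≤m+n 16 984) le))
    build K L N (suc m) le = subst (Rest 3 (suc m * 2)) size (pad K r r≥ (Legged.many (record { β = 1 ; s = 10 ; unit = L }) m))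
      where
      r : ℕ
      r = N ∸ (8 + suc m * 10)
      ar₃ : ∀ m → 72 + suc m * 10 + (928 + suc m * 1990) ≡ 1000 * suc (suc m * 2)
      ar₃ = solve-∀
      72≤ : 72 + suc m * 10 ≤ N
      72≤ = ≤-trans (m≤m+n _ _) (≤-trans (≤-reflexive (ar₃ m)) le)
      r≥ : 64 ≤ r
      r≥ = subst (_≤ r) (m+n∸n≡m 64 (8 + suc m * 10)) (∸-monoˡ-≤ (8 + suc m * 10) (≤-trans (≤-reflexive (sym (+-assoc 64 8 (suc m * 10)))) 72≤))
      ar₂ : ∀ r x → 8 * 1 + (r * 1 + x) ≡ r + (8 + x)
      ar₂ = solve-∀
      size : 8 * 1 + (r * 1 + suc m * 10) ≡ N
      size = trans (ar₂ r (suc m * 10)) (m∸n+n≡m (≤-trans (m≤n+m (8 + suc m * 10) 64) (≤-trans (≤-reflexive (sym (+-assoc 64 8 (suc m * 10)))) 72≤)))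

  -- The handshake lemma, and regions that admit a switch

  module Parity {n D′ : ℕ} (M : RMap n D′) where
    open RMap M hiding (noloop; simple)

    half-eq : (xs : List X) → Unique xs → (∀ {d} → d ∈ xs → α d ∈ xs) → length xs ≡ 2 * length (filter lower? xs)
    half-eq xs u cl = ≤-antisym (≤-trans (unique-⊆ {ys = ls ++ map α ls} u sub) (≤-reflexive (trans (length-++ ls) (cong (length ls +_) (trans (length-map α ls) (sym (+-identityʳ _))))))) (half xs u cl)
      where
      ls : List X
      ls = filter lower? xs
      sub : ∀ {d} → d ∈ xs → d ∈ ls ++ map α ls
      sub {d} i with lower-or d
      ... | inj₁ l = ∈-++⁺ˡ (∈-filter⁺ lower? i l)
      ... | inj₂ l = ∈-++⁺ʳ ls (subst (_∈ map α ls) (inv d) (∈-map⁺ α (∈-filter⁺ lower? (cl i) l)))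

    even-darts : ∃ λ k → n * D ≡ 2 * k
    even-darts = length (filter lower? allX) , trans (sym length-allX) (half-eq allX (Finite.uniq FX) (λ _ → Finite.complete FX _))

    module _ (Q : Fin n → Set) (Q? : ∀ v → Dec (Q v)) where
      open Region M Q Q?

      handshake : ∀ {b} (legAt : Fin b → X) → (∀ k → Leg (legAt k)) → (∀ {k k′} → legAt k ≡ legAt k′ → k ≡ k′) →
        (∀ d → Leg d → ∃ λ k → legAt k ≡ d) → ∃ λ k → length verts * D ≡ b + 2 * k
      handshake {b} legAt legL inj all = length (filter lower? qs) , trans (≤-antisym le (≤-trans (≤-reflexive (cong (length qs +_) (sym lenb))) (qs-count uls lsL))) (trans (+-comm (length qs) b) (cong (b +_) (half-eq qs (UP.filter⁺ inner? (Finite.uniq FX)) qs-α)))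
        where
        ls : List X
        ls = map legAt (allFin b)
        uls : Unique ls
        uls = UP.map⁺ inj (UP.allFin⁺ b)
        lenb : length ls ≡ b
        lenb = trans (length-map legAt (allFin b)) (length-tabulate {n = b} id)
        lsL : ∀ {d} → d ∈ ls → Leg d
        lsL i with ∈-map⁻ legAt {xs = allFin b} i
        ... | k , _ , refl = legL k
        le : length verts * D ≤ length qs + b
        le = subst₂ _≤_ (trans (length-cart verts (allFin D)) (cong (length verts *_) (length-tabulate {n = D} id)))
          (trans (length-++ qs) (cong (length qs +_) lenb))
          (unique-⊆ {xs = cartesianProduct verts (allFin D)} {ys = qs ++ ls} (UP.cartesianProduct⁺ (UP.filter⁺ Q? (UP.allFin⁺ n)) (UP.allFin⁺ D)) sub)
          where
          sub : ∀ {d} → d ∈ cartesianProduct verts (allFin D) → d ∈ qs ++ ls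
          sub {v , i} m with Q? (hd (v , i)) | proj₂ (∈-filter⁻ Q? {xs = allFin n} (proj₁ (∈-cartesianProduct⁻ verts (allFin D) m)))
          ... | yes q | qv = ∈-++⁺ˡ (∈-filter⁺ inner? (Finite.complete FX _) (qv , q))
          ... | no nq | qv = let (k , e) = all (v , i) (qv , nq) in ∈-++⁺ʳ qs (subst (_∈ ls) e (∈-map⁺ legAt (∈-allFin k)))

  module Sites {n D′ h : ℕ} {J : Graph h} (core : Core D′ h J) (tmpl : Template D′) (Xh : ℕ) (hX : h * suc D′ ≡ 2 * Xh)
    (M : RMap n D′) (P : RMap.PlanarR M) (G : Graph n) (symG : ∀ u v → adj G u v ≡ adj G v u) (pres : Presents M G)
    (Q : Fin n → Set) (Q? : ∀ v → Dec (Q v)) where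
    open RMap M hiding (noloop; simple)
    open Region M Q Q?

    At : ℕ → Fin n → Set
    At κ a = Σ (Switch (suc D′) κ J G) λ s → a ∈ Switch.B s

    parity : ∀ {N₂ b k} → length verts ≡ h + N₂ → length verts * D ≡ b + 2 * k → N₂ * D + 2 * Xh ≡ b + 2 * k
    parity {N₂} {b} {k} s e = trans (cong (N₂ * D +_) (sym hX)) (trans (+-comm (N₂ * D) (h * D)) (trans (sym (*-distribʳ-+ D h N₂)) (trans (cong (_* D) (sym s)) e)))

    openSite : ∀ {c b₀} → length verts ≤ c → h + 1000 * suc b₀ ≤ length verts →
      length (filter leg? allX) ≤ b₀ → ∀ r → Q r → (∀ v → Q v → Conn LS v r) → (∃ λ d → Leg d) → NN (At (suc c + c * D) r)
    openSite {c} {b₀} sc big lb r qr conn leg = do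
      L ← orderLegs r qr conn leg
      go L
      where
      go : Legs → NN (At (suc c + c * D) r)
      go L = tmpl b N₂ Xh k (parity {N₂} {b} {k} size hk) (≤-trans (*-monoʳ-≤ 1000 (s≤s b≤)) N₂≥) λ rest → do
          P′ ← Place.open-planar core M P G symG pres Q Q? size rest legAt legL legAt-inj legAll ps contour inside ps-bound
          (s , q∈) ← Place.switch core M P G symG pres Q Q? size rest legAt legL legAt-inj legAll (≤-trans (≤-reflexive (sym size)) sc) P′
          return (s , q∈ r qr)
        where
        open Legs L
        b≤ : b ≤ b₀
        b≤ = ≤-trans (subst (_≤ length (filter leg? allX)) (length-tabulate {n = b} id)
          (inj-count (λ k d → legAt k ≡ d) {ys = filter leg? allX} (UP.allFin⁺ b) (λ {k} _ → legAt k , ∈-filter⁺ leg? (Finite.complete FX _) (legL k) , refl)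
            (λ ne p q → ne (legAt-inj (trans p (sym q)))))) lb
        N₂ : ℕ
        N₂ = length verts ∸ h
        size : length verts ≡ h + N₂
        size = sym (m+[n∸m]≡n (≤-trans (m≤m+n h _) big))
        N₂≥ : 1000 * suc b₀ ≤ N₂
        N₂≥ = subst (_≤ N₂) (m+n∸m≡n h (1000 * suc b₀)) (∸-monoˡ-≤ h big)
        k : ℕ
        k = proj₁ (Parity.handshake M Q Q? legAt legL legAt-inj legAll)
        hk : length verts * D ≡ b + 2 * k
        hk = proj₂ (Parity.handshake M Q Q? legAt legL legAt-inj legAll)

    closedSite : ∀ {c} → length verts ≤ c → h + 1000 ≤ length verts → (∀ d → ¬ Leg d) → ∀ r → Q r → NN (At (suc c + c * D) r)
    closedSite {c} sc big nl r qr = do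
      C ← closedRegion cs ccover nl
      go C
      where
      open PlanarR P
      go : Closed cs → NN (At (suc c + c * D) r)
      go C = tmpl 0 N₂ Xh k (parity {N₂} {0} {k} size hk) N₂≥ λ rest → do
          P′ ← Place.closed-planar core M P G symG pres Q Q? size rest nolegs (λ ()) noinj (λ d l → ⊥-elim (nl d l)) refl ps inside ps-bound
          (s , q∈) ← Place.switch core M P G symG pres Q Q? size rest nolegs (λ ()) noinj (λ d l → ⊥-elim (nl d l)) (≤-trans (≤-reflexive (sym size)) sc) P′
          return (s , q∈ r qr)
        where
        open Closed C
        N₂ : ℕ
        N₂ = length verts ∸ h
        size : length verts ≡ h + N₂
        size = sym (m+[n∸m]≡n (≤-trans (m≤m+n h _) big))
        N₂≥ : 1000 * 1 ≤ N₂
        N₂≥ = subst (_≤ N₂) (m+n∸m≡n h 1000) (∸-monoˡ-≤ h big)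
        nolegs : Fin 0 → X
        nolegs ()
        noinj : ∀ {k k′} → nolegs k ≡ nolegs k′ → k ≡ k′
        noinj {()}
        none : ∃ λ k → length verts * D ≡ 0 + 2 * k
        none = Parity.handshake M Q Q? {0} nolegs (λ ()) noinj (λ d l → ⊥-elim (nl d l))
        k : ℕ
        k = proj₁ none
        hk : length verts * D ≡ 0 + 2 * k
        hk = proj₂ none



  -- The core obtained from H; existence of regular planar graphs

  adj-delete→ : ∀ {h} (H : Graph h) {a b i j} → a ≢ b → Adj (deleteEdge H a b) i j →
    Adj H i j × ¬ (i ≡ a × j ≡ b) × ¬ (i ≡ b × j ≡ a)
  adj-delete→ H {a} {b} {i} {j} a≢b e with i FP.≟ b
  ... | yes refl with j FP.≟ a
  ... | yes refl = ⊥-elim (ff (trans (sym (trans (cong (λ r → lookup r a) (VP.lookup∘update b G₁ _)) (VP.lookup∘update a (lookup G₁ b) false))) e))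
    where
    G₁ : Graph _
    G₁ = H [ a ]≔ (lookup H a [ b ]≔ false)
    ff : false ≢ true
    ff ()
  ... | no nj = trans (sym (trans (cong (λ r → lookup r j) (VP.lookup∘update b G₁ _)) (trans (VP.lookup∘update′ nj (lookup G₁ b) false) (cong (λ r → lookup r j) (VP.lookup∘update′ (a≢b ∘ sym) H _))))) e ,
    (λ { (q , _) → a≢b (sym q) }) , (λ { (_ , q) → nj q })
    where
    G₁ : Graph _
    G₁ = H [ a ]≔ (lookup H a [ b ]≔ false)
  adj-delete→ H {a} {b} {i} {j} a≢b e | no ni with i FP.≟ a
  ... | yes refl with j FP.≟ b
  ... | yes refl = ⊥-elim (ff (trans (sym (trans (cong (λ r → lookup r b) (trans (VP.lookup∘update′ ni G₁ _) (VP.lookup∘update a H _))) (VP.lookup∘update b (lookup H a) false))) e))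
    where
    G₁ : Graph _
    G₁ = H [ a ]≔ (lookup H a [ b ]≔ false)
    ff : false ≢ true
    ff ()
  ... | no nj = trans (sym (trans (cong (λ r → lookup r j) (trans (VP.lookup∘update′ ni G₁ _) (VP.lookup∘update a H _))) (VP.lookup∘update′ nj (lookup H a) false))) e ,
    (λ { (_ , q) → nj q }) , (λ { (q , _) → ni q })
    where
    G₁ : Graph _
    G₁ = H [ a ]≔ (lookup H a [ b ]≔ false)
  adj-delete→ H {a} {b} {i} {j} a≢b e | no ni | no na =
    trans (sym (cong (λ r → lookup r j) (trans (VP.lookup∘update′ ni G₁ _) (VP.lookup∘update′ na H _)))) e ,
    (λ { (q , _) → na q }) , (λ { (q , _) → ni q })
    where
    G₁ : Graph _
    G₁ = H [ a ]≔ (lookup H a [ b ]≔ false)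

  →adj-delete : ∀ {h} (H : Graph h) {a b i j} → a ≢ b → Adj H i j → ¬ (i ≡ a × j ≡ b) → ¬ (i ≡ b × j ≡ a) →
    Adj (deleteEdge H a b) i j
  →adj-delete H {a} {b} {i} {j} a≢b e n₁ n₂ = go (i FP.≟ b) (i FP.≟ a)
    where
    G₁ : Graph _
    G₁ = H [ a ]≔ (lookup H a [ b ]≔ false)
    go : Dec (i ≡ b) → Dec (i ≡ a) → Adj (deleteEdge H a b) i j
    go (yes refl) _ = trans (cong (λ r → lookup r j) (VP.lookup∘update b G₁ _)) (trans (VP.lookup∘update′ (λ q → n₂ (refl , q)) (lookup G₁ b) false) (trans (cong (λ r → lookup r j) (VP.lookup∘update′ (a≢b ∘ sym) H _)) e))
    go (no ni) (yes refl) = trans (cong (λ r → lookup r j) (trans (VP.lookup∘update′ ni G₁ _) (VP.lookup∘update a H _))) (trans (VP.lookup∘update′ (λ q → n₁ (refl , q)) (lookup H a) false) e)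
    go (no ni) (no na) = trans (cong (λ r → lookup r j) (trans (VP.lookup∘update′ ni G₁ _) (VP.lookup∘update′ na H _))) e

  reach→conn : ∀ {n} {G : Graph n} {u v} → Reach G u v → Conn (Adj G) u v
  reach→conn here = nil
  reach→conn (step r a) = ctrans (reach→conn r) (clink a)

  module FromMap {D′ h : ℕ} (H : Graph h) (M : RMap h D′) (presents : Presents M H) (planar : RMap.PlanarR M)
    (a b : Fin h) (ab : Adj H a b) (con : Connected (deleteEdge H a b)) where
    open RMap M hiding (noloop)
    open PlanarR planar
    open Presents presents

    d₀ : X
    d₀ = a , proj₁ (adj→ ab)
    hd₀ : hd d₀ ≡ b
    hd₀ = proj₂ (adj→ ab)
    a≢b : a ≢ b
    a≢b e = RMap.noloop M a (proj₁ (adj→ ab)) (trans hd₀ (sym e))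
    core : (fs′ : List X) → Indep (Conn φL) fs′ → Cover (Conn φL) fs′ → Core D′ h (deleteEdge H a b)
    core fs′ find′ fcov = record { chain = Bead.chain M fs′ find′ fcov gen d₀ conn′ ; dis = Bead.distinct M fs′ find′ fcov gen d₀ conn′ ; enough = Bead.enough M fs′ find′ fcov gen d₀ conn′
      ; link→ = λ {i} {j} l → to (Bead.link⁻ M fs′ find′ fcov gen d₀ conn′ {i} {j} l) ; →link = λ {i} {j} e → Bead.link⁺ M fs′ find′ fcov gen d₀ conn′ {i} {j} (back e) }
      where
      L″ : Fin h → Fin h → Set
      L″ u v = ∃ λ i → hd (u , i) ≡ v × (u , i) ≢ d₀ × (u , i) ≢ α d₀
      to : ∀ {i j} → L″ i j → Adj (deleteEdge H a b) i j
      to {i} (k , refl , n₁ , n₂) = →adj-delete H a≢b (→adj i k)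
        (λ { (refl , q) → n₁ (cong (i ,_) (simple (trans q (sym hd₀)))) })
        (λ { (q , r) → n₂ (dart q r) })
        where
        dart : i ≡ b → hd (i , k) ≡ a → (i , k) ≡ α d₀
        dart q r = same (trans q (sym hd₀)) (trans r (sym (cong proj₁ (inv d₀))))
          where
          same : ∀ {d e} → proj₁ d ≡ proj₁ e → hd d ≡ hd e → d ≡ e
          same {u , _} {.u , _} refl q = cong (u ,_) (simple q)
      back : ∀ {i j} → Adj (deleteEdge H a b) i j → L″ i j
      back {i} {j} e with adj-delete→ H a≢b e
      ... | e′ , n₁ , n₂ with adj→ e′
      ... | k , refl = k , refl , (λ q → n₁ (cong proj₁ q , trans (cong hd q) hd₀)) ,
            (λ q → n₂ (trans (cong proj₁ q) hd₀ , trans (cong hd q) (cong proj₁ (inv d₀))))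
      one≤ : 1 ≤ length cs
      one≤ with ccover a
      ... | c , here _ , _ = s≤s z≤n
      ... | c , there _ , _ = s≤s z≤n
      gen : h * D + 4 ≤ 2 * h + 2 * length fs′
      gen = ≤-trans (+-monoʳ-≤ (h * D) (*-monoʳ-≤ 4 one≤)) (≤-trans genus0 (+-monoʳ-≤ (2 * h) (*-monoʳ-≤ 2 (indep≤cover connEq findep (λ {x} _ → fcov x)))))
      conn′ : ∀ u v → Conn L″ u v
      conn′ u v = cmap (λ e → clink (back e)) (reach→conn (con u v))

    coreOfMap : NN (Core D′ h (deleteEdge H a b))
    coreOfMap = do
      (fs′ , find′ , fcov) ← nn-reps FX connEq
      return (core fs′ find′ fcov)

  coreOf : ∀ {D′ h} (H : Graph h) → InP h (suc D′) H → ∀ a b → Adj H a b → Connected (deleteEdge H a b) →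
    NN (Core D′ h (deleteEdge H a b))
  coreOf {D′} H inP = FromMap.coreOfMap H (MapOf.M m) (MapOf.presents m) (MapOf.planar m)
    where
    m : MapOf H
    m = mapOf {D′ = D′} inP

  -- A patch without legs is a planar map in its own right. A ring of fillers of total size n thus
  -- gives a graph in the class.
  module Whole {n D′ f : ℕ} {A : Set} (P : Patch D′ A 0 f) (I : A ≅ Fin n)
    (gen : n * suc D′ + 4 ≤ 2 * n + 2 * f) (a₀ : A) where
    open Patch P
    open _≅_ I
    private
      X : Set
      X = Fin n × Fin (suc D′)
      dn : X → A × Fin (suc D′)
      dn (u , i) = from u , i
      upp : A × Fin (suc D′) → X
      upp (a , i) = to a , i
      du : ∀ d → dn (upp d) ≡ d
      du (a , i) = cong (_, i) (ft a)
      ud : ∀ d → upp (dn d) ≡ d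
      ud (u , i) = cong (_, i) (tf u)
      partner : ∀ d → ∃ λ e → β d ≡ inj₁ e
      partner d with β d
      ... | inj₁ e = e , refl
      ... | inj₂ ()
      α : X → X
      α d = upp (proj₁ (partner (dn d)))
      link : ∀ d → β (dn d) ≡ inj₁ (dn (α d))
      link d = trans (proj₂ (partner (dn d))) (cong inj₁ (sym (du _)))
      inj₁-inj : ∀ {x y} → inj₁ {B = Fin 0} x ≡ inj₁ {A = A × Fin (suc D′)} y → x ≡ y
      inj₁-inj refl = refl
      dn-inj : ∀ {d e} → dn d ≡ dn e → d ≡ e
      dn-inj {d} {e} q = trans (sym (ud d)) (trans (cong upp q) (ud e))
      inv : ∀ d → α (α d) ≡ d
      inv d = dn-inj (inj₁-inj (trans (sym (link (α d))) (β-sym (link d))))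

    whole : RMap n D′
    whole = record { α = α ; inv = inv ; noloop = λ u i e → noloop (link (u , i)) (sym (cong from e))
      ; simple = λ {u} {i} {j} e → cong proj₂ (simple (link (u , i)) (link (u , j)) refl (cong from e)) }

    open RMap whole using (PlanarR; φL; AdjL; φ)

    planar : PlanarR
    planar = record { fs = fs ; cs = to a₀ ∷ [] ; findep = unique→indep (UP.map⁺ inj (UP.allFin⁺ f)) indep
      ; cindep = [] ∷ [] ; ccover = λ v → to a₀ , here refl , subst (λ z → Conn AdjL z (to a₀)) (tf v) (all (from v))
      ; genus0 = subst (λ z → n * suc D′ + 4 ≤ 2 * n + 2 * z) (sym (trans (length-map rep (allFin f)) (length-tabulate {n = f} id))) gen }
      where
      rep : Fin f → X
      rep c = upp (proj₁ (lab-surj c))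
      rep-lab : ∀ c → lab (dn (rep c)) ≡ inj₂ c
      rep-lab c = trans (cong lab (du _)) (proj₂ (lab-surj c))
      fs : List X
      fs = map rep (allFin f)
      inj₂-inj : ∀ {x y : Fin f} → inj₂ {A = Fin 0} x ≡ inj₂ y → x ≡ y
      inj₂-inj refl = refl
      inj : ∀ {c c′} → rep c ≡ rep c′ → c ≡ c′
      inj {c} {c′} e = inj₂-inj (trans (sym (rep-lab c)) (trans (cong (lab ∘ dn) e) (rep-lab c′)))
      lab-conn : ∀ {d e} → Conn φL d e → lab (dn d) ≡ lab (dn e)
      lab-conn = cfold (kerEq (lab ∘ dn)) (λ { {d} refl → sym (lab-β (link d)) })
      indep : ∀ {x y} → x ∈ fs → y ∈ fs → Conn φL x y → x ≡ y
      indep i j c with ∈-map⁻ rep {xs = allFin f} i | ∈-map⁻ rep {xs = allFin f} j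
      ... | a , _ , refl | b , _ , refl = cong rep (inj₂-inj (trans (sym (rep-lab a)) (trans (lab-conn c) (rep-lab b))))
      all : ∀ a → Conn AdjL (to a) (to a₀)
      all a = cgmap to (λ { {x} (i , j , q) → clink (i , trans (sym (tf _)) (cong (to ∘ proj₁)
        (inj₁-inj (trans (sym (link (to x , i))) (trans (cong (λ z → β (z , i)) (ft x)) q))))) }) (conn a a₀)

  -- Supplies the strict inequality of the theorem in the case that there are no bad graphs at all.
  nonempty : ∀ {D′} → Template D′ → ∀ n k → n * suc D′ ≡ 2 * k → 1000 ≤ n → NN (∃ λ G → InP n (suc D′) G)
  nonempty {D′} tmpl n k e le = tmpl 0 n 0 k (trans (+-identityʳ _) e) le λ rest → return (go rest)
    where
    go : Rest D′ 0 n → ∃ λ G → InP n (suc D′) G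
    go rest = ToGraph.graph (Whole.whole patch S.iso gen a₀) , ToGraph.inP (Whole.whole patch S.iso gen a₀) (Whole.planar patch S.iso gen a₀)
      where
      module S = Sized (Rest.sized rest)
      patch : Patch D′ S.A 0 (closedFaces 0 S.f)
      patch = Closed′.patch S.chain (Rest.far rest)
      a₀ : S.A
      a₀ = proj₁ (Chain.pd S.chain lft)
      gen : n * suc D′ + 4 ≤ 2 * n + 2 * closedFaces 0 S.f
      gen = ≤-trans (+-monoˡ-≤ 4 S.enough) (≤-reflexive (ar n S.f))
        where
        ar : ∀ n f → 2 * n + 2 * f + 0 + 4 ≡ 2 * n + 2 * suc (suc f)
        ar = solve-∀

  -- Linearly many sites in every planar regular graph

  atmost1∈ : {A : Set} {P : A → Set} (P? : ∀ x → Dec (P x)) {xs : List A} → Unique xs →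
    (∀ {x y} → x ∈ xs → y ∈ xs → P x → P y → x ≡ y) → ∑ xs (λ x → 𝟙 (P? x)) ≤ 1
  atmost1∈ P? {xs} u h = subst (_≤ 1) (length-filter P? xs)
    (inj-count (λ x _ → x ∈ filter P? xs) {ys = tt ∷ []} (UP.filter⁺ P? u) (λ i → tt , here refl , i)
      (λ ne i j → let (a , p) = ∈-filter⁻ P? {xs = xs} i ; (b , q) = ∈-filter⁻ P? {xs = xs} j in ne (h a b p q)))

  At : ∀ {h n} → ℕ → ℕ → Graph h → Graph n → Fin n → Set
  At D κ J G a = Σ (Switch D κ J G) λ s → a ∈ Switch.B s

  -- Pieces are cut so sparsely that most of them have boundary at most size / Nm.
  module Constants (D′ h : ℕ) where
    abstract
      Nm z Kc cmax : ℕ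
      -- From `Nm` ≤ size and `Nm` · legs ≤ size the template's demand h + 1000 (legs + 1) ≤ size
      -- follows by adding and halving. The choice of z leaves at most n / 2 vertices in pieces with
      -- too many legs. `cmax` covers both a single piece, of size at most `Kc`, and a batch of `Nm`
      -- + 1 pieces with fewer than `Nm` vertices each.
      Nm = 2 * h + 2000
      z = 2 * Nm
      Kc = pieceBound (suc D′) z
      cmax = Kc + suc Nm * Nm

      Nm≡ : Nm ≡ 2 * h + 2000
      Nm≡ = refl
      z≡ : z ≡ 2 * Nm
      z≡ = refl
      Kc≡ : Kc ≡ pieceBound (suc D′) z
      Kc≡ = refl
      cmax≡ : cmax ≡ Kc + suc Nm * Nm
      cmax≡ = refl
      0<Kc : 0 < Kc
      0<Kc = s≤s z≤n

    κ : ℕ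
    κ = suc cmax + cmax * suc D′

  module Harvest {n D′ h : ℕ} {J : Graph h} (core : Core D′ h J) (tmpl : Template D′) (Xh : ℕ) (hX : h * suc D′ ≡ 2 * Xh)
    (M : RMap n D′) (P : RMap.PlanarR M) (G : Graph n) (symG : ∀ u v → adj G u v ≡ adj G v u) (pres : Presents M G)
    (Nm z Kc cmax : ℕ) (Nm≡ : Nm ≡ 2 * h + 2000) (z≡ : z ≡ 2 * Nm) (cm≡ : cmax ≡ Kc + suc Nm * Nm)
    (PP : Pieces M (suc z) Kc) (conn? : ∀ u v → Dec (Conn (Pieces.Un PP) u v))
    (rs : List (Fin n)) (rind : Indep (Conn (Pieces.Un PP)) rs) (rcov : Cover (Conn (Pieces.Un PP)) rs) where
    open RMap M hiding (noloop; simple)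
    open Pieces PP

    κ : ℕ
    κ = suc cmax + cmax * D

    Good : Set
    Good = ∃ λ as → Unique as × n ≤ 4 * Kc * length as × (∀ {a} → a ∈ as → At D κ J G a)

    cls : Fin n → List (Fin n)
    cls r = filter (conn? r) (allFin n)

    size legs : Fin n → ℕ
    size r = length (cls r)

    Lg : Fin n → X → Set
    Lg r d = Conn Un r (proj₁ d) × ¬ Conn Un r (hd d)

    lg? : ∀ r d → Dec (Lg r d)
    lg? r d = conn? r (proj₁ d) ×-dec ¬? (conn? r (hd d))

    legs r = length (filter (lg? r) allX)

    urs : Unique rs
    urs = AllPairs.map (λ nc e → nc (creflexive e)) rind

    size≤ : ∀ r → size r ≤ Kc
    size≤ r = small r (cls r) (UP.filter⁺ (conn? r) (UP.allFin⁺ n)) (λ i → proj₂ (∈-filter⁻ (conn? r) {xs = allFin n} i))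

    size-sum : n ≤ ∑ rs size
    size-sum = begin
      n ≡⟨ sym (trans (∑-const 1 (allFin n)) (trans (*-identityʳ _) (length-tabulate {n = n} id))) ⟩
      ∑ (allFin n) (λ _ → 1) ≤⟨ ∑-mono (allFin n) (λ {v} _ → le v) ⟩
      ∑ (allFin n) (λ v → ∑ rs (λ r → 𝟙 (conn? r v))) ≡⟨ ∑-swap _ (allFin n) rs ⟩
      ∑ rs (λ r → ∑ (allFin n) (λ v → 𝟙 (conn? r v))) ≡⟨ ∑-cong rs (λ {r} _ → sym (length-filter (conn? r) (allFin n))) ⟩
      ∑ rs size ∎
      where
      open ≤-Reasoning
      le : ∀ v → 1 ≤ ∑ rs (λ r → 𝟙 (conn? r v))
      le v with rcov v
      ... | r , r∈ , c = ≤-trans (≤-reflexive (sym (𝟙-yes (conn? r v) (csym c)))) (∑-≤-∈ (λ r → 𝟙 (conn? r v)) r∈)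

    legs-sum : ∑ rs legs ≤ length (filter cut? allX)
    legs-sum = begin
      ∑ rs legs ≡⟨ ∑-cong rs (λ {r} _ → length-filter (lg? r) allX) ⟩
      ∑ rs (λ r → ∑ allX (λ d → 𝟙 (lg? r d))) ≡⟨ ∑-swap _ rs allX ⟩
      ∑ allX (λ d → ∑ rs (λ r → 𝟙 (lg? r d))) ≤⟨ ∑-mono allX (λ {d} _ → le d (cut? d)) ⟩
      ∑ allX (λ d → 𝟙 (cut? d)) ≡⟨ sym (length-filter cut? allX) ⟩
      length (filter cut? allX) ∎
      where
      open ≤-Reasoning
      le : ∀ d (c : Dec (Cut d)) → ∑ rs (λ r → 𝟙 (lg? r d)) ≤ 𝟙 c
      le d (yes _) = atmost1∈ (λ r → lg? r d) urs (λ i j p q → indep-∈ connEq rind i j (ctrans (proj₁ p) (csym (proj₁ q))))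
      le d (no nc) = ≤-reflexive (trans (∑-cong rs (λ {r} _ → 𝟙-no (lg? r d) (λ p → proj₂ p (ctrans (proj₁ p) (clink (proj₂ d , refl , nc)))))) (∑-0 rs))

    abstract
      good? : ∀ r → Dec (Nm * legs r ≤ size r)
      good? r = Nm * legs r ≤? size r

    goods : List (Fin n)
    goods = filter good? rs

    -- Pieces that are not good have fewer than `Nm` vertices per leg, so together they contain at
    -- most n / 2 vertices. The other n / 2 lie in good pieces of at most `Kc` vertices.
    many-good : n ≤ 2 * Kc * length goods
    many-good = begin
      n ≤⟨ +-cancelʳ-≤ n _ _ (begin
        n + n ≡⟨ cong (n +_) (sym (+-identityʳ n)) ⟩
        2 * n ≤⟨ *-monoʳ-≤ 2 (≤-trans size-sum split) ⟩
        2 * (S + Nm * C) ≡⟨ ar S Nm C ⟩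
        2 * S + 2 * Nm * C ≤⟨ +-monoʳ-≤ (2 * S) (≤-trans (*-monoˡ-≤ C (≤-trans (≤-reflexive (sym z≡)) (n≤1+n z))) few) ⟩
        2 * S + n ∎) ⟩
      2 * S ≤⟨ *-monoʳ-≤ 2 S≤ ⟩
      2 * (Kc * length goods) ≡⟨ sym (*-assoc 2 Kc (length goods)) ⟩
      2 * Kc * length goods ∎
      where
      open ≤-Reasoning
      ar : ∀ s m c → 2 * (s + m * c) ≡ 2 * s + 2 * m * c
      ar = solve-∀
      S C : ℕ
      S = ∑ rs (λ r → 𝟙 (good? r) * size r)
      C = length (filter cut? allX)
      pt : ∀ r → size r ≤ 𝟙 (good? r) * size r + Nm * legs r
      pt r with good? r
      ... | yes _ = ≤-trans (≤-reflexive (sym (+-identityʳ (size r)))) (m≤m+n _ _)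
      ... | no ng = <⇒≤ (≰⇒> ng)
      split : ∑ rs size ≤ S + Nm * C
      split = begin
        ∑ rs size ≤⟨ ∑-mono rs (λ {r} _ → pt r) ⟩
        ∑ rs (λ r → 𝟙 (good? r) * size r + Nm * legs r) ≡⟨ ∑-+ _ _ rs ⟩
        S + ∑ rs (λ r → Nm * legs r) ≡⟨ cong (S +_) (∑-* Nm legs rs) ⟩
        S + Nm * ∑ rs legs ≤⟨ +-monoʳ-≤ S (*-monoʳ-≤ Nm legs-sum) ⟩
        S + Nm * C ∎
      S≤ : S ≤ Kc * length goods
      S≤ = begin
        S ≤⟨ ∑-mono rs (λ {r} _ → ≤-trans (*-monoʳ-≤ (𝟙 (good? r)) (size≤ r)) (≤-reflexive (*-comm (𝟙 (good? r)) Kc))) ⟩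
        ∑ rs (λ r → Kc * 𝟙 (good? r)) ≡⟨ ∑-* Kc _ rs ⟩
        Kc * ∑ rs (λ r → 𝟙 (good? r)) ≡⟨ cong (Kc *_) (sym (length-filter good? rs)) ⟩
        Kc * length goods ∎

    abstract
      big? : ∀ r → Dec (Nm ≤ size r)
      big? r = Nm ≤? size r

    abstract
      bigs smalls : List (Fin n)
      bigs = filter big? goods
      smalls = filter (λ r → ¬? (big? r)) goods

      bigs-unique : Unique bigs
      bigs-unique = UP.filter⁺ big? (UP.filter⁺ good? urs)

      smalls-unique : Unique smalls
      smalls-unique = UP.filter⁺ (λ r → ¬? (big? r)) (UP.filter⁺ good? urs)

      big-∈ : ∀ {t} → t ∈ bigs → (Nm * legs t ≤ size t) × Nm ≤ size t
      big-∈ i with ∈-filter⁻ big? {xs = goods} i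
      ... | j , b = proj₂ (∈-filter⁻ good? {xs = rs} j) , b

      small-∈ : ∀ {t} → t ∈ smalls → (Nm * legs t ≤ size t) × ¬ Nm ≤ size t
      small-∈ i with ∈-filter⁻ (λ r → ¬? (big? r)) {xs = goods} i
      ... | j , nb = proj₂ (∈-filter⁻ good? {xs = rs} j) , nb

      bigs-smalls : length bigs + length smalls ≡ length goods
      bigs-smalls = filter-split big? (λ r → ¬? (big? r)) (λ a b → b a) id goods

    in-class : ∀ {r u v} → Conn Un r u → Conn Un u v → Conn (Region.LS M (Conn Un r) (conn? r)) u v
    in-class ru nil = nil
    in-class ru (fwd l@(i , e , _) c) = fwd ((i , e) , ru , ctrans ru (clink l)) (in-class (ctrans ru (clink l)) c)
    in-class ru (bwd l@(i , e , _) c) = bwd ((i , e) , ctrans ru (csym (clink l)) , ru) (in-class (ctrans ru (csym (clink l))) c)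

    Nm-big : 2 * (h + 1000) ≡ Nm
    Nm-big = trans (*-distribˡ-+ 2 h 1000) (sym Nm≡)

    h+1000≤ : h + 1000 ≤ Nm
    h+1000≤ = ≤-trans (m≤m+n _ _) (≤-reflexive Nm-big)

    big-site : ∀ {r} → Nm * legs r ≤ size r → Nm ≤ size r → NN (At D κ J G r)
    big-site {r} gd bg = nn-dec {∃ λ d → Lg r d} >>= λ
      { (yes leg) → Sites.openSite core tmpl Xh hX M P G symG pres (Conn Un r) (conn? r) {cmax} {legs r}
          (≤-trans (size≤ r) (≤-trans (m≤m+n Kc _) (≤-reflexive (sym cm≡)))) enough legs≤ r nil (λ v c → csym (in-class nil c)) leg
      ; (no nl) → Sites.closedSite core tmpl Xh hX M P G symG pres (Conn Un r) (conn? r) {cmax}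
          (≤-trans (size≤ r) (≤-trans (m≤m+n Kc _) (≤-reflexive (sym cm≡)))) (≤-trans h+1000≤ bg) (λ d l → nl (d , l)) r nil }
      where
      open ≤-Reasoning
      legs≤ : length (filter (Region.leg? M (Conn Un r) (conn? r)) allX) ≤ legs r
      legs≤ = unique-⊆ {ys = filter (lg? r) allX} (UP.filter⁺ (Region.leg? M (Conn Un r) (conn? r)) (Finite.uniq FX))
        (λ i → ∈-filter⁺ (lg? r) (Finite.complete FX _) (proj₂ (∈-filter⁻ (Region.leg? M (Conn Un r) (conn? r)) {xs = allX} i)))
      ar : ∀ h b → 2 * (h + 1000 * suc b) ≡ 2 * (h + 1000) + 2000 * b
      ar = solve-∀
      enough : h + 1000 * suc (legs r) ≤ size r
      enough = *-cancelˡ-≤ 2 (begin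
        2 * (h + 1000 * suc (legs r)) ≡⟨ ar h (legs r) ⟩
        2 * (h + 1000) + 2000 * legs r ≤⟨ +-mono-≤ (≤-trans (≤-reflexive Nm-big) bg) (≤-trans (*-monoˡ-≤ (legs r) (≤-trans (m≤n+m 2000 (2 * h)) (≤-reflexive (sym Nm≡)))) gd) ⟩
        size r + size r ≡⟨ cong (size r +_) (sym (+-identityʳ (size r))) ⟩
        2 * size r ∎)

    module _ (enough : Nm ≤ length smalls) where
      ts : List (Fin n)
      ts = List.take Nm smalls

      take-∈ : ∀ {A : Set} m (xs : List A) {x} → x ∈ List.take m xs → x ∈ xs
      take-∈ (suc m) (x ∷ xs) (here e) = here e
      take-∈ (suc m) (x ∷ xs) (there i) = there (take-∈ m xs i)

      -- A good piece with fewer than `Nm` vertices has less than one leg, so it is a component of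
      -- the graph. With `Nm` further ones the region becomes large enough. The same further pieces
      -- serve for all r: sites may overlap, as each switch is made by itself and the anchor r tells
      -- them apart.
      small-site : ∀ {r} → r ∈ smalls → NN (At D κ J G r)
      small-site {r} r∈ = Sites.closedSite core tmpl Xh hX M P G symG pres Q Q? {cmax} le ge closed r (here nil)
        where
        open ≤-Reasoning
        Q : Fin n → Set
        Q v = Any (λ t → Conn Un t v) (r ∷ ts)
        Q? : ∀ v → Dec (Q v)
        Q? v = Any.any? (λ t → conn? t v) (r ∷ ts)
        mem : ∀ {t} → t ∈ r ∷ ts → t ∈ smalls
        mem (here refl) = r∈
        mem (there i) = take-∈ Nm smalls i
        split : ∀ {v} (xs : List (Fin n)) → Any (λ t → Conn Un t v) xs → ∃ λ t → t ∈ xs × Conn Un t v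
        split (x ∷ xs) (here c) = x , here refl , c
        split (x ∷ xs) (there q) = let (t , i , c) = split xs q in t , there i , c
        join : ∀ {v t} (xs : List (Fin n)) → t ∈ xs → Conn Un t v → Any (λ t → Conn Un t v) xs
        join (x ∷ xs) (here refl) c = here c
        join (x ∷ xs) (there i) c = there (join xs i c)
        len-ts : length ts ≡ Nm
        len-ts = trans (length-take Nm smalls) (m≤n⇒m⊓n≡m enough)
        ge : h + 1000 ≤ length (filter Q? (allFin n))
        ge = ≤-trans h+1000≤ (≤-trans (≤-reflexive (sym len-ts)) (unique-⊆ {ys = filter Q? (allFin n)}
          (UP.take⁺ Nm smalls-unique) (λ i → ∈-filter⁺ Q? (∈-allFin _) (there (join ts i nil)))))
        le : length (filter Q? (allFin n)) ≤ cmax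
        le = begin
          length (filter Q? (allFin n)) ≤⟨ unique-⊆ {ys = concatMap cls (r ∷ ts)} (UP.filter⁺ Q? (UP.allFin⁺ n)) sub ⟩
          length (concatMap cls (r ∷ ts)) ≡⟨ length-concatMap cls (r ∷ ts) ⟩
          ∑ (r ∷ ts) size ≤⟨ ∑-mono (r ∷ ts) (λ i → <⇒≤ (≰⇒> (proj₂ (small-∈ (mem i))))) ⟩
          ∑ (r ∷ ts) (λ _ → Nm) ≡⟨ trans (∑-const Nm (r ∷ ts)) (cong (λ k → suc k * Nm) len-ts) ⟩
          suc Nm * Nm ≤⟨ m≤n+m _ Kc ⟩
          Kc + suc Nm * Nm ≡⟨ sym cm≡ ⟩
          cmax ∎
          where
          sub : ∀ {v} → v ∈ filter Q? (allFin n) → v ∈ concatMap cls (r ∷ ts)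
          sub {v} i with split (r ∷ ts) (proj₂ (∈-filter⁻ Q? {xs = allFin n} i))
          ... | t , t∈ , c = ∈-cM⁺ cls t∈ (∈-filter⁺ (conn? t) (∈-allFin v) c)
        closed : ∀ d → ¬ (Q (proj₁ d) × ¬ Q (hd d))
        closed d (q , nq) with split (r ∷ ts) q
        ... | t , t∈ , c with small-∈ (mem t∈)
        ... | g , nb = absurd (legs t) refl
          where
          leg : d ∈ filter (lg? t) allX
          leg = ∈-filter⁺ (lg? t) (Finite.complete FX d) (c , λ c′ → nq (join (r ∷ ts) t∈ c′))
          absurd : ∀ k → legs t ≡ k → ⊥
          absurd zero e with filter (lg? t) allX | leg
          absurd zero () | x ∷ xs | i
          absurd (suc k) e = nb (≤-trans (≤-trans (m≤m*n Nm (suc k)) (≤-reflexive (cong (Nm *_) (sym e)))) g)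

    gather : ∀ xs → Unique xs → n ≤ 4 * Kc * length xs → (∀ r → r ∈ xs → NN (At D κ J G r)) → NN Good
    gather xs u le f = nn-∈ {P = At D κ J G} xs f >>= λ g → return (xs , u , le , λ {a} → g {a})

    majority : ∀ {x y} → length goods ≡ x + y → x ≤ y → n ≤ 4 * Kc * y
    majority {x} {y} e le = begin
      n ≤⟨ many-good ⟩
      2 * Kc * length goods ≡⟨ cong (2 * Kc *_) e ⟩
      2 * Kc * (x + y) ≤⟨ *-monoʳ-≤ (2 * Kc) (+-monoˡ-≤ y le) ⟩
      2 * Kc * (y + y) ≡⟨ ar Kc y ⟩
      4 * Kc * y ∎
      where
      open ≤-Reasoning
      ar : ∀ k s → 2 * k * (s + s) ≡ 4 * k * s
      ar = solve-∀

    harvest : 4 * Kc * Nm ≤ n → 0 < Kc → NN Good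
    harvest big 0<Kc = [ mostly-small , mostly-big ]′ (≤-total (length bigs) (length smalls))
      where
      mostly-small : length bigs ≤ length smalls → NN Good
      mostly-small le = gather smalls smalls-unique n≤ (λ r i → small-site enough i)
        where
        n≤ : n ≤ 4 * Kc * length smalls
        n≤ = majority (sym bigs-smalls) le
        enough : Nm ≤ length smalls
        enough = *-cancelˡ-≤ (4 * Kc) {{ℕ.>-nonZero (*-mono-≤ {1} {4} (s≤s z≤n) 0<Kc)}} (≤-trans big n≤)
      mostly-big : length smalls ≤ length bigs → NN Good
      mostly-big le = gather bigs bigs-unique (majority (sym (trans (+-comm (length smalls) _) bigs-smalls)) le)
        (λ r i → big-site (proj₁ (big-∈ i)) (proj₂ (big-∈ i)))

  module _ {n D′ h : ℕ} {J : Graph h} (core : Core D′ h J) (tmpl : Template D′) (Xh : ℕ) (hX : h * suc D′ ≡ 2 * Xh)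
    (M : RMap n D′) (P : RMap.PlanarR M) (G : Graph n) (symG : ∀ u v → adj G u v ≡ adj G v u) (pres : Presents M G) where
    open Constants D′ h

    switchesOf : 4 * Kc * Nm ≤ n →
      NN (∃ λ as → Unique as × n ≤ 4 * Kc * length as × (∀ {a′} → a′ ∈ as → At (suc D′) κ J G a′))
    switchesOf big = hyperfinite M P z λ PP₀ → go (subst (Pieces M (suc z)) (sym Kc≡) PP₀)
      where
      go : Pieces M (suc z) Kc → NN (∃ λ as → Unique as × n ≤ 4 * Kc * length as × (∀ {a′} → a′ ∈ as → At (suc D′) κ J G a′))
      go PP = do
        conn? ← nn-fin (finFinite n) (λ u → nn-fin (finFinite n) (λ v → nn-dec {Conn (Pieces.Un PP) u v}))
        (rs , rind , rcov) ← nn-reps (finFinite n) (connEq {L = Pieces.Un PP})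
        Harvest.harvest core tmpl Xh hX M P G symG pres Nm z Kc cmax Nm≡ z≡ cmax≡ PP conn? rs rind rcov big 0<Kc

  module _ {D′ h : ℕ} (tmpl : Template D′) (H : Graph h) (inP : InP h (suc D′) H)
           (a b : Fin h) (ab : Adj H a b) (con : Connected (deleteEdge H a b)) where
    open Constants D′ h

    switches : ∀ {n} (G : Graph n) → InP n (suc D′) G → 4 * Kc * Nm ≤ n →
      NN (∃ λ as → Unique as × n ≤ 4 * Kc * length as × (∀ {a′} → a′ ∈ as → At (suc D′) κ (deleteEdge H a b) G a′))
    switches {n} G inG big = do
      core ← coreOf H inP a b ab con
      switchesOf core tmpl (proj₁ even) (proj₂ even) (MapOf.M m) (MapOf.planar m) G (proj₁ (proj₁ inG)) (MapOf.presents m) big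
      where
      m : MapOf {n} {D′} G
      m = mapOf {D′ = D′} inG
      even : ∃ λ k → h * suc D′ ≡ 2 * k
      even = Parity.even-darts (MapOf.M (mapOf {D′ = D′} inP))

  -- Encoding switches, and how they change the number of disjoint appearances

  allVec : {A : Set} → List A → ∀ k → List (Vec.Vec A k)
  allVec xs zero = Vec.[] ∷ []
  allVec xs (suc k) = concatMap (λ x → map (x Vec.∷_) (allVec xs k)) xs

  allVec-complete : {A : Set} {xs : List A} → (∀ a → a ∈ xs) → ∀ {k} (v : Vec.Vec A k) → v ∈ allVec xs k
  allVec-complete c Vec.[] = here refl
  allVec-complete {xs = xs} c (a Vec.∷ v) = ∈-cM⁺ (λ x → map (x Vec.∷_) (allVec xs _)) (c a) (∈-map⁺ (a Vec.∷_) (allVec-complete c v))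

  bools : List Bool
  bools = true ∷ false ∷ []

  bools-complete : ∀ b → b ∈ bools
  bools-complete true = here refl
  bools-complete false = there (here refl)

  vec-ext : {A : Set} {k : ℕ} {u v : Vec.Vec A k} → (∀ i → lookup u i ≡ lookup v i) → u ≡ v
  vec-ext {u = Vec.[]} {Vec.[]} f = refl
  vec-ext {u = a Vec.∷ u} {b Vec.∷ v} f = cong₂ Vec._∷_ (f zero) (vec-ext (f ∘ suc))

  graph-ext : ∀ {n} {G G′ : Graph n} → (∀ u v → adj G u v ≡ adj G′ u v) → G ≡ G′
  graph-ext f = vec-ext (λ u → vec-ext (f u))

  walk-++ : ∀ {n} {G : Graph n} {a b u v w} → Walk G a u v → Walk G b v w → Walk G (b + a) u w
  walk-++ {a = a} {b} p stop = walk-≤ (m≤n+m a b) p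
  walk-++ p (move q e) = move (walk-++ p q) e

  walk-rev : ∀ {n} {G : Graph n} → (∀ u v → adj G u v ≡ adj G v u) → ∀ {k u v} → Walk G k u v → Walk G k v u
  walk-rev s stop = stop
  walk-rev {G = G} s {suc k} {u} (move {v = v} {w} p e) = subst (λ z → Walk G z w u) (+-comm k 1) (walk-++ (move {k = 0} stop (trans (s w v) e)) (walk-rev s p))

  neighbours : ∀ {n} → Graph n → Fin n → List (Fin n)
  neighbours {n} G u = filter (λ v → adj G u v BP.≟ true) (allFin n)

  nth : {A : Set} → List A → ℕ → A → A
  nth [] _ d = d
  nth (x ∷ xs) zero d = x
  nth (x ∷ xs) (suc k) d = nth xs k d

  nth-index : {A : Set} {xs : List A} {v d : A} (i : v ∈ xs) → nth xs (toℕ (Any.index i)) d ≡ v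
  nth-index (here e) = sym e
  nth-index (there i) = nth-index i

  nth-∈ : {A : Set} {xs : List A} {d : A} → d ∈ xs → ∀ k → nth xs k d ∈ xs
  nth-∈ {xs = xs} {d} i k = [ (λ e → subst (_∈ xs) (sym e) i) , id ]′ (go xs k)
    where
    go : ∀ ys k → nth ys k d ≡ d ⊎ nth ys k d ∈ ys
    go [] k = inj₁ refl
    go (y ∷ ys) zero = inj₂ (here refl)
    go (y ∷ ys) (suc k) = [ inj₁ , inj₂ ∘ there ]′ (go ys k)

  unique-fibres : {A B : Set} (f : A → List B) {xs : List A} → Unique xs → (∀ a → Unique (f a)) →
    Unique (concatMap (λ a → map (a ,_) (f a)) xs)
  unique-fibres f [] uf = []
  unique-fibres f {x ∷ xs} (q ∷ u) uf = UP.++⁺ (UP.map⁺ (cong proj₂) (uf x)) (unique-fibres f u uf) dis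
    where
    fibre : ∀ {y} ys {p} → p ∈ map (y ,_) ys → proj₁ p ≡ y
    fibre (z ∷ zs) (here refl) = refl
    fibre (z ∷ zs) (there i) = fibre zs i
    dis : ∀ {p} → p ∈ map (x ,_) (f x) × p ∈ concatMap (λ a → map (a ,_) (f a)) xs → ⊥
    dis {p} (i , j) = go xs q j
      where
      go : ∀ zs → All (x ≢_) zs → ¬ p ∈ concatMap (λ a → map (a ,_) (f a)) zs
      go (z ∷ zs) (n ∷ ns) k with ∈-++⁻ (map (z ,_) (f z)) k
      ... | inj₁ l = n (trans (sym (fibre (f x) i)) (fibre (f z) l))
      ... | inj₂ l = go zs ns l

  fibres-∈ : {A B : Set} (f : A → List B) {xs : List A} {p : A × B} → p ∈ concatMap (λ a → map (a ,_) (f a)) xs →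
    proj₁ p ∈ xs × proj₂ p ∈ f (proj₁ p)
  fibres-∈ f {x ∷ xs} k with ∈-++⁻ (map (x ,_) (f x)) k
  ... | inj₂ l = let (i , j) = fibres-∈ f {xs} l in there i , j
  ... | inj₁ l with ∈-map⁻ (x ,_) l
  ... | b , b∈ , refl = here refl , b∈

  -- walks are encoded by words: the letter zero stays put, suc i goes to the i-th neighbour
  module Words {n : ℕ} (D : ℕ) (G : Graph n) where
    letter : Fin n → Fin (suc D) → Fin n
    letter u zero = u
    letter u (suc i) = nth (neighbours G u) (toℕ i) u

    run : ∀ {k} → Fin n → Vec.Vec (Fin (suc D)) k → Fin n
    run u Vec.[] = u
    run u (a Vec.∷ w) = letter (run u w) a

    module _ (reg : Regular D G) where
      degree-length : ∀ u → length (neighbours G u) ≡ D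
      degree-length u = trans (sym (countF-filter n (adj G u))) (reg u)

      word : ∀ {k u v} → Walk G k u v → ∃ λ (w : Vec.Vec (Fin (suc D)) k) → run u w ≡ v
      word {zero} stop = Vec.[] , refl
      word {suc k} {u} stop = let (w , e) = word {k} {u} stop in zero Vec.∷ w , e
      word {suc k} {u} {v} (move {v = x} p a) = let (w , e) = word p in
        suc (fromℕ< lt) Vec.∷ w , trans (cong (λ z → nth (neighbours G z) (toℕ (fromℕ< lt)) z) e) (trans (cong (λ i → nth (neighbours G x) i x) (FP.toℕ-fromℕ< lt)) (nth-index m))
        where
        m : v ∈ neighbours G x
        m = ∈-filter⁺ (λ v → adj G x v BP.≟ true) (∈-allFin v) a
        lt : toℕ (Any.index m) < D
        lt = subst (toℕ (Any.index m) <_) (degree-length x) (FP.toℕ<n (Any.index m))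

  module Codes (D κ : ℕ) where
    -- Words that lead from a vertex of the appearance to κ positions, the adjacencies of the old
    -- graph among these positions, and the index of the anchor. A word has 2 κ letters: at most κ
    -- steps back to `w`, then at most κ to the position. The number of codes does not depend on n.
    Code : Set
    Code = Vec.Vec (Vec.Vec (Fin (suc D)) (κ + κ)) κ × Vec.Vec (Vec.Vec Bool κ) κ × Fin κ

    codes : List Code
    codes = cartesianProduct (allVec (allVec (allFin (suc D)) (κ + κ)) κ) (cartesianProduct (allVec (allVec bools κ) κ) (allFin κ))

    codes-complete : ∀ c → c ∈ codes
    codes-complete (a , b , i) = ∈-cartesianProduct⁺ (allVec-complete (allVec-complete ∈-allFin) a) (∈-cartesianProduct⁺ (allVec-complete (allVec-complete bools-complete) b) (∈-allFin i))

  module Counting {n h : ℕ} (D κ : ℕ) (J : Graph h) where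
    open Codes D κ

    Set′ : Set
    Set′ = Vec.Vec Bool n

    Disj : Set′ → Set′ → Set
    Disj U W = ∀ v → v ∈S U → ¬ v ∈S W

    Family : Graph n → List Set′ → Set
    Family G Ws = AllPairs Disj Ws × All (TwoAppears J G) Ws

    AtMost : ℕ → Graph n → Set
    AtMost j G = ∀ Ws → Family G Ws → length Ws ≤ j

    elems : Set′ → List (Fin n)
    elems W = filter (λ v → lookup W v BP.≟ true) (allFin n)

    ∈-elems : ∀ {W v} → v ∈S W → v ∈ elems W
    ∈-elems {W} e = ∈-filter⁺ (λ v → lookup W v BP.≟ true) (∈-allFin _) e

    elems-∈ : ∀ {W v} → v ∈ elems W → v ∈S W
    elems-∈ {W} i = proj₂ (∈-filter⁻ (λ v → lookup W v BP.≟ true) {xs = allFin n} i)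

    some : ∀ {G} {W : Set′} → TwoAppears J G W → ∃ λ v → v ∈S W
    some (_ , (r₁ , _ , _ , _ , m , _)) = r₁ , m

    elems-small : ∀ {G} {W : Set′} → TwoAppears J G W → length (elems W) ≤ h
    elems-small {W = W} ((σ , _ , mem , _) , _) = subst (length (elems W) ≤_) (trans (length-map σ (allFin h)) (length-tabulate {n = h} id))
      (unique-⊆ {ys = map σ (allFin h)} (UP.filter⁺ (λ v → lookup W v BP.≟ true) (UP.allFin⁺ n))
        (λ {v} i → let (k , e) = Equivalence.to (mem v) (elems-∈ {W} i) in subst (_∈ map σ (allFin h)) e (∈-map⁺ σ (∈-allFin k))))

    atMost-n : ∀ G → AtMost n G
    atMost-n G Ws (dj , ap) = subst (length Ws ≤_) (length-tabulate {n = n} id)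
      (inj-count (λ W v → v ∈S W) {ys = allFin n} dj (λ {W} i → let (v , m) = some {G} {W} (All.lookup ap i) in v , ∈-allFin v , m) (λ {U} {W} {v} d a b → d v a b))

    family-unique : ∀ {G Ws} → Family G Ws → Unique Ws
    family-unique ([] , _) = []
    family-unique {G} {U ∷ _} (d ∷ ds , a ∷ as) = All.map (λ {W} dj e → let (v , m) = some {G} {U} a in dj v m (subst (v ∈S_) e m)) d ∷ family-unique {G} (ds , as)

    touch? : ∀ (U : List (Fin n)) (W : Set′) → Dec (Any (λ v → v ∈S W) U)
    touch? U W = Any.any? (λ v → lookup W v BP.≟ true) U

    module _ {G : Graph n} (s : Switch D κ J G) where
      open Switch s
      private
        symG′ : ∀ u v → adj G′ u v ≡ adj G′ v u
        symG′ = proj₁ (proj₁ inP)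

      zone : List (Fin n)
      zone = B ++ concatMap (neighbours G′) B

      zone-size : length zone ≤ κ + κ * D
      zone-size = ≤-trans (≤-reflexive (trans (length-++ B) (cong (length B +_) (trans (length-concatMap (neighbours G′) B)
        (trans (∑-cong B (λ {u} _ → Words.degree-length D G′ (proj₁ (proj₂ inP)) u)) (∑-const D B)))))) (+-mono-≤ B≤ (*-monoˡ-≤ D B≤))

      -- An appearance that avoids `B` keeps its inner edges and its leaving edges. The
      -- non-adjacency of v₁ and v₂ could be affected only with v₁ in `B`; then r₁ would be a
      -- neighbour of `B`, and for this reason the zone includes the neighbours.
      survives : ∀ {W} → ¬ Any (λ v → v ∈S W) zone → TwoAppears J G′ W → TwoAppears J G W
      survives {W} nt ((σ , inc , mem , ad) , (r₁ , v₁ , r₂ , v₂ , m₁ , m₂ , n₁ , n₂ , e₁ , e₂ , nr , nv , na , lv)) =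
        (σ , inc , mem , λ i j → trans (ad i j) (sym (agree (σ i) (σ j) (inj₁ (outB (Equivalence.from (mem (σ i)) (i , refl))))))) ,
        (r₁ , v₁ , r₂ , v₂ , m₁ , m₂ , n₁ , n₂ , trans (at m₁) e₁ , trans (at m₂) e₂ , nr , nv , trans (agree v₁ v₂ (inj₁ v₁∉)) na ,
         λ r v m n e → lv r v m n (trans (sym (at m)) e))
        where
        lose : ∀ {v} → v ∈ zone → v ∈S W → Any (λ v → v ∈S W) zone
        lose {v} i m = go i
          where
          go : ∀ {xs} → v ∈ xs → Any (λ v → v ∈S W) xs
          go (here refl) = here m
          go (there j) = there (go j)
        outB : ∀ {v} → v ∈S W → v ∉ B
        outB m i = nt (lose (∈-++⁺ˡ i) m)
        at : ∀ {r v} → r ∈S W → adj G r v ≡ adj G′ r v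
        at {r} {v} m = agree r v (inj₁ (outB m))
        v₁∉ : v₁ ∉ B
        v₁∉ i = nt (lose (∈-++⁺ʳ B (∈-cM⁺ (neighbours G′) i (∈-filter⁺ (λ v → adj G′ v₁ v BP.≟ true) (∈-allFin r₁) (trans (symG′ v₁ r₁) e₁)))) m₁)

      -- Disjoint appearances that meet the zone use up different vertices of it. The others were
      -- present before the switch.
      lipschitz : ∀ {j} → AtMost j G → AtMost (j + (κ + κ * D)) G′
      lipschitz {j} am Ws (dj , ap) = begin
        length Ws ≡⟨ sym (filter-split (λ W → ¬? (touch? zone W)) (touch? zone) (λ a b → a b) (λ {W} nn → decidable-stable (touch? zone W) nn) Ws) ⟩
        length (filter (λ W → ¬? (touch? zone W)) Ws) + length (filter (touch? zone) Ws)
          ≤⟨ +-mono-≤ (am _ (APP.filter⁺ (λ W → ¬? (touch? zone W)) dj , All.tabulate (λ {W} i → let (k , nt) = ∈-filter⁻ (λ W → ¬? (touch? zone W)) {xs = Ws} i in survives {W} nt (All.lookup ap k))))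
               (≤-trans (inj-count (λ W v → v ∈S W) {ys = zone} (APP.filter⁺ (touch? zone) dj) (λ {W} i → hit W zone (proj₂ (∈-filter⁻ (touch? zone) {xs = Ws} i))) (λ {U} {W} {v} d a b → d v a b)) zone-size) ⟩
        j + (κ + κ * D) ∎
        where
        open ≤-Reasoning
        hit : ∀ W xs → Any (λ v → v ∈S W) xs → ∃ λ v → v ∈ xs × v ∈S W
        hit W (x ∷ xs) (here m) = x , here refl , m
        hit W (x ∷ xs) (there q) = let (v , i , m) = hit W xs q in v , there i , m

    place : Graph n × (Fin n × Code) → Fin κ → Fin n
    place (G′ , v , ws , _) i = Words.run D G′ v (lookup ws i)

    record Decodes (p : Graph n × Fin n) (q : Graph n × (Fin n × Code)) : Set where
      field
        same   : ∀ u v → (∀ i → place q i ≢ u) ⊎ (∀ i → place q i ≢ v) → adj (proj₁ p) u v ≡ adj (proj₁ q) u v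
        bits   : ∀ i j → lookup (lookup (proj₁ (proj₂ (proj₂ (proj₂ q)))) i) j ≡ adj (proj₁ p) (place q i) (place q j)
        anchor : place q (proj₂ (proj₂ (proj₂ (proj₂ q)))) ≡ proj₂ p

    -- Away from the positions the old graph coincides with the new one, and among the positions it
    -- is recorded bit by bit.
    decodes-inj : ∀ {p p′ q} → Decodes p q → Decodes p′ q → p ≡ p′
    decodes-inj {p} {p′} {q} d d′ = cong₂ _,_ (graph-ext eq) (trans (sym D₁.anchor) D₂.anchor)
      where
      module D₁ = Decodes d
      module D₂ = Decodes d′
      seen? : ∀ u → Dec (∃ λ i → place q i ≡ u)
      seen? u = FP.any? (λ i → place q i FP.≟ u)
      eq : ∀ u v → adj (proj₁ p) u v ≡ adj (proj₁ p′) u v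
      eq u v with seen? u | seen? v
      ... | yes (i , refl) | yes (j , refl) = trans (sym (D₁.bits i j)) (D₂.bits i j)
      ... | no nu | _ = trans (D₁.same u v (inj₁ λ i e → nu (i , e))) (sym (D₂.same u v (inj₁ λ i e → nu (i , e))))
      ... | yes _ | no nv = trans (D₁.same u v (inj₂ λ i e → nv (i , e))) (sym (D₂.same u v (inj₂ λ i e → nv (i , e))))

    encode : ∀ {G a v} (s : Switch D κ J G) → a ∈ Switch.B s → v ∈S Switch.W s → ∃ λ c → Decodes (G , a) (Switch.G′ s , v , c)
    encode {G} {a} {v} s a∈ v∈ = c , record
      { same = λ x y ne → agree x y ([ (λ f → inj₁ (missed f)) , (λ f → inj₂ (missed f)) ]′ ne)
      ; bits = λ i j → trans (cong (λ r → lookup r j) (lookup∘tabulate _ i)) (trans (lookup∘tabulate _ j) (cong₂ (adj G) (sym (place≡ i)) (sym (place≡ j))))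
      ; anchor = trans (place≡ _) (pos-index a∈) }
      where
      open Switch s
      pos : Fin κ → Fin n
      pos i = nth B (toℕ i) a
      index : ∀ {x} → x ∈ B → Fin κ
      index i = fromℕ< (≤-trans (FP.toℕ<n (Any.index i)) B≤)
      pos-index : ∀ {x} (i : x ∈ B) → pos (index i) ≡ x
      pos-index i = trans (cong (λ k → nth B k a) (FP.toℕ-fromℕ< _)) (nth-index i)
      spell : ∀ i → ∃ λ w → Words.run D G′ v w ≡ pos i
      spell i = Words.word D G′ (proj₁ (proj₂ inP)) (walk-++ (walk-rev (proj₁ (proj₁ inP)) (near (W⊆B v∈))) (near (nth-∈ a∈ (toℕ i))))
      c : Code
      c = tabulate (λ i → proj₁ (spell i)) , tabulate (λ i → tabulate (λ j → adj G (pos i) (pos j))) , index a∈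
      place≡ : ∀ i → place (G′ , v , c) i ≡ pos i
      place≡ i = trans (cong (Words.run D G′ v) (lookup∘tabulate _ i)) (proj₂ (spell i))
      missed : ∀ {x} → (∀ i → place (G′ , v , c) i ≢ x) → x ∉ B
      missed f i = f (index i) (trans (place≡ _) (pos-index i))

    atMost-mono : ∀ {i j G} → i ≤ j → AtMost i G → AtMost j G
    atMost-mono le am Ws f = ≤-trans (am Ws f) le

    elems-∈-concat : ∀ {v} Us → v ∈ concatMap elems Us → ∃ λ U → U ∈ Us × v ∈S U
    elems-∈-concat (U ∷ Us) i with ∈-++⁻ (elems U) i
    ... | inj₁ j = U , here refl , elems-∈ {U} j
    ... | inj₂ j = let (U′ , k , m) = elems-∈-concat Us j in U′ , there k , m

    -- the members of a maximal disjoint family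
    hitting : ∀ {j G} → AtMost j G → NN (∃ λ U → length U ≤ j * h × (∀ {W} → TwoAppears J G W → ∃ λ v → v ∈ U × v ∈S W))
    hitting {j} {G} am = do
      -- A family of greatest length appears as one of least deficit. Because `AtMost` caps the
      -- lengths at j, adding a set makes the truncated difference strictly smaller.
      (m , (𝓜 , fam , e) , mn) ← nn-min {λ m → ∃ λ 𝓜 → Family G 𝓜 × m ≡ j ∸ length 𝓜} j j ≤-refl ([] , ([] , []) , refl)
      return (concatMap elems 𝓜 , small 𝓜 fam , λ {W} ap → hit 𝓜 fam (subst (λ k → ∀ i → _ → k ≤ i) e mn) {W} ap (touch? (concatMap elems 𝓜) W))
      where
      open ≤-Reasoning
      small : ∀ 𝓜 → Family G 𝓜 → length (concatMap elems 𝓜) ≤ j * h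
      small 𝓜 fam = begin
        length (concatMap elems 𝓜) ≡⟨ length-concatMap elems 𝓜 ⟩
        ∑ 𝓜 (length ∘ elems) ≤⟨ ∑-mono 𝓜 (λ {U} i → elems-small {G} {U} (All.lookup (proj₂ fam) i)) ⟩
        ∑ 𝓜 (λ _ → h) ≡⟨ ∑-const h 𝓜 ⟩
        length 𝓜 * h ≤⟨ *-monoˡ-≤ h (am 𝓜 fam) ⟩
        j * h ∎
      find : ∀ {W : Set′} xs → Any (λ v → v ∈S W) xs → ∃ λ v → v ∈ xs × v ∈S W
      find (x ∷ xs) (here m) = x , here refl , m
      find {W} (x ∷ xs) (there q) = let (v , i , m) = find {W} xs q in v , there i , m
      lose : ∀ {W : Set′} {v} xs → v ∈ xs → v ∈S W → Any (λ v → v ∈S W) xs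
      lose (x ∷ xs) (here refl) m = here m
      lose {W} (x ∷ xs) (there i) m = there (lose {W} xs i m)
      hit : ∀ 𝓜 → Family G 𝓜 → (∀ i → (∃ λ 𝓜′ → Family G 𝓜′ × i ≡ j ∸ length 𝓜′) → j ∸ length 𝓜 ≤ i) →
        ∀ {W} → TwoAppears J G W → Dec (Any (λ v → v ∈S W) (concatMap elems 𝓜)) → ∃ λ v → v ∈ concatMap elems 𝓜 × v ∈S W
      hit 𝓜 fam mn {W} ap (yes q) = find {W} (concatMap elems 𝓜) q
      hit 𝓜 (dj , aps) mn {W} ap (no nq) = ⊥-elim (<⇒≱ (∸-monoʳ-< (n<1+n (length 𝓜)) (am _ bigger)) (mn _ (W ∷ 𝓜 , bigger , refl)))
        where
        bigger : Family G (W ∷ 𝓜)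
        bigger = All.tabulate (λ {U} i v vW vU → nq (lose {W} (concatMap elems 𝓜) (∈-cM⁺ elems i (∈-elems {U} vU)) vW)) ∷ dj , ap ∷ aps

  -- Growth of the levels

  module Levels {n h : ℕ} (D κ : ℕ) (J : Graph h) (K : ℕ) (all : List (Graph n)) (uall : Unique all)
    (inAll : ∀ G → InP n D G → G ∈ all) (allIn : ∀ G → G ∈ all → InP n D G) where
    open Codes D κ
    open Counting {n} {h} D κ J

    Measured : Graph n → Set
    Measured G = ∃ λ m → AtMost m G × (∀ j → AtMost j G → m ≤ j)

    -- Data are collected for all Boolean matrices, so that they can be used as functions of the
    -- graph. Outside the class the list of anchors may be empty, hence the condition in front of
    -- the bound.
    Sources : Graph n → Set
    Sources G = ∃ λ as → Unique as × (InP n D G → n ≤ K * length as) × (∀ {a} → a ∈ as → At D κ J G a)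

    Hitting : Graph n → ℕ → Set
    Hitting G m = ∃ λ U → length U ≤ m * h × (∀ {W} → TwoAppears J G W → ∃ λ v → v ∈ U × v ∈S W)

    Survey : Graph n → Set
    Survey G = Sources G × Σ (Measured G) λ m → Hitting G (proj₁ m)

    L Q : ℕ
    L = κ + κ * D
    Q = K * (h * length codes)

    module Count (dat : ∀ G → Survey G) where
      as : Graph n → List (Fin n)
      as G = proj₁ (proj₁ (dat G))

      m : Graph n → ℕ
      m G = proj₁ (proj₁ (proj₂ (dat G)))

      U : Graph n → List (Fin n)
      U G = proj₁ (proj₂ (proj₂ (dat G)))

      level : ℕ → List (Graph n)
      level j = filter (λ G → m G ≤? j) all

      level-∈ : ∀ {j G} → G ∈ level j → G ∈ all × m G ≤ j
      level-∈ {j} i = ∈-filter⁻ (λ G → m G ≤? j) {xs = all} i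

      in-level : ∀ {j G} → InP n D G → AtMost j G → G ∈ level j
      in-level {j} {G} p am = ∈-filter⁺ (λ G → m G ≤? j) (inAll G p) (proj₂ (proj₂ (proj₁ (proj₂ (dat G)))) j am)

      pairs : ℕ → List (Graph n × Fin n)
      pairs j = concatMap (λ G → map (G ,_) (as G)) (level j)

      targets : ℕ → List (Graph n × (Fin n × Code))
      targets j = concatMap (λ G → map (G ,_) (cartesianProduct (U G) codes)) (level j)

      pairs-size : ∀ j → length (level j) * n ≤ K * length (pairs j)
      pairs-size j = begin
        length (level j) * n ≡⟨ sym (∑-const n (level j)) ⟩
        ∑ (level j) (λ _ → n) ≤⟨ ∑-mono (level j) (λ {G} i → proj₁ (proj₂ (proj₂ (proj₁ (dat G)))) (allIn G (proj₁ (level-∈ {j} i)))) ⟩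
        ∑ (level j) (λ G → K * length (as G)) ≡⟨ ∑-* K _ (level j) ⟩
        K * ∑ (level j) (λ G → length (as G)) ≡⟨ cong (K *_) (sym (trans (length-concatMap _ (level j)) (∑-cong (level j) (λ {G} _ → length-map (G ,_) (as G))))) ⟩
        K * length (pairs j) ∎
        where open ≤-Reasoning

      targets-size : ∀ j → length (targets j) ≤ length (level j) * (j * h * length codes)
      targets-size j = begin
        length (targets j) ≡⟨ trans (length-concatMap _ (level j)) (∑-cong (level j) (λ {G} _ → trans (length-map (G ,_) (cartesianProduct (U G) codes)) (length-cart (U G) codes))) ⟩
        ∑ (level j) (λ G → length (U G) * length codes) ≤⟨ ∑-mono (level j) (λ {G} i → *-monoˡ-≤ (length codes) (≤-trans (proj₁ (proj₂ (proj₂ (proj₂ (dat G))))) (*-monoˡ-≤ h (proj₂ (level-∈ {j} i))))) ⟩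
        ∑ (level j) (λ _ → j * h * length codes) ≡⟨ ∑-const _ (level j) ⟩
        length (level j) * (j * h * length codes) ∎
        where open ≤-Reasoning

      decode : ∀ j {p} → p ∈ pairs j → ∃ λ q → q ∈ targets (j + L) × Decodes p q
      decode j {G , a} i with fibres-∈ as {level j} i
      ... | G∈ , a∈ with proj₂ (proj₂ (proj₂ (proj₁ (dat G)))) a∈
      ... | s , aB with proj₂ (proj₂ (proj₂ (proj₂ (dat (Switch.G′ s))))) {Switch.W s} (Switch.app s)
      ... | v , vU , vW with encode s aB vW
      ... | c , d = (Switch.G′ s , v , c) ,
        ∈-cM⁺ (λ G → map (G ,_) (cartesianProduct (U G) codes))
          (in-level {j + L} (Switch.inP s) (lipschitz s {j} (atMost-mono {G = G} (proj₂ (level-∈ {j} G∈)) (proj₁ (proj₂ (proj₁ (proj₂ (dat G))))))))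
          (∈-map⁺ (Switch.G′ s ,_) (∈-cartesianProduct⁺ vU (codes-complete c))) , d

      -- Double counting of graphs with an anchor: every graph of level j has at least n / K
      -- anchors. Encoding maps these pairs injectively to a graph of level j + L, a vertex of its
      -- hitting set, of which there are at most (j + L) h, and a code.
      transfer : ∀ j → length (level j) * n ≤ Q * (j + L) * length (level (j + L))
      transfer j = begin
        length (level j) * n ≤⟨ pairs-size j ⟩
        K * length (pairs j) ≤⟨ *-monoʳ-≤ K (inj-count Decodes (unique-fibres as (UP.filter⁺ (λ G → m G ≤? j) uall) (λ G → proj₁ (proj₂ (proj₁ (dat G))))) (decode j) (λ ne d d′ → ne (decodes-inj d d′))) ⟩
        K * length (targets (j + L)) ≤⟨ *-monoʳ-≤ K (targets-size (j + L)) ⟩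
        K * (length (level (j + L)) * ((j + L) * h * length codes)) ≡⟨ ar K (length (level (j + L))) (j + L) h (length codes) ⟩
        Q * (j + L) * length (level (j + L)) ∎
        where
        open ≤-Reasoning
        ar : ∀ k l j h c → k * (l * (j * h * c)) ≡ k * (h * c) * j * l
        ar = solve-∀

      growth : ∀ j → 0 < n → 8 * Q * (j + L) ≤ n → length (level j) * 8 ≤ length (level (j + L))
      growth j 0<n le = *-cancelʳ-≤ _ _ n {{ℕ.>-nonZero 0<n}} (begin
        length (level j) * 8 * n ≡⟨ ar (length (level j)) n ⟩
        8 * (length (level j) * n) ≤⟨ *-monoʳ-≤ 8 (transfer j) ⟩
        8 * (Q * (j + L) * length (level (j + L))) ≡⟨ ar′ Q (j + L) (length (level (j + L))) ⟩
        length (level (j + L)) * (8 * Q * (j + L)) ≤⟨ *-monoʳ-≤ (length (level (j + L))) le ⟩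
        length (level (j + L)) * n ∎)
        where
        open ≤-Reasoning
        ar : ∀ l n → l * 8 * n ≡ 8 * (l * n)
        ar = solve-∀
        ar′ : ∀ q j l → 8 * (q * j * l) ≡ l * (8 * q * j)
        ar′ = solve-∀

      tower : ∀ t i → 0 < n → 8 * Q * (t + i * L) ≤ n → length (level t) * 8 ^ i ≤ length (level (t + i * L))
      tower t zero 0<n le = ≤-reflexive (trans (*-identityʳ _) (cong (length ∘ level) (sym (+-identityʳ t))))
      tower t (suc i) 0<n le = begin
        length (level t) * (8 * 8 ^ i) ≡⟨ ar (length (level t)) (8 ^ i) ⟩
        length (level t) * 8 ^ i * 8 ≤⟨ *-monoˡ-≤ 8 (tower t i 0<n (≤-trans (*-monoʳ-≤ (8 * Q) (+-monoʳ-≤ t (m≤n+m (i * L) L))) le)) ⟩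
        length (level (t + i * L)) * 8 ≤⟨ growth (t + i * L) 0<n (≤-trans (≤-reflexive (cong (8 * Q *_) shift)) le) ⟩
        length (level (t + i * L + L)) ≡⟨ cong (length ∘ level) shift ⟩
        length (level (t + (L + i * L))) ∎
        where
        open ≤-Reasoning
        ar : ∀ l e → l * (8 * e) ≡ l * e * 8
        ar = solve-∀
        shift : t + i * L + L ≡ t + (L + i * L)
        shift = trans (+-assoc t (i * L) L) (cong (t +_) (+-comm (i * L) L))

      -- The climb has t steps of height `L` and starts from level t, not from 0, since the bad
      -- graphs lie there. It ends at level t + t L = t (L + 1), and the condition on n allows
      -- growth by 8 up to that level.
      few : ∀ {bad} t → 0 < n → 8 * Q * (t * suc L) ≤ n → Unique bad → (∀ {G} → G ∈ bad → InP n D G × AtMost t G) →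
        length bad * 8 ^ t ≤ length all
      few {bad} t 0<n le ub sub = begin
        length bad * 8 ^ t ≤⟨ *-monoˡ-≤ (8 ^ t) (unique-⊆ ub (λ i → in-level {t} (proj₁ (sub i)) (proj₂ (sub i)))) ⟩
        length (level t) * 8 ^ t ≤⟨ tower t t 0<n (≤-trans (≤-reflexive (cong (8 * Q *_) (sym (*-suc t L)))) le) ⟩
        length (level (t + t * L)) ≤⟨ unique-⊆ {ys = all} (UP.filter⁺ (λ G → m G ≤? (t + t * L)) uall) (λ i → proj₁ (level-∈ {t + t * L} i)) ⟩
        length all ∎
        where open ≤-Reasoning

    few-bad : (∀ G → InP n D G → NN (∃ λ as → Unique as × n ≤ K * length as × (∀ {a} → a ∈ as → At D κ J G a))) →
      ∀ {bad} t → 0 < n → 8 * Q * (t * suc L) ≤ n → Unique bad → (∀ {G} → G ∈ bad → InP n D G × AtMost t G) →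
      NN (length bad * 8 ^ t ≤ length all)
    few-bad sw t 0<n le ub sub = do
      dat ← nn-list (allVec (allVec bools n) n) measure
      return (Count.few (λ G → dat (allVec-complete (allVec-complete bools-complete) G)) t 0<n le ub sub)
      where
      sources : ∀ G → NN (Sources G)
      sources G = nn-dec {InP n D G} >>= λ
        { (yes p) → sw G p >>= λ { (as , u , le , at) → return (as , u , (λ _ → le) , λ {a} → at {a}) }
        ; (no np) → return ([] , [] , (λ p → ⊥-elim (np p)) , λ ()) }
      measure : ∀ G → NN (Survey G)
      measure G = do
        s ← sources G
        (k , am , mn) ← nn-min {λ j → AtMost j G} n n ≤-refl (atMost-n G)
        hit ← hitting {k} {G} am
        return (s , (k , am , mn) , hit)

  -- A bound for the exponential series

  -- multichoose M k = C (M + k ∸ 1) k, the coefficient of yᵏ in (1 − y)⁻ᴹ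
  multichoose : ℕ → ℕ → ℕ
  multichoose _       zero    = 1
  multichoose zero    (suc k) = 0
  multichoose (suc M) (suc k) = multichoose (suc M) k + multichoose M (suc k)

  -- Two quotients of neighbouring binomial coefficients, with denominators cleared. The inductive
  -- step of each uses the other, so they are proved together.
  multichoose-ratio : ∀ M k → suc k * multichoose M (suc k) ≡ (M + k) * multichoose M k
  multichoose-shift : ∀ M k → M * multichoose (suc M) k ≡ (M + k) * multichoose M k
  multichoose-ratio zero zero = refl
  multichoose-ratio zero (suc k) = trans (*-zeroʳ k) (sym (*-zeroʳ k))
  multichoose-ratio (suc M) k = begin
    suc k * (multichoose (suc M) k + multichoose M (suc k)) ≡⟨ *-distribˡ-+ (suc k) _ (multichoose M (suc k)) ⟩
    suc k * multichoose (suc M) k + suc k * multichoose M (suc k)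
      ≡⟨ cong (suc k * multichoose (suc M) k +_) (trans (multichoose-ratio M k) (sym (multichoose-shift M k))) ⟩
    suc k * multichoose (suc M) k + M * multichoose (suc M) k ≡⟨ ar k M (multichoose (suc M) k) ⟩
    (suc M + k) * multichoose (suc M) k ∎
    where
    open ≡-Reasoning
    ar : ∀ k M b → suc k * b + M * b ≡ (suc M + k) * b
    ar = solve-∀
  multichoose-shift M zero = cong (_* 1) (sym (+-identityʳ M))
  multichoose-shift M (suc k) = begin
    M * (multichoose (suc M) k + multichoose M (suc k)) ≡⟨ *-distribˡ-+ M _ (multichoose M (suc k)) ⟩
    M * multichoose (suc M) k + M * multichoose M (suc k)
      ≡⟨ cong (_+ M * multichoose M (suc k)) (trans (multichoose-shift M k) (sym (multichoose-ratio M k))) ⟩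
    suc k * multichoose M (suc k) + M * multichoose M (suc k) ≡⟨ ar k M (multichoose M (suc k)) ⟩
    (M + suc k) * multichoose M (suc k) ∎
    where
    open ≡-Reasoning
    ar : ∀ k M b → suc k * b + M * b ≡ (M + suc k) * b
    ar = solve-∀

  -- 2ᴷ times the K-th partial sum of (1 − y)⁻ᴹ at y = ½
  halves : ℕ → ℕ → ℕ
  halves M zero    = 1
  halves M (suc K) = 2 * halves M K + multichoose M (suc K)

  -- The identity (1 - y)⁻ᴹ = (1 - y) (1 - y)⁻⁽ᴹ⁺¹⁾ for partial sums at y = ½, multiplied by a power
  -- of two.
  halves-suc : ∀ M K → halves (suc M) (suc K) ≡ halves M (suc K) + halves (suc M) K
  halves-suc M zero = ar (multichoose M 1)
    where
    ar : ∀ b → 2 * 1 + (1 + b) ≡ 2 * 1 + b + 1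
    ar = solve-∀
  halves-suc M (suc K) = trans (cong (λ z → 2 * z + (multichoose (suc M) (suc K) + multichoose M (suc (suc K)))) (halves-suc M K))
    (ar (halves M (suc K)) (halves (suc M) K) (multichoose (suc M) (suc K)) (multichoose M (suc (suc K))))
    where
    ar : ∀ x y b c → 2 * (x + y) + (b + c) ≡ 2 * x + c + (2 * y + b)
    ar = solve-∀

  -- The series has the value (1 - ½)⁻ᴹ = 2ᴹ and positive terms. For natural numbers this becomes a
  -- double induction along `halves-suc`, without limits.
  halves≤ : ∀ M K → halves M K ≤ 2 ^ M * 2 ^ K
  halves≤ zero zero = s≤s z≤n
  halves≤ zero (suc K) = ≤-trans (≤-reflexive (+-identityʳ _)) (≤-trans (*-monoʳ-≤ 2 (halves≤ zero K)) (≤-reflexive (ar (2 ^ K))))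
    where
    ar : ∀ a → 2 * (1 * a) ≡ 1 * (2 * a)
    ar = solve-∀
  halves≤ (suc M) zero = *-mono-≤ {1} {2 ^ suc M} (m^n>0 2 (suc M)) (s≤s z≤n)
  halves≤ (suc M) (suc K) = begin
    halves (suc M) (suc K) ≡⟨ halves-suc M K ⟩
    halves M (suc K) + halves (suc M) K ≤⟨ +-mono-≤ (halves≤ M (suc K)) (halves≤ (suc M) K) ⟩
    2 ^ M * 2 ^ suc K + 2 ^ suc M * 2 ^ K ≡⟨ ar (2 ^ M) (2 ^ K) ⟩
    2 ^ suc M * 2 ^ suc K ∎
    where
    open ≤-Reasoning
    ar : ∀ a b → a * (2 * b) + 2 * a * b ≡ 2 * a * (2 * b)
    ar = solve-∀

  module Embedding where
    open ℚᵘP.≃-Reasoning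

    private
      unnormal : ∀ a → toℚᵘ (ℕtoℚ a) ℚᵘ.≃ ℚᵘ.mkℚᵘ (ℤ.+ a) 0
      unnormal a = QP.toℚᵘ-fromℚᵘ (ℚᵘ.mkℚᵘ (ℤ.+ a) 0)

    ℕtoℚ-* : ∀ a b → ℕtoℚ (a * b) ≡ ℕtoℚ a ℚ.* ℕtoℚ b
    ℕtoℚ-* a b = QP.toℚᵘ-injective (begin
      toℚᵘ (ℕtoℚ (a * b)) ≈⟨ unnormal (a * b) ⟩
      ℚᵘ.mkℚᵘ (ℤ.+ (a * b)) 0 ≡⟨ cong (λ z → ℚᵘ.mkℚᵘ z 0) (ℤP.pos-* a b) ⟩
      ℚᵘ.mkℚᵘ (ℤ.+ a) 0 ℚᵘ.* ℚᵘ.mkℚᵘ (ℤ.+ b) 0 ≈⟨ ℚᵘP.*-cong (unnormal a) (unnormal b) ⟨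
      toℚᵘ (ℕtoℚ a) ℚᵘ.* toℚᵘ (ℕtoℚ b) ≈⟨ QP.toℚᵘ-homo-* (ℕtoℚ a) (ℕtoℚ b) ⟨
      toℚᵘ (ℕtoℚ a ℚ.* ℕtoℚ b) ∎)

    ℕtoℚ-+ : ∀ a b → ℕtoℚ (a + b) ≡ ℕtoℚ a ℚ.+ ℕtoℚ b
    ℕtoℚ-+ a b = QP.toℚᵘ-injective (begin
      toℚᵘ (ℕtoℚ (a + b)) ≈⟨ unnormal (a + b) ⟩
      ℚᵘ.mkℚᵘ (ℤ.+ (a + b)) 0 ≡⟨ cong (λ z → ℚᵘ.mkℚᵘ z 0) (cong₂ ℤ._+_ (sym (ℤP.*-identityʳ (ℤ.+ a))) (sym (ℤP.*-identityʳ (ℤ.+ b)))) ⟩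
      ℚᵘ.mkℚᵘ (ℤ.+ a) 0 ℚᵘ.+ ℚᵘ.mkℚᵘ (ℤ.+ b) 0 ≈⟨ ℚᵘP.+-cong (unnormal a) (unnormal b) ⟨
      toℚᵘ (ℕtoℚ a) ℚᵘ.+ toℚᵘ (ℕtoℚ b) ≈⟨ QP.toℚᵘ-homo-+ (ℕtoℚ a) (ℕtoℚ b) ⟨
      toℚᵘ (ℕtoℚ a ℚ.+ ℕtoℚ b) ∎)

    ℕtoℚ-inverse : ∀ k → (ℤ.+ 1 ℚ./ suc k) ℚ.* ℕtoℚ (suc k) ≡ 1ℚ
    ℕtoℚ-inverse k = QP.toℚᵘ-injective (begin
      toℚᵘ ((ℤ.+ 1 ℚ./ suc k) ℚ.* ℕtoℚ (suc k)) ≈⟨ QP.toℚᵘ-homo-* (ℤ.+ 1 ℚ./ suc k) (ℕtoℚ (suc k)) ⟩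
      toℚᵘ (ℤ.+ 1 ℚ./ suc k) ℚᵘ.* toℚᵘ (ℕtoℚ (suc k)) ≈⟨ ℚᵘP.*-cong (QP.toℚᵘ-fromℚᵘ (ℚᵘ.mkℚᵘ (ℤ.+ 1) k)) (unnormal (suc k)) ⟩
      ℚᵘ.mkℚᵘ (ℤ.+ 1) k ℚᵘ.* ℚᵘ.mkℚᵘ (ℤ.+ suc k) 0 ≈⟨ ℚᵘ.*≡* (cong (λ z → ℤ.+ suc z) (ar k)) ⟩
      toℚᵘ 1ℚ ∎)
      where
      ar : ∀ k → (k + 0 * suc k) * 1 ≡ k * 1 + 0
      ar = solve-∀

    ℕtoℚ-mono : ∀ {a b} → a ≤ b → ℕtoℚ a ℚ.≤ ℕtoℚ b
    ℕtoℚ-mono {a} {b} le = QP.toℚᵘ-cancel-≤ (ℚᵘP.≤-respˡ-≃ (ℚᵘP.≃-sym (unnormal a)) (ℚᵘP.≤-respʳ-≃ (ℚᵘP.≃-sym (unnormal b))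
      (ℚᵘ.*≤* (ℤP.*-monoʳ-≤-nonNeg (ℤ.+ 1) (ℤ.+≤+ le)))))

    ℕtoℚ-mono-< : ∀ {a b} → a < b → ℕtoℚ a ℚ.< ℕtoℚ b
    ℕtoℚ-mono-< {a} {b} le = QP.toℚᵘ-cancel-< (ℚᵘP.<-respˡ-≃ (ℚᵘP.≃-sym (unnormal a)) (ℚᵘP.<-respʳ-≃ (ℚᵘP.≃-sym (unnormal b))
      (ℚᵘ.*<* (ℤP.*-monoʳ-<-pos (ℤ.+ 1) (ℤ.+<+ le)))))

  open Embedding public

  ℕtoℚ≥0 : ∀ a → 0ℚ ℚ.≤ ℕtoℚ a
  ℕtoℚ≥0 a = ℕtoℚ-mono {0} {a} z≤n

  recip>0 : ∀ k → 0ℚ ℚ.< (ℤ.+ 1 ℚ./ suc k)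
  recip>0 k = QP.positive⁻¹ (ℤ.+ 1 ℚ./ suc k) {{QP.normalize-pos 1 (suc k)}}

  *-mono-≤-≥0 : ∀ {a b c d} → 0ℚ ℚ.≤ c → 0ℚ ℚ.≤ b → a ℚ.≤ b → c ℚ.≤ d → a ℚ.* c ℚ.≤ b ℚ.* d
  *-mono-≤-≥0 {a} {b} {c} {d} c0 b0 ab cd = QP.≤-trans (QP.*-monoʳ-≤-nonNeg c {{ℚ.nonNegative c0}} ab) (QP.*-monoˡ-≤-nonNeg b {{ℚ.nonNegative b0}} cd)

  *-≥0 : ∀ {a b} → 0ℚ ℚ.≤ a → 0ℚ ℚ.≤ b → 0ℚ ℚ.≤ a ℚ.* b
  *-≥0 {a} {b} a0 b0 = QP.≤-trans (QP.≤-reflexive (sym (QP.*-zeroʳ a))) (QP.*-monoˡ-≤-nonNeg a {{ℚ.nonNegative a0}} b0)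

  cancel-≤ : ∀ {a b} c → 0 < c → a ℚ.* ℕtoℚ c ℚ.≤ b ℚ.* ℕtoℚ c → a ℚ.≤ b
  cancel-≤ c c0 le = QP.*-cancelʳ-≤-pos (ℕtoℚ c) {{ℚ.positive (ℕtoℚ-mono-< c0)}} le

  -- xᵏ / k! ≤ (2m)(2m + 1)⋯(2m + k − 1) / (2ᵏ k!), so eˣ is dominated by (1 − ½)⁻²ᵐ.
  module Exponential (x : ℚ) (m : ℕ) (x0 : 0ℚ ℚ.≤ x) (xm : x ℚ.≤ ℕtoℚ m) where
    private
      M : ℕ
      M = m * 2

    expTerm≤ : ∀ k → expTerm x k ℚ.* ℕtoℚ (2 ^ k) ℚ.≤ ℕtoℚ (multichoose M k)
    expTerm≤ zero = QP.≤-reflexive (QP.*-identityˡ (ℕtoℚ 1))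
    expTerm≤ (suc k) = cancel-≤ (suc k) (s≤s z≤n) (begin
      e ℚ.* x ℚ.* i ℚ.* ℕtoℚ (2 * 2 ^ k) ℚ.* s ≡⟨ cong (λ z → e ℚ.* x ℚ.* i ℚ.* z ℚ.* s) (ℕtoℚ-* 2 (2 ^ k)) ⟩
      e ℚ.* x ℚ.* i ℚ.* (ℕtoℚ 2 ℚ.* p) ℚ.* s ≡⟨ shuffle e x i (ℕtoℚ 2) p s ⟩
      e ℚ.* p ℚ.* (x ℚ.* ℕtoℚ 2) ℚ.* (i ℚ.* s) ≡⟨ trans (cong (e ℚ.* p ℚ.* (x ℚ.* ℕtoℚ 2) ℚ.*_) (ℕtoℚ-inverse k)) (QP.*-identityʳ _) ⟩
      e ℚ.* p ℚ.* (x ℚ.* ℕtoℚ 2) ≤⟨ *-mono-≤-≥0 (*-≥0 x0 (ℕtoℚ≥0 2)) (ℕtoℚ≥0 (multichoose M k)) (expTerm≤ k)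
        (QP.≤-trans (QP.*-monoʳ-≤-nonNeg (ℕtoℚ 2) xm) (QP.≤-trans (QP.≤-reflexive (sym (ℕtoℚ-* m 2))) (ℕtoℚ-mono (m≤m+n M k)))) ⟩
      ℕtoℚ (multichoose M k) ℚ.* ℕtoℚ (M + k) ≡⟨ trans (sym (ℕtoℚ-* (multichoose M k) (M + k))) (cong ℕtoℚ (trans (*-comm (multichoose M k) (M + k)) (trans (sym (multichoose-ratio M k)) (*-comm (suc k) (multichoose M (suc k)))))) ⟩
      ℕtoℚ (multichoose M (suc k) * suc k) ≡⟨ ℕtoℚ-* (multichoose M (suc k)) (suc k) ⟩
      ℕtoℚ (multichoose M (suc k)) ℚ.* s ∎)
      where
      open QP.≤-Reasoning
      e i p s : ℚ
      e = expTerm x k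
      i = ℤ.+ 1 ℚ./ suc k
      p = ℕtoℚ (2 ^ k)
      s = ℕtoℚ (suc k)
      shuffle : ∀ e x i t p s → e ℚ.* x ℚ.* i ℚ.* (t ℚ.* p) ℚ.* s ≡ e ℚ.* p ℚ.* (x ℚ.* t) ℚ.* (i ℚ.* s)
      shuffle = solve 6 (λ e x i t p s → e :* x :* i :* (t :* p) :* s := e :* p :* (x :* t) :* (i :* s)) refl
        where open +-*-Solver

    expPartial≤halves : ∀ K → expPartial x K ℚ.* ℕtoℚ (2 ^ K) ℚ.≤ ℕtoℚ (halves M K)
    expPartial≤halves zero = QP.≤-reflexive (QP.*-identityˡ (ℕtoℚ 1))
    expPartial≤halves (suc K) = begin
      (expPartial x K ℚ.+ expTerm x (suc K)) ℚ.* ℕtoℚ (2 ^ suc K) ≡⟨ QP.*-distribʳ-+ (ℕtoℚ (2 ^ suc K)) (expPartial x K) (expTerm x (suc K)) ⟩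
      expPartial x K ℚ.* ℕtoℚ (2 ^ suc K) ℚ.+ expTerm x (suc K) ℚ.* ℕtoℚ (2 ^ suc K)
        ≡⟨ cong (ℚ._+ expTerm x (suc K) ℚ.* ℕtoℚ (2 ^ suc K)) (trans (cong (expPartial x K ℚ.*_) (trans (cong ℕtoℚ (*-comm 2 (2 ^ K))) (ℕtoℚ-* (2 ^ K) 2))) (sym (QP.*-assoc (expPartial x K) (ℕtoℚ (2 ^ K)) (ℕtoℚ 2)))) ⟩
      expPartial x K ℚ.* ℕtoℚ (2 ^ K) ℚ.* ℕtoℚ 2 ℚ.+ expTerm x (suc K) ℚ.* ℕtoℚ (2 ^ suc K)
        ≤⟨ QP.+-mono-≤ (QP.*-monoʳ-≤-nonNeg (ℕtoℚ 2) (expPartial≤halves K)) (expTerm≤ (suc K)) ⟩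
      ℕtoℚ (halves M K) ℚ.* ℕtoℚ 2 ℚ.+ ℕtoℚ (multichoose M (suc K)) ≡⟨ cong (ℚ._+ ℕtoℚ (multichoose M (suc K))) (trans (sym (ℕtoℚ-* (halves M K) 2)) (cong ℕtoℚ (*-comm (halves M K) 2))) ⟩
      ℕtoℚ (2 * halves M K) ℚ.+ ℕtoℚ (multichoose M (suc K)) ≡⟨ sym (ℕtoℚ-+ (2 * halves M K) (multichoose M (suc K))) ⟩
      ℕtoℚ (halves M (suc K)) ∎
      where open QP.≤-Reasoning

    expPartial≤ : ∀ K → expPartial x K ℚ.≤ ℕtoℚ (4 ^ m)
    expPartial≤ K = cancel-≤ (2 ^ K) (m^n>0 2 K) (QP.≤-trans (expPartial≤halves K) (QP.≤-trans (ℕtoℚ-mono (halves≤ M K))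
      (QP.≤-reflexive (trans (ℕtoℚ-* (2 ^ M) (2 ^ K)) (cong (λ z → ℕtoℚ z ℚ.* ℕtoℚ (2 ^ K)) (trans (cong (2 ^_) (*-comm m 2)) (sym (^-*-assoc 2 2 m))))))))

  mulExpLess : ∀ {b g x} m → 0ℚ ℚ.≤ x → x ℚ.≤ ℕtoℚ m → b * 4 ^ m < g → MulExpLess b x g
  mulExpLess {b} {g} {x} m x0 xm lt = ℕtoℚ (b * 4 ^ m) , ℕtoℚ-mono-< lt , λ K →
    QP.≤-trans (QP.*-monoˡ-≤-nonNeg (ℕtoℚ b) {{ℚ.nonNegative (ℕtoℚ≥0 b)}} (Exponential.expPartial≤ x m x0 xm K)) (QP.≤-reflexive (sym (ℕtoℚ-* b (4 ^ m))))

  -- The constants and the final estimate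

  module Rate (D′ h : ℕ) where
    open Constants D′ h

    D K L Q q threshold : ℕ
    D = suc D′
    K = 4 * Kc
    L = κ + κ * D
    Q = K * (h * length (Codes.codes D κ))
    -- With t = n / q the product t q is at most n, which gives the condition 8 Q t (L + 1) ≤ n of
    -- `few`; the successor keeps q positive. In the threshold 3 q makes t at least 3, 1000 serves
    -- `nonempty` and `K * Nm` serves `switches`.
    q = suc (8 * Q * suc L)
    threshold = 3 * q + (1000 + K * Nm)

    α : ℚ
    α = ℤ.+ 1 ℚ./ q

    α>0 : 0ℚ ℚ.< α
    α>0 = recip>0 (8 * Q * suc L)

    scaled : ∀ n → α ℚ.* ℕtoℚ n ℚ.≤ ℕtoℚ (suc (n / q))
    scaled n = QP.≤-trans (QP.*-monoˡ-≤-nonNeg α {{ℚ.nonNegative (QP.<⇒≤ (α>0))}} (ℕtoℚ-mono n≤)) (QP.≤-reflexive eq)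
      where
      n≤ : n ≤ suc (n / q) * q
      n≤ = ≤-trans (≤-reflexive (m≡m%n+[m/n]*n n q)) (+-monoˡ-≤ (n / q * q) (<⇒≤ (m%n<n n q)))
      eq : α ℚ.* ℕtoℚ (suc (n / q) * q) ≡ ℕtoℚ (suc (n / q))
      eq = trans (cong (α ℚ.*_) (trans (cong ℕtoℚ (*-comm (suc (n / q)) q)) (ℕtoℚ-* q (suc (n / q)))))
        (trans (sym (QP.*-assoc α (ℕtoℚ q) (ℕtoℚ (suc (n / q))))) (trans (cong (ℚ._* ℕtoℚ (suc (n / q))) (ℕtoℚ-inverse (8 * Q * suc L))) (QP.*-identityˡ _)))

    -- 8ᵗ = 2ᵗ 4ᵗ, and 2ᵗ ≥ 8 pays for the additional factor 4 that comes from rounding αn up to t +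
    -- 1, with something left for strictness. When b = 0, strictness comes from 0 < g.
    8-beats-4 : ∀ b g t → 3 ≤ t → b * 8 ^ t ≤ g → 0 < g → b * 4 ^ suc t < g
    8-beats-4 zero g t _ _ g0 = g0
    8-beats-4 (suc b) g t t≥3 le _ = <-≤-trans (*-monoʳ-< (suc b) lt) le
      where
      open ≤-Reasoning
      ar : ∀ a b → 2 * a * (4 * b) ≡ 8 * (a * b)
      ar = solve-∀
      powers : ∀ t → 2 ^ t * 4 ^ t ≡ 8 ^ t
      powers zero = refl
      powers (suc t) = trans (ar (2 ^ t) (4 ^ t)) (cong (8 *_) (powers t))
      lt : 4 ^ suc t < 8 ^ t
      lt = begin-strict
        4 * 4 ^ t <⟨ *-monoˡ-< (4 ^ t) {{ℕ.>-nonZero (m^n>0 4 t)}} {4} {8} (s≤s (s≤s (s≤s (s≤s (s≤s z≤n))))) ⟩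
        8 * 4 ^ t ≤⟨ *-monoˡ-≤ (4 ^ t) (^-monoʳ-≤ 2 t≥3) ⟩
        2 ^ t * 4 ^ t ≡⟨ powers t ⟩
        8 ^ t ∎

    module _ (tmpl : Template D′) (H : Graph h) (inP : InP h D H) (a b : Fin h) (ab : Adj H a b) (con : Connected (deleteEdge H a b))
             (n k : ℕ) (big : threshold ≤ n) (even : n * D ≡ 2 * k) where
      private
        t : ℕ
        t = n / q
        J : Graph h
        J = deleteEdge H a b

      3≤t : 3 ≤ t
      3≤t = ≤-trans (≤-reflexive (sym (m*n/n≡m 3 q))) (/-monoˡ-≤ q (≤-trans (m≤m+n (3 * q) _) big))

      fits : 8 * Q * (t * suc L) ≤ n
      fits = begin
        8 * Q * (t * suc L) ≡⟨ ar (8 * Q) t (suc L) ⟩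
        t * (8 * Q * suc L) ≤⟨ *-monoʳ-≤ t (n≤1+n _) ⟩
        t * q ≤⟨ m/n*n≤m n q ⟩
        n ∎
        where
        open ≤-Reasoning
        ar : ∀ a t l → a * (t * l) ≡ t * (a * l)
        ar = solve-∀

      -- Disjoint appearances are distinct sets, because they are non-empty. So t + 1 of them would
      -- already be the required αn appearances.
      lacking : ∀ {G} → ¬ HasAppearances (α ℚ.* ℕtoℚ n) J G → Counting.AtMost {n} {h} D κ J t G
      lacking {G} lacks Ws fam = ≮⇒≥ λ lt → lacks (Ws , Counting.family-unique {n} {h} D κ J {G} fam , proj₂ fam , QP.≤-trans (scaled n) (ℕtoℚ-mono lt))

      failure : ProbFailLess n D (HasAppearances (α ℚ.* ℕtoℚ n) J) (α ℚ.* ℕtoℚ n)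
      failure all bad uall all⇔ ubad bad⇔ =
        mulExpLess {length bad} {length all} (suc t) (*-≥0 (QP.<⇒≤ (α>0)) (ℕtoℚ≥0 n)) (scaled n)
          (decidable-stable (length bad * 4 ^ suc t <? length all) do
            (G , inG) ← nonempty tmpl n k even (≤-trans (m≤m+n 1000 _) n≥)
            le ← Levels.few-bad {n} {h} D κ J K all uall (λ G → Equivalence.from (all⇔ G)) (λ G → Equivalence.to (all⇔ G))
              (λ G inG → switches tmpl H inP a b ab con G inG (≤-trans (m≤n+m _ 1000) n≥))
              t (≤-trans (s≤s z≤n) n≥) fits ubad (λ {G} i → let (p , lacks) = Equivalence.to (bad⇔ G) i in p , lacking {G} lacks)
            return (8-beats-4 (length bad) (length all) t 3≤t le (inhabited (Equivalence.from (all⇔ G) inG))))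
        where
        n≥ : 1000 + K * Nm ≤ n
        n≥ = ≤-trans (m≤n+m _ (3 * q)) big
        inhabited : ∀ {G : Graph n} {Gs} → G ∈ Gs → 0 < length Gs
        inhabited (here _) = s≤s z≤n
        inhabited (there _) = s≤s z≤n

open import Data.Nat using (ℕ; _≤_)
open import Data.Nat.Divisibility using (_∣_)
open import Data.Fin using (Fin)
open import Data.Product using (∃-syntax; _×_)
open import Data.Sum using (_⊎_)
open import Data.Bool using (true)
open import Data.Rational using (ℚ; _<_; _*_; 0ℚ)
open import Relation.Binary.PropositionalEquality using (_≡_)
open import Relation.Nullary using (¬_)

import Data.Nat as ℕ
open import Data.Nat using (zero; suc)
open Switching using (module Rate; template₃; template₄; template₅)
open import Data.Nat.Divisibility using (divides)
open import Data.Nat.Properties using (*-assoc; *-comm)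
open import Data.Product using (∃; _,_)
open import Data.Sum using (inj₁; inj₂)
open import Relation.Binary.PropositionalEquality using (refl; sym; trans; cong)

theorem5 : (D : ℕ) → 3 ≤ D → (h : ℕ) →
    ∃[ α ] ∃[ N ] (0ℚ < α ×
    ((H : Graph h) → IsSimple H → Regular D H → Connected H → Planar H →
    (a b : Fin h) → adj H a b ≡ true → Connected (deleteEdge H a b) →
    (n : ℕ) → N ≤ n → (D ≡ 4 ⊎ ((D ≡ 3 ⊎ D ≡ 5) × 2 ∣ n)) →
    ProbFailLess n D (HasAppearances (α * ℕtoℚ n) (deleteEdge H a b))
    (α * ℕtoℚ n)))
theorem5 zero () h
theorem5 (suc D′) _ h = Rate.α D′ h , Rate.threshold D′ h , Rate.α>0 D′ h ,
  λ H simple regular _ planar a b ab con n big cases → prove {D′} H (simple , regular , planar) a b ab con n big cases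
  where
  even : ∀ {n} D → 2 ∣ n → ∃ λ k → n ℕ.* D ≡ 2 ℕ.* k
  even D (divides k refl) = k ℕ.* D , trans (cong (ℕ._* D) (*-comm k 2)) (*-assoc 2 k D)
  prove : ∀ {D′} (H : Graph h) → InP h (suc D′) H → (a b : Fin h) → adj H a b ≡ true → Connected (deleteEdge H a b) →
    ∀ n → Rate.threshold D′ h ≤ n → suc D′ ≡ 4 ⊎ ((suc D′ ≡ 3 ⊎ suc D′ ≡ 5) × 2 ∣ n) →
    ProbFailLess n (suc D′) (HasAppearances (Rate.α D′ h * ℕtoℚ n) (deleteEdge H a b)) (Rate.α D′ h * ℕtoℚ n)
  prove {_} H inP a b ab con n big (inj₁ refl) = Rate.failure 3 h template₄ H inP a b ab con n (n ℕ.* 2) big (trans (sym (*-assoc n 2 2)) (*-comm (n ℕ.* 2) 2))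
  prove {_} H inP a b ab con n big (inj₂ (inj₁ refl , e)) = let (k , eq) = even 3 e in Rate.failure 2 h template₃ H inP a b ab con n k big eq
  prove {_} H inP a b ab con n big (inj₂ (inj₂ refl , e)) = let (k , eq) = even 5 e in Rate.failure 4 h template₅ H inP a b ab con n k big eq
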